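{- Let $q=2^r$. Whenever $\pm$ appears, either $+$ is chosen everywhere (with $n\ge2$ even) or $-$ is chosen everywhere (with $n\ge1$ odd for $i=1$, and $n\ge3$ odd for $i=2$). Let $\{C_{i,j}^\pm(n,q)\}_{j=0}^{N_i^\pm(n,q)}$ be the weight distribution of $C(DC_i^\pm(n,q))$ for $i=1,2$, and assume $q\ge4$ in the case $i=2$. (a) For $j=0,\dots,N_1^\pm(n,q)$, $$C_{1,j}^\pm(n,q)=\sum\binom{q^{ -1}A_1^\pm(n,q)(B_1^\pm(n,q)+1)}{\nu_0}\prod_{tr(\beta^{ -1})=0}\binom{q^{ -1}A_1^\pm(n,q)(B_1^\pm(n,q)+q+1)}{\nu_\beta}\prod_{tr(\beta^{ -1})=1}\binom{q^{ -1}A_1^\pm(n,q)(B_1^\pm(n,q)-q+1)}{\nu_\beta}.$$ The products are over $\beta\in\mathbb{F}_q^*$, and the sum is over all families of nonnegative integers $\{\nu_\beta\}_{\beta\in\mathbb{F}_q}$ with $\sum_\beta\nu_\beta=j$ and $\sum_\beta\nu_\beta\beta=0$. (b) For $j=0,\dots,N_2^\pm(n,q)$, $$C_{2,j}^\pm(n,q)=\sum\binom{q^{ -1}A_2^\pm(n,q)(B_2^\pm(n,q)+q^3-q^2-1)}{\nu_0}\prod_{\substack{\tau\in\mathbb{Z},\ |\tau|<2\sqrt q\\ \tau\equiv-1\ (\mathrm{mod}\ 4)}}\ \prod_{\beta\in\mathbb{F}_q^*:\,K(\lambda;\beta^{ -1})=\tau}\binom{q^{ -1}A_2^\pm(n,q)(B_2^\pm(n,q)+q\tau-q^2-1)}{\nu_\beta}.$$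 The sum is over all families of nonnegative integers $\{\nu_\beta\}_{\beta\in\mathbb{F}_q}$ with $\sum_\beta\nu_\beta=j$ and $\sum_\beta\nu_\beta\beta=0$.
   Context: Let $q=2^r$ and let $\mathbb{F}_q$ be the field with $q$ elements. Let $tr(x)=x+x^2+\cdots+x^{2^{r-1}}$, $\lambda(x)=(-1)^{tr(x)}$, and $K(\lambda;a)=\sum_{\alpha\in\mathbb{F}_q^*}\lambda(\alpha+a\alpha^{ -1})$. Binomial coefficients satisfy $\binom ba=0$ if $a>b$ or $a<0$. $Tr$ is the matrix trace. $O^+(2n,q)$ is the group of $g\in GL(2n,q)$ preserving $\theta^+(x)=\sum_{i=1}^nx_ix_{n+i}$. $P^+=P^+(2n,q)$ is the subgroup of all products $\begin{bmatrix}A&0\\0&{}^tA^{ -1}\end{bmatrix}\begin{bmatrix}1_n&B\\0&1_n\end{bmatrix}$ with $A\in GL(n,q)$ and $B$ an $n\times n$ symmetric matrix with zero diagonal. For $0\le s\le n$, $\sigma_s^+$ is the $2n\times2n$ matrix which, in block form for $2n=s+(n-s)+s+(n-s)$, is $\begin{bmatrix}0&0&1_s&0\\0&1_{n-s}&0&0\\1_s&0&0&0\\0&0&0&1_{n-s}\end{bmatrix}$. The double cosets are: - $DC_1^+(n,q)=P^+\sigma_{n-1}^+P^+$ and $DC_2^+(n,q)=P^+\sigma_{n-2}^+P^+$ for even $n\ge2$; - $DC_1^-(n,q)=P^+\sigma_{n-1}^+P^+$ for odd $n\ge1$; - $DC_2^-(n,q)=P^+\sigma_{n-2}^+P^+$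 for odd $n\ge3$. With $\left[\begin{smallmatrix}n\\k\end{smallmatrix}\right]_q=\prod_{j=0}^{k-1}\frac{q^{n-j}-1}{q^{k-j}-1}$ and empty products equal to $1$, define: - $A_1^+(n,q)=q^{(5n^2-6n)/4}\left[\begin{smallmatrix}n\\1\end{smallmatrix}\right]_q\prod_{j=1}^{n/2}(q^{2j-1}-1)$; - $B_1^+(n,q)=q^{(n-2)^2/4}\prod_{j=1}^{n/2}(q^{2j}-1)$; - $A_2^+(n,q)=q^{(5n^2-6n)/4}\left[\begin{smallmatrix}n\\2\end{smallmatrix}\right]_q\prod_{j=1}^{(n-2)/2}(q^{2j-1}-1)$; - $B_2^+(n,q)=q^{(n^2-8n+12)/4}(q^{n-1}-1)(q^n-1)\prod_{j=1}^{(n-2)/2}(q^{2j}-1)$; - $A_1^-(n,q)=q^{(5n^2-4n-1)/4}\left[\begin{smallmatrix}n\\1\end{smallmatrix}\right]_q\prod_{j=1}^{(n-1)/2}(q^{2j-1}-1)$; - $B_1^-(n,q)=q^{(n^2-6n+5)/4}(q^n-1)\prod_{j=1}^{(n-1)/2}(q^{2j}-1)$; - $A_2^-(n,q)=q^{(5n^2-8n+3)/4}\left[\begin{smallmatrix}n\\2\end{smallmatrix}\right]_q\prod_{j=1}^{(n-1)/2}(q^{2j-1}-1)$; - $B_2^-(n,q)=q^{(n-3)^2/4}(q^n-1)\prod_{j=1}^{(n-1)/2}(q^{2j}-1)$. $N_i^\pm(n,q)=A_i^\pm(n,q)B_i^\pm(n,q)=|DC_i^\pm(n,q)|$. For an ordering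 $g_1,\dots,g_N$ of $DC_i^\pm(n,q)$, the binary code is $C(DC_i^\pm(n,q))=\{u\in\mathbb{F}_2^N:\sum_ju_j\,Tr\,g_j=0\text{ in }\mathbb{F}_q\}$. Its weight distribution $C_{i,j}^\pm(n,q)$ is the number of codewords of Hamming weight $j$. -}

module Defs where

open import Data.Nat as ℕ using (ℕ; zero; suc; _≤_; _^_)
import Data.Nat.Properties as ℕP
open import Data.Nat.Combinatorics using (_C_)
open import Data.Nat.ListAction using () renaming (sum to sumℕ)
open import Data.Integer as ℤ using (ℤ; +_; -[1+_])
import Data.Integer.Properties as ℤP
open import Data.Integer.DivMod using () renaming (_/_ to _/ℤ_; _%_ to _%ℤ_)
open import Data.Rational as ℚ using (ℚ; 0ℚ; 1ℚ; floor)
open import Data.Fin as Fin using (Fin; toℕ)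
import Data.Fin.Properties as FinP
open import Data.Bool using (Bool; true; false; if_then_else_)
open import Data.List as List using (List; []; _∷_; length; upTo; concatMap; filter; allFin)
open import Data.List.Membership.Propositional using (_∈_)
open import Data.List.Relation.Unary.Unique.Propositional using (Unique)
open import Data.Vec as Vec using (Vec; []; _∷_; lookup; tabulate; zipWith; transpose; fromList; _++_)
open import Data.Product using (Σ; Σ-syntax; ∃; _×_; _,_)
open import Relation.Nullary using (¬_; does)
open import Relation.Nullary.Decidable using (_×-dec_)
open import Relation.Binary.PropositionalEquality using (_≡_; _≢_)
open import Relation.Binary.Definitions using (DecidableEquality)
open import Algebra.Structures using (IsCommutativeRing)
open import Function.Bundles using (_↔_; Inverse)

record FiniteField (r : ℕ) : Set₁ where
  infixl 6 _+_
  infixl 7 _*_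
  field
    Carrier : Set
    _+_ _*_ : Carrier → Carrier → Carrier
    -_ : Carrier → Carrier
    0# 1# : Carrier
    _⁻¹ : Carrier → Carrier
    isCommutativeRing : IsCommutativeRing _≡_ _+_ _*_ -_ 0# 1#
    0≢1 : 0# ≢ 1#
    ⁻¹-inverse : ∀ x → x ≢ 0# → x * (x ⁻¹) ≡ 1#
    _≟_ : DecidableEquality Carrier
    enum : Fin (2 ^ r) ↔ Carrier

data Sign : Set where
  plus minus : Sign

Valid₁ : Sign → ℕ → Set
Valid₁ plus  n = 2 ≤ n × n ℕ.% 2 ≡ 0
Valid₁ minus n = 1 ≤ n × n ℕ.% 2 ≡ 1

Valid₂ : Sign → ℕ → Set
Valid₂ plus  n = 2 ≤ n × n ℕ.% 2 ≡ 0
Valid₂ minus n = 3 ≤ n × n ℕ.% 2 ≡ 1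

ℕ→ℚ : ℕ → ℚ
ℕ→ℚ m = (+ m) ℚ./ 1

ℤ→ℚ : ℤ → ℚ
ℤ→ℚ z = z ℚ./ 1

-- 1/m (with the harmless convention 1/0 = 0; only used with m = q^k ≥ 1)
invℕ : ℕ → ℚ
invℕ zero    = 0ℚ
invℕ (suc m) = (+ 1) ℚ./ suc m

-- exact natural division (convention: division by 0 gives 0)
divℕ : ℕ → ℕ → ℕ
divℕ m zero    = 0
divℕ m (suc d) = m ℕ./ suc d

qpow : ℕ → ℤ → ℚ
qpow q (+ k)      = ℕ→ℚ (q ^ k)
qpow q -[1+ k ]   = invℕ (q ^ suc k)

prodℚ : ℕ → (ℕ → ℚ) → ℚ
prodℚ m f = List.foldr (λ j acc → f (suc j) ℚ.* acc) 1ℚ (upTo m)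

prodℕ : ℕ → (ℕ → ℕ) → ℕ
prodℕ m f = List.foldr (λ j acc → f j ℕ.* acc) 1 (upTo m)

gauss : ℕ → ℕ → ℕ → ℕ
gauss q n k = divℕ (prodℕ k (λ j → q ^ (n ℕ.∸ j) ℕ.∸ 1))
                   (prodℕ k (λ j → q ^ (k ℕ.∸ j) ℕ.∸ 1))

qm1 : ℕ → ℕ → ℚ
qm1 q a = ℕ→ℚ (q ^ a) ℚ.- 1ℚ

-- exponent (a n^2 + b n + c)/4 as an integer (exact in all uses)
ex : ℤ → ℤ → ℤ → ℕ → ℤ
ex a b c n = (a ℤ.* (+ n) ℤ.* (+ n) ℤ.+ b ℤ.* (+ n) ℤ.+ c) /ℤ (+ 4)

A₁ : Sign → ℕ → ℕ → ℚ
A₁ plus  q n = qpow q (ex (+ 5) (ℤ.- (+ 6)) (+ 0) n) ℚ.* ℕ→ℚ (gauss q n 1)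
               ℚ.* prodℚ (n ℕ./ 2) (λ j → qm1 q (2 ℕ.* j ℕ.∸ 1))
A₁ minus q n = qpow q (ex (+ 5) (ℤ.- (+ 4)) (ℤ.- (+ 1)) n) ℚ.* ℕ→ℚ (gauss q n 1)
               ℚ.* prodℚ ((n ℕ.∸ 1) ℕ./ 2) (λ j → qm1 q (2 ℕ.* j ℕ.∸ 1))

B₁ : Sign → ℕ → ℕ → ℚ
B₁ plus  q n = qpow q (ex (+ 1) (ℤ.- (+ 4)) (+ 4) n)
               ℚ.* prodℚ (n ℕ./ 2) (λ j → qm1 q (2 ℕ.* j))
B₁ minus q n = qpow q (ex (+ 1) (ℤ.- (+ 6)) (+ 5) n) ℚ.* qm1 q n
               ℚ.* prodℚ ((n ℕ.∸ 1) ℕ./ 2) (λ j → qm1 q (2 ℕ.* j))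

A₂ : Sign → ℕ → ℕ → ℚ
A₂ plus  q n = qpow q (ex (+ 5) (ℤ.- (+ 6)) (+ 0) n) ℚ.* ℕ→ℚ (gauss q n 2)
               ℚ.* prodℚ ((n ℕ.∸ 2) ℕ./ 2) (λ j → qm1 q (2 ℕ.* j ℕ.∸ 1))
A₂ minus q n = qpow q (ex (+ 5) (ℤ.- (+ 8)) (+ 3) n) ℚ.* ℕ→ℚ (gauss q n 2)
               ℚ.* prodℚ ((n ℕ.∸ 1) ℕ./ 2) (λ j → qm1 q (2 ℕ.* j ℕ.∸ 1))

B₂ : Sign → ℕ → ℕ → ℚ
B₂ plus  q n = qpow q (ex (+ 1) (ℤ.- (+ 8)) (+ 12) n) ℚ.* qm1 q (n ℕ.∸ 1) ℚ.* qm1 q n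
               ℚ.* prodℚ ((n ℕ.∸ 2) ℕ./ 2) (λ j → qm1 q (2 ℕ.* j))
B₂ minus q n = qpow q (ex (+ 1) (ℤ.- (+ 6)) (+ 9) n) ℚ.* qm1 q n
               ℚ.* prodℚ ((n ℕ.∸ 1) ℕ./ 2) (λ j → qm1 q (2 ℕ.* j))

-- binomial coefficient with integer top: binom b a = 0 if a > b (in particular if b < 0)
binomℤ : ℤ → ℕ → ℕ
binomℤ (+ m)    a = m C a
binomℤ -[1+ _ ] a = 0

-- the top entry q^{-1} A (B + c), coerced to ℤ (it is an integer in all uses)
top : ℕ → ℚ → ℚ → ℚ → ℤ
top q A B c = floor (invℕ q ℚ.* (A ℚ.* (B ℚ.+ c)))

families : (len j : ℕ) → List (Vec ℕ len)
families zero    j = [] ∷ []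
families (suc l) j = concatMap (λ v → List.map (λ a → a ∷ v) (upTo (suc j))) (families l j)

allWords : (N : ℕ) → List (Vec Bool N)
allWords zero    = [] ∷ []
allWords (suc N) = concatMap (λ w → (true ∷ w) ∷ (false ∷ w) ∷ []) (allWords N)

hammingWeight : ∀ {N} → Vec Bool N → ℕ
hammingWeight []           = 0
hammingWeight (true ∷ w)   = suc (hammingWeight w)
hammingWeight (false ∷ w)  = hammingWeight w

module _ {r : ℕ} (F : FiniteField r) where
  open FiniteField F

  q : ℕ
  q = 2 ^ r

  ΣF : (Carrier → Carrier) → Carrier
  ΣF f = List.foldr (λ k acc → f (Inverse.to enum k) + acc) 0# (allFin q)

  _·_ : ℕ → Carrier → Carrier
  zero  · x = 0#
  suc k · x = x + (k · x)

  _^F_ : Carrier → ℕ → Carrier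
  x ^F zero  = 1#
  x ^F suc k = x * (x ^F k)

  tr : Carrier → Carrier
  tr x = List.foldr (λ k acc → (x ^F (2 ^ k)) + acc) 0# (upTo r)

  λc : Carrier → ℤ
  λc x = if does (tr x ≟ 0#) then + 1 else ℤ.- (+ 1)

  K : Carrier → ℤ
  K a = List.foldr (λ k acc → let α = Inverse.to enum k in
                       (if does (α ≟ 0#) then + 0 else λc (α + a * (α ⁻¹))) ℤ.+ acc)
                    (+ 0) (allFin q)

  Mat : ℕ → ℕ → Set
  Mat m k = Vec (Vec Carrier k) m

  dot : ∀ {k} → Vec Carrier k → Vec Carrier k → Carrier
  dot u v = Vec.foldr _ _+_ 0# (zipWith _*_ u v)

  _⊗_ : ∀ {m k l} → Mat m k → Mat k l → Mat m l
  A ⊗ B = Vec.map (λ row → Vec.map (λ col → dot row col) (transpose B)) A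

  𝟙 : (m : ℕ) → Mat m m
  𝟙 m = tabulate λ i → tabulate λ j → if does (i Fin.≟ j) then 1# else 0#

  𝟘 : (m k : ℕ) → Mat m k
  𝟘 m k = Vec.replicate m (Vec.replicate k 0#)

  block : ∀ {n} → Mat n n → Mat n n → Mat n n → Mat n n → Mat (n ℕ.+ n) (n ℕ.+ n)
  block A B C′ D = zipWith _++_ A B ++ zipWith _++_ C′ D

  Tr : ∀ {m} → Mat m m → Carrier
  Tr M = Vec.foldr _ _+_ 0# (tabulate λ i → lookup (lookup M i) i)

  InP : (n : ℕ) → Mat (n ℕ.+ n) (n ℕ.+ n) → Set
  InP n p = Σ[ A ∈ Mat n n ] Σ[ A' ∈ Mat n n ] Σ[ B ∈ Mat n n ]
              ((A ⊗ A' ≡ 𝟙 n) × (A' ⊗ A ≡ 𝟙 n))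
            × (transpose B ≡ B) × (∀ i → lookup (lookup B i) i ≡ 0#)
            × (p ≡ block A (𝟘 n n) (𝟘 n n) (transpose A') ⊗ block (𝟙 n) B (𝟘 n n) (𝟙 n))

  -- σ_s^+ : the permutation matrix swapping coordinates k and n+k for k < s
  σperm : ℕ → ℕ → ℕ → ℕ
  σperm n s m = if does (m ℕ.<? s) then m ℕ.+ n
                else if does (n ℕ.≤? m) ∧′ does (m ℕ.<? n ℕ.+ s) then m ℕ.∸ n else m
    where
    _∧′_ : Bool → Bool → Bool
    true ∧′ b = b
    false ∧′ b = false

  σ : (n s : ℕ) → Mat (n ℕ.+ n) (n ℕ.+ n)
  σ n s = tabulate λ i → tabulate λ j →
            if does (toℕ j ℕ.≟ σperm n s (toℕ i)) then 1# else 0#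

  InDC : (n s : ℕ) → Mat (n ℕ.+ n) (n ℕ.+ n) → Set
  InDC n s g = Σ[ p₁ ∈ _ ] Σ[ p₂ ∈ _ ] InP n p₁ × InP n p₂ × (g ≡ (p₁ ⊗ σ n s) ⊗ p₂)

  Enumerates : (n s : ℕ) → List (Mat (n ℕ.+ n) (n ℕ.+ n)) → Set
  Enumerates n s gs = Unique gs × (∀ g → g ∈ gs → InDC n s g) × (∀ g → InDC n s g → g ∈ gs)

  -- weight distribution of C(DC) = {u ∈ F_2^N : Σ_j u_j Tr g_j = 0}
  syndrome : ∀ {n'} → (gs : List (Mat (n' ℕ.+ n') (n' ℕ.+ n'))) → Vec Bool (length gs) → Carrier
  syndrome gs u = Vec.foldr _ _+_ 0#
                    (zipWith (λ b g → if b then Tr g else 0#) u (fromList gs))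

  weightDist : ∀ {n} → List (Mat (n ℕ.+ n) (n ℕ.+ n)) → ℕ → ℕ
  weightDist {n} gs j = length (filter (λ u → (hammingWeight u ℕ.≟ j) ×-dec (syndrome {n} gs u ≟ 0#))
                                   (allWords (length gs)))

  familySum : ℕ → ((Carrier → ℕ) → ℕ) → ℕ
  familySum j summand =
    sumℕ (List.map (λ v → summand (λ β → lookup v (Inverse.from enum β)))
      (filter (λ v → (sumℕ (List.map (λ k → lookup v k) (allFin q)) ℕ.≟ j)
                     ×-dec (List.foldr (λ k acc → (lookup v k · Inverse.to enum k) + acc) 0# (allFin q) ≟ 0#))
              (families q j)))

  ΠF* : (Carrier → ℕ) → ℕ
  ΠF* f = List.foldr (λ k acc → let β = Inverse.to enum k in
                         (if does (β ≟ 0#) then 1 else f β) ℕ.* acc) 1 (allFin q)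

  qℚ : ℚ
  qℚ = ℕ→ℚ q

  formulaA : Sign → ℕ → ℕ → ℕ
  formulaA sg n j = familySum j λ ν →
      binomℤ (top q A B 1ℚ) (ν 0#)
      ℕ.* ΠF* (λ β → if does (tr (β ⁻¹) ≟ 0#) then binomℤ (top q A B (qℚ ℚ.+ 1ℚ)) (ν β)
                    else if does (tr (β ⁻¹) ≟ 1#) then binomℤ (top q A B (1ℚ ℚ.- qℚ)) (ν β)
                    else 1)
    where
    A = A₁ sg q n
    B = B₁ sg q n

  -- right-hand side of (b): the double product over τ (|τ| < 2√q, τ ≡ -1 mod 4)
  -- and β with K(λ;β⁻¹) = τ, written as one product over β ∈ F_q^*
  formulaB : Sign → ℕ → ℕ → ℕ
  formulaB sg n j = familySum j λ ν →
      binomℤ (top q A B (qℚ ℚ.* qℚ ℚ.* qℚ ℚ.- qℚ ℚ.* qℚ ℚ.- 1ℚ)) (ν 0#)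
      ℕ.* ΠF* (λ β → let τ = K (β ⁻¹) in
                 if does (τ ℤ.* τ ℤ.<? + (4 ℕ.* q)) ∧ does ((τ %ℤ (+ 4)) ℕ.≟ 3)
                 then binomℤ (top q A B (qℚ ℚ.* ℤ→ℚ τ ℚ.- qℚ ℚ.* qℚ ℚ.- 1ℚ)) (ν β)
                 else 1)
    where
    A = A₂ sg q n
    B = B₂ sg q n
    _∧_ : Bool → Bool → Bool
    true ∧ b = b
    false ∧ b = false

{-# OPTIONS --safe #-}
-- Pascal's rule along the list g₁, …, g_N gives C_j = Σ Π_β C(N_β, ν_β), where N_β is the number of elements
-- of trace β in the double coset, so everything rests on computing N_β.
--
-- Write σ = σ_s and m = n − s. The pairs (p₁ , p₂) ∈ P × P with Tr (p₁ σ p₂) = β are counted twice: along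
-- p₁ σ p₂ every fibre has |P ∩ σ P σ| elements, and along p₂ p₁ every fibre has |P| elements and
-- Tr (p₁ σ p₂) = Tr (σ p₂ p₁). So the double coset may be replaced by σ P. For p ∈ P with factors A and B,
-- Tr (σ p) is a linear form in the alternating matrix B plus a term in A. The form is nonzero, hence
-- equidistributed, unless A is block lower triangular with a symmetric s × s corner; then Tr (σ p) = Tr D + Tr D⁻¹
-- for the m × m corner D. The number of D ∈ GL(m) with Tr D + Tr D⁻¹ = β is governed by tr(β⁻¹) for m = 1 and
-- by K(λ; β⁻¹) for m = 2.
--
-- In (b) the ranges of τ require K ≡ −1 mod 4, from the involution α ↦ a/α, and |K| < 2√q. For the latter,
-- Manin's argument gives n² − K n + q ≥ 0 for all n; with |K| = 2n + 1 this is n(n + 1) ≤ q, where equality is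
-- impossible as q ≥ 4 is a power of 2.
module Submission where

-- Counts are bijections with `Fin k`, without character sums, and identities stay free of
-- subtraction and division until they meet the rational constants. The two factors have a
-- group-theoretic meaning: A B = |P|² / |P ∩ σPσ| is the size of the double coset, A B / q is the
-- share of each trace if every linear form were equidistributed, and the forms that vanish
-- contribute the correction A c / q. If κ is the number of D in GL(m) with Tr D + Tr D⁻¹ = β, then
-- ε c = q κ - |GL(m)|, with ε = 1 for m = 1 and ε = q for m = 2. The obstacle in (b) is the bound
-- on K. Manin's inequality concerns degrees: n² - K n + q is the degree of the numerator of an
-- x-coordinate. Degrees of numerators obey a recurrence only for fractions in lowest terms, so
-- Bézout coprimality is carried along the whole sequence of points. The argument is run for both
-- fibres of the trace, which gives the inequality for K and for -K.

-- Finite counting by explicit enumerations.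

module Counting where

  open import Data.Nat using (ℕ; zero; suc; _+_; _*_; _≤_; _^_)
  import Data.Nat.Properties as ℕP
  open import Data.Fin using (Fin; zero; suc; splitAt; _↑ˡ_; _↑ʳ_; combine; remQuot)
  import Data.Fin.Properties as FinP
  open import Data.Vec using (Vec; []; _∷_)
  open import Data.List as List using (List; []; _∷_; length)
  open import Data.List.Relation.Unary.Any using (here; there)
  open import Data.List.Relation.Unary.All as All using (All)
  open import Data.List.Relation.Unary.AllPairs as AllPairs using (AllPairs)
  open import Data.List.Relation.Unary.Unique.Propositional using (Unique)
  open import Data.List.Membership.Propositional using (_∈_)
  open import Data.Product using (∃; _×_; _,_; proj₁; proj₂)
  open import Data.Product.Properties using (,-injective)
  open import Data.Sum using (_⊎_; inj₁; inj₂)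
  open import Data.Empty using (⊥-elim)
  open import Data.Unit using (⊤; tt)
  open import Relation.Nullary using (¬_; yes; no)
  open import Relation.Unary using (Decidable)
  open import Relation.Binary.Definitions using (DecidableEquality)
  open import Relation.Binary.PropositionalEquality
  open import Function using (id)

  -- Only elements of `A` are enumerated, not proofs of `P`. A predicate may therefore contain
  -- existential witnesses, such as an inverse matrix or a factorisation, without being counted more
  -- than once.
  record Card {A : Set} (P : A → Set) (k : ℕ) : Set where
    constructor card
    field
      el  : Fin k → A
      el∈ : ∀ i → P (el i)
      inj : ∀ {i j} → el i ≡ el j → i ≡ j
      sur : ∀ a → P a → ∃ λ i → el i ≡ a

  open Card public

  private variable
    A B : Set
    P Q : A → Set
    k l : ℕ

  card-≤ : Card P k → Card Q l → (f : A → B) → (∀ a → P a → Q (f a)) →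
           (∀ a b → P a → P b → f a ≡ f b → a ≡ b) → k ≤ l
  card-≤ {P = P} c d f pq fi = FinP.injective⇒≤ {f = g} λ {i} {j} e →
      inj c (fi _ _ (el∈ c i) (el∈ c j)
        (trans (sym (proj₂ (h i))) (trans (cong (el d) e) (proj₂ (h j)))))
    where
    h : ∀ i → ∃ λ j → el d j ≡ f (el c i)
    h i = sur d _ (pq _ (el∈ c i))
    g = λ i → proj₁ (h i)

  -- Double counting enters here: two enumerations of one predicate become an equation between
  -- natural numbers.
  card-unique : Card P k → Card P l → k ≡ l
  card-unique c d = ℕP.≤-antisym (card-≤ c d id (λ _ p → p) (λ _ _ _ _ e → e))
                                 (card-≤ d c id (λ _ p → p) (λ _ _ _ _ e → e))

  card-bij : Card P k → (f : A → B) (g : B → A) →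
             (∀ a → P a → Q (f a)) → (∀ b → Q b → P (g b)) →
             (∀ a → P a → g (f a) ≡ a) → (∀ b → Q b → f (g b) ≡ b) → Card Q k
  card-bij c f g pq qp gf fg = card (λ i → f (el c i)) (λ i → pq _ (el∈ c i))
    (λ {i} {j} e → inj c (trans (sym (gf _ (el∈ c i))) (trans (cong g e) (gf _ (el∈ c j)))))
    (λ b qb → let (i , e) = sur c (g b) (qp b qb) in i , trans (cong f e) (fg b qb))

  card-iff : Card P k → (∀ a → P a → Q a) → (∀ a → Q a → P a) → Card Q k
  card-iff c f g = card-bij c id id f g (λ _ _ → refl) (λ _ _ → refl)

  card-subst : k ≡ l → Card P k → Card P l
  card-subst refl c = c

  card-zero : (∀ a → ¬ P a) → Card P 0
  card-zero n = card (λ ()) (λ ()) (λ { {()} }) (λ a p → ⊥-elim (n a p))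

  card-one : (a : A) → P a → (∀ b → P b → b ≡ a) → Card P 1
  card-one a p u = card (λ _ → a) (λ _ → p) (λ { {zero} {zero} _ → refl }) (λ b pb → zero , sym (u b pb))

  card-two : (a b : A) → a ≢ b → P a → P b → (∀ c → P c → c ≡ a ⊎ c ≡ b) → Card P 2
  card-two {A = A} {P = P} a b ne pa pb u = card e e∈ ei es
    where
    e : Fin 2 → A
    e zero = a
    e (suc zero) = b
    e∈ : ∀ i → P (e i)
    e∈ zero = pa
    e∈ (suc zero) = pb
    ei : ∀ {i j} → e i ≡ e j → i ≡ j
    ei {zero} {zero} _ = refl
    ei {zero} {suc zero} q = ⊥-elim (ne q)
    ei {suc zero} {zero} q = ⊥-elim (ne (sym q))
    ei {suc zero} {suc zero} _ = refl
    es : ∀ c → P c → ∃ λ i → e i ≡ c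
    es c pc with u c pc
    ... | inj₁ q = zero , sym q
    ... | inj₂ q = suc zero , sym q

  card-Σ : {P : A → Set} {R : A → B → Set} → Card P k → (∀ a → P a → Card (R a) l) →
           Card {A = A × B} (λ p → P (proj₁ p) × R (proj₁ p) (proj₂ p)) (k * l)
  card-Σ {A = A} {B = B} {k = k} {l = l} {P = P} {R} c d = card e e∈ ei es
    where
    D : (i : Fin k) → Card (R (el c i)) l
    D i = d _ (el∈ c i)
    e′ : Fin k × Fin l → A × B
    e′ (i , j) = el c i , el (D i) j
    e′-inj : ∀ x y → e′ x ≡ e′ y → x ≡ y
    e′-inj (i , j) (i′ , j′) q with inj c (proj₁ (,-injective q))
    ... | refl = cong (i ,_) (inj (D i) (proj₂ (,-injective q)))
    e : Fin (k * l) → A × B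
    e x = e′ (remQuot l x)
    e∈ : ∀ x → P (proj₁ (e x)) × R (proj₁ (e x)) (proj₂ (e x))
    e∈ x = el∈ c _ , el∈ (D (proj₁ (remQuot {k} l x))) _
    ei : ∀ {x y} → e x ≡ e y → x ≡ y
    ei {x} {y} q = trans (sym (FinP.combine-remQuot {k} l x))
      (trans (cong (λ p → combine (proj₁ p) (proj₂ p)) (e′-inj (remQuot {k} l x) (remQuot {k} l y) q))
             (FinP.combine-remQuot {k} l y))
    es : ∀ p → P (proj₁ p) × R (proj₁ p) (proj₂ p) → ∃ λ x → e x ≡ p
    es (a , b) (pa , rb) with sur c a pa
    ... | (i , refl) with sur (D i) b rb
    ... | (j , refl) = combine i j , cong e′ (FinP.remQuot-combine i j)

  card-× : {P : A → Set} {Q : B → Set} → Card P k → Card Q l →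
           Card {A = A × B} (λ p → P (proj₁ p) × Q (proj₂ p)) (k * l)
  card-× c d = card-Σ c (λ _ _ → d)

  card-⊎ : {P Q R : A → Set} → Card P k → Card Q l → (∀ a → P a → ¬ Q a) →
           (∀ a → P a → R a) → (∀ a → Q a → R a) → (∀ a → R a → P a ⊎ Q a) → Card R (k + l)
  card-⊎ {A = A} {k = k} {l = l} {P = P} {Q} {R} c d dis pr qr cov = card e e∈ ei es
    where
    e′ : Fin k ⊎ Fin l → A
    e′ (inj₁ i) = el c i
    e′ (inj₂ j) = el d j
    e′-inj : ∀ x y → e′ x ≡ e′ y → x ≡ y
    e′-inj (inj₁ i) (inj₁ j) q = cong inj₁ (inj c q)
    e′-inj (inj₁ i) (inj₂ j) q = ⊥-elim (dis _ (el∈ c i) (subst Q (sym q) (el∈ d j)))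
    e′-inj (inj₂ i) (inj₁ j) q = ⊥-elim (dis _ (el∈ c j) (subst Q q (el∈ d i)))
    e′-inj (inj₂ i) (inj₂ j) q = cong inj₂ (inj d q)
    e : Fin (k + l) → A
    e x = e′ (splitAt k x)
    e∈′ : ∀ x → R (e′ x)
    e∈′ (inj₁ i) = pr _ (el∈ c i)
    e∈′ (inj₂ i) = qr _ (el∈ d i)
    e∈ : ∀ x → R (e x)
    e∈ x = e∈′ (splitAt k x)
    ei : ∀ {x y} → e x ≡ e y → x ≡ y
    ei {x} {y} q = trans (sym (FinP.join-splitAt k l x))
      (trans (cong (Data.Fin.join k l) (e′-inj (splitAt k x) (splitAt k y) q)) (FinP.join-splitAt k l y))
    es : ∀ a → R a → ∃ λ x → e x ≡ a
    es a ra with cov a ra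
    ... | inj₁ pa = let (i , q) = sur c a pa in i ↑ˡ l , trans (cong e′ (FinP.splitAt-↑ˡ k i l)) q
    ... | inj₂ qa = let (i , q) = sur d a qa in k ↑ʳ i , trans (cong e′ (FinP.splitAt-↑ʳ k l i)) q

  card-split : {P Q : A → Set} → Card P k → Decidable Q →
    ∃ λ k₁ → ∃ λ k₂ → Card (λ a → P a × Q a) k₁ × Card (λ a → P a × ¬ Q a) k₂ × k₁ + k₂ ≡ k
  card-split {k = zero} c Q? =
    0 , 0 , card-zero no-P , card-zero no-P , refl
    where
    no-P : ∀ {Z : _ → Set} a → ¬ (_ × Z a)
    no-P a (p , _) with sur c a p
    ... | () , _
  card-split {A = A} {k = suc k} {P = P} {Q} c Q? with card-split {P = λ a → P a × a ≢ el c zero} {Q} rest Q?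
    where
    rest : Card (λ a → P a × a ≢ el c zero) k
    rest = card (λ i → el c (suc i)) (λ i → el∈ c (suc i) , λ e → FinP.0≢1+n (sym (inj c e)))
      (λ e → FinP.suc-injective (inj c e)) s
      where
      s : ∀ a → P a × a ≢ el c zero → ∃ λ i → el c (suc i) ≡ a
      s a (p , ne) with sur c a p
      ... | zero , e = ⊥-elim (ne (sym e))
      ... | suc i , e = i , e
  ... | k₁ , k₂ , c₁ , c₂ , eq with Q? (el c zero)
  ... | yes qz = suc k₁ , k₂ ,
        card-⊎ (card-one {P = λ a → a ≡ el c zero} _ refl (λ _ e → e)) c₁ (λ { a e ((_ , ne) , _) → ne e })
          (λ { a refl → el∈ c zero , qz }) (λ { a ((p , _) , q) → p , q }) cov
        , card-iff c₂ (λ { a ((p , _) , q) → p , q }) (λ { a (p , q) → (p , λ { refl → q qz }) , q })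
        , cong suc eq
    where
    cov : ∀ a → P a × Q a → a ≡ el c zero ⊎ ((P a × a ≢ el c zero) × Q a)
    cov a (p , q) with sur c a p
    ... | zero , e = inj₁ (sym e)
    ... | suc i , refl = inj₂ ((p , λ e → FinP.0≢1+n (sym (inj c e))) , q)
  ... | no nq = k₁ , suc k₂ ,
        card-iff c₁ (λ { a ((p , _) , q) → p , q }) (λ { a (p , q) → (p , λ { refl → nq q }) , q })
        , card-⊎ (card-one {P = λ a → a ≡ el c zero} _ refl (λ _ e → e)) c₂ (λ { a e ((_ , ne) , _) → ne e })
          (λ { a refl → el∈ c zero , nq }) (λ { a ((p , _) , q) → p , q }) cov
        , trans (ℕP.+-suc k₁ k₂) (cong suc eq)
    where
    cov : ∀ a → P a × ¬ Q a → a ≡ el c zero ⊎ ((P a × a ≢ el c zero) × ¬ Q a)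
    cov a (p , q) with sur c a p
    ... | zero , e = inj₁ (sym e)
    ... | suc i , refl = inj₂ ((p , λ e → FinP.0≢1+n (sym (inj c e))) , q)

  card-minus : {P Q : A → Set} → Card P k → Decidable Q → Card (λ a → P a × Q a) l →
               ∃ λ m → Card (λ a → P a × ¬ Q a) m × l + m ≡ k
  card-minus c Q? d with card-split c Q?
  ... | k₁ , k₂ , c₁ , c₂ , e with card-unique c₁ d
  ... | refl = k₂ , c₂ , e

  card-fibres : {P : A → Set} {Q : B → Set} → Card P k → Card Q l → (f : A → B) →
    (∀ a → P a → Q (f a)) → ∀ {m} → (∀ b → Q b → Card (λ a → P a × f a ≡ b) m) → k ≡ l * m
  card-fibres {P = P} {Q} c d f pq fib = card-unique c
    (card-bij (card-Σ d fib) proj₂ (λ a → f a , a) (λ { _ (_ , p , _) → p })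
      (λ a p → pq a p , p , refl) (λ { _ (_ , _ , refl) → refl }) (λ _ _ → refl))

  card-list : (xs : List A) → Unique xs → Card (_∈ xs) (length xs)
  card-list [] _ = card-zero (λ _ ())
  card-list (x ∷ xs) (u AllPairs.∷ us) = card-⊎ (card-one {P = _≡ x} x refl (λ _ e → e)) (card-list xs us)
    (λ { a refl m → All.lookup u m refl }) (λ { a refl → here refl }) (λ _ → there)
    (λ { a (here e) → inj₁ e ; a (there m) → inj₂ m })

  card-vec : Card {A} (λ _ → ⊤) k → ∀ n → Card {Vec A n} (λ _ → ⊤) (k ^ n)
  card-vec c zero = card-one [] tt (λ { [] _ → refl })
  card-vec c (suc n) = card-bij (card-× c (card-vec c n)) (λ { (x , xs) → x ∷ xs }) (λ { (x ∷ xs) → x , xs })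
    (λ _ _ → tt) (λ _ _ → tt , tt) (λ _ _ → refl) (λ { (_ ∷ _) _ → refl })

  -- If `b` were missed, sending the extra point of `A ⊎ ⊤` to `b` would extend `f` to an injection
  -- of k + 1 elements into k.
  finite-surjective : Card {A} (λ _ → ⊤) k → (f : A → A) → (∀ a b → f a ≡ f b → a ≡ b) →
                      DecidableEquality A → ∀ b → ∃ λ a → f a ≡ b
  finite-surjective {A = A} {k = k} c f fi _≟_ b with FinP.any? (λ i → f (el c i) ≟ b)
  ... | yes (i , e) = el c i , e
  ... | no ne = ⊥-elim (ℕP.<-irrefl refl (ℕP.≤-trans (ℕP.≤-reflexive (ℕP.+-comm 1 k))
          (card-≤ {P = λ _ → ⊤} {Q = λ _ → ⊤} (card-⊎ {P = λ x → ∃ λ a → x ≡ inj₁ a} {Q = λ x → x ≡ inj₂ tt} {R = λ _ → ⊤}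
              (card-bij c inj₁ g (λ a _ → a , refl) (λ _ _ → tt) (λ _ _ → refl) (λ { _ (a , refl) → refl }))
              (card-one (inj₂ tt) refl (λ _ e → e)) (λ { _ (a , refl) () }) (λ _ _ → tt) (λ _ _ → tt)
              (λ { (inj₁ a) _ → inj₁ (a , refl) ; (inj₂ tt) _ → inj₂ refl }))
            c F (λ _ _ → tt) (λ a b _ _ → F-inj a b))))
    where
    nf : ∀ a → f a ≢ b
    nf a e = let (i , q) = sur c a tt in ne (i , trans (cong f q) e)
    F : A ⊎ ⊤ → A
    F (inj₁ a) = f a
    F (inj₂ _) = b
    g : A ⊎ ⊤ → A
    g (inj₁ a) = a
    g (inj₂ _) = b
    F-inj : ∀ x y → F x ≡ F y → x ≡ y
    F-inj (inj₁ x) (inj₁ y) e = cong inj₁ (fi x y e)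
    F-inj (inj₁ x) (inj₂ y) e = ⊥-elim (nf x e)
    F-inj (inj₂ x) (inj₁ y) e = ⊥-elim (nf y (sym e))
    F-inj (inj₂ tt) (inj₂ tt) _ = refl

-- Rings of characteristic two, coprimality, and x-coordinates of consecutive points on a curve.

module CharTwo where

  open import Algebra.Bundles using (CommutativeRing; RawRing)
  open import Level using (0ℓ)
  open import Data.Bool using (Bool; true; false; _xor_; _∧_)
  open import Data.Maybe using (Maybe; just; nothing)
  open import Data.Product using (∃; _×_; _,_)
  open import Function using (id)
  import Relation.Binary.PropositionalEquality as ≡
  open import Algebra.Solver.Ring.AlmostCommutativeRing using (fromCommutativeRing; _-Raw-AlmostCommutative⟶_)
  import Algebra.Solver.Ring

  𝔽₂ : RawRing 0ℓ 0ℓ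
  𝔽₂ = record { Carrier = Bool ; _≈_ = ≡._≡_ ; _+_ = _xor_ ; _*_ = _∧_ ; -_ = id ; 0# = false ; 1# = true }

  -- With coefficients in the field of two elements the normal form of the ring solver cancels equal
  -- terms and forgets signs, so identities that hold only modulo 2 are decided directly.
  module Solver (R : CommutativeRing 0ℓ 0ℓ)
                (1+1≈0 : CommutativeRing._≈_ R
                   (CommutativeRing._+_ R (CommutativeRing.1# R) (CommutativeRing.1# R)) (CommutativeRing.0# R)) where
    open CommutativeRing R
    open import Relation.Binary.Reasoning.Setoid setoid

    private
      ⟦_⟧ : Bool → Carrier
      ⟦ true ⟧ = 1#
      ⟦ false ⟧ = 0#

      +-hom : ∀ a b → ⟦ a xor b ⟧ ≈ ⟦ a ⟧ + ⟦ b ⟧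
      +-hom true true = sym 1+1≈0
      +-hom true false = sym (+-identityʳ _)
      +-hom false b = sym (+-identityˡ _)

      *-hom : ∀ a b → ⟦ a ∧ b ⟧ ≈ ⟦ a ⟧ * ⟦ b ⟧
      *-hom true b = sym (*-identityˡ _)
      *-hom false b = sym (zeroˡ _)

      neg-hom : ∀ a → ⟦ a ⟧ ≈ - ⟦ a ⟧
      neg-hom a = begin
        ⟦ a ⟧                         ≈⟨ +-identityʳ _ ⟨
        ⟦ a ⟧ + 0#                    ≈⟨ +-congˡ (-‿inverseʳ _) ⟨
        ⟦ a ⟧ + (⟦ a ⟧ + - ⟦ a ⟧)     ≈⟨ +-assoc _ _ _ ⟨
        ⟦ a ⟧ + ⟦ a ⟧ + - ⟦ a ⟧       ≈⟨ +-congʳ (+-hom a a) ⟨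
        ⟦ a xor a ⟧ + - ⟦ a ⟧         ≈⟨ +-congʳ (reflexive (≡.cong ⟦_⟧ (xor-self a))) ⟩
        0# + - ⟦ a ⟧                  ≈⟨ +-identityˡ _ ⟩
        - ⟦ a ⟧                       ∎
        where
        xor-self : ∀ a → a xor a ≡.≡ false
        xor-self true = ≡.refl
        xor-self false = ≡.refl

      morphism : 𝔽₂ -Raw-AlmostCommutative⟶ fromCommutativeRing R
      morphism = record { ⟦_⟧ = ⟦_⟧ ; +-homo = +-hom ; *-homo = *-hom ; -‿homo = neg-hom
                        ; 0-homo = refl ; 1-homo = refl }

      _coeff≟_ : ∀ a b → Maybe (⟦ a ⟧ ≈ ⟦ b ⟧)
      true coeff≟ true = just refl
      false coeff≟ false = just refl
      _ coeff≟ _ = nothing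

    open Algebra.Solver.Ring 𝔽₂ (fromCommutativeRing R) morphism _coeff≟_ public
      using (solve; _:=_; _:+_; _:*_; con)

    x+x≈0 : ∀ x → x + x ≈ 0#
    x+x≈0 = solve 1 (λ x → x :+ x := con false) refl

    +≈0⇒≈ : ∀ {x y} → x + y ≈ 0# → x ≈ y
    +≈0⇒≈ {x} {y} e = begin
      x            ≈⟨ solve 2 (λ x y → x := (x :+ y) :+ y) refl x y ⟩
      (x + y) + y  ≈⟨ +-congʳ e ⟩
      0# + y       ≈⟨ +-identityˡ y ⟩
      y            ∎

    ≈⇒+≈0 : ∀ {x y} → x ≈ y → x + y ≈ 0#
    ≈⇒+≈0 {x} {y} e = trans (+-congʳ e) (x+x≈0 y)

    *≈0 : ∀ {x} k → x ≈ 0# → k * x ≈ 0#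
    *≈0 k e = trans (*-congˡ e) (zeroʳ k)

    0+0≈0 : ∀ {x y} → x ≈ 0# → y ≈ 0# → x + y ≈ 0#
    0+0≈0 e f = trans (+-cong e f) (+-identityˡ 0#)

    -- The Bézout form supplies explicit cofactors, from which later numerators and denominators are
    -- built.
    Coprime : Carrier → Carrier → Set
    Coprime x y = ∃ λ u → ∃ λ v → u * x + v * y ≈ 1#

    coprime-sym : ∀ {x y} → Coprime x y → Coprime y x
    coprime-sym (u , v , e) = v , u , trans (+-comm _ _) e

    coprime-* : ∀ {x y z} → Coprime x z → Coprime y z → Coprime (x * y) z
    coprime-* {x} {y} {z} (u , v , e) (u′ , v′ , e′) = u * u′ , u * x * v′ + v * (u′ * y + v′ * z) , (begin
      u * u′ * (x * y) + (u * x * v′ + v * (u′ * y + v′ * z)) * z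
        ≈⟨ solve 7 (λ u v u′ v′ x y z → u :* u′ :* (x :* y) :+ (u :* x :* v′ :+ v :* (u′ :* y :+ v′ :* z)) :* z
            := (u :* x :+ v :* z) :* (u′ :* y :+ v′ :* z)) refl u v u′ v′ x y z ⟩
      (u * x + v * z) * (u′ * y + v′ * z) ≈⟨ *-cong e e′ ⟩
      1# * 1# ≈⟨ *-identityˡ _ ⟩
      1# ∎)

    coprime-factor : ∀ {n x y z} → n ≈ x * y → Coprime n z → Coprime y z
    coprime-factor {n} {x} {y} {z} e (u , v , h) =
      u * x , v , trans (+-congʳ (trans (*-assoc u x y) (*-congˡ (sym e)))) h

    coprime-congʳ : ∀ {x y z} → y ≈ z → Coprime x y → Coprime x z
    coprime-congʳ e (u , v , h) = u , v , trans (+-congˡ (*-congˡ (sym e))) h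

    coprime-∣ : ∀ {x y z} → Coprime x y → (∃ λ p → z ≈ x * p) → (∃ λ p → z ≈ y * p) → ∃ λ p → z ≈ x * y * p
    coprime-∣ {x} {y} {z} (u , v , e) (p , ep) (s , es) = u * s + v * p , (begin
      z                            ≈⟨ *-identityʳ z ⟨
      z * 1#                       ≈⟨ *-congˡ e ⟨
      z * (u * x + v * y)          ≈⟨ distribˡ _ _ _ ⟩
      z * (u * x) + z * (v * y)    ≈⟨ +-cong (*-congʳ es) (*-congʳ ep) ⟩
      y * s * (u * x) + x * p * (v * y) ≈⟨ solve 6 (λ x y u v p s → y :* s :* (u :* x) :+ x :* p :* (v :* y)
           := x :* y :* (u :* s :+ v :* p)) refl x y u v p s ⟩
      x * y * (u * s + v * p) ∎)

    sq : Carrier → Carrier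
    sq x = x * x

    sq-cong : ∀ {x y} → x ≈ y → sq x ≈ sq y
    sq-cong e = *-cong e e

    -- On y² + xy = x³ + c² the x-coordinates X, Y of points differing by ± a point with
    -- x-coordinate t satisfy this symmetric relation; here X = f/g and Y = F/G.
    module Biquadratic (t c : Carrier) where
      α β γ : Carrier → Carrier → Carrier
      α F G = sq (t * G + F)
      β F G = t * F * G
      γ F G = sq (t * F + c * G)

      Related : (f g F G : Carrier) → Carrier
      Related f g F G = α F G * sq f + β F G * (f * g) + γ F G * sq g

      -- The quadratic form α x² + β xy + γ y² vanishes at (f , g); by coprimality it splits off the
      -- corresponding linear factor, and the other factor gives the next point.
      next : ∀ {c⁻¹ f g F G} → c * c⁻¹ ≈ 1# → (∀ x → f * x ≈ 0# → x ≈ 0#) → Coprime f g → Coprime F G →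
             Related f g F G ≈ 0# →
             ∃ λ f₂ → ∃ λ g₂ → f * f₂ ≈ γ F G × (f * g₂ + f₂ * g ≈ β F G)
               × Coprime f₂ g₂ × Related F G f₂ g₂ ≈ 0#
      next {c⁻¹} {f} {g} {F} {G} cc cancel (u , v , uv) (U , V , UV) rel =
        f₂ , g₂ , sym C≈ , B≈ , (U₂ , V₂ , cop) , rel′
        where
        A = α F G
        B = β F G
        C = γ F G
        -- From u f + v g = 1, C = C (u² f² + v² g²), and the relation replaces C g² by A f² + B f
        -- g; every term then contains f, and f₂ is the cofactor.
        f₂ = C * sq u * f + sq v * (A * f + B * g)
        C≈ : C ≈ f * f₂
        C≈ = +≈0⇒≈ (begin
          C + f * f₂  ≈⟨ solve 7 (λ A B C f g u v → C :+ f :* (C :* (u :* u) :* f :+ v :* v :* (A :* f :+ B :* g))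
                := C :* ((u :* f :+ v :* g) :* (u :* f :+ v :* g)) :+ C :+
                   v :* v :* (A :* (f :* f) :+ B :* (f :* g) :+ C :* (g :* g))) refl A B C f g u v ⟩
          C * sq (u * f + v * g) + C + sq v * Related f g F G
            ≈⟨ 0+0≈0 (≈⇒+≈0 (trans (*-congˡ (trans (sq-cong uv) (*-identityˡ _))) (*-identityʳ C))) (*≈0 _ rel) ⟩
          0# ∎)
        X = B + f₂ * g
        -- The quotient of X by f: since A f = g X, multiplying by f gives (u f + v g) X = X.
        g₂ = u * X + v * A
        Af≈ : A * f ≈ g * X
        Af≈ = +≈0⇒≈ (cancel _ (begin
          f * (A * f + g * (B + f₂ * g)) ≈⟨ solve 6 (λ A B C f g f₂ → f :* (A :* f :+ g :* (B :+ f₂ :* g))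
             := (C :+ f :* f₂) :* (g :* g) :+ (A :* (f :* f) :+ B :* (f :* g) :+ C :* (g :* g))) refl A B C f g f₂ ⟩
          (C + f * f₂) * sq g + Related f g F G ≈⟨ 0+0≈0 (trans (*-congʳ (≈⇒+≈0 C≈)) (zeroˡ _)) rel ⟩
          0# ∎))
        fg₂≈ : f * g₂ ≈ X
        fg₂≈ = begin
          f * (u * X + v * A)        ≈⟨ solve 5 (λ f u v X A → f :* (u :* X :+ v :* A) := u :* f :* X :+ v :* (A :* f)) refl f u v X A ⟩
          u * f * X + v * (A * f)    ≈⟨ +-congˡ (*-congˡ Af≈) ⟩
          u * f * X + v * (g * X)    ≈⟨ solve 5 (λ f u v X g → u :* f :* X :+ v :* (g :* X) := (u :* f :+ v :* g) :* X) refl f u v X g ⟩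
          (u * f + v * g) * X        ≈⟨ *-congʳ uv ⟩
          1# * X                     ≈⟨ *-identityˡ X ⟩
          X                          ∎
        B≈ : f * g₂ + f₂ * g ≈ B
        B≈ = trans (+-congʳ fg₂≈) (solve 2 (λ B y → B :+ y :+ y := B) refl B (f₂ * g))
        A≈ : A ≈ g * g₂
        A≈ = +≈0⇒≈ (cancel _ (begin
          f * (A + g * g₂)     ≈⟨ solve 4 (λ f A g g₂ → f :* (A :+ g :* g₂) := A :* f :+ g :* (f :* g₂)) refl f A g g₂ ⟩
          A * f + g * (f * g₂) ≈⟨ ≈⇒+≈0 (trans Af≈ (*-congˡ (sym fg₂≈))) ⟩
          0# ∎))
        -- The relation is symmetric in the two fractions. Its form now factors as (g x + f y)(g₂ x
        -- + f₂ y), and the second factor vanishes at (f₂ , g₂) in characteristic 2.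
        rel′ : Related F G f₂ g₂ ≈ 0#
        rel′ = begin
          Related F G f₂ g₂ ≈⟨ solve 6 (λ t c F G f₂ g₂ →
              (t :* g₂ :+ f₂) :* (t :* g₂ :+ f₂) :* (F :* F) :+ t :* f₂ :* g₂ :* (F :* G) :+ (t :* f₂ :+ c :* g₂) :* (t :* f₂ :+ c :* g₂) :* (G :* G)
              := (t :* G :+ F) :* (t :* G :+ F) :* (f₂ :* f₂) :+ t :* F :* G :* (f₂ :* g₂) :+ (t :* F :+ c :* G) :* (t :* F :+ c :* G) :* (g₂ :* g₂))
              refl t c F G f₂ g₂ ⟩
          Related f₂ g₂ F G ≈⟨ solve 7 (λ A B C f g f₂ g₂ → A :* (f₂ :* f₂) :+ B :* (f₂ :* g₂) :+ C :* (g₂ :* g₂)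
              := (A :+ g :* g₂) :* (f₂ :* f₂) :+ (f :* g₂ :+ f₂ :* g :+ B) :* (f₂ :* g₂) :+ (C :+ f :* f₂) :* (g₂ :* g₂))
              refl A B C f g f₂ g₂ ⟩
          (A + g * g₂) * sq f₂ + (f * g₂ + f₂ * g + B) * (f₂ * g₂) + (C + f * f₂) * sq g₂
            ≈⟨ 0+0≈0 (0+0≈0 (trans (*-congʳ (≈⇒+≈0 A≈)) (zeroˡ _)) (trans (*-congʳ (≈⇒+≈0 B≈)) (zeroˡ _)))
                     (trans (*-congʳ (≈⇒+≈0 C≈)) (zeroˡ _)) ⟩
          0# ∎
        -- Chosen so that f₂ p + g₂ s = c⁻² (C G² + B²); with C = (t F + c G)² and B = t F G only G⁴
        -- survives.
        p = sq c⁻¹ * (f * sq G + B * g)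
        s = sq c⁻¹ * (B * f)
        G⁴ : sq (sq G) ≈ f₂ * p + g₂ * s
        G⁴ = +≈0⇒≈ (begin
          sq (sq G) + (f₂ * p + g₂ * s) ≈⟨ solve 9 (λ t c c′ F G f g f₂ g₂ →
               (G :* G) :* (G :* G) :+ (f₂ :* (c′ :* c′ :* (f :* (G :* G) :+ t :* F :* G :* g)) :+ g₂ :* (c′ :* c′ :* (t :* F :* G :* f)))
               := (G :* G) :* (G :* G) :* (con true :+ (c :* c′) :* (c :* c′))
                 :+ c′ :* c′ :* (G :* G) :* ((t :* F :+ c :* G) :* (t :* F :+ c :* G) :+ f :* f₂)
                 :+ c′ :* c′ :* (t :* F :* G) :* (f :* g₂ :+ f₂ :* g :+ t :* F :* G))
               refl t c c⁻¹ F G f g f₂ g₂ ⟩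
          sq (sq G) * (1# + sq (c * c⁻¹)) + sq c⁻¹ * sq G * (C + f * f₂) + sq c⁻¹ * B * (f * g₂ + f₂ * g + B)
            ≈⟨ 0+0≈0 (0+0≈0 (*≈0 _ (≈⇒+≈0 (sym (trans (sq-cong cc) (*-identityˡ _))))) (*≈0 _ (≈⇒+≈0 C≈))) (*≈0 _ (≈⇒+≈0 B≈)) ⟩
          0# ∎)
        -- Fourth powers are additive, so 1 = (U F + V G)⁴ and A² = t⁴ G⁴ + F⁴ combine to 1 = W G⁴ +
        -- U⁴ A². Both G⁴ and A = g g₂ lie in the ideal of f₂ and g₂.
        W = sq (sq U) * sq (sq t) + sq (sq V)
        U₂ = W * p
        V₂ = sq (sq U) * A * g + W * s
        cop : U₂ * f₂ + V₂ * g₂ ≈ 1#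
        cop = begin
          W * p * f₂ + (sq (sq U) * A * g + W * s) * g₂
            ≈⟨ solve 8 (λ W p f₂ U A g s g₂ → W :* p :* f₂ :+ (U :* A :* g :+ W :* s) :* g₂
                 := W :* (f₂ :* p :+ g₂ :* s) :+ U :* A :* (g :* g₂)) refl W p f₂ (sq (sq U)) A g s g₂ ⟩
          W * (f₂ * p + g₂ * s) + sq (sq U) * A * (g * g₂) ≈⟨ +-cong (*-congˡ G⁴) (*-congˡ A≈) ⟨
          W * sq (sq G) + sq (sq U) * A * A
            ≈⟨ solve 5 (λ U V t F G →
                 ((U :* U) :* (U :* U) :* ((t :* t) :* (t :* t)) :+ (V :* V) :* (V :* V)) :* ((G :* G) :* (G :* G))
                 :+ (U :* U) :* (U :* U) :* ((t :* G :+ F) :* (t :* G :+ F)) :* ((t :* G :+ F) :* (t :* G :+ F))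
                 := ((U :* F :+ V :* G) :* (U :* F :+ V :* G)) :* ((U :* F :+ V :* G) :* (U :* F :+ V :* G))) refl U V t F G ⟩
          sq (sq (U * F + V * G)) ≈⟨ sq-cong (trans (sq-cong UV) (*-identityˡ _)) ⟩
          sq 1#                   ≈⟨ *-identityˡ _ ⟩
          1# ∎

-- The field with q elements: characteristic, Frobenius, trace and square roots.

module FieldBasics where

  open import Defs using (FiniteField)
  open Counting
  open CharTwo
  open import Data.Nat as ℕ using (ℕ; zero; suc)
  import Data.Nat.Properties as ℕP
  open import Data.Fin using (Fin; zero; suc)
  open import Data.Bool using (false; if_then_else_)
  open import Data.List as List using (List; []; _∷_; upTo)
  import Data.List.Properties as ListP
  open import Data.Product using (_,_; proj₁; proj₂)
  open import Data.Sum using (_⊎_; inj₁; inj₂)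
  open import Data.Empty using (⊥-elim)
  open import Data.Unit using (⊤; tt)
  open import Algebra.Bundles using (CommutativeRing)
  open import Level using (0ℓ)
  open import Relation.Nullary using (yes; no; does)
  open import Relation.Binary.PropositionalEquality
  open import Function using (_∘_; Inverse; mk↔ₛ′)

  module Field {r : ℕ} (F : FiniteField r) where
    open FiniteField F public
    open Defs using () renaming (q to fieldSize; tr to trF; _^F_ to powF)

    infixr 8 _^_
    _^_ : Carrier → ℕ → Carrier
    _^_ = powF F

    q : ℕ
    q = 2 ℕ.^ r

    ring : CommutativeRing 0ℓ 0ℓ
    ring = record { isCommutativeRing = isCommutativeRing }

    open CommutativeRing ring public
      using (+-assoc; +-comm; +-identityˡ; +-identityʳ; *-assoc; *-comm; *-identityˡ; *-identityʳ;
             distribˡ; distribʳ; zeroˡ; zeroʳ; -‿inverseˡ; -‿inverseʳ; semiring; *-commutativeMonoid; +-commutativeMonoid)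

    open import Algebra.Properties.Semiring.Sum semiring public
      using (sum; sum-cong-≗; ∑-distrib-+; ∑-comm; *-distribˡ-sum; *-distribʳ-sum; sum-permute; sum-replicate-zero)
    open import Algebra.Properties.CommutativeMonoid.Sum *-commutativeMonoid
      using () renaming (sum to prod; sum-permute to prod-permute; sum-cong-≗ to prod-cong; ∑-distrib-+ to prod-distrib)

    to : Fin q → Carrier
    to = Inverse.to enum

    from : Carrier → Fin q
    from = Inverse.from enum

    to∘from : ∀ x → to (from x) ≡ x
    to∘from x = Inverse.inverseˡ enum refl

    from∘to : ∀ i → from (to i) ≡ i
    from∘to i = Inverse.inverseʳ enum refl

    to-injective : ∀ {i j} → to i ≡ to j → i ≡ j
    to-injective {i} {j} e = trans (sym (from∘to i)) (trans (cong from e) (from∘to j))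

    card-F : Card {Carrier} (λ _ → ⊤) q
    card-F = card to (λ _ → tt) to-injective (λ a _ → from a , to∘from a)

    1≢0 : 1# ≢ 0#
    1≢0 e = 0≢1 (sym e)

    x*y≡0 : ∀ {x y} → x * y ≡ 0# → x ≢ 0# → y ≡ 0#
    x*y≡0 {x} {y} e n = begin
      y                  ≡⟨ *-identityˡ y ⟨
      1# * y             ≡⟨ cong (_* y) (trans (*-comm _ _) (⁻¹-inverse x n)) ⟨
      x ⁻¹ * x * y       ≡⟨ *-assoc _ _ _ ⟩
      x ⁻¹ * (x * y)     ≡⟨ cong (x ⁻¹ *_) e ⟩
      x ⁻¹ * 0#          ≡⟨ zeroʳ _ ⟩
      0#                 ∎ where open ≡-Reasoning

    *-≢0 : ∀ {x y} → x ≢ 0# → y ≢ 0# → x * y ≢ 0#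
    *-≢0 n m e = m (x*y≡0 e n)

    *-cancelˡ : ∀ {a x y} → a ≢ 0# → a * x ≡ a * y → x ≡ y
    *-cancelˡ {a} {x} {y} n e = trans (h x) (trans (cong (a ⁻¹ *_) e) (sym (h y)))
      where
      h : ∀ x → x ≡ a ⁻¹ * (a * x)
      h x = trans (sym (*-identityˡ x)) (trans (cong (_* x) (sym (trans (*-comm _ _) (⁻¹-inverse a n)))) (*-assoc _ _ _))

    ⁻¹-≢0 : ∀ {x} → x ≢ 0# → x ⁻¹ ≢ 0#
    ⁻¹-≢0 {x} n e = 0≢1 (trans (sym (zeroʳ x)) (trans (cong (x *_) (sym e)) (⁻¹-inverse x n)))

    ^-≢0 : ∀ {x} n → x ≢ 0# → x ^ n ≢ 0#
    ^-≢0 zero h e = 0≢1 (sym e)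
    ^-≢0 (suc n) h = *-≢0 h (^-≢0 n h)

    private
      translate : (f g : Carrier → Carrier) → (∀ x → f (g x) ≡ x) → (∀ x → g (f x) ≡ x) → _
      translate f g fg gf = mk↔ₛ′ {A = Fin q} {B = Fin q} (from ∘ f ∘ to) (from ∘ g ∘ to)
        (λ i → trans (cong (from ∘ f) (to∘from _)) (trans (cong from (fg _)) (from∘to i)))
        (λ i → trans (cong (from ∘ g) (to∘from _)) (trans (cong from (gf _)) (from∘to i)))

    private
      sum-const : ∀ n x → sum {n} (λ _ → x) ≡ Defs._·_ F n x
      sum-const zero x = refl
      sum-const (suc n) x = cong (x +_) (sum-const n x)

      prod-const : ∀ n x → prod {n} (λ _ → x) ≡ x ^ n
      prod-const zero x = refl
      prod-const (suc n) x = cong (x *_) (prod-const n x)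

      ·-2^ : ∀ k → Defs._·_ F (2 ℕ.^ k) 1# ≡ (1# + 1#) ^ k
      ·-2^ zero = +-identityʳ 1#
      ·-2^ (suc k) = begin
        (2 ℕ.^ k ℕ.+ (2 ℕ.^ k ℕ.+ 0)) · 1#       ≡⟨ ·-+ (2 ℕ.^ k) _ ⟩
        2 ℕ.^ k · 1# + (2 ℕ.^ k ℕ.+ 0) · 1#      ≡⟨ cong (λ z → 2 ℕ.^ k · 1# + z · 1#) (ℕP.+-identityʳ (2 ℕ.^ k)) ⟩
        2 ℕ.^ k · 1# + 2 ℕ.^ k · 1#              ≡⟨ cong₂ _+_ (·-2^ k) (·-2^ k) ⟩
        (1# + 1#) ^ k + (1# + 1#) ^ k            ≡⟨ cong₂ _+_ (*-identityˡ _) (*-identityˡ _) ⟨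
        1# * (1# + 1#) ^ k + 1# * (1# + 1#) ^ k  ≡⟨ distribʳ _ _ _ ⟨
        (1# + 1#) * (1# + 1#) ^ k                ∎
        where
        open ≡-Reasoning
        _·_ = Defs._·_ F
        infixl 7 _·_
        ·-+ : ∀ m n → (m ℕ.+ n) · 1# ≡ m · 1# + n · 1#
        ·-+ zero n = sym (+-identityˡ _)
        ·-+ (suc m) n = trans (cong (1# +_) (·-+ m n)) (sym (+-assoc _ _ _))

    -- Translation by 1 permutes the field, so q · 1 = 0; as q is a power of 2 the characteristic is 2.
    1+1≡0 : 1# + 1# ≡ 0#
    1+1≡0 with (1# + 1#) ≟ 0#
    ... | yes e = e
    ... | no n = ⊥-elim (^-≢0 r n (trans (sym (·-2^ r)) (trans (sym (sum-const q 1#)) q·1)))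
      where
      open ≡-Reasoning
      S = sum to
      eq : S ≡ S + sum {q} (λ _ → 1#)
      eq = begin
        S ≡⟨ sum-permute to (translate (_+ 1#) (_+ - 1#) (λ x → trans (+-assoc _ _ _) (trans (cong (x +_) (-‿inverseˡ 1#)) (+-identityʳ x)))
                (λ x → trans (+-assoc _ _ _) (trans (cong (x +_) (-‿inverseʳ 1#)) (+-identityʳ x)))) ⟩
        sum (λ i → to (from (to i + 1#))) ≡⟨ sum-cong-≗ (λ i → to∘from (to i + 1#)) ⟩
        sum (λ i → to i + 1#) ≡⟨ ∑-distrib-+ to (λ _ → 1#) ⟩
        S + sum {q} (λ _ → 1#) ∎
      q·1 : sum {q} (λ _ → 1#) ≡ 0#
      q·1 = begin
        T                 ≡⟨ +-identityˡ T ⟨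
        0# + T            ≡⟨ cong (_+ T) (-‿inverseˡ S) ⟨
        - S + S + T       ≡⟨ +-assoc _ _ _ ⟩
        - S + (S + T)     ≡⟨ cong (- S +_) eq ⟨
        - S + S           ≡⟨ -‿inverseˡ S ⟩
        0#                ∎
        where T = sum {q} (λ _ → 1#)

    open Solver ring 1+1≡0 public

    -- Multiplication by x ≠ 0 permutes the field. To take a product over all elements, `φ` replaces
    -- 0 by 1; `ψ` restores the factor x that this loses at 0. Hence P x^q = P x for a nonzero
    -- product P.
    x^q≡x : ∀ x → x ^ q ≡ x
    x^q≡x x with x ≟ 0#
    ... | yes refl = pos q (ℕP.m^n>0 2 r)
      where
      pos : ∀ n → 1 ℕ.≤ n → 0# ^ n ≡ 0#
      pos (suc n) _ = zeroˡ _
    ... | no n = *-cancelˡ P≢0 (begin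
        P * x ^ q ≡⟨ cong (P *_) (prod-const q x) ⟨
        P * prod {q} (λ _ → x) ≡⟨ prod-distrib (φ ∘ to) (λ _ → x) ⟨
        prod (λ i → φ (to i) * x) ≡⟨ prod-cong (λ i → eq (to i)) ⟩
        prod (λ i → φ (x * to i) * ψ (to i)) ≡⟨ prod-distrib (λ i → φ (x * to i)) (ψ ∘ to) ⟩
        prod (λ i → φ (x * to i)) * prod (ψ ∘ to) ≡⟨ cong₂ _*_ perm prodψ ⟩
        P * x ∎)
      where
      open ≡-Reasoning
      φ ψ : Carrier → Carrier
      φ y = if does (y ≟ 0#) then 1# else y
      ψ y = if does (y ≟ 0#) then x else 1#
      P = prod (φ ∘ to)
      φ≢0 : ∀ y → φ y ≢ 0#
      φ≢0 y with y ≟ 0#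
      ... | yes _ = 1≢0
      ... | no m = m
      prod≢0 : ∀ {n} (f : Fin n → Carrier) → (∀ i → f i ≢ 0#) → prod f ≢ 0#
      prod≢0 {zero} f h = 1≢0
      prod≢0 {suc n} f h = *-≢0 (h zero) (prod≢0 (f ∘ suc) (h ∘ suc))
      P≢0 : P ≢ 0#
      P≢0 = prod≢0 _ (λ i → φ≢0 (to i))
      eq : ∀ y → φ y * x ≡ φ (x * y) * ψ y
      eq y with y ≟ 0# | (x * y) ≟ 0#
      ... | yes refl | yes _ = refl
      ... | yes refl | no m = ⊥-elim (m (zeroʳ x))
      ... | no m | yes e = ⊥-elim (m (x*y≡0 e n))
      ... | no m | no _ = trans (*-comm y x) (sym (*-identityʳ _))
      perm : prod (λ i → φ (x * to i)) ≡ P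
      perm = sym (trans (prod-permute (φ ∘ to) (translate (x *_) (x ⁻¹ *_)
          (λ y → trans (sym (*-assoc _ _ _)) (trans (cong (_* y) (⁻¹-inverse x n)) (*-identityˡ y)))
          (λ y → trans (sym (*-assoc _ _ _)) (trans (cong (_* y) (trans (*-comm _ _) (⁻¹-inverse x n))) (*-identityˡ y)))))
        (prod-cong (λ i → cong φ (to∘from (x * to i)))))
      single : ∀ {n} (f : Fin n → Carrier) (i : Fin n) → f i ≡ x → (∀ j → j ≢ i → f j ≡ 1#) → prod f ≡ x
      ones : ∀ {n} (f : Fin n → Carrier) → (∀ i → f i ≡ 1#) → prod f ≡ 1#
      ones {zero} f h = refl
      ones {suc n} f h = trans (cong₂ _*_ (h zero) (ones (f ∘ suc) (h ∘ suc))) (*-identityˡ _)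
      single f zero e h = trans (cong₂ _*_ e (ones (f ∘ suc) (λ j → h (suc j) (λ ())))) (*-identityʳ x)
      single f (suc i) e h = trans (cong₂ _*_ (h zero (λ ())) (single (f ∘ suc) i e (λ j ne → h (suc j) (λ { refl → ne refl })))) (*-identityˡ x)
      ψ0 : ∀ y → y ≡ 0# → ψ y ≡ x
      ψ0 y e with y ≟ 0#
      ... | yes _ = refl
      ... | no m = ⊥-elim (m e)
      ψ1 : ∀ y → y ≢ 0# → ψ y ≡ 1#
      ψ1 y m with y ≟ 0#
      ... | yes e = ⊥-elim (m e)
      ... | no _ = refl
      prodψ : prod (ψ ∘ to) ≡ x
      prodψ = single (ψ ∘ to) (from 0#) (ψ0 _ (to∘from 0#)) (λ j ne → ψ1 _ (λ e → ne (trans (sym (from∘to j)) (cong from e))))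

    ^-+ : ∀ x m n → x ^ (m ℕ.+ n) ≡ x ^ m * x ^ n
    ^-+ x zero n = sym (*-identityˡ _)
    ^-+ x (suc m) n = trans (cong (x *_) (^-+ x m n)) (sym (*-assoc _ _ _))

    frob : ℕ → Carrier → Carrier
    frob k x = x ^ (2 ℕ.^ k)

    frob-suc : ∀ k x → frob (suc k) x ≡ sq (frob k x)
    frob-suc k x = trans (cong (λ z → x ^ (2 ℕ.^ k ℕ.+ z)) (ℕP.+-identityʳ _)) (^-+ x (2 ℕ.^ k) (2 ℕ.^ k))

    sq-+ : ∀ x y → sq (x + y) ≡ sq x + sq y
    sq-+ = solve 2 (λ x y → (x :+ y) :* (x :+ y) := x :* x :+ y :* y) refl

    sq-* : ∀ x y → sq (x * y) ≡ sq x * sq y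
    sq-* = solve 2 (λ x y → (x :* y) :* (x :* y) := (x :* x) :* (y :* y)) refl

    frob-+ : ∀ k x y → frob k (x + y) ≡ frob k x + frob k y
    frob-+ zero x y = trans (*-identityʳ _) (sym (cong₂ _+_ (*-identityʳ x) (*-identityʳ y)))
    frob-+ (suc k) x y = trans (frob-suc k _) (trans (cong sq (frob-+ k x y))
      (trans (sq-+ _ _) (sym (cong₂ _+_ (frob-suc k x) (frob-suc k y)))))

    frob-sq : ∀ k x → frob k (sq x) ≡ sq (frob k x)
    frob-sq zero x = trans (*-identityʳ _) (sym (cong sq (*-identityʳ x)))
    frob-sq (suc k) x = trans (frob-suc k _) (trans (cong sq (frob-sq k x)) (cong sq (sym (frob-suc k x))))

    -- Partial traces over the first k conjugates. Inductions run on k, which for the trace itself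
    -- is tied to the size of the field.
    ptr : ℕ → Carrier → Carrier
    ptr k x = List.foldr (λ k acc → frob k x + acc) 0# (upTo k)

    ptr-suc : ∀ k x → ptr (suc k) x ≡ ptr k x + frob k x
    ptr-suc k x = begin
      ptr (suc k) x ≡⟨ cong (List.foldr _ 0#) (ListP.upTo-∷ʳ k) ⟨
      List.foldr _ 0# (upTo k List.++ k ∷ []) ≡⟨ snoc (upTo k) ⟩
      ptr k x + frob k x ∎
      where
      open ≡-Reasoning
      snoc : ∀ xs → List.foldr (λ k acc → frob k x + acc) 0# (xs List.++ k ∷ []) ≡ List.foldr (λ k acc → frob k x + acc) 0# xs + frob k x
      snoc [] = +-comm _ _
      snoc (y ∷ xs) = trans (cong (frob y x +_) (snoc xs)) (sym (+-assoc _ _ _))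

    ptr-+ : ∀ k x y → ptr k (x + y) ≡ ptr k x + ptr k y
    ptr-+ zero x y = sym (+-identityˡ _)
    ptr-+ (suc k) x y = trans (ptr-suc k _) (trans (cong₂ _+_ (ptr-+ k x y) (frob-+ k x y))
      (trans (solve 4 (λ a b c d → (a :+ b) :+ (c :+ d) := (a :+ c) :+ (b :+ d)) refl _ _ _ _)
        (sym (cong₂ _+_ (ptr-suc k x) (ptr-suc k y)))))

    ptr-sq : ∀ k x → ptr k (sq x) ≡ sq (ptr k x)
    ptr-sq zero x = sym (zeroˡ _)
    ptr-sq (suc k) x = trans (ptr-suc k _) (trans (cong₂ _+_ (ptr-sq k x) (frob-sq k x))
      (trans (sym (sq-+ _ _)) (cong sq (sym (ptr-suc k x)))))

    -- Squaring shifts the sum by one conjugate, so the sum with its square telescopes. For k = r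
    -- the right side is x^q + x = 0, which makes the trace take only the values 0 and 1.
    ptr-artin : ∀ k x → sq (ptr k x) + ptr k x ≡ frob k x + x
    ptr-artin zero x = trans (solve 1 (λ x → con false :* con false :+ con false := x :+ x) refl x) (cong (_+ x) (sym (*-identityʳ x)))
    ptr-artin (suc k) x = begin
      sq (ptr (suc k) x) + ptr (suc k) x ≡⟨ cong (λ z → sq z + z) (ptr-suc k x) ⟩
      sq (t + f) + (t + f) ≡⟨ solve 2 (λ t f → (t :+ f) :* (t :+ f) :+ (t :+ f) := (t :* t :+ t) :+ (f :* f :+ f)) refl t f ⟩
      (sq t + t) + (sq f + f) ≡⟨ cong (_+ (sq f + f)) (ptr-artin k x) ⟩
      (f + x) + (sq f + f) ≡⟨ solve 3 (λ f x s → (f :+ x) :+ (s :+ f) := s :+ x) refl f x (sq f) ⟩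
      sq f + x ≡⟨ cong (_+ x) (frob-suc k x) ⟨
      frob (suc k) x + x ∎
      where
      open ≡-Reasoning
      t = ptr k x
      f = frob k x

    tr : Carrier → Carrier
    tr = trF F

    tr-+ : ∀ x y → tr (x + y) ≡ tr x + tr y
    tr-+ = ptr-+ r

    tr-sq : ∀ x → tr (sq x) ≡ tr x
    tr-sq x = +≈0⇒≈ (trans (cong (_+ tr x) (ptr-sq r x)) (trans (ptr-artin r x) (≈⇒+≈0 (x^q≡x x))))

    sq≡self⇒bit : ∀ {x} → sq x ≡ x → x ≡ 0# ⊎ x ≡ 1#
    sq≡self⇒bit {x} e with x ≟ 0#
    ... | yes z = inj₁ z
    ... | no n = inj₂ (*-cancelˡ n (trans e (sym (*-identityʳ x))))

    tr-bit : ∀ x → tr x ≡ 0# ⊎ tr x ≡ 1#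
    tr-bit x = sq≡self⇒bit (trans (sym (ptr-sq r x)) (tr-sq x))

    tr-artin : ∀ x → tr (sq x + x) ≡ 0#
    tr-artin x = trans (tr-+ _ _) (≈⇒+≈0 (tr-sq x))

    tr-0 : tr 0# ≡ 0#
    tr-0 = trans (cong tr (solve 0 (con false := con false :* con false :+ con false) refl)) (tr-artin 0#)

    sq≡0 : ∀ {x} → sq x ≡ 0# → x ≡ 0#
    sq≡0 {x} e with x ≟ 0#
    ... | yes z = z
    ... | no n = x*y≡0 e n

    sq-injective : ∀ {x y} → sq x ≡ sq y → x ≡ y
    sq-injective {x} {y} e = +≈0⇒≈ (sq≡0 (trans (sq-+ x y) (≈⇒+≈0 e)))

    √ : Carrier → Carrier
    √ x = proj₁ (finite-surjective card-F sq (λ _ _ → sq-injective) _≟_ x)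

    sq-√ : ∀ x → sq (√ x) ≡ x
    sq-√ x = proj₂ (finite-surjective card-F sq (λ _ _ → sq-injective) _≟_ x)

    √-sq : ∀ x → √ (sq x) ≡ x
    √-sq x = sq-injective (sq-√ (sq x))

    r≢0 : r ≢ 0
    r≢0 e = 0≢1 (trans (sym (to∘from 0#)) (trans (cong to (one (cong (2 ℕ.^_) e) _ _)) (to∘from 1#)))
      where
      one : ∀ {n} → n ≡ 1 → (i j : Fin n) → i ≡ j
      one refl zero zero = refl

-- Polynomials over the field: degrees, values, roots and coprimality.

module Polynomials where

  open import Defs using (FiniteField)
  open Counting
  open CharTwo
  open FieldBasics
  open import Data.Nat as ℕ using (ℕ; zero; suc; _≤_; _<_; z≤n; s≤s; _⊔_)
  import Data.Nat.Properties as ℕP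
  open import Data.Bool using (true; false)
  open import Data.List as List using (List; []; _∷_; length)
  open import Data.List.Relation.Unary.All as All using (All; []; _∷_)
  open import Data.List.Relation.Unary.AllPairs using ([]; _∷_)
  open import Data.List.Relation.Unary.Unique.Propositional using (Unique)
  open import Data.Product using (∃; _×_; _,_; proj₁; proj₂)
  open import Data.Sum using (_⊎_; inj₁; inj₂)
  open import Data.Empty using (⊥-elim)
  open import Algebra.Bundles using (CommutativeRing)
  open import Algebra.Structures using (IsCommutativeRing)
  open import Level using (0ℓ)
  open import Relation.Nullary using (yes; no)
  open import Relation.Binary.Definitions using (tri<; tri≈; tri>)
  open import Relation.Binary.PropositionalEquality
  open import Function using (_∘_; id)

  module Polys {r : ℕ} (F : FiniteField r) where
    private module K = Field F
    open K using (Carrier; 0#; 1#)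

    Series : Set
    Series = ℕ → Carrier

    _⋆_ : Series → Series → Series
    (f ⋆ g) zero    = f 0 K.* g 0
    (f ⋆ g) (suc n) = f 0 K.* g (suc n) K.+ ((f ∘ suc) ⋆ g) n

    ⋆-cong : ∀ {f f′ g g′} → f ≗ f′ → g ≗ g′ → (f ⋆ g) ≗ (f′ ⋆ g′)
    ⋆-cong e h zero = cong₂ K._*_ (e 0) (h 0)
    ⋆-cong e h (suc n) = cong₂ K._+_ (cong₂ K._*_ (e 0) (h (suc n))) (⋆-cong (e ∘ suc) h n)

    ⋆-suc : ∀ f g n → (f ⋆ g) (suc n) ≡ f (suc n) K.* g 0 K.+ (f ⋆ (g ∘ suc)) n
    ⋆-suc f g zero = K.+-comm _ _
    ⋆-suc f g (suc n) = trans (cong (f 0 K.* g (suc (suc n)) K.+_) (⋆-suc (f ∘ suc) g n))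
      (K.solve 3 (λ a b c → a K.:+ (b K.:+ c) K.:= b K.:+ (a K.:+ c)) refl _ _ _)

    ⋆-comm : ∀ f g → (f ⋆ g) ≗ (g ⋆ f)
    ⋆-comm f g zero = K.*-comm _ _
    ⋆-comm f g (suc n) = trans (cong₂ K._+_ (K.*-comm _ _) (⋆-comm (f ∘ suc) g n)) (sym (⋆-suc g f n))

    ⋆-distribʳ : ∀ h f g → ((λ n → f n K.+ g n) ⋆ h) ≗ (λ n → (f ⋆ h) n K.+ (g ⋆ h) n)
    ⋆-distribʳ h f g zero = K.distribʳ _ _ _
    ⋆-distribʳ h f g (suc n) = trans (cong₂ K._+_ (K.distribʳ _ _ _) (⋆-distribʳ h (f ∘ suc) (g ∘ suc) n))
      (K.solve 4 (λ a b c d → (a K.:+ b) K.:+ (c K.:+ d) K.:= (a K.:+ c) K.:+ (b K.:+ d)) refl _ _ _ _)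

    ⋆-scale : ∀ a f g → ((λ n → a K.* f n) ⋆ g) ≗ (λ n → a K.* (f ⋆ g) n)
    ⋆-scale a f g zero = K.*-assoc _ _ _
    ⋆-scale a f g (suc n) = trans (cong₂ K._+_ (K.*-assoc _ _ _) (⋆-scale a (f ∘ suc) g n)) (sym (K.distribˡ _ _ _))

    ⋆-assoc : ∀ f g h → ((f ⋆ g) ⋆ h) ≗ (f ⋆ (g ⋆ h))
    ⋆-assoc f g h zero = K.*-assoc _ _ _
    ⋆-assoc f g h (suc n) = begin
      f 0 K.* g 0 K.* h (suc n) K.+ ((λ m → f 0 K.* g (suc m) K.+ ((f ∘ suc) ⋆ g) m) ⋆ h) n
        ≡⟨ cong₂ K._+_ (K.*-assoc _ _ _) (⋆-distribʳ h (λ m → f 0 K.* g (suc m)) ((f ∘ suc) ⋆ g) n) ⟩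
      f 0 K.* (g 0 K.* h (suc n)) K.+ (((λ m → f 0 K.* g (suc m)) ⋆ h) n K.+ (((f ∘ suc) ⋆ g) ⋆ h) n)
        ≡⟨ cong (f 0 K.* (g 0 K.* h (suc n)) K.+_) (cong₂ K._+_ (⋆-scale (f 0) (g ∘ suc) h n) (⋆-assoc (f ∘ suc) g h n)) ⟩
      f 0 K.* (g 0 K.* h (suc n)) K.+ (f 0 K.* ((g ∘ suc) ⋆ h) n K.+ ((f ∘ suc) ⋆ (g ⋆ h)) n)
        ≡⟨ K.+-assoc _ _ _ ⟨
      f 0 K.* (g 0 K.* h (suc n)) K.+ f 0 K.* ((g ∘ suc) ⋆ h) n K.+ ((f ∘ suc) ⋆ (g ⋆ h)) n
        ≡⟨ cong (K._+ ((f ∘ suc) ⋆ (g ⋆ h)) n) (K.distribˡ _ _ _) ⟨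
      (f ⋆ (g ⋆ h)) (suc n) ∎ where open ≡-Reasoning

    Below : Series → ℕ → Set
    Below f n = ∀ k → n ≤ k → f k ≡ 0#

    Below-weaken : ∀ {f m n} → m ≤ n → Below f m → Below f n
    Below-weaken h b k l = b k (ℕP.≤-trans h l)

    Below-+ : ∀ {f g n} → Below f n → Below g n → Below (λ k → f k K.+ g k) n
    Below-+ b c k l = trans (cong₂ K._+_ (b k l) (c k l)) (K.+-identityˡ _)

    Below-cong : ∀ {f g n} → f ≗ g → Below f n → Below g n
    Below-cong e b k l = trans (sym (e k)) (b k l)

    0⋆ : ∀ {f} g → Below f 0 → ∀ n → (f ⋆ g) n ≡ 0#
    0⋆ g b zero = trans (cong (K._* g 0) (b 0 z≤n)) (K.zeroˡ _)
    0⋆ g b (suc n) = trans (cong₂ K._+_ (trans (cong (K._* g (suc n)) (b 0 z≤n)) (K.zeroˡ _)) (0⋆ g (λ k _ → b (suc k) z≤n) n)) (K.+-identityˡ _)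

    Below-⋆ : ∀ {f g} a b → Below f (suc a) → Below g b → Below (f ⋆ g) (a ℕ.+ b)
    Below-⋆ {f} {g} zero b bf bg zero l = trans (cong (f 0 K.*_) (bg 0 l)) (K.zeroʳ _)
    Below-⋆ {f} {g} zero b bf bg (suc k) l =
      trans (cong₂ K._+_ (trans (cong (f 0 K.*_) (bg (suc k) l)) (K.zeroʳ _)) (0⋆ g (λ k _ → bf (suc k) (s≤s z≤n)) k)) (K.+-identityˡ _)
    Below-⋆ {f} {g} (suc a) b bf bg (suc k) (s≤s l) =
      trans (cong₂ K._+_ (trans (cong (f 0 K.*_) (bg (suc k) (ℕP.≤-trans (ℕP.m≤n+m b a) (ℕP.m≤n⇒m≤1+n l)))) (K.zeroʳ _))
        (Below-⋆ a b (λ k l → bf (suc k) (s≤s l)) bg k l)) (K.+-identityˡ _)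

    ⋆-top : ∀ {f g} a b → Below f (suc a) → Below g (suc b) → (f ⋆ g) (a ℕ.+ b) ≡ f a K.* g b
    ⋆-top {f} {g} zero zero bf bg = refl
    ⋆-top {f} {g} zero (suc b) bf bg = trans (cong (f 0 K.* g (suc b) K.+_) (0⋆ g (λ k _ → bf (suc k) (s≤s z≤n)) b)) (K.+-identityʳ _)
    ⋆-top {f} {g} (suc a) b bf bg =
      trans (cong₂ K._+_ (trans (cong (f 0 K.*_) (bg (suc (a ℕ.+ b)) (s≤s (ℕP.m≤n+m b a)))) (K.zeroʳ _))
        (⋆-top a b (λ k l → bf (suc k) (s≤s l)) bg)) (K.+-identityˡ _)

    -- The stored bound need not be sharp and `_≈_` ignores it, so leading zeros never have to be
    -- normalised away; `HasDeg` carries the degree separately.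
    record Poly : Set where
      no-eta-equality
      constructor poly
      field
        coef  : Series
        bound : ℕ
        below : Below coef bound

    open Poly public

    infix 4 _≈_
    record _≈_ (p s : Poly) : Set where
      constructor pointwise
      field at : coef p ≗ coef s

    open _≈_ public

    infixl 6 _+_
    infixl 7 _*_

    opaque
      _+_ _*_ : Poly → Poly → Poly
      p + s = poly (λ k → coef p k K.+ coef s k) (bound p ⊔ bound s)
        (Below-+ (Below-weaken (ℕP.m≤m⊔n _ _) (below p)) (Below-weaken (ℕP.m≤n⊔m (bound p) _) (below s)))
      p * s = poly (coef p ⋆ coef s) (bound p ℕ.+ bound s)
        (Below-⋆ (bound p) (bound s) (Below-weaken (ℕP.n≤1+n _) (below p)) (below s))

      const : Carrier → Poly
      const a = poly (λ { zero → a ; (suc _) → 0# }) 1 (λ { (suc k) _ → refl })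

      t : Poly
      t = poly (λ { (suc zero) → 1# ; _ → 0# }) 2 (λ { (suc (suc k)) _ → refl ; (suc zero) (s≤s ()) })

      const-* : ∀ a p k → coef (const a * p) k ≡ a K.* coef p k
      const-* a p zero = refl
      const-* a p (suc k) = trans (cong (a K.* coef p (suc k) K.+_) (0⋆ (coef p) (λ _ _ → refl) k)) (K.+-identityʳ _)

    opaque
      unfolding _+_

      isCommutativeRing : IsCommutativeRing _≈_ _+_ _*_ id (const 0#) (const 1#)
      isCommutativeRing = record
        { isRing = record
          { +-isAbelianGroup = record
            { isGroup = record
              { isMonoid = record
                { isSemigroup = record
                  { isMagma = record
                    { isEquivalence = record { refl = pointwise λ _ → refl ; sym = λ e → pointwise λ k → sym (at e k) ; trans = λ e h → pointwise λ k → trans (at e k) (at h k) }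
                    ; ∙-cong = λ e h → pointwise λ k → cong₂ K._+_ (at e k) (at h k) }
                  ; assoc = λ _ _ _ → pointwise λ _ → K.+-assoc _ _ _ }
                ; identity = (λ _ → pointwise λ { zero → K.+-identityˡ _ ; (suc _) → K.+-identityˡ _ }) , (λ _ → pointwise λ { zero → K.+-identityʳ _ ; (suc _) → K.+-identityʳ _ }) }
              ; inverse = (λ _ → pointwise λ { zero → K.x+x≈0 _ ; (suc _) → K.x+x≈0 _ }) , (λ _ → pointwise λ { zero → K.x+x≈0 _ ; (suc _) → K.x+x≈0 _ })
              ; ⁻¹-cong = id }
            ; comm = λ _ _ → pointwise λ _ → K.+-comm _ _ }
          ; *-cong = λ e h → pointwise (⋆-cong (at e) (at h))
          ; *-assoc = λ p s u → pointwise (⋆-assoc (coef p) (coef s) (coef u))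
          ; *-identity = (λ p → pointwise λ k → trans (const-* 1# p k) (K.*-identityˡ _))
            , (λ p → pointwise λ k → trans (⋆-comm (coef p) (coef (const 1#)) k) (trans (const-* 1# p k) (K.*-identityˡ _)))
          ; distrib = (λ p s u → pointwise λ k → trans (⋆-comm (coef p) _ k) (trans (⋆-distribʳ (coef p) (coef s) (coef u) k)
               (cong₂ K._+_ (⋆-comm (coef s) (coef p) k) (⋆-comm (coef u) (coef p) k))))
            , (λ p s u → pointwise (⋆-distribʳ (coef p) (coef s) (coef u)))
          }
        ; *-comm = λ p s → pointwise (⋆-comm (coef p) (coef s)) }

      1+1≈0 : const 1# + const 1# ≈ const 0#
      1+1≈0 = pointwise λ { zero → K.1+1≡0 ; (suc k) → K.+-identityˡ _ }

      const0 : ∀ k → coef (const 0#) k ≡ 0#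
      const0 zero = refl
      const0 (suc _) = refl

      const-+ : ∀ a b → const (a K.+ b) ≈ const a + const b
      const-+ a b = pointwise λ { zero → refl ; (suc k) → sym (K.+-identityˡ _) }

      const-*-const : ∀ a b → const (a K.* b) ≈ const a * const b
      const-*-const a b = pointwise λ { zero → refl ; (suc k) → sym (trans (const-* a (const b) (suc k)) (K.zeroʳ a)) }

      coef-+ : ∀ p s k → coef (p + s) k ≡ coef p k K.+ coef s k
      coef-+ p s k = refl

      coef-* : ∀ p s k → coef (p * s) k ≡ (coef p ⋆ coef s) k
      coef-* p s k = refl

      Below-const : ∀ a → Below (coef (const a)) 1
      Below-const a (suc _) _ = refl

      Below-t : Below (coef t) 2
      Below-t (suc zero) (s≤s ())
      Below-t (suc (suc k)) _ = refl

      coef-t-1 : coef t 1 ≡ 1#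
      coef-t-1 = refl

      coef-const-0 : ∀ a → coef (const a) 0 ≡ a
      coef-const-0 a = refl

    polyRing : CommutativeRing 0ℓ 0ℓ
    polyRing = record { isCommutativeRing = isCommutativeRing }

    module R = CommutativeRing polyRing
    open Solver polyRing 1+1≈0 public

    LessDeg : Poly → ℕ → Set
    LessDeg p = Below (coef p)

    HasDeg : Poly → ℕ → Set
    HasDeg p d = LessDeg p (suc d) × coef p d ≢ 0#

    LessDeg-* : ∀ {p s a b} → LessDeg p (suc a) → LessDeg s b → LessDeg (p * s) (a ℕ.+ b)
    LessDeg-* {p} {s} {a} {b} l l′ = Below-cong (λ k → sym (coef-* p s k)) (Below-⋆ a b l l′)

    HasDeg-* : ∀ {p s a b} → HasDeg p a → HasDeg s b → HasDeg (p * s) (a ℕ.+ b)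
    HasDeg-* {p} {s} {a} {b} (l , n) (l′ , n′) =
      subst (LessDeg (p * s)) (ℕP.+-suc a b) (LessDeg-* {p} {s} l l′) ,
      λ e → K.*-≢0 n n′ (trans (sym (trans (coef-* p s (a ℕ.+ b)) (⋆-top a b l l′))) e)

    HasDeg-cong : ∀ {p s d} → p ≈ s → HasDeg p d → HasDeg s d
    HasDeg-cong {d = d} e (l , n) = Below-cong (at e) l , λ z → n (trans (at e d) z)

    HasDeg-unique : ∀ {p a b} → HasDeg p a → HasDeg p b → a ≡ b
    HasDeg-unique {p} {a} {b} (l , n) (l′ , n′) with ℕP.<-cmp a b
    ... | tri< h _ _ = ⊥-elim (n′ (l b h))
    ... | tri≈ _ e _ = e
    ... | tri> _ _ h = ⊥-elim (n (l′ a h))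

    LessDeg-+ : ∀ {p s n} → LessDeg p n → LessDeg s n → LessDeg (p + s) n
    LessDeg-+ {p} {s} l l′ = Below-cong (λ k → sym (coef-+ p s k)) (Below-+ l l′)

    HasDeg-+ˡ : ∀ {p s d} → HasDeg p d → LessDeg s d → HasDeg (p + s) d
    HasDeg-+ˡ {p} {s} {d} (l , n) l′ = LessDeg-+ {p} {s} l (Below-weaken (ℕP.n≤1+n d) l′) ,
      λ z → n (trans (sym (K.+-identityʳ _)) (trans (cong (coef p d K.+_) (sym (l′ d ℕP.≤-refl))) (trans (sym (coef-+ p s d)) z)))

    -- Descent from the stored bound of `s`: the top coefficient of the product is the product of
    -- the top coefficients, so if it vanishes the candidate top coefficient of `s` vanishes too.
    LessDeg-quotient : ∀ {p s d} k → HasDeg p d → LessDeg (p * s) (d ℕ.+ k) → LessDeg s k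
    LessDeg-quotient {p} {s} {d} k (l , n) ps = descend (bound s) (Below-weaken (ℕP.m≤m+n (bound s) k) (below s))
      where
      descend : ∀ j → LessDeg s (j ℕ.+ k) → LessDeg s k
      descend zero b = b
      descend (suc j) b = descend j λ i h → help i (ℕP.m≤n⇒m<n∨m≡n h)
        where
        help : ∀ i → (j ℕ.+ k < i) ⊎ (j ℕ.+ k ≡ i) → coef s i ≡ 0#
        help i (inj₁ h) = b i h
        help i (inj₂ refl) = K.x*y≡0 (trans (sym (trans (coef-* p s (d ℕ.+ (j ℕ.+ k))) (⋆-top d (j ℕ.+ k) l b)))
          (ps (d ℕ.+ (j ℕ.+ k)) (ℕP.+-monoʳ-≤ d (ℕP.m≤n+m k j)))) n

    *-cancel-0 : ∀ {p d} → HasDeg p d → ∀ s → p * s ≈ const 0# → s ≈ const 0#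
    *-cancel-0 {p} h s e = pointwise λ k →
      trans (LessDeg-quotient {p} {s} 0 h (λ k _ → trans (at e k) (const0 k)) k z≤n) (sym (const0 k))

    zero-or-degree : ∀ p → p ≈ const 0# ⊎ ∃ λ d → HasDeg p d
    zero-or-degree p = go (bound p) (below p)
      where
      go : ∀ n → LessDeg p n → p ≈ const 0# ⊎ ∃ λ d → HasDeg p d
      go zero b = inj₁ (pointwise λ k → trans (b k z≤n) (sym (const0 k)))
      go (suc n) b with coef p n K.≟ 0#
      ... | no h = inj₂ (n , b , h)
      ... | yes z = go n λ k h → help k (ℕP.m≤n⇒m<n∨m≡n h)
        where
        help : ∀ k → (n < k) ⊎ (n ≡ k) → coef p k ≡ 0#
        help k (inj₁ h) = b k h
        help k (inj₂ refl) = z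

    HasDeg-quotient : ∀ {p s d e} → HasDeg p d → HasDeg (p * s) e → ∃ λ k → HasDeg s k × d ℕ.+ k ≡ e
    HasDeg-quotient {p} {s} {e = e} hp hps with zero-or-degree s
    ... | inj₁ z = ⊥-elim (proj₂ hps (trans (at (R.trans (R.*-congˡ {p} z) (R.zeroʳ p)) e) (const0 e)))
    ... | inj₂ (k , hk) = k , hk , HasDeg-unique {p * s} (HasDeg-* {p} {s} hp hk) hps

    HasDeg-const : ∀ {a} → a ≢ 0# → HasDeg (const a) 0
    HasDeg-const {a} n = Below-const a , λ e → n (trans (sym (coef-const-0 a)) e)

    LessDeg-1⇒const : ∀ {p} → LessDeg p 1 → p ≈ const (coef p 0)
    LessDeg-1⇒const {p} l = pointwise λ { zero → sym (coef-const-0 _) ; (suc k) → trans (l (suc k) (s≤s z≤n)) (sym (Below-const _ (suc k) (s≤s z≤n))) }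

    HasDeg-t : HasDeg t 1
    HasDeg-t = Below-t , λ e → K.1≢0 (trans (sym coef-t-1) e)

    HasDeg-cofactor : ∀ {p s d k} → HasDeg p d → HasDeg (p * s) (d ℕ.+ k) → HasDeg s k
    HasDeg-cofactor {p} {s} {d} {k} hp hps = subst (HasDeg s) (ℕP.+-cancelˡ-≡ d _ _ (proj₂ (proj₂ quot))) (proj₁ (proj₂ quot))
      where quot = HasDeg-quotient {p} {s} hp hps

    HasDeg-sq : ∀ {p d} → HasDeg p d → HasDeg (p * p) (2 ℕ.* d)
    HasDeg-sq {p} {d} h = subst (HasDeg (p * p)) (cong (d ℕ.+_) (sym (ℕP.+-identityʳ d))) (HasDeg-* {p} {p} h h)

    infixr 8 _^_
    _^_ : Poly → ℕ → Poly
    p ^ zero = const 1#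
    p ^ suc n = p * (p ^ n)

    HasDeg-^ : ∀ n → HasDeg (t ^ n) n
    HasDeg-^ zero = HasDeg-const K.1≢0
    HasDeg-^ (suc n) = HasDeg-* {t} {t ^ n} HasDeg-t (HasDeg-^ n)

    -- p ≡ e modulo (t − a), i.e. p takes the value e at a.
    Value : Poly → Carrier → Carrier → Set
    Value p a e = ∃ λ p₁ → p ≈ (t + const a) * p₁ + const e

    value-const : ∀ a e → Value (const e) a e
    value-const a e = const 0# , solve 2 (λ x e → e := x :* con false :+ e) R.refl (t + const a) (const e)

    value-t : ∀ a → Value t a a
    value-t a = const 1# , solve 2 (λ t a → t := (t :+ a) :* con true :+ a) R.refl t (const a)

    value-+ : ∀ {p s a e f} → Value p a e → Value s a f → Value (p + s) a (e K.+ f)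
    value-+ {p} {s} {a} {e} {f} (p₁ , ep) (s₁ , es) = p₁ + s₁ ,
      R.trans (R.+-cong {p} {_} {s} ep es) (R.trans (solve 5 (λ x p s e f → x :* p :+ e :+ (x :* s :+ f) := x :* (p :+ s) :+ (e :+ f))
        R.refl (t + const a) p₁ s₁ (const e) (const f)) (R.+-congˡ {(t + const a) * (p₁ + s₁)} {const e + const f} {const (e K.+ f)} (R.sym {const (e K.+ f)} {const e + const f} (const-+ e f))))

    value-* : ∀ {p s a e f} → Value p a e → Value s a f → Value (p * s) a (e K.* f)
    value-* {p} {s} {a} {e} {f} (p₁ , ep) (s₁ , es) = p₁ * s + const e * s₁ ,
      R.trans (R.*-congʳ {s} {p} ep) (R.trans (solve 4 (λ x p s e → (x :* p :+ e) :* s := x :* (p :* s) :+ e :* s)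
        R.refl (t + const a) p₁ s (const e)) (R.trans (R.+-congˡ {(t + const a) * (p₁ * s)} (R.*-congˡ {const e} {s} es))
        (R.trans (solve 6 (λ x p s e s₁ f → x :* (p :* s) :+ e :* (x :* s₁ :+ f) := x :* (p :* s :+ e :* s₁) :+ e :* f)
          R.refl (t + const a) p₁ s (const e) s₁ (const f)) (R.+-congˡ {(t + const a) * (p₁ * s + const e * s₁)} {const e * const f} {const (e K.* f)} (R.sym {const (e K.* f)} {const e * const f} (const-*-const e f))))))

    value-^ : ∀ {p a e} n → Value p a e → Value (p ^ n) a (e K.^ n)
    value-^ zero v = value-const _ _
    value-^ {p} (suc n) v = value-* {p} {p ^ n} v (value-^ {p} n v)

    value-cong : ∀ {p s a e f} → p ≈ s → e ≡ f → Value p a e → Value s a f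
    value-cong {p} {s} h refl (p₁ , ep) = p₁ , R.trans (R.sym {p} {s} h) ep

    root⇒factor : ∀ {p a} → Value p a 0# → ∃ λ p₁ → p ≈ (t + const a) * p₁
    root⇒factor {p} {a} (p₁ , e) = p₁ , R.trans e (solve 1 (λ x → x :+ con false := x) R.refl _)

    nonroot⇒coprime : ∀ {p a e} → Value p a e → e ≢ 0# → Coprime p (t + const a)
    nonroot⇒coprime {p} {a} {e} (p₁ , ep) n = const e⁻¹ , const e⁻¹ * p₁ ,
      R.trans (R.+-congʳ {const e⁻¹ * p₁ * (t + const a)} (R.*-congˡ {const e⁻¹} {p} ep))
        (R.trans (solve 4 (λ i x p e → i :* (x :* p :+ e) :+ i :* p :* x := i :* e) R.refl (const e⁻¹) (t + const a) p₁ (const e))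
          (R.trans (R.sym {const (e⁻¹ K.* e)} {const e⁻¹ * const e} (const-*-const e⁻¹ e)) (R.reflexive (cong const (trans (K.*-comm _ _) (K.⁻¹-inverse e n))))))
      where e⁻¹ = e K.⁻¹

    roots : List Carrier → Poly
    roots [] = const 1#
    roots (a ∷ as) = (t + const a) * roots as

    HasDeg-linear : ∀ a → HasDeg (t + const a) 1
    HasDeg-linear a = HasDeg-+ˡ {t} {const a} HasDeg-t (Below-const a)

    HasDeg-roots : ∀ as → HasDeg (roots as) (length as)
    HasDeg-roots [] = HasDeg-const K.1≢0
    HasDeg-roots (a ∷ as) = HasDeg-* {t + const a} {roots as} (HasDeg-linear a) (HasDeg-roots as)

    roots-coprime : ∀ {p} as → All (λ a → Coprime p (t + const a)) as → Coprime p (roots as)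
    roots-coprime {p} [] [] = const 0# , const 1# , solve 1 (λ p → con false :* p :+ con true :* con true := con true) R.refl p
    roots-coprime {p} (a ∷ as) (c ∷ cs) = coprime-sym {(t + const a) * roots as} {p}
      (coprime-* {t + const a} {roots as} {p} (coprime-sym {p} c) (coprime-sym {p} (roots-coprime {p} as cs)))

    linear-coprime : ∀ {a b} → a ≢ b → Coprime (t + const a) (t + const b)
    linear-coprime {a} {b} n = nonroot⇒coprime {t + const a} {b} {b K.+ a}
      (value-+ {t} {const a} (value-t b) (value-const b a)) (λ e → n (sym (K.+≈0⇒≈ e)))

    -- Linear factors at distinct points are coprime, so divisibility by each of them gives
    -- divisibility by their product.
    roots-divide : ∀ {p} as → Unique as → All (λ a → Value p a 0#) as → ∃ λ p₁ → p ≈ roots as * p₁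
    roots-divide {p} [] _ _ = p , solve 1 (λ p → p := con true :* p) R.refl p
    roots-divide {p} (a ∷ as) (u ∷ us) (v ∷ vs) =
      coprime-∣ {t + const a} {roots as} {p} (roots-coprime {t + const a} as (All.map linear-coprime u))
        (root⇒factor {p} v) (roots-divide {p} as us vs)

-- Surjectivity of the trace, Artin-Schreier equations and quadratic equations.

module TraceMap where

  open import Defs using (FiniteField)
  open Counting
  open CharTwo
  open FieldBasics
  open Polynomials
  open import Data.Nat as ℕ using (ℕ; zero; suc; _<_; _≤_; z≤n; s≤s)
  import Data.Nat.Properties as ℕP
  open import Data.Fin as Fin using (zero; suc)
  import Data.Fin.Properties as FinP
  open import Data.Bool using (true; false)
  open import Data.List as List using (List; []; _∷_; length; filter; allFin)
  import Data.List.Properties as ListP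
  open import Data.List.Membership.Propositional.Properties using (∈-filter⁺; ∈-filter⁻; ∈-allFin)
  open import Data.List.Relation.Unary.All as All using (All; []; _∷_)
  import Data.List.Relation.Unary.All.Properties as AllP
  open import Data.List.Relation.Unary.Unique.Propositional using (Unique)
  import Data.List.Relation.Unary.Unique.Propositional.Properties as UniqueP
  open import Data.Product using (∃; _×_; _,_; proj₁; proj₂)
  open import Data.Sum using (_⊎_; inj₁; inj₂)
  open import Data.Empty using (⊥-elim)
  open import Data.Unit using (⊤; tt)
  open import Relation.Nullary using (yes; no)
  open import Relation.Unary using (Decidable)
  open import Relation.Binary.PropositionalEquality
  open import Function using (_∘_)

  elements : ∀ {A : Set} {P : A → Set} {k} → Card P k → List A
  elements c = List.tabulate (el c)

  elements-unique : ∀ {A : Set} {P : A → Set} {k} (c : Card P k) → Unique (elements c)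
  elements-unique c = UniqueP.tabulate⁺ (inj c)

  elements-length : ∀ {A : Set} {P : A → Set} {k} (c : Card P k) → length (elements c) ≡ k
  elements-length c = ListP.length-tabulate (el c)

  elements-all : ∀ {A : Set} {P Q : A → Set} {k} (c : Card P k) → (∀ a → P a → Q a) → All Q (elements c)
  elements-all c f = AllP.tabulate⁺ (λ i → f _ (el∈ c i))

  -- The injective `rank` selects one element of each two-element orbit, the one with smaller rank,
  -- and `f` maps the selected elements bijectively onto the others.
  involution-even : ∀ {A : Set} {P : A → Set} {k} → Card P k → (rank : A → ℕ) → (∀ {a b} → rank a ≡ rank b → a ≡ b) →
    (f : A → A) → (∀ a → P a → P (f a)) → (∀ a → P a → f (f a) ≡ a) → (∀ a → P a → f a ≢ a) → ∃ λ m → k ≡ m ℕ.+ m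
  involution-even {P = P} c rank rank-inj f pf ff nf with card-split c (λ a → rank a ℕP.<? rank (f a))
  ... | k₁ , k₂ , c₁ , c₂ , refl = k₁ , cong (k₁ ℕ.+_) (sym (card-unique
      (card-bij c₁ f f
        (λ a (p , l) → pf a p , λ h → ℕP.<-asym l (subst (rank (f a) <_) (cong rank (ff a p)) h))
        (λ a (p , l) → pf a p , subst (rank (f a) <_) (cong rank (sym (ff a p)))
          (ℕP.≤∧≢⇒< (ℕP.≮⇒≥ l) (λ e → nf a p (rank-inj e))))
        (λ a (p , _) → ff a p) (λ a (p , _) → ff a p)) c₂))

  module Trace {r : ℕ} (F : FiniteField r) where
    open Field F
    open Polys F using (Poly; HasDeg; LessDeg; Value; roots) renaming (_^_ to _^ᵖ_; _+_ to _+ᵖ_)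
    private module P = Polys F

    card-filter : {Q : Carrier → Set} (Q? : Decidable Q) → Card Q (length (filter (Q? ∘ to) (allFin q)))
    card-filter {Q} Q? = card-bij (card-list _ (UniqueP.filter⁺ (Q? ∘ to) (UniqueP.allFin⁺ q))) to from
      (λ i m → proj₂ (∈-filter⁻ (Q? ∘ to) {xs = allFin q} m))
      (λ a h → ∈-filter⁺ (Q? ∘ to) (∈-allFin (from a)) (subst Q (sym (to∘from a)) h))
      (λ i _ → from∘to i) (λ a _ → to∘from a)

    private
      trPoly : ℕ → Poly
      trPoly zero = P.const 0#
      trPoly (suc k) = P.t ^ᵖ (2 ℕ.^ k) +ᵖ trPoly k

      value-trPoly : ∀ k a → Value (trPoly k) a (ptr k a)
      value-trPoly zero a = P.value-const a 0#
      value-trPoly (suc k) a = P.value-cong P.R.refl (trans (+-comm _ _) (sym (ptr-suc k a)))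
        (P.value-+ (P.value-^ (2 ℕ.^ k) (P.value-t a)) (value-trPoly k a))

      mutual
        LessDeg-trPoly : ∀ k → LessDeg (trPoly k) (2 ℕ.^ k)
        LessDeg-trPoly zero = P.Below-const 0#
        LessDeg-trPoly (suc k) = P.Below-weaken (ℕP.≤-trans (ℕP.+-monoˡ-≤ (2 ℕ.^ k) (ℕP.m^n>0 2 k))
            (ℕP.+-monoʳ-≤ (2 ℕ.^ k) (ℕP.m≤m+n (2 ℕ.^ k) 0))) (proj₁ (HasDeg-trPoly k))

        HasDeg-trPoly : ∀ k → HasDeg (trPoly (suc k)) (2 ℕ.^ k)
        HasDeg-trPoly k = P.HasDeg-+ˡ {P.t ^ᵖ (2 ℕ.^ k)} {trPoly k} (P.HasDeg-^ (2 ℕ.^ k)) (LessDeg-trPoly k)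

    -- tr is a polynomial of degree q/2, so it cannot vanish at all q points.
    tr-surjective : ∃ λ θ → tr θ ≡ 1#
    tr-surjective with FinP.any? (λ i → tr (to i) ≟ 1#)
    ... | yes (i , e) = to i , e
    ... | no n = ⊥-elim (impossible r trPoly-0 refl)
      where
      tr≡0 : ∀ a → tr a ≡ 0#
      tr≡0 a with tr-bit a
      ... | inj₁ e = e
      ... | inj₂ e = ⊥-elim (n (from a , trans (cong tr (to∘from a)) e))
      trPoly-0 : All (λ a → Value (trPoly r) a 0#) (elements card-F)
      trPoly-0 = elements-all card-F (λ a _ → P.value-cong P.R.refl (tr≡0 a) (value-trPoly r a))
      impossible : ∀ k → All (λ a → Value (trPoly k) a 0#) (elements card-F) → k ≢ r
      impossible zero _ e = r≢0 (sym e)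
      impossible (suc k) all e with P.roots-divide {trPoly (suc k)} _ (elements-unique card-F) all
      ... | p₁ , h with P.HasDeg-quotient {roots (elements card-F)} {p₁} (P.HasDeg-roots (elements card-F)) (P.HasDeg-cong h (HasDeg-trPoly k))
      ... | l , _ , eq = ℕP.<-irrefl refl (ℕP.<-≤-trans (ℕP.^-monoʳ-< 2 (s≤s (s≤s z≤n)) (ℕP.n<1+n k))
        (subst₂ _≤_ (trans (elements-length card-F) (cong (2 ℕ.^_) (sym e))) eq (ℕP.m≤m+n _ l)))

    private
      θ = proj₁ tr-surjective
      tr-θ = proj₂ tr-surjective

    -- The additive map y ↦ y² + y + tr(θ y) θ is injective, hence onto, and its trace is tr(θ y).
    artin-schreier : ∀ x → tr x ≡ 0# → ∃ λ y → sq y + y ≡ x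
    artin-schreier x e = y , (begin
        sq y + y              ≡⟨ +-identityʳ _ ⟨
        sq y + y + 0#         ≡⟨ cong (sq y + y +_) (trans (cong (_* θ) L≡0) (zeroˡ θ)) ⟨
        G y                   ≡⟨ Gy ⟩
        x                     ∎)
      where
      open ≡-Reasoning
      L G : Carrier → Carrier
      L y = tr (θ * y)
      G y = sq y + y + L y * θ
      tr-scale : ∀ b → b ≡ 0# ⊎ b ≡ 1# → tr (b * θ) ≡ b
      tr-scale _ (inj₁ refl) = trans (cong tr (zeroˡ θ)) tr-0
      tr-scale _ (inj₂ refl) = trans (cong tr (*-identityˡ θ)) tr-θ
      tr-G : ∀ y → tr (G y) ≡ L y
      tr-G y = trans (tr-+ _ _) (trans (cong₂ _+_ (tr-artin y) (tr-scale _ (tr-bit _))) (+-identityˡ _))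
      G-+ : ∀ y z → G (y + z) ≡ G y + G z
      G-+ y z = trans (cong (λ w → sq (y + z) + (y + z) + w * θ) (trans (cong tr (distribˡ θ y z)) (tr-+ _ _)))
        (solve 5 (λ y z a b t → (y :+ z) :* (y :+ z) :+ (y :+ z) :+ (a :+ b) :* t
          := (y :* y :+ y :+ a :* t) :+ (z :* z :+ z :+ b :* t)) refl y z (L y) (L z) θ)
      G-0 : ∀ y → G y ≡ 0# → y ≡ 0#
      G-0 y e = help (sq≡self⇒bit (+≈0⇒≈ (trans (sym (+-identityʳ _)) (trans (cong (sq y + y +_) (sym Lθ)) e))))
        where
        Ly : L y ≡ 0#
        Ly = trans (sym (tr-G y)) (trans (cong tr e) tr-0)
        Lθ : L y * θ ≡ 0#
        Lθ = trans (cong (_* θ) Ly) (zeroˡ θ)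
        help : y ≡ 0# ⊎ y ≡ 1# → y ≡ 0#
        help (inj₁ z) = z
        help (inj₂ z) = ⊥-elim (1≢0 (trans (sym tr-θ) (trans (cong tr (trans (sym (*-identityʳ θ)) (cong (θ *_) (sym z)))) Ly)))
      G-inj : ∀ y z → G y ≡ G z → y ≡ z
      G-inj y z e = +≈0⇒≈ (G-0 _ (trans (G-+ y z) (≈⇒+≈0 e)))
      y = proj₁ (finite-surjective card-F G G-inj _≟_ x)
      Gy = proj₂ (finite-surjective card-F G G-inj _≟_ x)
      L≡0 : L y ≡ 0#
      L≡0 = trans (sym (tr-G y)) (trans (cong tr Gy) e)

    card-≢0 : ∃ λ k → Card (λ x → x ≢ 0#) k × suc k ≡ q
    card-≢0 with card-minus card-F (_≟ 0#) (card-one {P = λ x → ⊤ × x ≡ 0#} 0# (tt , refl) (λ _ → proj₂))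
    ... | k , c , e = k , card-iff c (λ _ → proj₂) (λ _ n → tt , n) , e

    -- Dividing by T² turns the equation into w² + w = δ / T² with w = z / T, and values of w² + w
    -- have trace 0.
    quadratic-tr : ∀ {T δ z} → T ≢ 0# → sq z + T * z + δ ≡ 0# → tr (δ * sq (T ⁻¹)) ≡ 0#
    quadratic-tr {T} {δ} {z} n e = trans (cong tr (begin
        δ * sq i                     ≡⟨ cong (_* sq i) (+≈0⇒≈ (trans (+-comm _ _) e)) ⟩
        (sq z + T * z) * sq i        ≡⟨ solve 3 (λ z T i → (z :* z :+ T :* z) :* (i :* i) := (z :* i) :* (z :* i) :+ T :* i :* (z :* i)) refl z T i ⟩
        sq (z * i) + T * i * (z * i) ≡⟨ cong (λ w → sq (z * i) + w * (z * i)) (⁻¹-inverse T n) ⟩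
        sq (z * i) + 1# * (z * i)    ≡⟨ cong (sq (z * i) +_) (*-identityˡ _) ⟩
        sq (z * i) + z * i           ∎)) (tr-artin (z * i))
      where
      open ≡-Reasoning
      i = T ⁻¹

    card-quadratic-from : ∀ {T δ y} → T ≢ 0# → sq y + y ≡ δ * sq (T ⁻¹) → Card (λ z → sq z + T * z + δ ≡ 0#) 2
    card-quadratic-from {T} {δ} {y} n ey = card-two (T * y) (T * y + T) (λ h → n (begin
          T ≡⟨ solve 2 (λ T y → T := y :+ (y :+ T)) refl T (T * y) ⟩
          T * y + (T * y + T) ≡⟨ ≈⇒+≈0 h ⟩ 0# ∎)) root
        (trans (solve 3 (λ T y δ → (y :+ T) :* (y :+ T) :+ T :* (y :+ T) :+ δ := y :* y :+ T :* y :+ δ) refl T (T * y) δ) root)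
        only
      where
      open ≡-Reasoning
      i = T ⁻¹
      root : sq (T * y) + T * (T * y) + δ ≡ 0#
      root = begin
        sq (T * y) + T * (T * y) + δ ≡⟨ solve 3 (λ T y δ → (T :* y) :* (T :* y) :+ T :* (T :* y) :+ δ := (y :* y :+ y) :* (T :* T) :+ δ) refl T y δ ⟩
        (sq y + y) * sq T + δ ≡⟨ cong (λ w → w * sq T + δ) ey ⟩
        δ * sq i * sq T + δ ≡⟨ solve 3 (λ δ i T → δ :* (i :* i) :* (T :* T) :+ δ := δ :* ((T :* i) :* (T :* i)) :+ δ) refl δ i T ⟩
        δ * sq (T * i) + δ ≡⟨ cong (λ w → δ * sq w + δ) (⁻¹-inverse T n) ⟩
        δ * sq 1# + δ ≡⟨ solve 1 (λ δ → δ :* (con true :* con true) :+ δ := con false) refl δ ⟩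
        0# ∎
      only : ∀ z → sq z + T * z + δ ≡ 0# → z ≡ T * y ⊎ z ≡ T * y + T
      only z ez with (z + T * y) ≟ 0#
      ... | yes h = inj₁ (+≈0⇒≈ h)
      ... | no h = inj₂ (+≈0⇒≈ (trans (sym (+-assoc _ _ _)) (x*y≡0 (begin
          (z + T * y) * (z + T * y + T) ≡⟨ solve 4 (λ z y T δ → (z :+ y) :* (z :+ y :+ T) := (z :* z :+ T :* z :+ δ) :+ (y :* y :+ T :* y :+ δ)) refl z (T * y) T δ ⟩
          (sq z + T * z + δ) + (sq (T * y) + T * (T * y) + δ) ≡⟨ 0+0≈0 ez root ⟩
          0# ∎) h)))

    card-quadratic : ∀ {T δ} → T ≢ 0# → tr (δ * sq (T ⁻¹)) ≡ 0# → Card (λ z → sq z + T * z + δ ≡ 0#) 2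
    card-quadratic n e = card-quadratic-from n (proj₂ (artin-schreier _ e))

-- Manin's degree argument for Kloosterman sums.

module Kloosterman where

  open import Defs using (FiniteField)
  open Counting
  open CharTwo
  open FieldBasics
  open Polynomials
  open TraceMap
  open import Data.Nat as ℕ using (ℕ; zero; suc; _≤_; z≤n; s≤s)
  import Data.Nat.Properties as ℕP
  open import Data.Nat.Tactic.RingSolver using (solve-∀)
  open import Data.Bool using (true; false)
  open import Data.List as List using ([]; _∷_; _++_)
  open import Data.List.Relation.Unary.All as All using (All; []; _∷_)
  import Data.List.Relation.Unary.All.Properties as AllP
  open import Data.List.Relation.Unary.AllPairs using ([]; _∷_)
  import Data.List.Relation.Unary.Unique.Propositional.Properties as UniqueP
  open import Data.Product using (∃; _×_; _,_; proj₁; proj₂)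
  open import Relation.Nullary using (¬_; Dec)
  open import Relation.Nullary.Decidable using (_×-dec_; ¬?)
  import Relation.Binary.PropositionalEquality as ≡
  open ≡ using (_≡_; _≢_; cong; subst)

  module Kloo {r : ℕ} (F : FiniteField r) where
    open Field F

    -- The fibres over 0 and 1 are the arguments with sign +1 and -1 in the Kloosterman sum. As a/α
    -- and its square have equal trace, the fibre over 0 is also the set of nonzero x-coordinates of
    -- rational points on y² + xy = x³ + a².
    Fibre : Carrier → Carrier → Carrier → Set
    Fibre a e α = α ≢ 0# × tr (α + a * α ⁻¹) ≡ e

  -- Manin's argument: the points P₀ + n Q on the constant curve y² + xy = x³ + a² over F(t), where Q has
  -- x-coordinate t and P₀ is its Frobenius image, have x-coordinates of degree n² − K n + q ≥ 0.
  module Manin {r′ : ℕ} (F : FiniteField (suc r′)) (a : FiniteField.Carrier F) (a≢0 : a ≢ FiniteField.0# F)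
               (e : FiniteField.Carrier F) (e² : FiniteField._*_ F e e ≡ e) (k : ℕ) (cardZ : Card (Kloo.Fibre F a e) k) where
    module K = Field F
    open K using (Carrier; 0#; 1#; q; frob; ptr)
    open Polys F
    open Trace F using (card-≢0)
    open import Relation.Binary.Reasoning.Setoid R.setoid

    private
      Z = Kloo.Fibre F a e
      c = const a

    s : ℕ → Poly
    s zero = const 1#
    s (suc j) = t * sq (s j)

    y : ℕ → Poly
    y zero = t
    y (suc j) = sq (y j)

    -- With `y j` = t^(2^j) and `s j` = t^(2^j - 1), `M (suc j)` is the partial trace of t + a/t
    -- over j + 1 conjugates, cleared of denominators by the factor t^(2^j).
    M : ℕ → Poly
    M zero = const 0#
    M (suc j) = sq (M j) + s j * (t * t + c)

    C : ℕ → Poly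
    C zero = c
    C (suc j) = sq (C j)

    t*s : ∀ j → t * s j ≈ y j
    t*s zero = solve 1 (λ t → t :* con true := t) R.refl t
    t*s (suc j) = R.trans (solve 2 (λ t s → t :* (t :* (s :* s)) := (t :* s) :* (t :* s)) R.refl t (s j)) (sq-cong (t*s j))

    -- This is `ptr-artin` for u = t + a/t, multiplied by t (y j)²: a partial trace plus its square
    -- telescopes to u^(2^(j+1)) + u.
    M-equation : ∀ j → t * (sq (M (suc j)) + y j * M (suc j))
                     ≈ t * sq (y (suc j)) + t * C (suc j) + t * t * y (suc j) + c * y (suc j)
    M-equation zero = solve 2 (λ t c → let m = con false :* con false :+ con true :* (t :* t :+ c) in
       t :* (m :* m :+ t :* m) := t :* ((t :* t) :* (t :* t)) :+ t :* (c :* c) :+ t :* t :* (t :* t) :+ c :* (t :* t)) R.refl t c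
    -- After multiplication by one more t, the new equation is the square of the previous one plus
    -- multiples of t s + y and of y (j + 1) + (y j)², which all vanish; the extra t is cancelled at
    -- the end.
    M-equation (suc j) = +≈0⇒≈ (*-cancel-0 HasDeg-t _ (begin
        t * (t * (sq m′ + Y * m′) + (t * sq (sq Y) + t * sq D + t * t * sq Y + c * sq Y))
          ≈⟨ solve 7 (λ t c S x Y D m → let m′ = m :* m :+ S :* (t :* t :+ c)
                                            E = t :* (m :* m :+ x :* m) :+ (t :* (Y :* Y) :+ t :* D :+ t :* t :* Y :+ c :* Y)
                                            yx = Y :+ x :* x
                                            sy = t :* S :+ Y
              in t :* (t :* (m′ :* m′ :+ Y :* m′) :+ (t :* ((Y :* Y) :* (Y :* Y)) :+ t :* (D :* D) :+ t :* t :* (Y :* Y) :+ c :* (Y :* Y)))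
                := E :* E :+ t :* t :* (m :* m) :* yx :+ (t :* t :+ c) :* (t :* t :+ c) :* (sy :* sy) :+ t :* Y :* (t :* t :+ c) :* sy)
                R.refl t c (s (suc j)) (y j) Y D m ⟩
        sq E + t * t * sq m * (Y + sq (y j)) + sq (t * t + c) * sq (t * s (suc j) + Y) + t * Y * (t * t + c) * (t * s (suc j) + Y)
          ≈⟨ 0+0≈0 (0+0≈0 (0+0≈0 (R.trans (sq-cong (≈⇒+≈0 (M-equation j))) (R.zeroˡ _)) (*≈0 _ (x+x≈0 Y)))
               (*≈0 _ (R.trans (sq-cong (≈⇒+≈0 (t*s (suc j)))) (R.zeroˡ _)))) (*≈0 _ (≈⇒+≈0 (t*s (suc j)))) ⟩
        const 0# ∎))
      where
      m = M (suc j)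
      m′ = M (suc (suc j))
      Y = y (suc j)
      D = C (suc j)
      E = t * (sq m + y j * m) + (t * sq Y + t * D + t * t * Y + c * Y)

    HasDeg-y : ∀ j → HasDeg (y j) (2 ℕ.^ j)
    HasDeg-y zero = HasDeg-t
    HasDeg-y (suc j) = HasDeg-sq {y j} (HasDeg-y j)

    LessDeg-s : ∀ j → LessDeg (s j) (2 ℕ.^ j)
    LessDeg-s j = LessDeg-quotient {t} {s j} (2 ℕ.^ j) HasDeg-t (Below-cong (at (R.sym (t*s j))) (proj₁ (HasDeg-y j)))

    HasDeg-tt+c : HasDeg (t * t + c) 2
    HasDeg-tt+c = HasDeg-+ˡ {t * t} {c} (HasDeg-* {t} {t} HasDeg-t HasDeg-t) (Below-weaken (s≤s z≤n) (Below-const a))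

    HasDeg-M : ∀ j → HasDeg (M (suc j)) (2 ℕ.^ suc j)
    HasDeg-M zero = HasDeg-cong (solve 1 (λ x → x := con false :* con false :+ con true :* x) R.refl (t * t + c)) HasDeg-tt+c
    HasDeg-M (suc j) = HasDeg-+ˡ {sq (M (suc j))} {s (suc j) * (t * t + c)} (HasDeg-sq {M (suc j)} (HasDeg-M j))
      (Below-cong (at (R.*-comm (t * t + c) (s (suc j)))) (Below-weaken le
        (LessDeg-* {t * t + c} {s (suc j)} (proj₁ HasDeg-tt+c) (LessDeg-s (suc j)))))
      where
      n = 2 ℕ.^ j
      le : 2 ℕ.+ 2 ℕ.^ suc j ≤ 2 ℕ.^ suc (suc j)
      le = ℕP.≤-trans (ℕP.+-monoˡ-≤ (2 ℕ.^ suc j) (ℕP.*-monoʳ-≤ 2 (ℕP.m^n>0 2 j)))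
        (ℕP.≤-reflexive (cong (2 ℕ.* n ℕ.+_) (≡.sym (ℕP.+-identityʳ _))))

    value-y : ∀ j α → Value (y j) α (frob j α)
    value-y zero α = value-cong R.refl (≡.sym (K.*-identityʳ α)) (value-t α)
    value-y (suc j) α = value-cong R.refl (≡.sym (K.frob-suc j α)) (value-* (value-y j α) (value-y j α))

    value-s : ∀ j {α} → α ≢ 0# → Value (s j) α (α K.⁻¹ K.* frob j α)
    value-s zero {α} n = value-cong R.refl (≡.sym (≡.trans (cong (α K.⁻¹ K.*_) (K.*-identityʳ α)) (≡.trans (K.*-comm _ _) (K.⁻¹-inverse α n))))
      (value-const α 1#)
    value-s (suc j) {α} n = value-cong R.refl (≡.trans
        (K.solve 3 (λ α i f → α K.:* ((i K.:* f) K.:* (i K.:* f)) K.:= (α K.:* i) K.:* (i K.:* (f K.:* f))) ≡.refl α (α K.⁻¹) (frob j α))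
        (≡.trans (cong (K._* (α K.⁻¹ K.* K.sq (frob j α))) (K.⁻¹-inverse α n)) (≡.trans (K.*-identityˡ _)
          (cong (α K.⁻¹ K.*_) (≡.sym (K.frob-suc j α))))))
      (value-* (value-t α) (value-* (value-s j n) (value-s j n)))

    private
      tt+c-value : ∀ j {α} → α ≢ 0# → Value (s j * (t * t + c)) α (frob j α K.* (α K.+ a K.* α K.⁻¹))
      tt+c-value j {α} n = value-cong R.refl (≡.trans
          (K.solve 4 (λ α a i f → (i K.:* f) K.:* (α K.:* α K.:+ a) K.:= f K.:* ((α K.:* i) K.:* α K.:+ a K.:* i)) ≡.refl α a (α K.⁻¹) (frob j α))
          (cong (λ w → frob j α K.* (w K.+ a K.* α K.⁻¹)) (≡.trans (cong (K._* α) (K.⁻¹-inverse α n)) (K.*-identityˡ α))))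
        (value-* (value-s j n) (value-+ (value-* (value-t α) (value-t α)) (value-const α a)))

    value-M : ∀ j {α} → α ≢ 0# → Value (M (suc j)) α (frob j α K.* ptr (suc j) (α K.+ a K.* α K.⁻¹))
    value-M zero {α} n = value-cong R.refl
      (K.solve 2 (λ f u → K.con false K.:* K.con false K.:+ f K.:* u K.:= f K.:* (u K.:* K.con true K.:+ K.con false)) ≡.refl (frob 0 α) (α K.+ a K.* α K.⁻¹))
      (value-+ (value-* (value-const α 0#) (value-const α 0#)) (tt+c-value 0 n))
    value-M (suc j) {α} n = value-cong R.refl eq (value-+ (value-* (value-M j n) (value-M j n)) (tt+c-value (suc j) n))
      where
      u = α K.+ a K.* α K.⁻¹
      f = frob (suc j) α
      p = ptr (suc j) u
      eq : K.sq (frob j α K.* p) K.+ f K.* u ≡ f K.* ptr (suc (suc j)) u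
      eq = ≡-begin
        where
        h : K.sq p ≡ p K.+ (frob (suc j) u K.+ u)
        h = K.+≈0⇒≈ (≡.trans (≡.sym (K.+-assoc _ _ _)) (K.≈⇒+≈0 (K.ptr-artin (suc j) u)))
        ≡-begin = ≡.trans (cong (K._+ f K.* u) (≡.trans (K.sq-* _ _) (≡.cong₂ K._*_ (≡.sym (K.frob-suc j α)) h)))
          (≡.trans (K.solve 4 (λ f p g u → f K.:* (p K.:+ (g K.:+ u)) K.:+ f K.:* u K.:= f K.:* (p K.:+ g)) ≡.refl f p (frob (suc j) u) u)
            (cong (f K.*_) (≡.sym (K.ptr-suc (suc j) u))))

    value-C : ∀ j → C j ≈ const (frob j a)
    value-C zero = R.reflexive (cong const (≡.sym (K.*-identityʳ a)))
    value-C (suc j) = R.trans (sq-cong (value-C j)) (R.trans (R.sym (const-*-const _ _)) (R.reflexive (cong const (≡.sym (K.frob-suc j a)))))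

    value-M-0 : ∀ j → Value (M (suc j)) 0# (frob j a)
    value-M-0 zero = value-cong R.refl (K.solve 1 (λ a → K.con false K.:* K.con false K.:+ K.con true K.:* (K.con false K.:* K.con false K.:+ a) K.:= a K.:* K.con true) ≡.refl a)
      (value-+ (value-* (value-const 0# 0#) (value-const 0# 0#)) (value-* (value-const 0# 1#)
        (value-+ (value-* (value-t 0#) (value-t 0#)) (value-const 0# a))))
    value-M-0 (suc j) = value-cong R.refl (≡.trans
        (K.solve 3 (λ f v a → f K.:* f K.:+ (K.con false K.:* (v K.:* v)) K.:* (K.con false K.:* K.con false K.:+ a) K.:= f K.:* f) ≡.refl (frob j a) (proj₁ (v j)) a)
        (≡.sym (K.frob-suc j a)))
      (value-+ (value-* (value-M-0 j) (value-M-0 j)) (value-* (value-* (value-t 0#) (value-* (proj₂ (v j)) (proj₂ (v j))))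
        (value-+ (value-* (value-t 0#) (value-t 0#)) (value-const 0# a))))
      where
      v : ∀ j → ∃ λ e → Value (s j) 0# e
      v zero = 1# , value-const 0# 1#
      v (suc j) = _ , value-* (value-t 0#) (value-* (proj₂ (v j)) (proj₂ (v j)))

    -- Here x² = t^q is the x-coordinate of P₀. The function (y + a)/x on the curve satisfies w² + w
    -- = x + a/x, so the partial traces above give N/x as the sum of its values at P₀ and Q, up to
    -- the constant e in {0, 1}. Then t N² / L² is the x-coordinate of one of P₀ ± Q, and e selects
    -- which.
    x N L : Poly
    x = y r′
    N = M (suc r′) + const e * x
    L = sq x + t

    N-equation : t * (sq N + x * N) ≈ (t * sq x + c) * L
    N-equation = begin
      t * (sq N + x * N) ≈⟨ solve 4 (λ t m x e → t :* ((m :+ e :* x) :* (m :+ e :* x) :+ x :* (m :+ e :* x))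
          := t :* (m :* m :+ x :* m) :+ t :* (x :* x) :* (e :* e :+ e)) R.refl t (M (suc r′)) x (const e) ⟩
      t * (sq (M (suc r′)) + x * M (suc r′)) + t * sq x * (sq (const e) + const e)
        ≈⟨ R.+-cong (M-equation r′) (*≈0 _ (≈⇒+≈0 (R.trans (R.sym (const-*-const e e)) (R.reflexive (cong const e²))))) ⟩
      t * sq (sq x) + t * C (suc r′) + t * t * sq x + c * sq x + const 0#
        ≈⟨ R.+-congʳ (R.+-congʳ (R.+-congʳ (R.+-congˡ (R.*-congˡ (R.trans (value-C (suc r′)) (R.reflexive (cong const (K.x^q≡x a)))))))) ⟩
      t * sq (sq x) + t * c + t * t * sq x + c * sq x + const 0#
        ≈⟨ solve 3 (λ t c y → t :* (y :* y) :+ t :* c :+ t :* t :* y :+ c :* y :+ con false := (t :* y :+ c) :* (y :+ t)) R.refl t c (sq x) ⟩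
      (t * sq x + c) * L ∎

    HasDeg-x² : HasDeg (sq x) q
    HasDeg-x² = HasDeg-y (suc r′)

    2≤q : 2 ≤ q
    2≤q = ℕP.*-monoʳ-≤ 2 (ℕP.m^n>0 2 r′)

    HasDeg-L : HasDeg L q
    HasDeg-L = HasDeg-+ˡ {sq x} {t} HasDeg-x² (Below-weaken 2≤q (proj₁ HasDeg-t))

    HasDeg-N : HasDeg N q
    HasDeg-N = HasDeg-+ˡ {M (suc r′)} {const e * x} (HasDeg-M r′)
      (Below-weaken (ℕP.+-mono-≤ (ℕP.m^n>0 2 r′) (ℕP.m≤m+n (2 ℕ.^ r′) 0))
        (LessDeg-* {const e} {x} {0} (Below-const e) (proj₁ (HasDeg-y r′))))

    value-L : ∀ α → Value L α 0#
    value-L α = value-cong R.refl (K.≈⇒+≈0 (≡.trans (≡.sym (K.frob-suc r′ α)) (K.x^q≡x α)))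
      (value-+ (value-* (value-y r′ α) (value-y r′ α)) (value-t α))

    value-N : ∀ {α} → α ≢ 0# → Value N α (frob r′ α K.* (K.tr (α K.+ a K.* α K.⁻¹) K.+ e))
    value-N {α} n = value-cong R.refl (K.solve 3 (λ f t e → f K.:* t K.:+ e K.:* f K.:= f K.:* (t K.:+ e)) ≡.refl _ _ e)
      (value-+ (value-M r′ n) (value-* (value-const α e) (value-y r′ α)))

    -- As a ≠ 0, N does not vanish at 0 whereas L does, so the factor t of the denominator does not
    -- cancel.
    value-N-0 : Value N 0# (frob r′ a)
    value-N-0 = value-cong R.refl (≡.trans (cong (λ w → frob r′ a K.+ e K.* w) (pow (2 ℕ.^ r′) (ℕP.m^n>0 2 r′)))
        (K.solve 2 (λ f e → f K.:+ e K.:* K.con false K.:= f) ≡.refl (frob r′ a) e))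
      (value-+ (value-M-0 r′) (value-* (value-const 0# e) (value-y r′ 0#)))
      where
      pow : ∀ n → 1 ≤ n → 0# K.^ n ≡ 0#
      pow (suc n) _ = K.zeroˡ _

    Z? : ∀ α → Dec (Z α)
    Z? α = ¬? (α K.≟ 0#) ×-dec (K.tr (α K.+ a K.* α K.⁻¹) K.≟ e)

    private
      card≢0 = proj₁ (proj₂ card-≢0)

      complement : ∃ λ l → Card (λ α → α ≢ 0# × ¬ Z α) l × k ℕ.+ l ≡ proj₁ card-≢0
      complement = card-minus card≢0 Z? (card-iff cardZ (λ α z → proj₁ z , z) (λ α → proj₂))

      l = proj₁ complement
      cardW = proj₁ (proj₂ complement)
      as = elements cardZ
      bs = elements cardW

    1+k+l≡q : 1 ℕ.+ (k ℕ.+ l) ≡ q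
    1+k+l≡q = ≡.trans (cong suc (proj₂ (proj₂ complement))) (proj₂ (proj₂ card-≢0))

    private
      -- L = t^q + t vanishes on the whole field and N, among nonzero elements, exactly on the
      -- fibre. Dividing both by `Pa` leaves coprime parts; this cancellation of k common roots is
      -- how the size of the fibre enters the degrees.
      Pa Pb : Poly
      Pa = roots as
      Pb = roots bs

      N-factor : ∃ λ M₁ → N ≈ Pa * M₁
      N-factor = roots-divide as (elements-unique cardZ) (elements-all cardZ λ α (n , h) →
        value-cong R.refl (≡.trans (cong (frob r′ α K.*_) (K.≈⇒+≈0 h)) (K.zeroʳ _)) (value-N n))

      M₁ = proj₁ N-factor

      L-factor : ∃ λ u → L ≈ roots (0# ∷ bs ++ as) * u
      L-factor = roots-divide (0# ∷ bs ++ as)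
        (AllP.++⁺ (elements-all cardW (λ α h e → proj₁ h (≡.sym e))) (elements-all cardZ (λ α h e → proj₁ h (≡.sym e)))
          ∷ UniqueP.++⁺ (elements-unique cardW) (elements-unique cardZ) (λ (p , s) → proj₂ (All.lookup W p) (All.lookup Zs s)))
        (value-L 0# ∷ AllP.++⁺ (elements-all cardW (λ α _ → value-L α)) (elements-all cardZ (λ α _ → value-L α)))
        where
        W = elements-all cardW (λ _ h → h)
        Zs = elements-all cardZ (λ _ h → h)

      roots-++ : ∀ xs ys → roots (xs ++ ys) ≈ roots xs * roots ys
      roots-++ [] ys = R.sym (R.*-identityˡ _)
      roots-++ (x ∷ xs) ys = R.trans (R.*-congˡ {t + const x} (roots-++ xs ys)) (R.sym (R.*-assoc (t + const x) (roots xs) (roots ys)))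

      u = proj₁ L-factor

      L₁ = Pb * u

      L≈ : t * Pa * L₁ ≈ L
      L≈ = R.sym (begin
        L ≈⟨ proj₂ L-factor ⟩
        (t + const 0#) * roots (bs ++ as) * u ≈⟨ R.*-congʳ {u} (R.*-congˡ {t + const 0#} (roots-++ bs as)) ⟩
        (t + const 0#) * (Pb * Pa) * u ≈⟨ solve 4 (λ t b a u → (t :+ con false) :* (b :* a) :* u := t :* a :* (b :* u)) R.refl t Pb Pa u ⟩
        t * Pa * L₁ ∎)

      HasDeg-Pa : HasDeg Pa k
      HasDeg-Pa = subst (HasDeg Pa) (elements-length cardZ) (HasDeg-roots as)

      HasDeg-Pb : HasDeg Pb l
      HasDeg-Pb = subst (HasDeg Pb) (elements-length cardW) (HasDeg-roots bs)

      HasDeg-tPa : HasDeg (t * Pa) (1 ℕ.+ k)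
      HasDeg-tPa = HasDeg-* {t} {Pa} HasDeg-t HasDeg-Pa

      HasDeg-L₁ : HasDeg L₁ l
      HasDeg-L₁ = HasDeg-cofactor {t * Pa} {L₁} HasDeg-tPa
        (HasDeg-cong (R.sym L≈) (subst (HasDeg L) (≡.sym 1+k+l≡q) HasDeg-L))

      HasDeg-u : HasDeg u 0
      HasDeg-u = HasDeg-cofactor {Pb} {u} HasDeg-Pb (subst (HasDeg L₁) (≡.sym (ℕP.+-identityʳ l)) HasDeg-L₁)

      HasDeg-M₁ : ∃ λ m → HasDeg M₁ m × k ℕ.+ m ≡ q
      HasDeg-M₁ = HasDeg-quotient {Pa} {M₁} HasDeg-Pa (HasDeg-cong (proj₂ N-factor) HasDeg-N)

      m = proj₁ HasDeg-M₁

      nonroot : ∀ {α e} → Value N α e → e ≢ 0# → Coprime M₁ (t + const α)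
      nonroot v n = coprime-factor {N} {Pa} {M₁} (proj₂ N-factor) (nonroot⇒coprime v n)

      cop-t : Coprime M₁ t
      cop-t = coprime-congʳ {M₁} (solve 1 (λ t → t :+ con false := t) R.refl t)
        (nonroot value-N-0 (K.^-≢0 (2 ℕ.^ r′) a≢0))

      cop-Pb : Coprime M₁ Pb
      cop-Pb = roots-coprime bs (elements-all cardW λ α (n , z) →
        nonroot (value-N n) (K.*-≢0 (K.^-≢0 (2 ℕ.^ r′) n) (λ h → z (n , K.+≈0⇒≈ h))))

      cop-u : Coprime u M₁
      cop-u = const i , const 0# , (begin
          const i * u + const 0# * M₁ ≈⟨ R.+-cong (R.*-congˡ {const i} u≈) (R.zeroˡ M₁) ⟩
          const i * const w + const 0# ≈⟨ R.+-identityʳ _ ⟩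
          const i * const w ≈⟨ const-*-const i w ⟨
          const (i K.* w) ≈⟨ R.reflexive (cong const (≡.trans (K.*-comm i w) (K.⁻¹-inverse w (proj₂ HasDeg-u)))) ⟩
          const 1# ∎)
        where
        w = coef u 0
        i = w K.⁻¹
        u≈ : u ≈ const w
        u≈ = LessDeg-1⇒const (proj₁ HasDeg-u)

      -- The fraction t N² / L² in lowest terms: with N = Pa M₁ and L = t Pa L₁, the factors t and
      -- Pa² cancel.
      F₁ G₁ : Poly
      F₁ = sq M₁
      G₁ = t * sq L₁

      cop-FG : Coprime F₁ G₁
      cop-FG = coprime-* {M₁} {M₁} {G₁} cop cop
        where
        cop-L₁ : Coprime L₁ M₁
        cop-L₁ = coprime-* {Pb} {u} {M₁} (coprime-sym {M₁} {Pb} cop-Pb) cop-u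
        cop : Coprime M₁ G₁
        cop = coprime-sym {G₁} {M₁} (coprime-* {t} {sq L₁} {M₁} (coprime-sym {M₁} {t} cop-t) (coprime-* {L₁} {L₁} {M₁} cop-L₁ cop-L₁))

    open Biquadratic t c

    private
      N′ L′ : Poly
      N′ = Pa * M₁
      L′ = t * Pa * L₁

      E≈0 : t * (sq N′ + x * N′) + (t * sq x + c) * L′ ≈ const 0#
      E≈0 = ≈⇒+≈0 (begin
          t * (sq N′ + x * N′) ≈⟨ R.*-congˡ {t} (R.+-cong (sq-cong N≈) (R.*-congˡ {x} N≈)) ⟩
          t * (sq N + x * N) ≈⟨ N-equation ⟩
          (t * sq x + c) * L ≈⟨ R.*-congˡ {t * sq x + c} L≈ ⟨
          (t * sq x + c) * L′ ∎)
        where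
        N≈ : N′ ≈ N
        N≈ = R.sym (proj₂ N-factor)

      -- The relation between Frobenius and (tN² : L²), with n = N², l = L², y = t^q.
      scaled : (y n l : Poly) → Poly
      scaled y n l = sq (t * l + t * n) * sq y + t * (t * n) * l * y + sq (t * (t * n) + c * l)

      scaled-related : ∀ X y F G → X * t * (X * t * Related y (const 1#) F G) ≈ scaled y (X * F) (X * (t * G))
      scaled-related = solve 6 (λ t c X y F G → let A = t :* G :+ F ; D = t :* F :+ c :* G ; n = X :* F ; l = X :* (t :* G) in
        X :* t :* (X :* t :* (A :* A :* (y :* y) :+ t :* F :* G :* (y :* con true) :+ D :* D :* (con true :* con true)))
        := (t :* l :+ t :* n) :* (t :* l :+ t :* n) :* (y :* y) :+ t :* (t :* n) :* l :* y :+ (t :* (t :* n) :+ c :* l) :* (t :* (t :* n) :+ c :* l)) R.refl t c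

      scaled-split : ∀ y n l → scaled y n l
        ≈ l * (t * t * (n * n + y * n) + (t * t * (y * y) + c * c) * l) + t * t * (n * n) * (y * y + t * t + l)
      scaled-split = solve 5 (λ t c y n l →
        (t :* l :+ t :* n) :* (t :* l :+ t :* n) :* (y :* y) :+ t :* (t :* n) :* l :* y :+ (t :* (t :* n) :+ c :* l) :* (t :* (t :* n) :+ c :* l)
        := l :* (t :* t :* (n :* n :+ y :* n) :+ (t :* t :* (y :* y) :+ c :* c) :* l) :+ t :* t :* (n :* n) :* (y :* y :+ t :* t :+ l)) R.refl t c

      scaled≈0 : scaled (sq x) (sq N′) (sq L′) ≈ const 0#
      scaled≈0 = R.trans (scaled-split (sq x) (sq N′) (sq L′)) (0+0≈0
        (*≈0 (sq L′) (begin
          t * t * (sq (sq N′) + sq x * sq N′) + (t * t * (sq (sq x)) + c * c) * sq L′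
            ≈⟨ solve 5 (λ t c x N L → t :* t :* ((N :* N) :* (N :* N) :+ (x :* x) :* (N :* N)) :+ (t :* t :* ((x :* x) :* (x :* x)) :+ c :* c) :* (L :* L)
                 := (t :* (N :* N :+ x :* N) :+ (t :* (x :* x) :+ c) :* L) :* (t :* (N :* N :+ x :* N) :+ (t :* (x :* x) :+ c) :* L)) R.refl t c x N′ L′ ⟩
          sq (t * (sq N′ + x * N′) + (t * sq x + c) * L′) ≈⟨ sq-cong E≈0 ⟩
          sq (const 0#) ≈⟨ R.zeroˡ _ ⟩
          const 0# ∎))
        (*≈0 (t * t * sq (sq N′)) (begin
          sq (sq x) + t * t + sq L′ ≈⟨ solve 3 (λ y t l → y :* y :+ t :* t :+ l :* l := (y :+ t :+ l) :* (y :+ t :+ l)) R.refl (sq x) t L′ ⟩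
          sq (L + L′) ≈⟨ sq-cong (≈⇒+≈0 (R.sym L≈)) ⟩
          sq (const 0#) ≈⟨ R.zeroˡ _ ⟩
          const 0# ∎)))

      -- Multiplying by (Pa² t)² restores N and L. By `scaled-split` the scaled relation then
      -- consists of a multiple of the square of `N-equation` and a multiple of the square of L =
      -- t^q + t.
      related₀ : Related (sq x) (const 1#) F₁ G₁ ≈ const 0#
      related₀ = *-cancel-0 deg _ (*-cancel-0 deg _ (begin
          sq Pa * t * (sq Pa * t * Related (sq x) (const 1#) F₁ G₁) ≈⟨ scaled-related (sq Pa) (sq x) F₁ G₁ ⟩
          scaled (sq x) (sq Pa * F₁) (sq Pa * (t * G₁))
            ≈⟨ R.+-cong (R.+-cong (R.*-congʳ {sq (sq x)} (sq-cong (R.+-cong (R.*-congˡ {t} l≈) (R.*-congˡ {t} n≈))))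
                 (R.*-congʳ {sq x} (R.*-cong (R.*-congˡ {t} (R.*-congˡ {t} n≈)) l≈)))
                 (sq-cong (R.+-cong (R.*-congˡ {t} (R.*-congˡ {t} n≈)) (R.*-congˡ {c} l≈))) ⟩
          scaled (sq x) (sq N′) (sq L′) ≈⟨ scaled≈0 ⟩
          const 0# ∎))
        where
        deg : HasDeg (sq Pa * t) (2 ℕ.* k ℕ.+ 1)
        deg = HasDeg-* {sq Pa} {t} (HasDeg-sq {Pa} HasDeg-Pa) HasDeg-t
        n≈ : sq Pa * F₁ ≈ sq N′
        n≈ = solve 2 (λ P M → P :* P :* (M :* M) := (P :* M) :* (P :* M)) R.refl Pa M₁
        l≈ : sq Pa * (t * G₁) ≈ sq L′
        l≈ = solve 3 (λ t P L → P :* P :* (t :* (t :* (L :* L))) := (t :* P :* L) :* (t :* P :* L)) R.refl t Pa L₁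

    -- f/g and f′/g′ are the x-coordinates of P₀ + n Q and P₀ + (n + 1) Q, for the sign of Q fixed
    -- by e. `eq` says d = n² - κ n + q with κ = 2 k + 1 - q, written without subtraction; κ is K
    -- for e = 0 and -K for e = 1. Denominators of smaller degree keep the leading term of `γ` from
    -- cancelling.
    record Stage (n : ℕ) : Set where
      field
        f g f′ g′ : Poly
        d d′ : ℕ
        rel : Related f g f′ g′ ≈ const 0#
        cop-fg : Coprime f g
        cop-f′g′ : Coprime f′ g′
        deg-f : HasDeg f d
        deg-g : LessDeg g d
        deg-F : HasDeg f′ d′
        deg-G : LessDeg g′ d′
        eq  : d ℕ.+ n ℕ.* (1 ℕ.+ (k ℕ.+ k)) ≡ n ℕ.* n ℕ.+ q ℕ.+ n ℕ.* q
        eq′ : d′ ℕ.+ suc n ℕ.* (1 ℕ.+ (k ℕ.+ k)) ≡ suc n ℕ.* suc n ℕ.+ q ℕ.+ suc n ℕ.* q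

    stage₀ : Stage 0
    stage₀ = record
      { f = sq x ; g = const 1# ; f′ = F₁ ; g′ = G₁ ; d = q ; d′ = 2 ℕ.* m ; rel = related₀
      ; cop-fg = const 0# , const 1# , solve 1 (λ x → con false :* x :+ con true :* con true := con true) R.refl (sq x)
      ; cop-f′g′ = cop-FG
      ; deg-f = HasDeg-x²
      ; deg-g = Below-weaken (ℕP.≤-trans (s≤s z≤n) 2≤q) (proj₁ (HasDeg-const K.1≢0))
      ; deg-F = HasDeg-sq {M₁} (proj₁ (proj₂ HasDeg-M₁))
      ; deg-G = subst (LessDeg G₁) 2m (proj₁ (HasDeg-* {t} {sq L₁} HasDeg-t (HasDeg-sq {L₁} HasDeg-L₁)))
      ; eq = ≡.trans (ℕP.+-identityʳ q) (≡.sym (ℕP.+-identityʳ q))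
      ; eq′ = ≡.trans (arith m k) (≡.trans (cong (λ z → suc (z ℕ.+ z)) (proj₂ (proj₂ HasDeg-M₁))) (arith′ q)) }
      where
      arith : ∀ m k → 2 ℕ.* m ℕ.+ 1 ℕ.* (1 ℕ.+ (k ℕ.+ k)) ≡ suc ((k ℕ.+ m) ℕ.+ (k ℕ.+ m))
      arith = solve-∀
      arith′ : ∀ q → suc (q ℕ.+ q) ≡ 1 ℕ.* 1 ℕ.+ q ℕ.+ 1 ℕ.* q
      arith′ = solve-∀
      m≡ : suc l ≡ m
      m≡ = ℕP.+-cancelˡ-≡ k (suc l) m (≡.trans (ℕP.+-suc k l) (≡.trans 1+k+l≡q (≡.sym (proj₂ (proj₂ HasDeg-M₁)))))
      arith″ : ∀ l → suc (1 ℕ.+ 2 ℕ.* l) ≡ 2 ℕ.* suc l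
      arith″ = solve-∀
      2m : suc (1 ℕ.+ 2 ℕ.* l) ≡ 2 ℕ.* m
      2m = ≡.trans (arith″ l) (cong (2 ℕ.*_) m≡)

    -- As deg g′ < d′, the product f f₂ = `γ` has degree 2 (d′ + 1). So the degrees satisfy d + d″ =
    -- 2 d′ + 2, the recurrence of a quadratic polynomial in n with leading coefficient 1; two
    -- initial degrees determine it.
    advance : ∀ {n} (S : Stage n) (f₂ g₂ : Poly) → Stage.f S * f₂ ≈ γ (Stage.f′ S) (Stage.g′ S) →
              Stage.f S * g₂ + f₂ * Stage.g S ≈ β (Stage.f′ S) (Stage.g′ S) →
              Coprime f₂ g₂ → Related (Stage.f′ S) (Stage.g′ S) f₂ g₂ ≈ const 0# → Stage (suc n)
    advance {n} S f₂ g₂ γ≈ β≈ cop rel = record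
      { f = f′ ; g = g′ ; f′ = f₂ ; g′ = g₂ ; d = d′ ; d′ = d″ ; rel = rel ; cop-fg = S.cop-f′g′ ; cop-f′g′ = cop
      ; deg-f = S.deg-F ; deg-g = S.deg-G ; deg-F = deg-f₂
      ; deg-G = LessDeg-quotient {f} {g₂} d″ S.deg-f (Below-cong (at (R.sym fg₂≈))
          (LessDeg-+ {β f′ g′} {g * f₂} (Below-weaken le (LessDeg-* {t * f′} {g′} (proj₁ (HasDeg-* {t} {f′} HasDeg-t S.deg-F)) S.deg-G))
                   (subst (LessDeg (g * f₂)) (ℕP.+-comm d″ d) (Below-cong (at (R.*-comm f₂ g)) (LessDeg-* {f₂} {g} (proj₁ deg-f₂) S.deg-g)))))
      ; eq = S.eq′
      ; eq′ = ℕP.+-cancelˡ-≡ (n ℕ.* n ℕ.+ q ℕ.+ n ℕ.* q) _ _ (≡.trans (cong (ℕ._+ (d″ ℕ.+ suc (suc n) ℕ.* κ)) (≡.sym S.eq))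
          (≡.trans (arith d d″ n κ) (≡.trans (cong (ℕ._+ (n ℕ.* κ ℕ.+ suc (suc n) ℕ.* κ)) d+d″) (≡.trans (arith′ d′ n κ)
            (≡.trans (cong (λ z → z ℕ.+ z ℕ.+ 2) S.eq′) (arith″ n q)))))) }
      where
      module S = Stage S
      open S using (f; g; f′; g′; d; d′)
      κ = 1 ℕ.+ (k ℕ.+ k)
      deg-γ : HasDeg (γ f′ g′) (2 ℕ.* (1 ℕ.+ d′))
      deg-γ = HasDeg-sq {t * f′ + c * g′} (HasDeg-+ˡ {t * f′} {c * g′} (HasDeg-* {t} {f′} HasDeg-t S.deg-F)
        (Below-weaken (ℕP.n≤1+n d′) (LessDeg-* {c} {g′} {0} (Below-const a) S.deg-G)))
      quot = HasDeg-quotient {f} {f₂} S.deg-f (HasDeg-cong (R.sym γ≈) deg-γ)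
      d″ = proj₁ quot
      deg-f₂ = proj₁ (proj₂ quot)
      d+d″ = proj₂ (proj₂ quot)
      le : 1 ℕ.+ d′ ℕ.+ d′ ≤ d ℕ.+ d″
      le = ℕP.≤-trans (ℕP.n≤1+n _) (ℕP.≤-reflexive (≡.trans (arith₀ d′) (≡.sym d+d″)))
        where
        arith₀ : ∀ d → suc (1 ℕ.+ d ℕ.+ d) ≡ 2 ℕ.* (1 ℕ.+ d)
        arith₀ = solve-∀
      fg₂≈ : f * g₂ ≈ β f′ g′ + g * f₂
      fg₂≈ = +≈0⇒≈ (begin
        f * g₂ + (β f′ g′ + g * f₂) ≈⟨ solve 5 (λ f g₂ b g f₂ → f :* g₂ :+ (b :+ g :* f₂) := (f :* g₂ :+ f₂ :* g) :+ b) R.refl f g₂ (β f′ g′) g f₂ ⟩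
        f * g₂ + f₂ * g + β f′ g′ ≈⟨ ≈⇒+≈0 β≈ ⟩
        const 0# ∎)
      arith : ∀ d d″ n κ → d ℕ.+ n ℕ.* κ ℕ.+ (d″ ℕ.+ suc (suc n) ℕ.* κ) ≡ d ℕ.+ d″ ℕ.+ (n ℕ.* κ ℕ.+ suc (suc n) ℕ.* κ)
      arith = solve-∀
      arith′ : ∀ d′ n κ → 2 ℕ.* (1 ℕ.+ d′) ℕ.+ (n ℕ.* κ ℕ.+ suc (suc n) ℕ.* κ) ≡ (d′ ℕ.+ suc n ℕ.* κ) ℕ.+ (d′ ℕ.+ suc n ℕ.* κ) ℕ.+ 2
      arith′ = solve-∀
      arith″ : ∀ n q → (suc n ℕ.* suc n ℕ.+ q ℕ.+ suc n ℕ.* q) ℕ.+ (suc n ℕ.* suc n ℕ.+ q ℕ.+ suc n ℕ.* q) ℕ.+ 2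
               ≡ n ℕ.* n ℕ.+ q ℕ.+ n ℕ.* q ℕ.+ (suc (suc n) ℕ.* suc (suc n) ℕ.+ q ℕ.+ suc (suc n) ℕ.* q)
      arith″ = solve-∀

    stage-suc : ∀ {n} → Stage n → Stage (suc n)
    stage-suc S = advance S _ _ (proj₁ γ≈) (proj₁ β≈) (proj₁ cop) (proj₂ cop)
      where
      step = next {const (a K.⁻¹)} (R.trans (R.sym (const-*-const a (a K.⁻¹))) (R.reflexive (cong const (K.⁻¹-inverse a a≢0))))
               (*-cancel-0 (Stage.deg-f S)) (Stage.cop-fg S) (Stage.cop-f′g′ S) (Stage.rel S)
      γ≈ = proj₂ (proj₂ step)
      β≈ = proj₂ γ≈
      cop = proj₂ β≈

    stage : ∀ n → Stage n
    stage zero = stage₀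
    stage (suc n) = stage-suc (stage n)

    degree-nonneg : ∀ n → n ℕ.* (1 ℕ.+ (k ℕ.+ k)) ≤ n ℕ.* n ℕ.+ q ℕ.+ n ℕ.* q
    degree-nonneg n = ℕP.≤-trans (ℕP.m≤n+m _ _) (ℕP.≤-reflexive (Stage.eq (stage n)))

-- The Kloosterman sum modulo 4 and the bound on its absolute value.

module KloostermanSum where

  open import Defs using (FiniteField)
  open Counting
  open CharTwo
  open FieldBasics
  open TraceMap
  open Kloosterman
  open import Data.Nat as ℕ using (ℕ; zero; suc; _≤_; _<_; z≤n; s≤s)
  import Data.Nat.Properties as ℕP
  open import Data.Nat.Divisibility using (_∣_; divides; ∣⇒≤; m∣m*n; n∣m*n; ∣1⇒≡1; 0∣⇒≡0)
  open import Data.Nat.Coprimality using (coprime-divisor)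
  open import Data.Nat.Tactic.RingSolver using (solve-∀)
  open import Data.Integer as ℤ using (ℤ; +_; ∣_∣)
  import Data.Integer.Properties as ℤP
  open import Data.Integer.DivMod using (a≡a%n+[a/n]*n; n%d<d)
  import Data.Integer.Tactic.RingSolver as ℤSolver
  open import Data.Fin using (toℕ; Fin)
  import Data.Fin.Properties as FinP
  open import Data.Bool using (if_then_else_)
  open import Data.List as List using (List; []; _∷_; length; filter; allFin)
  import Data.List.Properties as ListP
  open import Data.Product using (∃; _×_; _,_; proj₁; proj₂)
  open import Data.Sum using (_⊎_; inj₁; inj₂)
  open import Data.Empty using (⊥; ⊥-elim)
  open import Relation.Nullary using (¬_; Dec; yes; no; does)
  open import Relation.Nullary.Decidable using (_×-dec_; ¬?)
  open import Relation.Binary.PropositionalEquality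
  open import Function using (_∘_)

  odd-∣-2^ : ∀ r {d} → ¬ 2 ∣ d → d ∣ 2 ℕ.^ r → d ≡ 1
  odd-∣-2^ zero n h = ∣1⇒≡1 h
  odd-∣-2^ (suc r) {d} n h = odd-∣-2^ r n (coprime-divisor (λ {c} (cd , c2) → only (∣⇒≤ c2) cd c2) h)
    where
    only : ∀ {c} → c ≤ 2 → c ∣ d → c ∣ 2 → c ≡ 1
    only {zero} _ _ z = ⊥-elim (case (0∣⇒≡0 z))
      where
      case : 2 ≢ 0
      case ()
    only {suc zero} _ _ _ = refl
    only {suc (suc zero)} _ cd _ = ⊥-elim (n cd)
    only {suc (suc (suc _))} (s≤s (s≤s ())) _ _

  parity : ∀ n → (∃ λ k → n ≡ k ℕ.+ k) ⊎ (∃ λ k → n ≡ suc (k ℕ.+ k))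
  parity zero = inj₁ (0 , refl)
  parity (suc n) with parity n
  ... | inj₁ (k , refl) = inj₂ (k , refl)
  ... | inj₂ (k , refl) = inj₁ (suc k , cong suc (sym (ℕP.+-suc k k)))

  double≢odd : ∀ a b → a ℕ.+ a ≢ suc (b ℕ.+ b)
  double≢odd (suc a) (suc b) e = double≢odd a b (ℕP.suc-injective (ℕP.suc-injective (trans (cong suc (sym (ℕP.+-suc a a)))
    (trans e (cong (λ z → suc (suc z)) (ℕP.+-suc b b))))))
  double≢odd (suc a) zero e = ℕP.1+n≢0 (ℕP.suc-injective (trans (cong suc (sym (ℕP.+-suc a a))) e))
  double≢odd zero b ()

  ¬2∣odd : ∀ k → ¬ 2 ∣ suc (k ℕ.+ k)
  ¬2∣odd k (divides c e) = double≢odd c k (trans (trans (cong (c ℕ.+_) (sym (ℕP.+-identityʳ c))) (ℕP.*-comm 2 c)) (sym e))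

  -- One of m and m + 1 is odd and divides a power of 2, so it equals 1. This leaves m = 0 and m =
  -- 1, with products 0 and 2.
  pronic≢2^ : ∀ {r} → 2 ≤ r → ∀ m → m ℕ.* suc m ≢ 2 ℕ.^ r
  pronic≢2^ {r} 2≤r m e with parity m
  ... | inj₁ (k , refl) with odd-∣-2^ r (¬2∣odd k) (subst (suc (k ℕ.+ k) ∣_) e (n∣m*n (k ℕ.+ k)))
  ... | h with k
  ... | zero = ℕP.<⇒≢ (ℕP.m^n>0 2 r) e
  ... | suc _ with h
  ... | ()
  pronic≢2^ {r} 2≤r m e | inj₂ (k , refl) with odd-∣-2^ r (¬2∣odd k) (subst (suc (k ℕ.+ k) ∣_) e (m∣m*n (suc (suc (k ℕ.+ k)))))
  ... | h with k
  ... | suc _ with h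
  ... | ()
  pronic≢2^ {suc (suc r)} (s≤s (s≤s _)) m e | inj₂ (k , refl) | h | zero =
    ℕP.<⇒≢ (ℕP.*-mono-≤ {3} {4} {1} (s≤s (s≤s (s≤s z≤n))) (ℕP.m^n>0 2 r)) (trans e (sym (ℕP.*-assoc 2 2 (2 ℕ.^ r))))

  mod-4 : ∀ {z} w → z ≡ + 3 ℤ.+ + 4 ℤ.* w → z Data.Integer.DivMod.% + 4 ≡ 3
  mod-4 {z} w e = help (z Data.Integer.DivMod.% + 4) (n%d<d z (+ 4)) (trans (sym e) (a≡a%n+[a/n]*n z (+ 4)))
    where
    d = z Data.Integer.DivMod./ + 4
    multiple : ∀ n → + 3 ℤ.+ + 4 ℤ.* w ≡ + n ℤ.+ d ℤ.* + 4 → ∣ + n ℤ.- + 3 ∣ ≡ 4 ℕ.* ∣ w ℤ.- d ∣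
    multiple n h = trans (cong ∣_∣ eq) (ℤP.abs-* (+ 4) (w ℤ.- d))
      where
      lem₁ : ∀ n d → n ℤ.- + 3 ≡ (n ℤ.+ d ℤ.* + 4) ℤ.- + 3 ℤ.- + 4 ℤ.* d
      lem₁ = ℤSolver.solve-∀
      lem₂ : ∀ w d → (+ 3 ℤ.+ + 4 ℤ.* w) ℤ.- + 3 ℤ.- + 4 ℤ.* d ≡ + 4 ℤ.* (w ℤ.- d)
      lem₂ = ℤSolver.solve-∀
      eq : + n ℤ.- + 3 ≡ + 4 ℤ.* (w ℤ.- d)
      eq = trans (lem₁ (+ n) d) (trans (cong (λ v → v ℤ.- + 3 ℤ.- + 4 ℤ.* d) (sym h)) (lem₂ w d))
    not-multiple : ∀ {j} k → suc j ≡ 4 ℕ.* k → suc j < 4 → ⊥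
    not-multiple zero () _
    not-multiple (suc k) e l = ℕP.<⇒≱ l (ℕP.≤-trans (ℕP.m≤m*n 4 (suc k)) (ℕP.≤-reflexive (sym e)))
    help : ∀ n → n < 4 → + 3 ℤ.+ + 4 ℤ.* w ≡ + n ℤ.+ d ℤ.* + 4 → n ≡ 3
    help 0 _ h = ⊥-elim (not-multiple ∣ w ℤ.- d ∣ (multiple 0 h) (s≤s (s≤s (s≤s (s≤s z≤n)))))
    help 1 _ h = ⊥-elim (not-multiple ∣ w ℤ.- d ∣ (multiple 1 h) (s≤s (s≤s (s≤s z≤n))))
    help 2 _ h = ⊥-elim (not-multiple ∣ w ℤ.- d ∣ (multiple 2 h) (s≤s (s≤s z≤n)))
    help 3 _ h = refl
    help (suc (suc (suc (suc n)))) (s≤s (s≤s (s≤s (s≤s ())))) h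

  -- With 2 k + 1 - q = k - k′ = 2 m + 1, the inequality n² - (2 m + 1) n + q ≥ 0 at n = m, next to
  -- the minimum at m + 1/2, reads m² + m ≤ q.
  square-bound : ∀ {q k k′ m} → 1 ℕ.+ (k ℕ.+ k′) ≡ q → k ≡ k′ ℕ.+ suc (m ℕ.+ m) →
    m ℕ.* (1 ℕ.+ (k ℕ.+ k)) ≤ m ℕ.* m ℕ.+ q ℕ.+ m ℕ.* q → m ℕ.* suc m ≤ q
  square-bound {q} {_} {k′} {m} refl refl h = ℕP.+-cancelˡ-≤ (m ℕ.* m ℕ.+ m ℕ.* q) _ _
    (ℕP.≤-trans (ℕP.≤-reflexive (arith m k′)) (ℕP.≤-trans h (ℕP.≤-reflexive (arith′ m q))))
    where
    arith : ∀ m k → m ℕ.* m ℕ.+ m ℕ.* (1 ℕ.+ (k ℕ.+ suc (m ℕ.+ m) ℕ.+ k)) ℕ.+ m ℕ.* suc m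
          ≡ m ℕ.* (1 ℕ.+ (k ℕ.+ suc (m ℕ.+ m) ℕ.+ (k ℕ.+ suc (m ℕ.+ m))))
    arith = solve-∀
    arith′ : ∀ m q → m ℕ.* m ℕ.+ q ℕ.+ m ℕ.* q ≡ m ℕ.* m ℕ.+ m ℕ.* q ℕ.+ q
    arith′ = solve-∀

  module KSum {r : ℕ} (F : FiniteField r) where
    open Field F
    open Trace F
    open Kloo F

    fibre? : ∀ a e α → Dec (Fibre a e α)
    fibre? a e α = ¬? (α ≟ 0#) ×-dec (tr (α + a * α ⁻¹) ≟ e)

    private
      module _ (a : Carrier) where
        count : Carrier → List (Fin q) → ℕ
        count e xs = length (filter (λ i → fibre? a e (to i)) xs)

        term : Fin q → ℤ
        term i = if does (to i ≟ 0#) then + 0 else Defs.λc F (to i + a * to i ⁻¹)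

        step-0 : ∀ e {i} xs → ¬ Fibre a e (to i) → count e (i ∷ xs) ≡ count e xs
        step-0 e {i} xs n = cong length (ListP.filter-reject (λ i → fibre? a e (to i)) {i} {xs} n)

        step-1 : ∀ e {i} xs → Fibre a e (to i) → count e (i ∷ xs) ≡ suc (count e xs)
        step-1 e {i} xs h = cong length (ListP.filter-accept (λ i → fibre? a e (to i)) {i} {xs} h)

        term-zero : ∀ {i} → to i ≡ 0# → term i ≡ + 0
        term-zero {i} e with to i ≟ 0#
        ... | yes _ = refl
        ... | no n = ⊥-elim (n e)

        term-tr : ∀ {i} → to i ≢ 0# → term i ≡ (if does (tr (to i + a * to i ⁻¹) ≟ 0#) then + 1 else ℤ.- (+ 1))
        term-tr {i} n with to i ≟ 0#
        ... | yes e = ⊥-elim (n e)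
        ... | no _ = refl

        sign-0 : ∀ x → tr x ≡ 0# → (if does (tr x ≟ 0#) then + 1 else ℤ.- (+ 1)) ≡ + 1
        sign-0 x e with tr x ≟ 0#
        ... | yes _ = refl
        ... | no n = ⊥-elim (n e)

        sign-1 : ∀ x → tr x ≡ 1# → (if does (tr x ≟ 0#) then + 1 else ℤ.- (+ 1)) ≡ ℤ.- (+ 1)
        sign-1 x e with tr x ≟ 0#
        ... | yes z = ⊥-elim (0≢1 (trans (sym z) e))
        ... | no _ = refl

        fold-count : ∀ xs → List.foldr (λ i acc → term i ℤ.+ acc) (+ 0) xs ≡ + count 0# xs ℤ.- + count 1# xs
        fold-count [] = refl
        fold-count (i ∷ xs) = go (to i ≟ 0#) (tr-bit u)
          where
          u = to i + a * to i ⁻¹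
          open ≡-Reasoning
          c₀ = count 0# xs
          c₁ = count 1# xs
          up : ∀ x y → + 1 ℤ.+ (x ℤ.- y) ≡ (+ 1 ℤ.+ x) ℤ.- y
          up = ℤSolver.solve-∀
          down : ∀ x y → ℤ.- (+ 1) ℤ.+ (x ℤ.- y) ≡ x ℤ.- (+ 1 ℤ.+ y)
          down = ℤSolver.solve-∀
          go : Dec (to i ≡ 0#) → tr u ≡ 0# ⊎ tr u ≡ 1# → term i ℤ.+ List.foldr (λ i acc → term i ℤ.+ acc) (+ 0) xs
               ≡ + count 0# (i ∷ xs) ℤ.- + count 1# (i ∷ xs)
          go (yes e) _ = trans (cong₂ ℤ._+_ (term-zero e) (fold-count xs)) (trans (ℤP.+-identityˡ _)
            (sym (cong₂ (λ x y → + x ℤ.- + y) (step-0 0# xs (λ h → proj₁ h e)) (step-0 1# xs (λ h → proj₁ h e)))))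
          go (no n) (inj₁ t) = trans (cong₂ ℤ._+_ (trans (term-tr n) (sign-0 u t)) (fold-count xs)) (trans (up (+ c₀) (+ c₁))
            (sym (cong₂ (λ x y → + x ℤ.- + y) (step-1 0# xs (n , t)) (step-0 1# xs (λ h → 0≢1 (trans (sym t) (proj₂ h)))))))
          go (no n) (inj₂ t) = trans (cong₂ ℤ._+_ (trans (term-tr n) (sign-1 u t)) (fold-count xs)) (trans (down (+ c₀) (+ c₁))
            (sym (cong₂ (λ x y → + x ℤ.- + y) (step-0 0# xs (λ h → 0≢1 (trans (sym (proj₂ h)) t))) (step-1 1# xs (n , t)))))

    record Counts (a : Carrier) : Set where
      field
        k₀ k₁ : ℕ
        card₀ : Card (Fibre a 0#) k₀
        card₁ : Card (Fibre a 1#) k₁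
        total : 1 ℕ.+ (k₀ ℕ.+ k₁) ≡ q
        sum≡  : Defs.K F a ≡ + k₀ ℤ.- + k₁

    counts : ∀ a → Counts a
    counts a = record
      { card₀ = card-filter (fibre? a 0#) ; card₁ = card-filter (fibre? a 1#)
      ; total = trans (cong suc (card-unique (card-⊎ (card-filter (fibre? a 0#)) (card-filter (fibre? a 1#))
          (λ α (_ , h) (_ , h′) → 0≢1 (trans (sym h) h′)) (λ _ → proj₁) (λ _ → proj₁) cov) (proj₁ (proj₂ card-≢0)))) (proj₂ (proj₂ card-≢0))
      ; sum≡ = fold-count a (allFin q) }
      where
      cov : ∀ α → α ≢ 0# → Fibre a 0# α ⊎ Fibre a 1# α
      cov α n with tr-bit (α + a * α ⁻¹)
      ... | inj₁ h = inj₁ (n , h)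
      ... | inj₂ h = inj₂ (n , h)

    quotient-involutive : ∀ {a α} → a ≢ 0# → α ≢ 0# → a * (a * α ⁻¹) ⁻¹ ≡ α
    quotient-involutive {a} {α} na n = *-cancelˡ (*-≢0 na (⁻¹-≢0 n)) (begin
      a * α ⁻¹ * (a * (a * α ⁻¹) ⁻¹) ≡⟨ solve 3 (λ x a i → x :* (a :* i) := a :* (x :* i)) refl (a * α ⁻¹) a ((a * α ⁻¹) ⁻¹) ⟩
      a * (a * α ⁻¹ * (a * α ⁻¹) ⁻¹) ≡⟨ cong (a *_) (⁻¹-inverse (a * α ⁻¹) (*-≢0 na (⁻¹-≢0 n))) ⟩
      a * 1# ≡⟨ cong (a *_) (⁻¹-inverse α n) ⟨
      a * (α * α ⁻¹) ≡⟨ solve 3 (λ a α i → a :* (α :* i) := a :* i :* α) refl a α (α ⁻¹) ⟩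
      a * α ⁻¹ * α ∎)
      where open ≡-Reasoning

    √≢0 : ∀ {a} → a ≢ 0# → √ a ≢ 0#
    √≢0 {a} n e = n (trans (sym (sq-√ a)) (trans (cong sq e) (zeroˡ 0#)))

    -- α ↦ a/α preserves the fibre over 0, and √a is its only fixed point.
    k₀-odd : ∀ {a k} → a ≢ 0# → Card (Fibre a 0#) k → ∃ λ m → k ≡ suc (m ℕ.+ m)
    k₀-odd {a} {k} na c = proj₁ even , trans (sym (proj₂ (proj₂ rest))) (cong suc (proj₂ even))
      where
      open ≡-Reasoning
      √-quotient : a * √ a ⁻¹ ≡ √ a
      √-quotient = begin
        a * √ a ⁻¹             ≡⟨ cong (λ z → z * √ a ⁻¹) (sq-√ a) ⟨
        √ a * √ a * √ a ⁻¹     ≡⟨ *-assoc (√ a) (√ a) (√ a ⁻¹) ⟩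
        √ a * (√ a * √ a ⁻¹)   ≡⟨ cong (√ a *_) (⁻¹-inverse (√ a) (√≢0 na)) ⟩
        √ a * 1#               ≡⟨ *-identityʳ (√ a) ⟩
        √ a                    ∎
      fixed : tr (√ a + a * √ a ⁻¹) ≡ 0#
      fixed = trans (cong tr (trans (cong (λ z → √ a + z) √-quotient) (x+x≈0 (√ a)))) tr-0
      rest : ∃ λ k′ → Card (λ α → Fibre a 0# α × ¬ α ≡ √ a) k′ × 1 ℕ.+ k′ ≡ k
      rest = card-minus c (_≟ √ a) (card-one {P = λ α → Fibre a 0# α × α ≡ √ a} (√ a) ((√≢0 na , fixed) , refl) (λ _ → proj₂))
      fixpoint : ∀ {α} → α ≢ 0# → a * α ⁻¹ ≡ α → α ≡ √ a
      fixpoint {α} n e = sq-injective (begin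
        α * α                ≡⟨ cong (α *_) e ⟨
        α * (a * α ⁻¹)       ≡⟨ solve 3 (λ α a i → α :* (a :* i) := a :* (α :* i)) refl α a (α ⁻¹) ⟩
        a * (α * α ⁻¹)       ≡⟨ cong (a *_) (⁻¹-inverse α n) ⟩
        a * 1#               ≡⟨ *-identityʳ a ⟩
        a                    ≡⟨ sq-√ a ⟨
        √ a * √ a            ∎)
      preserve : ∀ α → Fibre a 0# α × ¬ α ≡ √ a → Fibre a 0# (a * α ⁻¹) × ¬ a * α ⁻¹ ≡ √ a
      preserve α ((n , t) , ne) = (*-≢0 na (⁻¹-≢0 n) , trans (cong tr (trans (cong (λ z → a * α ⁻¹ + z) (quotient-involutive na n)) (+-comm (a * α ⁻¹) α))) t)
        , λ e → ne (begin
            α                 ≡⟨ quotient-involutive na n ⟨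
            a * (a * α ⁻¹) ⁻¹ ≡⟨ cong (λ z → a * z ⁻¹) e ⟩
            a * √ a ⁻¹        ≡⟨ √-quotient ⟩
            √ a               ∎)
      rank-injective : ∀ {x y} → toℕ (from x) ≡ toℕ (from y) → x ≡ y
      rank-injective {x} {y} e = trans (sym (to∘from x)) (trans (cong to (FinP.toℕ-injective e)) (to∘from y))
      even : ∃ λ m → proj₁ rest ≡ m ℕ.+ m
      even = involution-even (proj₁ (proj₂ rest)) (toℕ ∘ from) rank-injective
        (λ α → a * α ⁻¹) preserve (λ α h → quotient-involutive na (proj₁ (proj₁ h)))
        (λ α h e → proj₂ h (fixpoint (proj₁ (proj₁ h)) e))

  -- As k₀ + k₁ = q - 1, K = 2 k₀ + 1 - q. With k₀ = 2 m + 1 and q = 4 h this equals 3 + 4 (m - h).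
  K-mod-4 : ∀ {r} (F : FiniteField r) → 2 ≤ r → ∀ {a} → a ≢ FiniteField.0# F → Defs.K F a Data.Integer.DivMod.% + 4 ≡ 3
  K-mod-4 {suc (suc r)} F (s≤s (s≤s _)) {a} na = main (k₀-odd na card₀)
    where
    open KSum F
    open Counts (counts a)
    h = 2 ℕ.^ r
    main : (∃ λ m → k₀ ≡ suc (m ℕ.+ m)) → Defs.K F a Data.Integer.DivMod.% + 4 ≡ 3
    main (m , e) = mod-4 (+ m ℤ.- + h) (trans sum≡ (trans (cong (λ z → z ℤ.- + k₁) k₀≡) (trans (arith (+ m) (+ k₁) (+ h))
        (trans (cong (λ w → + 3 ℤ.+ + 4 ℤ.* (+ m ℤ.- + h) ℤ.+ w) zero-diff) (ℤP.+-identityʳ (+ 3 ℤ.+ + 4 ℤ.* (+ m ℤ.- + h)))))))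
      where
      k₀≡ : + k₀ ≡ + 1 ℤ.+ (+ m ℤ.+ + m)
      k₀≡ = cong +_ e
      tot : + 1 ℤ.+ ((+ 1 ℤ.+ (+ m ℤ.+ + m)) ℤ.+ + k₁) ≡ + 4 ℤ.* + h
      tot = trans (cong (λ z → + 1 ℤ.+ (z ℤ.+ + k₁)) (sym k₀≡)) (trans (cong +_ (trans total (sym (ℕP.*-assoc 2 2 h)))) (ℤP.pos-* 4 h))
      arith : ∀ m k h → (+ 1 ℤ.+ (m ℤ.+ m)) ℤ.- k ≡ + 3 ℤ.+ + 4 ℤ.* (m ℤ.- h) ℤ.+ (+ 4 ℤ.* h ℤ.- (+ 1 ℤ.+ ((+ 1 ℤ.+ (m ℤ.+ m)) ℤ.+ k)))
      arith = ℤSolver.solve-∀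
      zero-diff : + 4 ℤ.* + h ℤ.- (+ 1 ℤ.+ ((+ 1 ℤ.+ (+ m ℤ.+ + m)) ℤ.+ + k₁)) ≡ + 0
      zero-diff = trans (cong (λ z → + 4 ℤ.* + h ℤ.- z) tot) (ℤP.+-inverseʳ (+ 4 ℤ.* + h))

  -- Manin's inequality is applied to the larger of the two fibres, so that the difference is |K|;
  -- it is odd because q is even. For |K| = 2 m + 1, K² = 4 m (m + 1) + 1, and m (m + 1) < q
  -- suffices.
  K-bound : ∀ {r} (F : FiniteField r) → 2 ≤ r → ∀ {a} → a ≢ FiniteField.0# F →
            Defs.K F a ℤ.* Defs.K F a ℤ.< + (4 ℕ.* 2 ℕ.^ r)
  K-bound {suc r} F 2≤r {a} na = subst (λ z → z ℤ.* z ℤ.< + (4 ℕ.* q)) (sym sum≡) (cases (ℕP.≤-total k₁ k₀))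
    where
    open Field F using (q; 0#; 1#; *-identityʳ; zeroˡ)
    open KSum F
    open Counts (counts a)
    open Manin F a na using (degree-nonneg)

    odd-diff : ∀ {k k′ D} → k ≡ k′ ℕ.+ D → 1 ℕ.+ (k ℕ.+ k′) ≡ q → ∃ λ m → D ≡ suc (m ℕ.+ m)
    odd-diff {_} {k′} {D} refl e with parity D
    ... | inj₂ h = h
    ... | inj₁ (j , refl) = ⊥-elim (double≢odd (2 ℕ.^ r) (k′ ℕ.+ j) (trans (cong (2 ℕ.^ r ℕ.+_) (sym (ℕP.+-identityʳ _)))
        (trans (sym e) (arith k′ j))))
      where
      arith : ∀ k j → 1 ℕ.+ (k ℕ.+ (j ℕ.+ j) ℕ.+ k) ≡ suc (k ℕ.+ j ℕ.+ (k ℕ.+ j))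
      arith = solve-∀

    bound : ∀ {k k′ D} → k ≡ k′ ℕ.+ D → 1 ℕ.+ (k ℕ.+ k′) ≡ q →
      (∀ n → n ℕ.* (1 ℕ.+ (k ℕ.+ k)) ≤ n ℕ.* n ℕ.+ q ℕ.+ n ℕ.* q) → D ℕ.* D < 4 ℕ.* q
    bound {k} {k′} e tot deg with odd-diff e tot
    ... | m , refl = ℕP.≤-trans (ℕP.≤-trans (ℕP.≤-reflexive (arith m)) (ℕP.+-monoʳ-≤ (4 ℕ.* (m ℕ.* suc m)) {2} {4} (s≤s (s≤s z≤n))))
        (ℕP.≤-trans (ℕP.≤-reflexive (arith′ (m ℕ.* suc m)))
          (ℕP.*-monoʳ-≤ 4 (ℕP.≤∧≢⇒< (square-bound {q} {k} {k′} {m} tot e (deg m)) (pronic≢2^ 2≤r m))))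
      where
      arith : ∀ m → suc (suc (m ℕ.+ m) ℕ.* suc (m ℕ.+ m)) ≡ 4 ℕ.* (m ℕ.* suc m) ℕ.+ 2
      arith = solve-∀
      arith′ : ∀ x → 4 ℕ.* x ℕ.+ 4 ≡ 4 ℕ.* suc x
      arith′ = solve-∀

    cases : k₁ ≤ k₀ ⊎ k₀ ≤ k₁ → (+ k₀ ℤ.- + k₁) ℤ.* (+ k₀ ℤ.- + k₁) ℤ.< + (4 ℕ.* q)
    cases (inj₁ l) = subst (ℤ._< + (4 ℕ.* q)) (sym sq≡) (ℤ.+<+ (bound eq total (degree-nonneg 0# (zeroˡ 0#) k₀ card₀)))
      where
      D = k₀ ℕ.∸ k₁
      eq : k₀ ≡ k₁ ℕ.+ D
      eq = sym (ℕP.m+[n∸m]≡n l)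
      lem : ∀ x y → (x ℤ.+ y) ℤ.- x ≡ y
      lem = ℤSolver.solve-∀
      diff : + k₀ ℤ.- + k₁ ≡ + D
      diff = trans (cong (λ z → + z ℤ.- + k₁) eq) (lem (+ k₁) (+ D))
      sq≡ : (+ k₀ ℤ.- + k₁) ℤ.* (+ k₀ ℤ.- + k₁) ≡ + (D ℕ.* D)
      sq≡ = trans (cong (λ z → z ℤ.* z) diff) (sym (ℤP.pos-* D D))
    cases (inj₂ l) = subst (ℤ._< + (4 ℕ.* q)) (sym sq≡) (ℤ.+<+ (bound eq (trans (cong suc (ℕP.+-comm k₁ k₀)) total)
        (degree-nonneg 1# (*-identityʳ 1#) k₁ card₁)))
      where
      D = k₁ ℕ.∸ k₀
      eq : k₁ ≡ k₀ ℕ.+ D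
      eq = sym (ℕP.m+[n∸m]≡n l)
      lem : ∀ x y → (x ℤ.- (x ℤ.+ y)) ℤ.* (x ℤ.- (x ℤ.+ y)) ≡ y ℤ.* y
      lem = ℤSolver.solve-∀
      sq≡ : (+ k₀ ℤ.- + k₁) ℤ.* (+ k₀ ℤ.- + k₁) ≡ + (D ℕ.* D)
      sq≡ = trans (cong (λ z → (+ k₀ ℤ.- + z) ℤ.* (+ k₀ ℤ.- + z)) eq) (trans (lem (+ k₀) (+ D)) (sym (ℤP.pos-* D D)))

import Defs
open import Data.Nat using (ℕ)

module OverField {r : ℕ} (F : Defs.FiniteField r) where

  module Field-F = FieldBasics.Field F
  module Trace-F = TraceMap.Trace F
  module Kloo-F = Kloosterman.Kloo F
  module KSum-F = KloostermanSum.KSum F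

  -- Block matrices, alternating matrices and invertibility over the field.

  module Matrices where

    import Defs
    open Defs using (FiniteField)
    open Counting
    open CharTwo
    open FieldBasics
    open import Data.Nat as ℕ using (ℕ; zero; suc)
    open import Data.Fin as Fin using (Fin; zero; suc; _↑ˡ_; _↑ʳ_)
    import Data.Fin.Properties as FinP
    open import Data.Bool using (if_then_else_)
    open import Data.Vec as Vec using (Vec; []; _∷_; lookup; tabulate; zipWith; transpose; replicate; _++_)
    import Data.Vec.Properties as VecP
    open import Data.Product using (∃; _×_; _,_; proj₁; proj₂)
    open import Data.Empty using (⊥-elim)
    open import Data.Unit using (⊤)
    open import Relation.Nullary using (yes; no; does)
    open import Relation.Binary.Definitions using (DecidableEquality)
    open import Relation.Binary.PropositionalEquality
    open import Function using (_∘_)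

    vec-ext : ∀ {A : Set} {n} {xs ys : Vec A n} → (∀ i → lookup xs i ≡ lookup ys i) → xs ≡ ys
    vec-ext {xs = xs} {ys} e = trans (sym (VecP.tabulate∘lookup xs)) (trans (VecP.tabulate-cong e) (VecP.tabulate∘lookup ys))

    fin-split : ∀ m {n} (P : Fin (m ℕ.+ n) → Set) → (∀ i → P (i ↑ˡ n)) → (∀ j → P (m ↑ʳ j)) → ∀ i → P i
    fin-split zero P l r i = r i
    fin-split (suc m) P l r zero = l zero
    fin-split (suc m) P l r (suc i) = fin-split m (P ∘ suc) (l ∘ suc) r i

    module Mats where
      open Field-F

      Mat : ℕ → ℕ → Set
      Mat = Defs.Mat F

      private variable
        m k l n m′ k′ l′ : ℕ

      ent : Mat m k → Fin m → Fin k → Carrier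
      ent A i j = lookup (lookup A i) j

      mk : (Fin m → Fin k → Carrier) → Mat m k
      mk f = tabulate λ i → tabulate λ j → f i j

      ent-mk : ∀ (f : Fin m → Fin k → Carrier) i j → ent (mk f) i j ≡ f i j
      ent-mk f i j = trans (cong (λ v → lookup v j) (VecP.lookup∘tabulate (λ i → tabulate (f i)) i)) (VecP.lookup∘tabulate (f i) j)

      ext : {A B : Mat m k} → (∀ i j → ent A i j ≡ ent B i j) → A ≡ B
      ext e = vec-ext λ i → vec-ext (e i)

      infixl 7 _⊗_
      infixl 9 _ᵀ
      infixl 6 _⊞_

      -- Opaque copies of the matrix operations: reasoning goes through their entries and block
      -- laws, and large products do not unfold to nested vectors.
      opaque
        _⊗_ : ∀ {m k l} → Mat m k → Mat k l → Mat m l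
        _⊗_ = Defs._⊗_ F

        𝟙 : ∀ m → Mat m m
        𝟙 = Defs.𝟙 F

        𝟘 : ∀ {m k} → Mat m k
        𝟘 {m} {k} = Defs.𝟘 F m k

        Tr : ∀ {m} → Mat m m → Carrier
        Tr = Defs.Tr F

        _ᵀ : ∀ {m k} → Mat m k → Mat k m
        _ᵀ = transpose

        _⊞_ : Mat m k → Mat m k → Mat m k
        A ⊞ B = mk λ i j → ent A i j + ent B i j

        blk : Mat m k → Mat m k′ → Mat m′ k → Mat m′ k′ → Mat (m ℕ.+ m′) (k ℕ.+ k′)
        blk A B C D = zipWith _++_ A B ++ zipWith _++_ C D

      opaque
        unfolding _⊗_

        ent-⊞ : ∀ (A B : Mat m k) i j → ent (A ⊞ B) i j ≡ ent A i j + ent B i j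
        ent-⊞ A B = ent-mk _

        ent-ᵀ : ∀ (A : Mat m k) i j → ent (A ᵀ) i j ≡ ent A j i
        ent-ᵀ (a ∷ A) i j = trans (cong (λ v → lookup v j)
            (trans (VecP.lookup-⊛ i (replicate _ _∷_ Vec.⊛ a) (A ᵀ)) (cong (λ f → f (lookup (A ᵀ) i))
              (trans (VecP.lookup-⊛ i (replicate _ _∷_) a) (cong (λ f → f (lookup a i)) (VecP.lookup-replicate i _∷_)))))) (cons j)
          where
          cons : ∀ j → lookup (lookup a i ∷ lookup (A ᵀ) i) j ≡ ent (a ∷ A) j i
          cons zero = refl
          cons (suc j) = ent-ᵀ A i j

      dot-sum : ∀ (u v : Vec Carrier k) → Defs.dot F u v ≡ sum (λ i → lookup u i * lookup v i)
      dot-sum [] [] = refl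
      dot-sum (x ∷ u) (y ∷ v) = cong (x * y +_) (dot-sum u v)

      opaque
        unfolding _⊗_

        ent-⊗ : ∀ (A : Mat m k) (B : Mat k l) i j → ent (A ⊗ B) i j ≡ sum (λ x → ent A i x * ent B x j)
        ent-⊗ A B i j = trans (cong (λ v → lookup v j) (VecP.lookup-map i (λ row → Vec.map (λ col → Defs.dot F row col) (transpose B)) A))
          (trans (VecP.lookup-map j (λ col → Defs.dot F (lookup A i) col) (transpose B)) (trans (dot-sum (lookup A i) (lookup (transpose B) j)) (sum-cong-≗ λ x → cong (ent A i x *_) (ent-ᵀ B j x))))

      δ : Fin m → Fin m → Carrier
      δ i j = if does (i Fin.≟ j) then 1# else 0#

      opaque
        unfolding _⊗_

        ent-𝟙 : ∀ (i j : Fin m) → ent (𝟙 m) i j ≡ δ i j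
        ent-𝟙 = ent-mk δ

        ent-𝟘 : ∀ (i : Fin m) (j : Fin k) → ent (𝟘 {m} {k}) i j ≡ 0#
        ent-𝟘 {k = k} i j = trans (cong (λ v → lookup v j) (VecP.lookup-replicate i (replicate k 0#))) (VecP.lookup-replicate j 0#)

      δ-refl : ∀ (i : Fin m) → δ i i ≡ 1#
      δ-refl i with i Fin.≟ i
      ... | yes _ = refl
      ... | no n = ⊥-elim (n refl)

      δ-≢ : ∀ {i j : Fin m} → i ≢ j → δ i j ≡ 0#
      δ-≢ {i = i} {j} n with i Fin.≟ j
      ... | yes e = ⊥-elim (n e)
      ... | no _ = refl

      δ-sym : ∀ (i j : Fin m) → δ i j ≡ δ j i
      δ-sym i j with i Fin.≟ j | j Fin.≟ i
      ... | yes _ | yes _ = refl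
      ... | no _ | no _ = refl
      ... | yes e | no n = ⊥-elim (n (sym e))
      ... | no n | yes e = ⊥-elim (n (sym e))

      sum-zero : ∀ {n} {f : Fin n → Carrier} → (∀ i → f i ≡ 0#) → sum f ≡ 0#
      sum-zero {n} e = trans (sum-cong-≗ e) (sum-replicate-zero n)

      sum-single : ∀ {n} {f : Fin n → Carrier} i → (∀ j → j ≢ i → f j ≡ 0#) → sum f ≡ f i
      sum-single {suc n} zero h = trans (cong (_ +_) (sum-zero (λ j → h (suc j) λ ()))) (+-identityʳ _)
      sum-single {suc n} (suc i) h = trans (cong₂ _+_ (h zero λ ()) (sum-single i λ j ne → h (suc j) (λ e → ne (FinP.suc-injective e)))) (+-identityˡ _)

      sum-split : ∀ m {n} (f : Fin (m ℕ.+ n) → Carrier) → sum f ≡ sum (λ i → f (i ↑ˡ n)) + sum (λ j → f (m ↑ʳ j))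
      sum-split zero f = sym (+-identityˡ _)
      sum-split (suc m) f = trans (cong (f zero +_) (sum-split m (f ∘ suc))) (sym (+-assoc _ _ _))

      ⊗-assoc : ∀ (A : Mat m k) (B : Mat k l) (C : Mat l n) → A ⊗ B ⊗ C ≡ A ⊗ (B ⊗ C)
      ⊗-assoc A B C = ext λ i j → begin
        ent (A ⊗ B ⊗ C) i j ≡⟨ ent-⊗ (A ⊗ B) C i j ⟩
        sum (λ y → ent (A ⊗ B) i y * ent C y j) ≡⟨ sum-cong-≗ (λ y → trans (cong (_* ent C y j) (ent-⊗ A B i y)) (*-distribʳ-sum (ent C y j) (λ x → ent A i x * ent B x y))) ⟩
        sum (λ y → sum (λ x → ent A i x * ent B x y * ent C y j)) ≡⟨ ∑-comm (λ y x → ent A i x * ent B x y * ent C y j) ⟩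
        sum (λ x → sum (λ y → ent A i x * ent B x y * ent C y j)) ≡⟨ sum-cong-≗ (λ x → trans (sum-cong-≗ (λ y → *-assoc (ent A i x) (ent B x y) (ent C y j))) (sym (*-distribˡ-sum (ent A i x) (λ y → ent B x y * ent C y j)))) ⟩
        sum (λ x → ent A i x * sum (λ y → ent B x y * ent C y j)) ≡⟨ sum-cong-≗ (λ x → cong (ent A i x *_) (ent-⊗ B C x j)) ⟨
        sum (λ x → ent A i x * ent (B ⊗ C) x j) ≡⟨ ent-⊗ A (B ⊗ C) i j ⟨
        ent (A ⊗ (B ⊗ C)) i j ∎ where open ≡-Reasoning

      ⊗-identityˡ : ∀ (A : Mat m k) → 𝟙 m ⊗ A ≡ A
      ⊗-identityˡ {m} A = ext λ i j → trans (ent-⊗ (𝟙 m) A i j) (trans (sum-single i (λ x ne →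
          trans (cong (_* ent A x j) (trans (ent-𝟙 i x) (δ-≢ (ne ∘ sym)))) (zeroˡ _)))
        (trans (cong (_* ent A i j) (trans (ent-𝟙 i i) (δ-refl i))) (*-identityˡ _)))

      ⊗-identityʳ : ∀ (A : Mat m k) → A ⊗ 𝟙 k ≡ A
      ⊗-identityʳ {k = k} A = ext λ i j → trans (ent-⊗ A (𝟙 k) i j) (trans (sum-single j (λ x ne →
          trans (cong (ent A i x *_) (trans (ent-𝟙 x j) (δ-≢ ne))) (zeroʳ _)))
        (trans (cong (ent A i j *_) (trans (ent-𝟙 j j) (δ-refl j))) (*-identityʳ _)))

      𝟘⊗ : ∀ (A : Mat k l) → 𝟘 {m} {k} ⊗ A ≡ 𝟘
      𝟘⊗ A = ext λ i j → trans (ent-⊗ 𝟘 A i j) (trans (sum-zero λ x → trans (cong (_* ent A x j) (ent-𝟘 i x)) (zeroˡ _)) (sym (ent-𝟘 i j)))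

      ⊗𝟘 : ∀ (A : Mat m k) → A ⊗ 𝟘 {k} {l} ≡ 𝟘
      ⊗𝟘 A = ext λ i j → trans (ent-⊗ A 𝟘 i j) (trans (sum-zero λ x → trans (cong (ent A i x *_) (ent-𝟘 x j)) (zeroʳ _)) (sym (ent-𝟘 i j)))

      ⊞-identityˡ : ∀ (A : Mat m k) → 𝟘 ⊞ A ≡ A
      ⊞-identityˡ A = ext λ i j → trans (ent-⊞ 𝟘 A i j) (trans (cong (_+ ent A i j) (ent-𝟘 i j)) (+-identityˡ _))

      ⊞-comm : ∀ (A B : Mat m k) → A ⊞ B ≡ B ⊞ A
      ⊞-comm A B = ext λ i j → trans (ent-⊞ A B i j) (trans (+-comm _ _) (sym (ent-⊞ B A i j)))

      ⊞-identityʳ : ∀ (A : Mat m k) → A ⊞ 𝟘 ≡ A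
      ⊞-identityʳ A = trans (⊞-comm A 𝟘) (⊞-identityˡ A)

      ⊞-assoc : ∀ (A B C : Mat m k) → A ⊞ B ⊞ C ≡ A ⊞ (B ⊞ C)
      ⊞-assoc A B C = ext λ i j → trans (ent-⊞ (A ⊞ B) C i j) (trans (cong (_+ ent C i j) (ent-⊞ A B i j)) (trans (+-assoc _ _ _)
        (sym (trans (ent-⊞ A (B ⊞ C) i j) (cong (ent A i j +_) (ent-⊞ B C i j))))))

      ⊞-self : ∀ (A : Mat m k) → A ⊞ A ≡ 𝟘
      ⊞-self A = ext λ i j → trans (ent-⊞ A A i j) (trans (x+x≈0 _) (sym (ent-𝟘 i j)))

      ⊗-distribˡ : ∀ (A : Mat m k) (B C : Mat k l) → A ⊗ (B ⊞ C) ≡ A ⊗ B ⊞ A ⊗ C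
      ⊗-distribˡ A B C = ext λ i j → begin
        ent (A ⊗ (B ⊞ C)) i j ≡⟨ ent-⊗ A (B ⊞ C) i j ⟩
        sum (λ x → ent A i x * ent (B ⊞ C) x j) ≡⟨ sum-cong-≗ (λ x → trans (cong (ent A i x *_) (ent-⊞ B C x j)) (distribˡ _ _ _)) ⟩
        sum (λ x → ent A i x * ent B x j + ent A i x * ent C x j) ≡⟨ ∑-distrib-+ (λ x → ent A i x * ent B x j) (λ x → ent A i x * ent C x j) ⟩
        sum (λ x → ent A i x * ent B x j) + sum (λ x → ent A i x * ent C x j) ≡⟨ cong₂ _+_ (ent-⊗ A B i j) (ent-⊗ A C i j) ⟨
        ent (A ⊗ B) i j + ent (A ⊗ C) i j ≡⟨ ent-⊞ (A ⊗ B) (A ⊗ C) i j ⟨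
        ent (A ⊗ B ⊞ A ⊗ C) i j ∎ where open ≡-Reasoning

      ᵀ-⊗ : ∀ (A : Mat m k) (B : Mat k l) → (A ⊗ B) ᵀ ≡ B ᵀ ⊗ A ᵀ
      ᵀ-⊗ A B = ext λ i j → trans (ent-ᵀ (A ⊗ B) i j) (trans (ent-⊗ A B j i) (trans
        (sum-cong-≗ λ x → trans (*-comm _ _) (sym (cong₂ _*_ (ent-ᵀ B i x) (ent-ᵀ A x j)))) (sym (ent-⊗ (B ᵀ) (A ᵀ) i j))))

      ᵀ-⊞ : ∀ (A B : Mat m k) → (A ⊞ B) ᵀ ≡ A ᵀ ⊞ B ᵀ
      ᵀ-⊞ A B = ext λ i j → trans (ent-ᵀ (A ⊞ B) i j) (trans (ent-⊞ A B j i) (sym (trans (ent-⊞ (A ᵀ) (B ᵀ) i j) (cong₂ _+_ (ent-ᵀ A i j) (ent-ᵀ B i j)))))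

      ᵀᵀ : ∀ (A : Mat m k) → A ᵀ ᵀ ≡ A
      ᵀᵀ A = ext λ i j → trans (ent-ᵀ (A ᵀ) i j) (ent-ᵀ A j i)

      𝟙ᵀ : 𝟙 m ᵀ ≡ 𝟙 m
      𝟙ᵀ {m} = ext λ i j → trans (ent-ᵀ (𝟙 m) i j) (trans (ent-𝟙 j i) (trans (δ-sym j i) (sym (ent-𝟙 i j))))

      𝟘ᵀ : 𝟘 {m} {k} ᵀ ≡ 𝟘
      𝟘ᵀ = ext λ i j → trans (ent-ᵀ 𝟘 i j) (trans (ent-𝟘 j i) (sym (ent-𝟘 i j)))

      ⊗-distribʳ : ∀ (C : Mat k l) (A B : Mat m k) → (A ⊞ B) ⊗ C ≡ A ⊗ C ⊞ B ⊗ C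
      ⊗-distribʳ C A B = begin
        (A ⊞ B) ⊗ C                  ≡⟨ ᵀᵀ ((A ⊞ B) ⊗ C) ⟨
        ((A ⊞ B) ⊗ C) ᵀ ᵀ            ≡⟨ cong _ᵀ (trans (ᵀ-⊗ (A ⊞ B) C) (trans (cong (C ᵀ ⊗_) (ᵀ-⊞ A B)) (⊗-distribˡ (C ᵀ) (A ᵀ) (B ᵀ)))) ⟩
        (C ᵀ ⊗ A ᵀ ⊞ C ᵀ ⊗ B ᵀ) ᵀ    ≡⟨ ᵀ-⊞ (C ᵀ ⊗ A ᵀ) (C ᵀ ⊗ B ᵀ) ⟩
        (C ᵀ ⊗ A ᵀ) ᵀ ⊞ (C ᵀ ⊗ B ᵀ) ᵀ ≡⟨ cong₂ _⊞_ (back A) (back B) ⟩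
        A ⊗ C ⊞ B ⊗ C                ∎
        where
        open ≡-Reasoning
        back : ∀ A → (C ᵀ ⊗ A ᵀ) ᵀ ≡ A ⊗ C
        back A = trans (cong _ᵀ (sym (ᵀ-⊗ A C))) (ᵀᵀ (A ⊗ C))

      foldr-sum : ∀ {n} (f : Fin n → Carrier) → Vec.foldr _ _+_ 0# (tabulate f) ≡ sum f
      foldr-sum {zero} f = refl
      foldr-sum {suc n} f = cong (f zero +_) (foldr-sum (f ∘ suc))

      opaque
        unfolding _⊗_

        Tr-sum : ∀ (A : Mat m m) → Tr A ≡ sum (λ i → ent A i i)
        Tr-sum A = foldr-sum (λ i → ent A i i)

      Tr-⊞ : ∀ (A B : Mat m m) → Tr (A ⊞ B) ≡ Tr A + Tr B
      Tr-⊞ A B = trans (Tr-sum (A ⊞ B)) (trans (sum-cong-≗ λ i → ent-⊞ A B i i) (trans (∑-distrib-+ (λ i → ent A i i) (λ i → ent B i i))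
        (sym (cong₂ _+_ (Tr-sum A) (Tr-sum B)))))

      Tr-𝟘 : Tr (𝟘 {m} {m}) ≡ 0#
      Tr-𝟘 {m} = trans (Tr-sum (𝟘 {m} {m})) (sum-zero λ i → ent-𝟘 {m} {m} i i)

      Tr-comm : ∀ (A : Mat m k) (B : Mat k m) → Tr (A ⊗ B) ≡ Tr (B ⊗ A)
      Tr-comm A B = begin
        Tr (A ⊗ B)                                    ≡⟨ Tr-sum (A ⊗ B) ⟩
        sum (λ i → ent (A ⊗ B) i i)                   ≡⟨ sum-cong-≗ (λ i → ent-⊗ A B i i) ⟩
        sum (λ i → sum (λ x → ent A i x * ent B x i)) ≡⟨ ∑-comm (λ i x → ent A i x * ent B x i) ⟩
        sum (λ x → sum (λ i → ent A i x * ent B x i)) ≡⟨ sum-cong-≗ (λ x → trans (sum-cong-≗ (λ i → *-comm (ent A i x) (ent B x i))) (sym (ent-⊗ B A x x))) ⟩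
        sum (λ x → ent (B ⊗ A) x x)                   ≡⟨ Tr-sum (B ⊗ A) ⟨
        Tr (B ⊗ A)                                    ∎ where open ≡-Reasoning

      module _ (A : Mat m k) (B : Mat m k′) (C : Mat m′ k) (D : Mat m′ k′) where
        private
          opaque
            unfolding blk

            top : ∀ i → lookup (blk A B C D) (i ↑ˡ m′) ≡ lookup A i ++ lookup B i
            top i = trans (VecP.lookup-++ˡ (zipWith _++_ A B) _ i) (VecP.lookup-zipWith _++_ i A B)
            bot : ∀ i → lookup (blk A B C D) (m ↑ʳ i) ≡ lookup C i ++ lookup D i
            bot i = trans (VecP.lookup-++ʳ (zipWith _++_ A B) _ i) (VecP.lookup-zipWith _++_ i C D)

        ent-blk₁₁ : ∀ i j → ent (blk A B C D) (i ↑ˡ m′) (j ↑ˡ k′) ≡ ent A i j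
        ent-blk₁₁ i j = trans (cong (λ v → lookup v (j ↑ˡ k′)) (top i)) (VecP.lookup-++ˡ (lookup A i) _ j)

        ent-blk₁₂ : ∀ i j → ent (blk A B C D) (i ↑ˡ m′) (k ↑ʳ j) ≡ ent B i j
        ent-blk₁₂ i j = trans (cong (λ v → lookup v (k ↑ʳ j)) (top i)) (VecP.lookup-++ʳ (lookup A i) _ j)

        ent-blk₂₁ : ∀ i j → ent (blk A B C D) (m ↑ʳ i) (j ↑ˡ k′) ≡ ent C i j
        ent-blk₂₁ i j = trans (cong (λ v → lookup v (j ↑ˡ k′)) (bot i)) (VecP.lookup-++ˡ (lookup C i) _ j)

        ent-blk₂₂ : ∀ i j → ent (blk A B C D) (m ↑ʳ i) (k ↑ʳ j) ≡ ent D i j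
        ent-blk₂₂ i j = trans (cong (λ v → lookup v (k ↑ʳ j)) (bot i)) (VecP.lookup-++ʳ (lookup C i) _ j)

        blk-ext : {X : Mat (m ℕ.+ m′) (k ℕ.+ k′)} → (∀ i j → ent X (i ↑ˡ m′) (j ↑ˡ k′) ≡ ent A i j) → (∀ i j → ent X (i ↑ˡ m′) (k ↑ʳ j) ≡ ent B i j) →
                  (∀ i j → ent X (m ↑ʳ i) (j ↑ˡ k′) ≡ ent C i j) → (∀ i j → ent X (m ↑ʳ i) (k ↑ʳ j) ≡ ent D i j) → X ≡ blk A B C D
        blk-ext {X} a b c d = ext (fin-split m _
          (λ i → fin-split k _ (λ j → trans (a i j) (sym (ent-blk₁₁ i j))) (λ j → trans (b i j) (sym (ent-blk₁₂ i j))))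
          (λ i → fin-split k _ (λ j → trans (c i j) (sym (ent-blk₂₁ i j))) (λ j → trans (d i j) (sym (ent-blk₂₂ i j)))))

      B₁₁ : Mat (m ℕ.+ m′) (k ℕ.+ k′) → Mat m k
      B₁₁ {m} {m′} {k} {k′} X = mk λ i j → ent X (i ↑ˡ m′) (j ↑ˡ k′)
      B₁₂ : Mat (m ℕ.+ m′) (k ℕ.+ k′) → Mat m k′
      B₁₂ {m} {m′} {k} {k′} X = mk λ i j → ent X (i ↑ˡ m′) (k ↑ʳ j)
      B₂₁ : Mat (m ℕ.+ m′) (k ℕ.+ k′) → Mat m′ k
      B₂₁ {m} {m′} {k} {k′} X = mk λ i j → ent X (m ↑ʳ i) (j ↑ˡ k′)
      B₂₂ : Mat (m ℕ.+ m′) (k ℕ.+ k′) → Mat m′ k′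
      B₂₂ {m} {m′} {k} {k′} X = mk λ i j → ent X (m ↑ʳ i) (k ↑ʳ j)

      blk-η : ∀ (X : Mat (m ℕ.+ m′) (k ℕ.+ k′)) → X ≡ blk (B₁₁ {m} {m′} {k} {k′} X) (B₁₂ {m} {m′} {k} {k′} X) (B₂₁ {m} {m′} {k} {k′} X) (B₂₂ {m} {m′} {k} {k′} X)
      blk-η {m} {m′} {k} {k′} X = blk-ext (B₁₁ {m} {m′} {k} {k′} X) (B₁₂ {m} {m′} {k} {k′} X) (B₂₁ {m} {m′} {k} {k′} X) (B₂₂ {m} {m′} {k} {k′} X)
        (λ i j → sym (ent-mk _ i j)) (λ i j → sym (ent-mk _ i j)) (λ i j → sym (ent-mk _ i j)) (λ i j → sym (ent-mk _ i j))

      module _ {A A′ : Mat m k} {B B′ : Mat m k′} {C C′ : Mat m′ k} {D D′ : Mat m′ k′} (e : blk A B C D ≡ blk A′ B′ C′ D′) where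
        private
          at : ∀ i j → ent (blk A B C D) i j ≡ ent (blk A′ B′ C′ D′) i j
          at i j = cong (λ X → ent X i j) e

        blk-inj₁₁ : A ≡ A′
        blk-inj₁₁ = ext λ i j → trans (sym (ent-blk₁₁ A B C D i j)) (trans (at _ _) (ent-blk₁₁ A′ B′ C′ D′ i j))
        blk-inj₁₂ : B ≡ B′
        blk-inj₁₂ = ext λ i j → trans (sym (ent-blk₁₂ A B C D i j)) (trans (at _ _) (ent-blk₁₂ A′ B′ C′ D′ i j))
        blk-inj₂₁ : C ≡ C′
        blk-inj₂₁ = ext λ i j → trans (sym (ent-blk₂₁ A B C D i j)) (trans (at _ _) (ent-blk₂₁ A′ B′ C′ D′ i j))
        blk-inj₂₂ : D ≡ D′
        blk-inj₂₂ = ext λ i j → trans (sym (ent-blk₂₂ A B C D i j)) (trans (at _ _) (ent-blk₂₂ A′ B′ C′ D′ i j))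

      blk-cong : {A A′ : Mat m k} {B B′ : Mat m k′} {C C′ : Mat m′ k} {D D′ : Mat m′ k′} →
                 A ≡ A′ → B ≡ B′ → C ≡ C′ → D ≡ D′ → blk A B C D ≡ blk A′ B′ C′ D′
      blk-cong refl refl refl refl = refl

      blk-⊗ : ∀ (A : Mat m k) (B : Mat m k′) (C : Mat m′ k) (D : Mat m′ k′)
                (E : Mat k l) (G : Mat k l′) (H : Mat k′ l) (I : Mat k′ l′) →
              blk A B C D ⊗ blk E G H I ≡ blk (A ⊗ E ⊞ B ⊗ H) (A ⊗ G ⊞ B ⊗ I) (C ⊗ E ⊞ D ⊗ H) (C ⊗ G ⊞ D ⊗ I)
      blk-⊗ {k = k} A B C D E G H I = blk-ext (A ⊗ E ⊞ B ⊗ H) (A ⊗ G ⊞ B ⊗ I) (C ⊗ E ⊞ D ⊗ H) (C ⊗ G ⊞ D ⊗ I)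
          (λ i j → expand A B i E H j (ent-blk₁₁ A B C D i) (ent-blk₁₂ A B C D i) (λ x → ent-blk₁₁ E G H I x j) (λ x → ent-blk₂₁ E G H I x j))
          (λ i j → expand A B i G I j (ent-blk₁₁ A B C D i) (ent-blk₁₂ A B C D i) (λ x → ent-blk₁₂ E G H I x j) (λ x → ent-blk₂₂ E G H I x j))
          (λ i j → expand C D i E H j (ent-blk₂₁ A B C D i) (ent-blk₂₂ A B C D i) (λ x → ent-blk₁₁ E G H I x j) (λ x → ent-blk₂₁ E G H I x j))
          (λ i j → expand C D i G I j (ent-blk₂₁ A B C D i) (ent-blk₂₂ A B C D i) (λ x → ent-blk₁₂ E G H I x j) (λ x → ent-blk₂₂ E G H I x j))
        where
        L = blk A B C D
        R = blk E G H I
        expand : ∀ {a b} (P : Mat a _) (Q : Mat a _) i (S : Mat _ b) (T : Mat _ b) j {i′ j′} →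
          (∀ x → ent L i′ (x ↑ˡ _) ≡ ent P i x) → (∀ x → ent L i′ (k ↑ʳ x) ≡ ent Q i x) →
          (∀ x → ent R (x ↑ˡ _) j′ ≡ ent S x j) → (∀ x → ent R (k ↑ʳ x) j′ ≡ ent T x j) →
          ent (L ⊗ R) i′ j′ ≡ ent (P ⊗ S ⊞ Q ⊗ T) i j
        expand P Q i S T j {i′} {j′} p s u v = trans (ent-⊗ L R i′ j′) (trans (sum-split k _)
          (trans (cong₂ _+_ (sum-cong-≗ λ x → cong₂ _*_ (p x) (u x)) (sum-cong-≗ λ x → cong₂ _*_ (s x) (v x)))
            (trans (sym (cong₂ _+_ (ent-⊗ P S i j) (ent-⊗ Q T i j))) (sym (ent-⊞ (P ⊗ S) (Q ⊗ T) i j)))))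

      blk-⊞ : ∀ (A : Mat m k) (B : Mat m k′) (C : Mat m′ k) (D : Mat m′ k′) A′ B′ C′ D′ →
              blk A B C D ⊞ blk A′ B′ C′ D′ ≡ blk (A ⊞ A′) (B ⊞ B′) (C ⊞ C′) (D ⊞ D′)
      blk-⊞ A B C D A′ B′ C′ D′ = blk-ext (A ⊞ A′) (B ⊞ B′) (C ⊞ C′) (D ⊞ D′)
        (λ i j → trans (ent-⊞ X Y _ _) (trans (cong₂ _+_ (ent-blk₁₁ A B C D i j) (ent-blk₁₁ A′ B′ C′ D′ i j)) (sym (ent-⊞ A A′ i j))))
        (λ i j → trans (ent-⊞ X Y _ _) (trans (cong₂ _+_ (ent-blk₁₂ A B C D i j) (ent-blk₁₂ A′ B′ C′ D′ i j)) (sym (ent-⊞ B B′ i j))))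
        (λ i j → trans (ent-⊞ X Y _ _) (trans (cong₂ _+_ (ent-blk₂₁ A B C D i j) (ent-blk₂₁ A′ B′ C′ D′ i j)) (sym (ent-⊞ C C′ i j))))
        (λ i j → trans (ent-⊞ X Y _ _) (trans (cong₂ _+_ (ent-blk₂₂ A B C D i j) (ent-blk₂₂ A′ B′ C′ D′ i j)) (sym (ent-⊞ D D′ i j))))
        where
        X = blk A B C D
        Y = blk A′ B′ C′ D′

      blk-ᵀ : ∀ (A : Mat m k) (B : Mat m k′) (C : Mat m′ k) (D : Mat m′ k′) → blk A B C D ᵀ ≡ blk (A ᵀ) (C ᵀ) (B ᵀ) (D ᵀ)
      blk-ᵀ A B C D = blk-ext (A ᵀ) (C ᵀ) (B ᵀ) (D ᵀ)
        (λ i j → trans (ent-ᵀ (blk A B C D) _ _) (trans (ent-blk₁₁ A B C D j i) (sym (ent-ᵀ A i j))))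
        (λ i j → trans (ent-ᵀ (blk A B C D) _ _) (trans (ent-blk₂₁ A B C D j i) (sym (ent-ᵀ C i j))))
        (λ i j → trans (ent-ᵀ (blk A B C D) _ _) (trans (ent-blk₁₂ A B C D j i) (sym (ent-ᵀ B i j))))
        (λ i j → trans (ent-ᵀ (blk A B C D) _ _) (trans (ent-blk₂₂ A B C D j i) (sym (ent-ᵀ D i j))))

      δ-cong : ∀ {a b} (f : Fin a → Fin b) → (∀ {i j} → f i ≡ f j → i ≡ j) → ∀ i j → δ (f i) (f j) ≡ δ i j
      δ-cong f fi i j with i Fin.≟ j
      ... | yes refl = δ-refl (f i)
      ... | no n = δ-≢ (n ∘ fi)

      ↑ˡ≢↑ʳ : ∀ {m} n (i : Fin m) (j : Fin n) → i ↑ˡ n ≢ m ↑ʳ j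
      ↑ˡ≢↑ʳ n (suc i) j e = ↑ˡ≢↑ʳ n i j (FinP.suc-injective e)

      𝟙-blk : ∀ m m′ → 𝟙 (m ℕ.+ m′) ≡ blk (𝟙 m) 𝟘 𝟘 (𝟙 m′)
      𝟙-blk m m′ = blk-ext (𝟙 m) 𝟘 𝟘 (𝟙 m′)
        (λ i j → trans (ent-𝟙 {m ℕ.+ m′} _ _) (trans (δ-cong (_↑ˡ m′) (FinP.↑ˡ-injective m′ _ _) i j) (sym (ent-𝟙 i j))))
        (λ i j → trans (ent-𝟙 {m ℕ.+ m′} _ _) (trans (δ-≢ (↑ˡ≢↑ʳ m′ i j)) (sym (ent-𝟘 i j))))
        (λ i j → trans (ent-𝟙 {m ℕ.+ m′} _ _) (trans (δ-≢ (↑ˡ≢↑ʳ m′ j i ∘ sym)) (sym (ent-𝟘 i j))))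
        (λ i j → trans (ent-𝟙 {m ℕ.+ m′} _ _) (trans (δ-cong (m ↑ʳ_) (FinP.↑ʳ-injective m _ _) i j) (sym (ent-𝟙 i j))))

      Tr-blk : ∀ (A : Mat m m) (B : Mat m m′) (C : Mat m′ m) (D : Mat m′ m′) → Tr (blk A B C D) ≡ Tr A + Tr D
      Tr-blk {m = m} A B C D = trans (Tr-sum (blk A B C D)) (trans (sum-split m (λ i → ent (blk A B C D) i i)) (cong₂ _+_
        (trans (sum-cong-≗ λ i → ent-blk₁₁ A B C D i i) (sym (Tr-sum A))) (trans (sum-cong-≗ λ i → ent-blk₂₂ A B C D i i) (sym (Tr-sum D)))))

      Symm Alt : Mat m m → Set
      Symm B = B ᵀ ≡ B
      Alt B = B ᵀ ≡ B × (∀ i → ent B i i ≡ 0#)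

      alt-⊞ : {A B : Mat m m} → Alt A → Alt B → Alt (A ⊞ B)
      alt-⊞ {A = A} {B} (s , d) (s′ , d′) = trans (ᵀ-⊞ A B) (cong₂ _⊞_ s s′) , λ i → trans (ent-⊞ A B i i) (trans (cong₂ _+_ (d i) (d′ i)) (+-identityˡ _))

      alt-𝟘 : Alt (𝟘 {m} {m})
      alt-𝟘 = 𝟘ᵀ , λ i → ent-𝟘 i i

      -- Off-diagonal terms occur in equal pairs, which cancel in characteristic 2.
      sum-alternating : ∀ {n} (g : Fin n → Fin n → Carrier) → (∀ i j → g i j ≡ g j i) → (∀ i → g i i ≡ 0#) → sum (λ i → sum (g i)) ≡ 0#
      sum-alternating {zero} g s d = refl
      sum-alternating {suc n} g s d = begin
        (g zero zero + row) + sum (λ i → g (suc i) zero + sum (λ j → g (suc i) (suc j)))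
          ≡⟨ cong₂ _+_ (trans (cong (_+ row) (d zero)) (+-identityˡ row)) (∑-distrib-+ (λ i → g (suc i) zero) (λ i → sum (λ j → g (suc i) (suc j)))) ⟩
        row + (sum (λ i → g (suc i) zero) + sum (λ i → sum (λ j → g (suc i) (suc j))))
          ≡⟨ cong (λ z → row + z) (cong₂ _+_ (sum-cong-≗ λ i → s (suc i) zero) (sum-alternating (λ i j → g (suc i) (suc j)) (λ i j → s (suc i) (suc j)) (λ i → d (suc i)))) ⟩
        row + (row + 0#) ≡⟨ trans (cong (row +_) (+-identityʳ row)) (x+x≈0 row) ⟩
        0# ∎
        where
        open ≡-Reasoning
        row = sum (λ j → g zero (suc j))

      alt-congruence : {B : Mat m m} → Alt B → ∀ (X : Mat m k) → Alt (X ᵀ ⊗ B ⊗ X)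
      alt-congruence {m = m} {B = B} (s , d) X = symm , diag
        where
        open ≡-Reasoning
        symm : (X ᵀ ⊗ B ⊗ X) ᵀ ≡ X ᵀ ⊗ B ⊗ X
        symm = begin
          (X ᵀ ⊗ B ⊗ X) ᵀ       ≡⟨ ᵀ-⊗ (X ᵀ ⊗ B) X ⟩
          X ᵀ ⊗ (X ᵀ ⊗ B) ᵀ     ≡⟨ cong (X ᵀ ⊗_) (trans (ᵀ-⊗ (X ᵀ) B) (cong₂ _⊗_ s (ᵀᵀ X))) ⟩
          X ᵀ ⊗ (B ⊗ X)         ≡⟨ ⊗-assoc (X ᵀ) B X ⟨
          X ᵀ ⊗ B ⊗ X           ∎
        diag : ∀ i → ent (X ᵀ ⊗ B ⊗ X) i i ≡ 0#
        diag i = begin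
          ent (X ᵀ ⊗ B ⊗ X) i i ≡⟨ ent-⊗ (X ᵀ ⊗ B) X i i ⟩
          sum (λ y → ent (X ᵀ ⊗ B) i y * ent X y i)
            ≡⟨ sum-cong-≗ (λ y → trans (cong (_* ent X y i) (trans (ent-⊗ (X ᵀ) B i y) (sum-cong-≗ λ x → cong (_* ent B x y) (ent-ᵀ X i x))))
                 (*-distribʳ-sum (ent X y i) (λ x → ent X x i * ent B x y))) ⟩
          sum (λ y → sum (λ x → ent X x i * ent B x y * ent X y i))
            ≡⟨ sum-alternating (λ y x → ent X x i * ent B x y * ent X y i)
                 (λ y x → trans (solve 3 (λ a b c → a :* b :* c := c :* b :* a) refl (ent X x i) (ent B x y) (ent X y i))
                   (cong (λ b → ent X y i * b * ent X x i) (trans (sym (ent-ᵀ B y x)) (cong (λ M → ent M y x) s))))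
                 (λ y → trans (cong (λ b → ent X y i * b * ent X y i) (d y)) (trans (cong (_* ent X y i) (zeroʳ _)) (zeroˡ _))) ⟩
          0# ∎

      _≟ᴹ_ : DecidableEquality (Mat m k)
      _≟ᴹ_ = VecP.≡-dec (VecP.≡-dec _≟_)

      card-Mat : ∀ m k → Card {Mat m k} (λ _ → ⊤) ((q ℕ.^ k) ℕ.^ m)
      card-Mat m k = card-vec (card-vec card-F k) m

      Inv : Mat m m → Set
      Inv {m} A = ∃ λ A′ → A ⊗ A′ ≡ 𝟙 m

      -- No determinant is involved: A A′ = 1 makes X ↦ A′ X injective, hence onto by finiteness. A
      -- preimage X of 1 satisfies A = A A′ X = X.
      ⊗-left-inverse : {A A′ : Mat m m} → A ⊗ A′ ≡ 𝟙 m → A′ ⊗ A ≡ 𝟙 m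
      ⊗-left-inverse {m} {A} {A′} e = trans (cong (A′ ⊗_) A≡X) A′X
        where
        open ≡-Reasoning
        cancel : ∀ X → A ⊗ (A′ ⊗ X) ≡ X
        cancel X = trans (sym (⊗-assoc A A′ X)) (trans (cong (_⊗ X) e) (⊗-identityˡ X))
        X∃ = finite-surjective (card-Mat m m) (A′ ⊗_) (λ X Y h → trans (sym (cancel X)) (trans (cong (A ⊗_) h) (cancel Y))) _≟ᴹ_ (𝟙 m)
        X = proj₁ X∃
        A′X : A′ ⊗ X ≡ 𝟙 m
        A′X = proj₂ X∃
        A≡X : A ≡ X
        A≡X = trans (sym (⊗-identityʳ A)) (trans (cong (A ⊗_) (sym A′X)) (cancel X))

      inverse-unique : {A B C : Mat m m} → A ⊗ B ≡ 𝟙 m → A ⊗ C ≡ 𝟙 m → B ≡ C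
      inverse-unique {m} {A} {B} {C} e h = begin
        B             ≡⟨ ⊗-identityʳ B ⟨
        B ⊗ 𝟙 m       ≡⟨ cong (B ⊗_) h ⟨
        B ⊗ (A ⊗ C)   ≡⟨ ⊗-assoc B A C ⟨
        B ⊗ A ⊗ C     ≡⟨ cong (_⊗ C) (⊗-left-inverse e) ⟩
        𝟙 m ⊗ C       ≡⟨ ⊗-identityˡ C ⟩
        C             ∎ where open ≡-Reasoning

      inv-⊗ : {A B : Mat m m} → Inv A → Inv B → Inv (A ⊗ B)
      inv-⊗ {m} {A} {B} (A′ , a) (B′ , b) = B′ ⊗ A′ , (begin
        A ⊗ B ⊗ (B′ ⊗ A′)   ≡⟨ ⊗-assoc A B (B′ ⊗ A′) ⟩
        A ⊗ (B ⊗ (B′ ⊗ A′)) ≡⟨ cong (A ⊗_) (trans (sym (⊗-assoc B B′ A′)) (trans (cong (_⊗ A′) b) (⊗-identityˡ A′))) ⟩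
        A ⊗ A′              ≡⟨ a ⟩
        𝟙 m                 ∎) where open ≡-Reasoning

      inv-inverse : {A : Mat m m} (a : Inv A) → Inv (proj₁ a)
      inv-inverse {A = A} (A′ , a) = A , ⊗-left-inverse a

      inv-factorʳ : {A B : Mat m m} → Inv A → Inv (A ⊗ B) → Inv B
      inv-factorʳ {A = A} {B} (A′ , a) i = subst Inv (trans (sym (⊗-assoc A′ A B)) (trans (cong (_⊗ B) (⊗-left-inverse a)) (⊗-identityˡ B)))
        (inv-⊗ (inv-inverse (A′ , a)) i)

      inv-factorˡ : {A B : Mat m m} → Inv B → Inv (A ⊗ B) → Inv A
      inv-factorˡ {A = A} {B} (B′ , b) i = subst Inv (trans (⊗-assoc A B B′) (trans (cong (A ⊗_) b) (⊗-identityʳ A))) (inv-⊗ i (inv-inverse (B′ , b)))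

      inv-ᵀ : {A : Mat m m} → Inv A → Inv (A ᵀ)
      inv-ᵀ {A = A} (A′ , a) = A′ ᵀ , trans (sym (ᵀ-⊗ A′ A)) (trans (cong _ᵀ (⊗-left-inverse {A = A} {A′} a)) 𝟙ᵀ)

  -- Numbers of invertible, invertible symmetric and alternating matrices.

  module GroupOrders where

    import Defs
    open Defs using (FiniteField)
    open Counting
    open CharTwo
    open FieldBasics
    open Matrices
    open import Data.Nat as ℕ using (ℕ; zero; suc; _≤_; z≤n; s≤s)
    import Data.Nat.Properties as ℕP
    open import Data.Fin as Fin using (Fin; zero; suc; _↑ˡ_; _↑ʳ_)
    import Data.Fin.Properties as FinP
    open import Data.Vec using ([]; _∷_)
    open import Data.Product using (∃; _×_; _,_; proj₁; proj₂)
    open import Data.Sum using (_⊎_; inj₁; inj₂)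
    open import Data.Empty using (⊥-elim)
    open import Data.Unit using (⊤; tt)
    open import Relation.Nullary using (¬_; yes; no)
    open import Relation.Nullary.Decidable using (_×-dec_)
    open import Relation.Binary.PropositionalEquality hiding (J)
    open import Function using (_∘_)

    -- Numbers of invertible, invertible symmetric, and alternating n × n matrices.
    gl sy al : ℕ → ℕ → ℕ
    gl q zero = 1
    gl q (suc n) = (q ℕ.^ suc n ℕ.∸ 1) ℕ.* (q ℕ.^ n ℕ.* gl q n)
    sy q zero = 1
    sy q (suc zero) = (q ℕ.∸ 1) ℕ.* (q ℕ.^ 0 ℕ.* 1)
    sy q (suc (suc n)) = (q ℕ.∸ 1) ℕ.* (q ℕ.^ suc n ℕ.* sy q (suc n)) ℕ.+ (q ℕ.^ suc n ℕ.∸ 1) ℕ.* (q ℕ.^ suc n ℕ.* sy q n)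
    al q zero = 1
    al q (suc n) = q ℕ.^ n ℕ.* al q n

    card-inhabited : ∀ {A : Set} {P : A → Set} {k} → 1 ≤ k → Card P k → ∃ P
    card-inhabited (s≤s _) c = el c zero , el∈ c zero

    module Orders where
      open Field-F
      open Mats

      private variable
        m k l n : ℕ

      2≤q : 2 ≤ q
      2≤q = 2≤2^ r r≢0
        where
        2≤2^ : ∀ r → r ≢ 0 → 2 ≤ 2 ℕ.^ r
        2≤2^ zero n = ⊥-elim (n refl)
        2≤2^ (suc r′) _ = ℕP.*-monoʳ-≤ 2 (ℕP.m^n>0 2 r′)

      gl>0 : ∀ n → 1 ≤ gl q n
      gl>0 zero = s≤s z≤n
      gl>0 (suc n) = ℕP.*-mono-≤ {1} {_} {1} (ℕP.m<n⇒0<n∸m (ℕP.≤-trans 2≤q (ℕP.≤-trans (ℕP.≤-reflexive (sym (ℕP.*-identityʳ q)))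
          (ℕP.*-monoʳ-≤ q (ℕP.m^n>0 q {{ℕ.>-nonZero (ℕP.≤-trans (s≤s z≤n) 2≤q)}} n)))))
        (ℕP.*-mono-≤ {1} {_} {1} (ℕP.m^n>0 q {{ℕ.>-nonZero (ℕP.≤-trans (s≤s z≤n) 2≤q)}} n) (gl>0 n))

      inv-upper⇒ : ∀ {A : Mat m m} {B} {D : Mat k k} → Inv (blk A B 𝟘 D) → Inv D
      inv-upper⇒ {m} {k} {A} {B} {D} (E , e) = B₂₂ {m} {k} {m} {k} E , (begin
          D ⊗ E₂₂             ≡⟨ trans (cong (_⊞ D ⊗ E₂₂) (𝟘⊗ E₁₂)) (⊞-identityˡ _) ⟨
          𝟘 ⊗ E₁₂ ⊞ D ⊗ E₂₂   ≡⟨ blk-inj₂₂ (trans (sym (blk-⊗ A B 𝟘 D _ _ _ _)) (trans (cong (blk A B 𝟘 D ⊗_) (sym (blk-η E))) (trans e (𝟙-blk m k)))) ⟩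
          𝟙 k                 ∎)
        where
        open ≡-Reasoning
        E₁₂ = B₁₂ {m} {k} {m} {k} E
        E₂₂ = B₂₂ {m} {k} {m} {k} E

      inv-upper⇐ : ∀ {A : Mat m m} {B} {D : Mat k k} → Inv A → Inv D → Inv (blk A B 𝟘 D)
      inv-upper⇐ {m} {k} {A} {B} {D} (A′ , a) (D′ , d) = blk A′ (A′ ⊗ (B ⊗ D′)) 𝟘 D′ , (begin
          blk A B 𝟘 D ⊗ blk A′ (A′ ⊗ (B ⊗ D′)) 𝟘 D′
            ≡⟨ blk-⊗ A B 𝟘 D A′ _ 𝟘 D′ ⟩
          blk (A ⊗ A′ ⊞ B ⊗ 𝟘) (A ⊗ (A′ ⊗ (B ⊗ D′)) ⊞ B ⊗ D′) (𝟘 ⊗ A′ ⊞ D ⊗ 𝟘) (𝟘 ⊗ (A′ ⊗ (B ⊗ D′)) ⊞ D ⊗ D′)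
            ≡⟨ blk-cong (trans (cong₂ _⊞_ a (⊗𝟘 B)) (⊞-identityʳ _))
                 (trans (cong (_⊞ B ⊗ D′) (trans (sym (⊗-assoc A A′ (B ⊗ D′))) (trans (cong (_⊗ (B ⊗ D′)) a) (⊗-identityˡ _)))) (⊞-self (B ⊗ D′)))
                 (trans (cong₂ _⊞_ (𝟘⊗ A′) (⊗𝟘 D)) (⊞-identityˡ _)) (trans (cong₂ _⊞_ (𝟘⊗ (A′ ⊗ (B ⊗ D′))) d) (⊞-identityˡ _)) ⟩
          blk (𝟙 m) 𝟘 𝟘 (𝟙 k) ≡⟨ 𝟙-blk m k ⟨
          𝟙 (m ℕ.+ k) ∎)
        where open ≡-Reasoning

      inv-lower⇒ : ∀ {A : Mat m m} {C} {D : Mat k k} → Inv (blk A 𝟘 C D) → Inv A × Inv D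
      inv-lower⇒ {m} {k} {A} {C} {D} (E , e) = (E₁₁ , (begin
          A ⊗ E₁₁             ≡⟨ trans (cong (A ⊗ E₁₁ ⊞_) (𝟘⊗ E₂₁)) (⊞-identityʳ _) ⟨
          A ⊗ E₁₁ ⊞ 𝟘 ⊗ E₂₁   ≡⟨ blk-inj₁₁ (trans (sym (blk-⊗ A 𝟘 C D _ _ _ _)) (trans (cong (blk A 𝟘 C D ⊗_) (sym (blk-η E))) (trans e (𝟙-blk m k)))) ⟩
          𝟙 m                 ∎)) , (E₂₂ , ⊗-left-inverse (begin
          E₂₂ ⊗ D             ≡⟨ trans (cong (_⊞ E₂₂ ⊗ D) (⊗𝟘 E₂₁)) (⊞-identityˡ _) ⟨
          E₂₁ ⊗ 𝟘 ⊞ E₂₂ ⊗ D   ≡⟨ blk-inj₂₂ (trans (sym (blk-⊗ E₁₁ E₁₂ E₂₁ E₂₂ A 𝟘 C D)) (trans (cong (_⊗ blk A 𝟘 C D) (sym (blk-η E))) (trans (⊗-left-inverse e) (𝟙-blk m k)))) ⟩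
          𝟙 k                 ∎))
        where
        open ≡-Reasoning
        E₁₁ = B₁₁ {m} {k} {m} {k} E
        E₁₂ = B₁₂ {m} {k} {m} {k} E
        E₂₁ = B₂₁ {m} {k} {m} {k} E
        E₂₂ = B₂₂ {m} {k} {m} {k} E

      lower-inverse : (A A′ : Mat m m) (C : Mat k m) (D D′ : Mat k k) → A ⊗ A′ ≡ 𝟙 m → D ⊗ D′ ≡ 𝟙 k →
                      blk A 𝟘 C D ⊗ blk A′ 𝟘 (D′ ⊗ (C ⊗ A′)) D′ ≡ 𝟙 (m ℕ.+ k)
      lower-inverse {m} {k} A A′ C D D′ a d = begin
          blk A 𝟘 C D ⊗ blk A′ 𝟘 (D′ ⊗ (C ⊗ A′)) D′
            ≡⟨ blk-⊗ A 𝟘 C D A′ 𝟘 (D′ ⊗ (C ⊗ A′)) D′ ⟩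
          blk (A ⊗ A′ ⊞ 𝟘 ⊗ (D′ ⊗ (C ⊗ A′))) (A ⊗ 𝟘 ⊞ 𝟘 ⊗ D′) (C ⊗ A′ ⊞ D ⊗ (D′ ⊗ (C ⊗ A′))) (C ⊗ 𝟘 ⊞ D ⊗ D′)
            ≡⟨ blk-cong (trans (cong₂ _⊞_ a (𝟘⊗ (D′ ⊗ (C ⊗ A′)))) (⊞-identityʳ _)) (trans (cong₂ _⊞_ (⊗𝟘 A) (𝟘⊗ D′)) (⊞-identityˡ _))
                 (trans (cong (C ⊗ A′ ⊞_) (trans (sym (⊗-assoc D D′ (C ⊗ A′))) (trans (cong (_⊗ (C ⊗ A′)) d) (⊗-identityˡ _)))) (⊞-self (C ⊗ A′)))
                 (trans (cong₂ _⊞_ (⊗𝟘 C) d) (⊞-identityˡ _)) ⟩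
          blk (𝟙 m) 𝟘 𝟘 (𝟙 k) ≡⟨ 𝟙-blk m k ⟨
          𝟙 (m ℕ.+ k) ∎
        where open ≡-Reasoning

      inv-lower⇐ : ∀ {A : Mat m m} {C} {D : Mat k k} → Inv A → Inv D → Inv (blk A 𝟘 C D)
      inv-lower⇐ {A = A} {C} {D} (A′ , a) (D′ , d) = _ , lower-inverse A A′ C D D′ a d

      inv-𝟙 : Inv (𝟙 n)
      inv-𝟙 {n} = 𝟙 n , ⊗-identityˡ (𝟙 n)

      module _ {A : Mat m m} {A′ : Mat m m} (a : A ⊗ A′ ≡ 𝟙 m) (B : Mat m k) (C : Mat k m) (D : Mat k k) where
        private
          S = D ⊞ C ⊗ A′ ⊗ B

          factor : blk A B C D ≡ blk (𝟙 m) 𝟘 (C ⊗ A′) (𝟙 k) ⊗ blk A B 𝟘 S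
          factor = sym (trans (blk-⊗ (𝟙 m) 𝟘 (C ⊗ A′) (𝟙 k) A B 𝟘 S)
            (blk-cong (trans (cong₂ _⊞_ (⊗-identityˡ A) (𝟘⊗ 𝟘)) (⊞-identityʳ A))
                      (trans (cong₂ _⊞_ (⊗-identityˡ B) (𝟘⊗ S)) (⊞-identityʳ B))
                      (trans (cong₂ _⊞_ (trans (⊗-assoc C A′ A) (trans (cong (C ⊗_) (⊗-left-inverse a)) (⊗-identityʳ C))) (⊗𝟘 (𝟙 k))) (⊞-identityʳ C))
                      (trans (cong (C ⊗ A′ ⊗ B ⊞_) (⊗-identityˡ S)) (trans (cong (C ⊗ A′ ⊗ B ⊞_) (⊞-comm D _))
                        (trans (sym (⊞-assoc (C ⊗ A′ ⊗ B) (C ⊗ A′ ⊗ B) D)) (trans (cong (_⊞ D) (⊞-self (C ⊗ A′ ⊗ B))) (⊞-identityˡ D)))))))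

          inv-L : Inv (blk (𝟙 m) 𝟘 (C ⊗ A′) (𝟙 k))
          inv-L = inv-lower⇐ {A = 𝟙 m} {C ⊗ A′} {𝟙 k} inv-𝟙 inv-𝟙

        schur⇒ : Inv (blk A B C D) → Inv (D ⊞ C ⊗ A′ ⊗ B)
        schur⇒ i = inv-upper⇒ {A = A} {B} {S} (inv-factorʳ inv-L (subst Inv factor i))

        schur⇐ : Inv (D ⊞ C ⊗ A′ ⊗ B) → Inv (blk A B C D)
        schur⇐ i = subst Inv (sym factor) (inv-⊗ inv-L (inv-upper⇐ {A = A} {B} {S} (A′ , a) i))

      rowAdd : Mat m k → Mat (m ℕ.+ k) (m ℕ.+ k)
      rowAdd {m} {k} e = blk (𝟙 m) e 𝟘 (𝟙 k)

      rowAdd-⊗ : ∀ (e : Mat m k) (A : Mat m m) (B : Mat m k) C D → rowAdd e ⊗ blk A B C D ≡ blk (A ⊞ e ⊗ C) (B ⊞ e ⊗ D) C D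
      rowAdd-⊗ {m} {k} e A B C D = trans (blk-⊗ (𝟙 m) e 𝟘 (𝟙 k) A B C D)
        (blk-cong (cong (_⊞ e ⊗ C) (⊗-identityˡ A)) (cong (_⊞ e ⊗ D) (⊗-identityˡ B))
          (trans (cong₂ _⊞_ (𝟘⊗ A) (⊗-identityˡ C)) (⊞-identityˡ C)) (trans (cong₂ _⊞_ (𝟘⊗ B) (⊗-identityˡ D)) (⊞-identityˡ D)))

      module _ (e : Mat m k) (A : Mat m m) (B : Mat m k) (C : Mat k m) (D : Mat k k) where
        rowAdd⇒ : Inv (blk A B C D) → Inv (blk (A ⊞ e ⊗ C) (B ⊞ e ⊗ D) C D)
        rowAdd⇒ i = subst Inv (rowAdd-⊗ e A B C D) (inv-⊗ (inv-upper⇐ {A = 𝟙 m} {e} {𝟙 k} inv-𝟙 inv-𝟙) i)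

        rowAdd⇐ : Inv (blk (A ⊞ e ⊗ C) (B ⊞ e ⊗ D) C D) → Inv (blk A B C D)
        rowAdd⇐ i = inv-factorʳ (inv-upper⇐ {A = 𝟙 m} {e} {𝟙 k} inv-𝟙 inv-𝟙) (subst Inv (sym (rowAdd-⊗ e A B C D)) i)

      scalar : Carrier → Mat 1 1
      scalar a = (a ∷ []) ∷ []

      scalar-inverse : ∀ {a} → a ≢ 0# → scalar a ⊗ scalar (a ⁻¹) ≡ 𝟙 1
      scalar-inverse {a} n = ext λ { zero zero → trans (ent-⊗ (scalar a) (scalar (a ⁻¹)) zero zero)
        (trans (+-identityʳ _) (trans (⁻¹-inverse a n) (sym (ent-𝟙 {1} zero zero)))) }

      scalar-0 : scalar 0# ≡ 𝟘
      scalar-0 = ext λ { zero zero → sym (ent-𝟘 {1} {1} zero zero) }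

      card-row : Card {Mat 1 n} (λ _ → ⊤) (q ℕ.^ n)
      card-row {n} = card-subst (ℕP.*-identityʳ (q ℕ.^ n)) (card-Mat 1 n)

      card-col : Card {Mat n 1} (λ _ → ⊤) (q ℕ.^ n)
      card-col {n} = card-subst (cong (ℕ._^ n) (ℕP.*-identityʳ q)) (card-Mat n 1)

      card-1×1 : Card {Mat 1 1} (λ _ → ⊤) q
      card-1×1 = card-subst (ℕP.*-identityʳ q) (card-row {1})

      card-nonzero : ∀ {m k c} → Card {Mat m k} (λ _ → ⊤) c → Card {Mat m k} (_≢ 𝟘) (c ℕ.∸ 1)
      card-nonzero c with card-minus c (_≟ᴹ 𝟘) (card-one {P = λ x → ⊤ × x ≡ 𝟘} 𝟘 (tt , refl) (λ _ → proj₂))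
      ... | j , d , refl = card-iff d (λ _ → proj₂) (λ _ n → tt , n)

      nonzero-entry : ∀ {c : Mat n 1} → c ≢ 𝟘 → ∃ λ i → ent c i zero ≢ 0#
      nonzero-entry {n} {c} ne with FinP.any? (λ i → Relation.Nullary.Decidable.¬? (ent c i zero ≟ 0#))
      ... | yes h = h
      ... | no h = ⊥-elim (ne (ext λ { i zero → zero-at i }))
        where
        zero-at : ∀ i → ent c i zero ≡ ent (𝟘 {n} {1}) i zero
        zero-at i with ent c i zero ≟ 0#
        ... | yes e = trans e (sym (ent-𝟘 i zero))
        ... | no ne = ⊥-elim (h (i , ne))

      unitRow : Fin n → Mat 1 n
      unitRow i = mk λ _ j → δ i j

      unitRow-⊗ : ∀ (i : Fin n) (c : Mat n 1) → unitRow i ⊗ c ≡ scalar (ent c i zero)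
      unitRow-⊗ i c = ext λ { zero zero → trans (ent-⊗ (unitRow i) c zero zero) (trans
        (sum-single i (λ j ne → trans (cong (_* ent c j zero) (trans (ent-mk (λ (_ : Fin 1) j → δ i j) zero j) (δ-≢ (ne ∘ sym)))) (zeroˡ (ent c j zero))))
        (trans (cong (_* ent c i zero) (trans (ent-mk (λ (_ : Fin 1) j → δ i j) zero i) (δ-refl i))) (*-identityˡ (ent c i zero)))) }

      card-first-column-pivot : ∀ {k} {a} (c : Mat n 1) → a ≢ 0# → Card {Mat n n} Inv k →
        Card {Mat 1 n × Mat n n} (λ p → Inv (blk (scalar a) (proj₁ p) c (proj₂ p))) (q ℕ.^ n ℕ.* k)
      card-first-column-pivot {n} {a = a} c na cg = card-bij (card-× card-row cg)
        (λ (r , S) → r , S ⊞ c ⊗ a⁻¹ ⊗ r) (λ (r , M) → r , M ⊞ c ⊗ a⁻¹ ⊗ r)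
        (λ (r , S) (_ , i) → schur⇐ (scalar-inverse na) r c _ (subst Inv (sym (undo S (c ⊗ a⁻¹ ⊗ r))) i))
        (λ (r , M) i → tt , schur⇒ (scalar-inverse na) r c M i)
        (λ (r , S) _ → cong (r ,_) (undo S _)) (λ (r , M) _ → cong (r ,_) (undo M _))
        where
        a⁻¹ = scalar (a ⁻¹)
        undo : ∀ (S X : Mat n n) → S ⊞ X ⊞ X ≡ S
        undo S X = trans (⊞-assoc S X X) (trans (cong (S ⊞_) (⊞-self X)) (⊞-identityʳ S))

      -- The number of completions is the same for every nonzero first column. If the corner is 0,
      -- some entry of `c` is not, and adding its row to the first row moves it into the corner;
      -- this row operation is a bijection on completions.
      card-first-column : ∀ {k} (α : Mat 1 1) (c : Mat n 1) → ¬ (α ≡ 𝟘 × c ≡ 𝟘) → Card {Mat n n} Inv k →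
        Card {Mat 1 n × Mat n n} (λ p → Inv (blk α (proj₁ p) c (proj₂ p))) (q ℕ.^ n ℕ.* k)
      card-first-column {n} {k} ((a ∷ []) ∷ []) c ne cg with a ≟ 0#
      ... | no na = card-first-column-pivot c na cg
      ... | yes refl = card-bij (card-first-column-pivot c (proj₂ piv) cg)
        (λ (r , M) → r ⊞ e ⊗ M , M) (λ (r , M) → r ⊞ e ⊗ M , M)
        (λ (r , M) i → rowAdd⇐ e (scalar 0#) (r ⊞ e ⊗ M) c M (subst Inv (blk-cong (sym pivot) (sym (undo r (e ⊗ M))) refl refl) i))
        (λ (r , M) i → subst Inv (blk-cong pivot refl refl refl) (rowAdd⇒ e (scalar 0#) r c M i))
        (λ (r , M) _ → cong (_, M) (undo r _)) (λ (r , M) _ → cong (_, M) (undo r _))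
        where
        piv : ∃ λ i → ent c i zero ≢ 0#
        piv = nonzero-entry (λ e → ne (scalar-0 , e))
        e = unitRow (proj₁ piv)
        pivot : scalar 0# ⊞ e ⊗ c ≡ scalar (ent c (proj₁ piv) zero)
        pivot = trans (trans (cong (_⊞ e ⊗ c) scalar-0) (⊞-identityˡ _)) (unitRow-⊗ (proj₁ piv) c)
        undo : ∀ (S X : Mat 1 n) → S ⊞ X ⊞ X ≡ S
        undo S X = trans (⊞-assoc S X X) (trans (cong (S ⊞_) (⊞-self X)) (⊞-identityʳ S))

      card-columns : Card {Mat 1 1 × Mat n 1} (λ p → ¬ (proj₁ p ≡ 𝟘 × proj₂ p ≡ 𝟘)) (q ℕ.^ suc n ℕ.∸ 1)
      card-columns {n} = card-subst (cong (ℕ._∸ 1) (proj₂ (proj₂ rest))) (card-iff (proj₁ (proj₂ rest)) (λ _ → proj₂) (λ _ n → tt , n))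
        where
        Zero : Mat 1 1 × Mat n 1 → Set
        Zero p = proj₁ p ≡ 𝟘 × proj₂ p ≡ 𝟘
        all : Card {Mat 1 1 × Mat n 1} (λ _ → ⊤) (q ℕ.^ suc n)
        all = card-iff (card-× card-1×1 (card-col {n})) (λ _ _ → tt) (λ _ _ → tt , tt)
        zero-only : Card {Mat 1 1 × Mat n 1} (λ p → ⊤ × Zero p) 1
        zero-only = card-one (𝟘 , 𝟘) (tt , refl , refl) (λ { _ (_ , refl , refl) → refl })
        rest : ∃ λ j → Card {Mat 1 1 × Mat n 1} (λ p → ⊤ × ¬ Zero p) j × 1 ℕ.+ j ≡ q ℕ.^ suc n
        rest = card-minus all (λ p → (proj₁ p ≟ᴹ 𝟘) ×-dec (proj₂ p ≟ᴹ 𝟘)) zero-only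

      inv⇒first-column : ∀ {α : Mat 1 1} {r} {c} {M : Mat n n} → Inv (blk α r c M) → ¬ (α ≡ 𝟘 × c ≡ 𝟘)
      inv⇒first-column {n} {r = r} {M = M} (E , e) (refl , refl) = 0≢1 (trans (trans (sym (ent-𝟘 {1} {1} zero zero)) (cong (λ X → ent X zero zero) eq)) (ent-𝟙 {1} zero zero))
        where
        E₁₁ = B₁₁ {1} {n} {1} {n} E
        E₁₂ = B₁₂ {1} {n} {1} {n} E
        eq : 𝟘 ≡ 𝟙 1
        eq = trans (sym (trans (cong₂ _⊞_ (⊗𝟘 E₁₁) (⊗𝟘 E₁₂)) (⊞-identityˡ 𝟘)))
          (blk-inj₁₁ (trans (sym (blk-⊗ E₁₁ E₁₂ _ _ 𝟘 r 𝟘 M)) (trans (cong (_⊗ blk 𝟘 r 𝟘 M) (sym (blk-η E))) (trans (⊗-left-inverse e) (𝟙-blk 1 n)))))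

      blk-B : ∀ (X : Mat (m ℕ.+ k) (m ℕ.+ k)) → blk (B₁₁ {m} {k} {m} {k} X) (B₁₂ {m} {k} {m} {k} X) (B₂₁ {m} {k} {m} {k} X) (B₂₂ {m} {k} {m} {k} X) ≡ X
      blk-B {m} {k} X = sym (blk-η {m} {k} {m} {k} X)

      module _ (A : Mat m m) (B : Mat m k) (C : Mat k m) (D : Mat k k) where
        private e = blk-B {m} {k} (blk A B C D)

        B₁₁-blk : B₁₁ {m} {k} {m} {k} (blk A B C D) ≡ A
        B₁₁-blk = blk-inj₁₁ e
        B₁₂-blk : B₁₂ {m} {k} {m} {k} (blk A B C D) ≡ B
        B₁₂-blk = blk-inj₁₂ e
        B₂₁-blk : B₂₁ {m} {k} {m} {k} (blk A B C D) ≡ C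
        B₂₁-blk = blk-inj₂₁ e
        B₂₂-blk : B₂₂ {m} {k} {m} {k} (blk A B C D) ≡ D
        B₂₂-blk = blk-inj₂₂ e

      card-GL : ∀ n → Card {Mat n n} Inv (gl q n)
      card-GL zero = card-one [] ([] , ext λ ()) (λ { [] _ → refl })
      card-GL (suc n) = card-bij (card-Σ (card-columns {n}) (λ p ne → card-first-column (proj₁ p) (proj₂ p) ne (card-GL n)))
        (λ ((α , c) , r , M) → blk α r c M)
        (λ X → (B₁₁ {1} {n} {1} {n} X , B₂₁ {1} {n} {1} {n} X) , B₁₂ {1} {n} {1} {n} X , B₂₂ {1} {n} {1} {n} X)
        (λ _ → proj₂)
        (λ X i → let i′ = subst Inv (blk-η {1} {n} {1} {n} X) i in inv⇒first-column i′ , i′)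
        (λ ((α , c) , r , M) _ → cong₂ _,_ (cong₂ _,_ (B₁₁-blk α r c M) (B₂₁-blk α r c M)) (cong₂ _,_ (B₁₂-blk α r c M) (B₂₂-blk α r c M)))
        (λ X _ → blk-B {1} {n} X)

      module _ {A : Mat m m} {B : Mat m k} {C : Mat k m} {D : Mat k k} where
        symm-blk⇒ : Symm (blk A B C D) → Symm A × C ᵀ ≡ B × B ᵀ ≡ C × Symm D
        symm-blk⇒ s = blk-inj₁₁ e , blk-inj₁₂ e , blk-inj₂₁ e , blk-inj₂₂ e
          where e = trans (sym (blk-ᵀ A B C D)) s

        symm-blk⇐ : Symm A → C ᵀ ≡ B → B ᵀ ≡ C → Symm D → Symm (blk A B C D)
        symm-blk⇐ a b c d = trans (blk-ᵀ A B C D) (blk-cong a b c d)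

        alt-blk⇒ : Alt (blk A B C D) → Alt A × C ᵀ ≡ B × Alt D
        alt-blk⇒ (s , z) = (proj₁ t , λ i → trans (sym (ent-blk₁₁ A B C D i i)) (z _)) , proj₁ (proj₂ t)
          , (proj₂ (proj₂ (proj₂ t)) , λ i → trans (sym (ent-blk₂₂ A B C D i i)) (z _))
          where t = symm-blk⇒ s

        alt-blk⇐ : Alt A → C ᵀ ≡ B → Alt D → Alt (blk A B C D)
        alt-blk⇐ (s , z) e (s′ , z′) = symm-blk⇐ s e (trans (cong _ᵀ (sym e)) (ᵀᵀ C)) s′ ,
          fin-split m _ (λ i → trans (ent-blk₁₁ A B C D i i) (z i)) (λ i → trans (ent-blk₂₂ A B C D i i) (z′ i))

      symm-scalar : ∀ (α : Mat 1 1) → Symm α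
      symm-scalar α = ext λ { zero zero → ent-ᵀ α zero zero }

      card-Alt-blk : ∀ m k {x y} → Card {Mat m m} Alt x → Card {Mat k k} Alt y → Card {Mat (m ℕ.+ k) (m ℕ.+ k)} Alt (x ℕ.* ((q ℕ.^ m) ℕ.^ k ℕ.* y))
      card-Alt-blk m k ca cb = card-bij (card-× ca (card-× (card-Mat k m) cb))
        (λ (A , C , D) → blk A (C ᵀ) C D) (λ X → B₁₁ {m} {k} {m} {k} X , B₂₁ {m} {k} {m} {k} X , B₂₂ {m} {k} {m} {k} X)
        (λ (A , C , D) (a , _ , d) → alt-blk⇐ a refl d)
        (λ X x → let (a , _ , d) = alt-blk⇒ (subst Alt (blk-η {m} {k} {m} {k} X) x) in a , tt , d)
        (λ (A , C , D) _ → cong₂ _,_ (B₁₁-blk A (C ᵀ) C D) (cong₂ _,_ (B₂₁-blk A (C ᵀ) C D) (B₂₂-blk A (C ᵀ) C D)))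
        (λ X x → trans (blk-cong refl (proj₁ (proj₂ (alt-blk⇒ (subst Alt (blk-η {m} {k} {m} {k} X) x)))) refl refl) (blk-B {m} {k} X))

      card-Alt : ∀ n → Card {Mat n n} Alt (al q n)
      card-Alt zero = card-one [] (ext (λ ()) , λ ()) (λ { [] _ → refl })
      card-Alt (suc n) = card-subst (trans (ℕP.*-identityˡ _) (cong (λ z → z ℕ.^ n ℕ.* al q n) (ℕP.*-identityʳ q)))
        (card-Alt-blk 1 n (card-one (scalar 0#) (symm-scalar _ , λ { zero → refl }) (λ { ((x ∷ []) ∷ []) (_ , z) → cong scalar (z zero) })) (card-Alt n))

      al-+ : ∀ m k → al q (m ℕ.+ k) ≡ al q m ℕ.* ((q ℕ.^ m) ℕ.^ k ℕ.* al q k)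
      al-+ m k = card-unique (card-Alt (m ℕ.+ k)) (card-Alt-blk m k (card-Alt m) (card-Alt k))

      SymmInv : Mat n n → Set
      SymmInv S = Symm S × Inv S

      symm-⊞ : {A B : Mat n n} → Symm A → Symm B → Symm (A ⊞ B)
      symm-⊞ {A = A} {B} s t = trans (ᵀ-⊞ A B) (cong₂ _⊞_ s t)

      symm-congruence : {B : Mat m m} → Symm B → ∀ (X : Mat k m) → Symm (X ⊗ B ⊗ X ᵀ)
      symm-congruence {B = B} s X = trans (ᵀ-⊗ (X ⊗ B) (X ᵀ)) (trans (cong₂ _⊗_ (ᵀᵀ X) (trans (ᵀ-⊗ X B) (cong (_⊗ X ᵀ) s))) (sym (⊗-assoc X B (X ᵀ))))

      -- The first unit vector, typed with `1 ℕ.+ 0` columns so that it is a block matrix with empty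
      -- right blocks and the block product applies.
      e₁ : Mat (1 ℕ.+ n) (1 ℕ.+ 0)
      e₁ {n} = blk (𝟙 1) 𝟘 𝟘 𝟘

      e₁e₁ᵀ : e₁ {n} ⊗ e₁ ᵀ ≡ blk (𝟙 1) 𝟘 𝟘 𝟘
      e₁e₁ᵀ {n} = trans (cong (e₁ {n} ⊗_) (trans (blk-ᵀ (𝟙 1) 𝟘 𝟘 𝟘) (blk-cong (𝟙ᵀ {1}) (𝟘ᵀ {n} {1}) (𝟘ᵀ {1} {0}) (𝟘ᵀ {n} {0}))))
        (trans (blk-⊗ (𝟙 1) 𝟘 𝟘 𝟘 (𝟙 1) 𝟘 𝟘 𝟘) (blk-cong
          (trans (cong₂ _⊞_ (⊗-identityˡ (𝟙 1)) (𝟘⊗ {0} {1} {1} 𝟘)) (⊞-identityʳ (𝟙 1)))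
          (trans (cong₂ _⊞_ (⊗𝟘 (𝟙 1)) (𝟘⊗ {0} {n} {1} 𝟘)) (⊞-identityʳ 𝟘))
          (trans (cong₂ _⊞_ (𝟘⊗ {1} {1} {n} (𝟙 1)) (𝟘⊗ {0} {1} {n} 𝟘)) (⊞-identityʳ 𝟘))
          (trans (cong₂ _⊞_ (𝟘⊗ {1} {n} {n} 𝟘) (𝟘⊗ {0} {n} {n} 𝟘)) (⊞-identityʳ 𝟘))))

      e₁ᵀe₁ : e₁ {n} ᵀ ⊗ e₁ ≡ 𝟙 1
      e₁ᵀe₁ {n} = trans (cong (_⊗ e₁ {n}) (trans (blk-ᵀ (𝟙 1) 𝟘 𝟘 𝟘) (blk-cong (𝟙ᵀ {1}) (𝟘ᵀ {n} {1}) (𝟘ᵀ {1} {0}) (𝟘ᵀ {n} {0}))))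
        (trans (blk-⊗ (𝟙 1) (𝟘 {1} {n}) (𝟘 {0} {1}) (𝟘 {0} {n}) (𝟙 1) (𝟘 {1} {0}) (𝟘 {n} {1}) (𝟘 {n} {0})) (trans (blk-cong
          (trans (cong₂ _⊞_ (⊗-identityˡ (𝟙 1)) (𝟘⊗ {n} {1} {1} 𝟘)) (⊞-identityʳ (𝟙 1)))
          (ext λ _ ()) (ext λ ()) (ext λ ())) (sym (𝟙-blk 1 0))))

      private
        -- The matrix with corner 0 and border e₁ has no pivot, so its second row is added to the
        -- first, which produces the pivot 1. The resulting Schur complement replaces the first row
        -- of M by a unit row, so invertibility depends on S alone while β and w stay free.
        reduced : ∀ {β : Mat 1 1} {w : Mat n 1} {S : Mat n n} → let M = blk β (w ᵀ) w S in
                  M ⊞ e₁ ⊗ 𝟙 1 ⊗ (e₁ ᵀ ⊞ e₁ ᵀ ⊗ M) ≡ blk (𝟙 1) 𝟘 w S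
        reduced {n} {β} {w} {S} = begin
          M ⊞ e₁ ⊗ 𝟙 1 ⊗ (e₁ ᵀ ⊞ e₁ ᵀ ⊗ M) ≡⟨ cong (λ X → M ⊞ X ⊗ (e₁ ᵀ ⊞ e₁ ᵀ ⊗ M)) (⊗-identityʳ (e₁ {n})) ⟩
          M ⊞ e₁ ⊗ (e₁ ᵀ ⊞ e₁ ᵀ ⊗ M)
            ≡⟨ cong (M ⊞_) (trans (⊗-distribˡ (e₁ {n}) (e₁ ᵀ) (e₁ ᵀ ⊗ M)) (cong₂ _⊞_ e₁e₁ᵀ (trans (sym (⊗-assoc (e₁ {n}) (e₁ ᵀ) M)) (cong (_⊗ M) e₁e₁ᵀ)))) ⟩
          M ⊞ (J ⊞ J ⊗ M)
            ≡⟨ cong (λ X → M ⊞ (J ⊞ X)) (trans (blk-⊗ (𝟙 1) 𝟘 𝟘 𝟘 β (w ᵀ) w S) (blk-cong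
                 (trans (cong₂ _⊞_ (⊗-identityˡ β) (𝟘⊗ w)) (⊞-identityʳ β)) (trans (cong₂ _⊞_ (⊗-identityˡ (w ᵀ)) (𝟘⊗ S)) (⊞-identityʳ (w ᵀ)))
                 (trans (cong₂ _⊞_ (𝟘⊗ β) (𝟘⊗ w)) (⊞-identityʳ 𝟘)) (trans (cong₂ _⊞_ (𝟘⊗ (w ᵀ)) (𝟘⊗ S)) (⊞-identityʳ 𝟘)))) ⟩
          M ⊞ (J ⊞ blk β (w ᵀ) 𝟘 𝟘) ≡⟨ cong (M ⊞_) (blk-⊞ (𝟙 1) 𝟘 𝟘 𝟘 β (w ᵀ) 𝟘 𝟘) ⟩
          M ⊞ blk (𝟙 1 ⊞ β) (𝟘 ⊞ w ᵀ) (𝟘 ⊞ 𝟘) (𝟘 ⊞ 𝟘) ≡⟨ blk-⊞ β (w ᵀ) w S (𝟙 1 ⊞ β) (𝟘 ⊞ w ᵀ) (𝟘 ⊞ 𝟘) (𝟘 ⊞ 𝟘) ⟩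
          blk (β ⊞ (𝟙 1 ⊞ β)) (w ᵀ ⊞ (𝟘 ⊞ w ᵀ)) (w ⊞ (𝟘 ⊞ 𝟘)) (S ⊞ (𝟘 ⊞ 𝟘))
            ≡⟨ blk-cong (trans (cong (β ⊞_) (⊞-comm (𝟙 1) β)) (trans (sym (⊞-assoc β β (𝟙 1))) (trans (cong (_⊞ 𝟙 1) (⊞-self β)) (⊞-identityˡ (𝟙 1)))))
                 (trans (cong (w ᵀ ⊞_) (⊞-identityˡ (w ᵀ))) (⊞-self (w ᵀ)))
                 (trans (cong (w ⊞_) (⊞-identityˡ 𝟘)) (⊞-identityʳ w)) (trans (cong (S ⊞_) (⊞-identityˡ 𝟘)) (⊞-identityʳ S)) ⟩
          blk (𝟙 1) 𝟘 w S ∎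
          where
          open ≡-Reasoning
          M = blk β (w ᵀ) w S
          J = blk (𝟙 1) 𝟘 𝟘 𝟘

        module _ (M : Mat (1 ℕ.+ n) (1 ℕ.+ n)) where
          private
            pivot : 𝟘 ⊞ e₁ {n} ᵀ ⊗ e₁ ≡ 𝟙 1
            pivot = trans (⊞-identityˡ _) e₁ᵀe₁
          hyperbolic⇒ : Inv (blk 𝟘 (e₁ ᵀ) e₁ M) → Inv (M ⊞ e₁ ⊗ 𝟙 1 ⊗ (e₁ ᵀ ⊞ e₁ ᵀ ⊗ M))
          hyperbolic⇒ i = schur⇒ (⊗-identityˡ (𝟙 1)) _ e₁ M (subst Inv (blk-cong pivot refl refl refl) (rowAdd⇒ (e₁ ᵀ) 𝟘 (e₁ ᵀ) e₁ M i))
          hyperbolic⇐ : Inv (M ⊞ e₁ ⊗ 𝟙 1 ⊗ (e₁ ᵀ ⊞ e₁ ᵀ ⊗ M)) → Inv (blk 𝟘 (e₁ ᵀ) e₁ M)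
          hyperbolic⇐ i = rowAdd⇐ (e₁ ᵀ) 𝟘 (e₁ ᵀ) e₁ M (subst Inv (blk-cong (sym pivot) refl refl refl) (schur⇐ (⊗-identityˡ (𝟙 1)) _ e₁ M i))

      card-symm-hyperbolic : ∀ {x} → Card {Mat n n} SymmInv x →
        Card {Mat (1 ℕ.+ n) (1 ℕ.+ n)} (λ M → Symm M × Inv (blk 𝟘 (e₁ ᵀ) e₁ M)) (q ℕ.^ suc n ℕ.* x)
      card-symm-hyperbolic {n} {x} cs = card-subst (sym (ℕP.*-assoc q (q ℕ.^ n) x))
        (card-bij (card-× card-1×1 (card-× (card-col {n}) cs))
          (λ (β , w , S) → blk β (w ᵀ) w S) (λ X → B₁₁ {1} {n} {1} {n} X , B₂₁ {1} {n} {1} {n} X , B₂₂ {1} {n} {1} {n} X)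
          (λ (β , w , S) (_ , _ , s , i) → symm-blk⇐ (symm-scalar β) refl (ᵀᵀ w) s ,
              hyperbolic⇐ _ (subst Inv (sym reduced) (inv-lower⇐ {A = 𝟙 1} {w} {S} inv-𝟙 i)))
          (λ X (s , i) → tt , tt , proj₂ (proj₂ (proj₂ (symm-blk⇒ (subst Symm (blk-η {1} {n} {1} {n} X) s)))) ,
              proj₂ (inv-lower⇒ {A = 𝟙 1} (subst Inv reduced (hyperbolic⇒ _ (subst (λ M → Inv (blk 𝟘 (e₁ ᵀ) e₁ M)) (sym (fix X s)) i)))))
          (λ (β , w , S) _ → cong₂ _,_ (B₁₁-blk β (w ᵀ) w S) (cong₂ _,_ (B₂₁-blk β (w ᵀ) w S) (B₂₂-blk β (w ᵀ) w S)))
          (λ X (s , _) → fix X s))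
        where
        fix : ∀ X → Symm X → blk (B₁₁ {1} {n} {1} {n} X) (B₂₁ {1} {n} {1} {n} X ᵀ) (B₂₁ {1} {n} {1} {n} X) (B₂₂ {1} {n} {1} {n} X) ≡ X
        fix X s = trans (blk-cong refl (proj₁ (proj₂ (symm-blk⇒ (subst Symm (blk-η {1} {n} {1} {n} X) s)))) refl refl) (blk-B {1} {n} X)

      column-completion : ∀ (c : Mat (1 ℕ.+ n) 1) → c ≢ 𝟘 → ∃ λ T → Inv T × T ⊗ e₁ ≡ c
      column-completion {n} c ne = blk α ρ c′ M , proj₂ completion , (begin
          blk α ρ c′ M ⊗ e₁ ≡⟨ blk-⊗ α ρ c′ M (𝟙 1) 𝟘 𝟘 𝟘 ⟩
          blk (α ⊗ 𝟙 1 ⊞ ρ ⊗ 𝟘) (α ⊗ 𝟘 ⊞ ρ ⊗ 𝟘) (c′ ⊗ 𝟙 1 ⊞ M ⊗ 𝟘) (c′ ⊗ 𝟘 ⊞ M ⊗ 𝟘)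
            ≡⟨ blk-cong (trans (cong₂ _⊞_ (⊗-identityʳ α) (⊗𝟘 ρ)) (⊞-identityʳ α)) (ext λ _ ()) (trans (cong₂ _⊞_ (⊗-identityʳ c′) (⊗𝟘 M)) (⊞-identityʳ c′)) (ext λ _ ()) ⟩
          blk α (B₁₂ {1} {n} {1} {0} c) c′ (B₂₂ {1} {n} {1} {0} c) ≡⟨ blk-η {1} {n} {1} {0} c ⟨
          c ∎)
        where
        open ≡-Reasoning
        α = B₁₁ {1} {n} {1} {0} c
        c′ = B₂₁ {1} {n} {1} {0} c
        𝟘-blk : blk (𝟘 {1} {1}) (B₁₂ {1} {n} {1} {0} c) (𝟘 {n} {1}) (B₂₂ {1} {n} {1} {0} c) ≡ 𝟘
        𝟘-blk = sym (blk-ext 𝟘 _ 𝟘 _ (λ i j → trans (ent-𝟘 {1 ℕ.+ n} {1} (i ↑ˡ n) (j ↑ˡ 0)) (sym (ent-𝟘 i j))) (λ _ ())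
          (λ i j → trans (ent-𝟘 {1 ℕ.+ n} {1} (1 ↑ʳ i) (j ↑ˡ 0)) (sym (ent-𝟘 i j))) (λ _ ()))
        completion = card-inhabited (ℕP.*-mono-≤ {1} {_} {1} (ℕP.m^n>0 q {{ℕ.>-nonZero (ℕP.≤-trans (s≤s z≤n) 2≤q)}} n) (gl>0 n))
          (card-first-column α c′ (λ (a , b) → ne (trans (blk-η {1} {n} {1} {0} c) (trans (blk-cong a refl b refl) 𝟘-blk))) (card-GL n))
        ρ = proj₁ (proj₁ completion)
        M = proj₂ (proj₁ completion)

      -- Congruence by a matrix T with first column c moves c to e₁.
      card-symm-congruent : ∀ {x} (c : Mat (1 ℕ.+ n) 1) → (∃ λ T → Inv T × T ⊗ e₁ ≡ c) → Card {Mat n n} SymmInv x →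
        Card {Mat (1 ℕ.+ n) (1 ℕ.+ n)} (λ M → Symm M × Inv (blk 𝟘 (c ᵀ) c M)) (q ℕ.^ suc n ℕ.* x)
      card-symm-congruent {n} c (T , (T′ , t) , Te₁) cs = card-bij (card-symm-hyperbolic cs)
          (λ M → T ⊗ M ⊗ T ᵀ) (λ M → T′ ⊗ M ⊗ T′ ᵀ)
          (λ M (s , i) → symm-congruence s T , subst Inv (conj M) (inv-⊗ (inv-⊗ inv-D i) (inv-ᵀ inv-D)))
          (λ M (s , i) → symm-congruence s T′ ,
              inv-factorʳ inv-D (inv-factorˡ (inv-ᵀ inv-D) (subst Inv (sym (trans (conj (T′ ⊗ M ⊗ T′ ᵀ)) (cong (blk 𝟘 (c ᵀ) c) (cancel t M)))) i)))
          (λ M _ → cancel (⊗-left-inverse t) M) (λ M _ → cancel t M)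
        where
        open ≡-Reasoning
        D = blk (𝟙 1) 𝟘 𝟘 T
        inv-D : Inv D
        inv-D = inv-lower⇐ {A = 𝟙 1} {𝟘} {T} inv-𝟙 (T′ , t)
        cancel : ∀ {T T′ : Mat (1 ℕ.+ n) (1 ℕ.+ n)} → T ⊗ T′ ≡ 𝟙 (1 ℕ.+ n) → ∀ M → T ⊗ (T′ ⊗ M ⊗ T′ ᵀ) ⊗ T ᵀ ≡ M
        cancel {T} {T′} t M = begin
          T ⊗ (T′ ⊗ M ⊗ T′ ᵀ) ⊗ T ᵀ     ≡⟨ cong (_⊗ T ᵀ) (trans (sym (⊗-assoc T (T′ ⊗ M) (T′ ᵀ))) (cong (_⊗ T′ ᵀ) (trans (sym (⊗-assoc T T′ M)) (trans (cong (_⊗ M) t) (⊗-identityˡ M))))) ⟩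
          M ⊗ T′ ᵀ ⊗ T ᵀ                ≡⟨ ⊗-assoc M (T′ ᵀ) (T ᵀ) ⟩
          M ⊗ (T′ ᵀ ⊗ T ᵀ)              ≡⟨ cong (M ⊗_) (trans (sym (ᵀ-⊗ T T′)) (trans (cong _ᵀ t) 𝟙ᵀ)) ⟩
          M ⊗ 𝟙 (1 ℕ.+ n)               ≡⟨ ⊗-identityʳ M ⟩
          M                             ∎
        conj : ∀ M → D ⊗ blk 𝟘 (e₁ ᵀ) e₁ M ⊗ D ᵀ ≡ blk 𝟘 (c ᵀ) c (T ⊗ M ⊗ T ᵀ)
        conj M = begin
          D ⊗ blk 𝟘 (e₁ ᵀ) e₁ M ⊗ D ᵀ
            ≡⟨ cong₂ _⊗_ (trans (blk-⊗ (𝟙 1) 𝟘 𝟘 T 𝟘 (e₁ ᵀ) e₁ M) (blk-cong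
                 (trans (cong₂ _⊞_ (⊗-identityˡ 𝟘) (𝟘⊗ e₁)) (⊞-identityˡ 𝟘)) (trans (cong₂ _⊞_ (⊗-identityˡ (e₁ ᵀ)) (𝟘⊗ M)) (⊞-identityʳ (e₁ ᵀ)))
                 (trans (cong₂ _⊞_ (𝟘⊗ {1} {1} {1 ℕ.+ n} 𝟘) Te₁) (⊞-identityˡ c)) (trans (cong (_⊞ T ⊗ M) (𝟘⊗ (e₁ ᵀ))) (⊞-identityˡ (T ⊗ M)))))
                 (trans (blk-ᵀ (𝟙 1) 𝟘 𝟘 T) (blk-cong (𝟙ᵀ {1}) (𝟘ᵀ {1 ℕ.+ n} {1}) (𝟘ᵀ {1} {1 ℕ.+ n}) refl)) ⟩
          blk 𝟘 (e₁ ᵀ) c (T ⊗ M) ⊗ blk (𝟙 1) 𝟘 𝟘 (T ᵀ)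
            ≡⟨ trans (blk-⊗ 𝟘 (e₁ ᵀ) c (T ⊗ M) (𝟙 1) 𝟘 𝟘 (T ᵀ)) (blk-cong
                 (trans (cong₂ _⊞_ (⊗-identityʳ 𝟘) (⊗𝟘 (e₁ ᵀ))) (⊞-identityˡ 𝟘))
                 (trans (cong₂ _⊞_ (𝟘⊗ {1} {1 ℕ.+ n} {1} 𝟘) (trans (sym (ᵀ-⊗ T e₁)) (cong _ᵀ Te₁))) (⊞-identityˡ (c ᵀ)))
                 (trans (cong₂ _⊞_ (⊗-identityʳ c) (⊗𝟘 (T ⊗ M))) (⊞-identityʳ c)) (trans (cong (_⊞ T ⊗ M ⊗ T ᵀ) (⊗𝟘 c)) (⊞-identityˡ (T ⊗ M ⊗ T ᵀ)))) ⟩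
          blk 𝟘 (c ᵀ) c (T ⊗ M ⊗ T ᵀ) ∎

      card-symm-isotropic : ∀ {x} (c : Mat (1 ℕ.+ n) 1) → c ≢ 𝟘 → Card {Mat n n} SymmInv x →
        Card {Mat (1 ℕ.+ n) (1 ℕ.+ n)} (λ M → Symm M × Inv (blk 𝟘 (c ᵀ) c M)) (q ℕ.^ suc n ℕ.* x)
      card-symm-isotropic c ne = card-symm-congruent c (column-completion c ne)

      private
        Shape : ℕ → Set
        Shape n = Mat 1 1 × Mat n 1 × Mat n n

        assemble : Shape n → Mat (1 ℕ.+ n) (1 ℕ.+ n)
        assemble (α , c , M) = blk α (c ᵀ) c M

        card-assembled : ∀ {x} → Card {Shape n} (λ p → Symm (proj₂ (proj₂ p)) × Inv (assemble p)) x → Card {Mat (1 ℕ.+ n) (1 ℕ.+ n)} SymmInv x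
        card-assembled {n} cp = card-bij cp assemble (λ X → B₁₁ {1} {n} {1} {n} X , B₂₁ {1} {n} {1} {n} X , B₂₂ {1} {n} {1} {n} X)
          (λ (α , c , M) (s , i) → symm-blk⇐ (symm-scalar α) refl (ᵀᵀ c) s , i)
          (λ X (s , i) → proj₂ (proj₂ (proj₂ (symm-blk⇒ (subst Symm (blk-η {1} {n} {1} {n} X) s)))) , subst Inv (sym (fix X s)) i)
          (λ (α , c , M) _ → cong₂ _,_ (B₁₁-blk α (c ᵀ) c M) (cong₂ _,_ (B₂₁-blk α (c ᵀ) c M) (B₂₂-blk α (c ᵀ) c M)))
          (λ X (s , _) → fix X s)
          where
          fix : ∀ X → Symm X → assemble (B₁₁ {1} {n} {1} {n} X , B₂₁ {1} {n} {1} {n} X , B₂₂ {1} {n} {1} {n} X) ≡ X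
          fix X s = trans (blk-cong refl (proj₁ (proj₂ (symm-blk⇒ (subst Symm (blk-η {1} {n} {1} {n} X) s)))) refl refl) (blk-B {1} {n} X)

        card-anisotropic : ∀ {x} → Card {Mat n n} SymmInv x →
          Card {Shape n} (λ p → proj₁ p ≢ 𝟘 × Symm (proj₂ (proj₂ p)) × Inv (assemble p)) ((q ℕ.∸ 1) ℕ.* (q ℕ.^ n ℕ.* x))
        card-anisotropic {n} cs = card-bij (card-× (card-nonzero card-1×1) (card-× card-col cs))
          shift shift
          (λ (α , c , S) (ne , _ , s , i) → ne , symm-⊞ s (symm-congruence (symm-scalar (inv α)) c) ,
              schur⇐ (α-inv α ne) (c ᵀ) c _ (subst Inv (sym (undo S (c ⊗ inv α ⊗ c ᵀ))) i))
          (λ (α , c , M) (ne , s , i) → ne , tt , symm-⊞ s (symm-congruence (symm-scalar (inv α)) c) , schur⇒ (α-inv α ne) (c ᵀ) c M i)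
          (λ (α , c , S) _ → cong (λ X → α , c , X) (undo S _)) (λ (α , c , S) _ → cong (λ X → α , c , X) (undo S _))
          where
          inv : Mat 1 1 → Mat 1 1
          inv α = scalar (ent α zero zero ⁻¹)
          α-inv : ∀ α → α ≢ 𝟘 → α ⊗ inv α ≡ 𝟙 1
          α-inv ((a ∷ []) ∷ []) ne = scalar-inverse (λ e → ne (trans (cong scalar e) scalar-0))
          shift : Shape n → Shape n
          shift (α , c , S) = α , c , S ⊞ c ⊗ inv α ⊗ c ᵀ
          undo : ∀ (S X : Mat n n) → S ⊞ X ⊞ X ≡ S
          undo S X = trans (⊞-assoc S X X) (trans (cong (S ⊞_) (⊞-self X)) (⊞-identityʳ S))

        card-isotropic : ∀ {x} → Card {Mat n n} SymmInv x →
          Card {Shape (suc n)} (λ p → proj₁ p ≡ 𝟘 × Symm (proj₂ (proj₂ p)) × Inv (assemble p)) ((q ℕ.^ suc n ℕ.∸ 1) ℕ.* (q ℕ.^ suc n ℕ.* x))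
        card-isotropic {n} cs = card-bij (card-Σ (card-nonzero card-col) (λ c ne → card-symm-isotropic c ne cs))
          (λ (c , M) → 𝟘 , c , M) proj₂ (λ (c , M) (_ , s , i) → refl , s , i)
          (λ { (α , c , M) (refl , s , i) → (λ e → inv⇒first-column i (refl , e)) , s , i })
          (λ _ _ → refl) (λ { (α , c , M) (refl , _) → refl })

      mutual
        -- Split by the corner α. For α ≠ 0 the Schur complement is symmetric of size one less, with
        -- the column free. For α = 0 the column must be nonzero; a congruence moves it to e₁ and a
        -- symmetric block of size two less remains. These are the two summands in the recursion of
        -- `sy`.
        card-Sy : ∀ n → Card {Mat n n} SymmInv (sy q n)
        card-Sy zero = card-one [] (ext (λ ()) , [] , ext λ ()) (λ { [] _ → refl })
        card-Sy (suc zero) = card-assembled (card-iff (card-anisotropic (card-Sy 0)) (λ _ → proj₂)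
          (λ (α , c , M) (s , i) → (λ e → inv⇒first-column i (e , ext λ ())) , s , i))
        card-Sy (suc (suc n)) = card-assembled (card-⊎ (card-anisotropic (card-Sy (suc n))) (card-isotropic (card-Sy n))
          (λ p (ne , _) (e , _) → ne e) (λ _ → proj₂) (λ _ → proj₂) cov)
          where
          cov : ∀ p → Symm (proj₂ (proj₂ p)) × Inv (assemble p) →
            (proj₁ p ≢ 𝟘 × Symm (proj₂ (proj₂ p)) × Inv (assemble p)) ⊎ (proj₁ p ≡ 𝟘 × Symm (proj₂ (proj₂ p)) × Inv (assemble p))
          cov p h with proj₁ p ≟ᴹ 𝟘
          ... | yes e = inj₂ (e , h)
          ... | no ne = inj₁ (ne , h)

  -- Matrices D of size one and two with Tr D + Tr D⁻¹ prescribed.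

  module TraceCounts where

    import Defs
    open Defs using (FiniteField)
    open Counting
    open CharTwo
    open FieldBasics
    open TraceMap
    open Kloosterman
    open KloostermanSum
    open Matrices
    open GroupOrders
    open import Data.Nat as ℕ using (ℕ; zero; suc)
    import Data.Nat.Properties as ℕP
    open import Data.Fin using (zero; suc)
    open import Data.Bool using (true; false)
    open import Data.Vec using ([]; _∷_)
    open import Data.Product using (∃; _×_; _,_; proj₁; proj₂)
    open import Data.Sum using (_⊎_; inj₁; inj₂)
    open import Data.Unit using (⊤; tt)
    open import Relation.Nullary using (¬_; Dec; yes; no)
    open import Relation.Binary.PropositionalEquality
    open import Function using (_∘_)

    module Kappa where
      open Field-F
      open Trace-F
      open Kloo-F
      open KSum-F
      open Mats hiding (δ)
      open Orders using (scalar; scalar-inverse)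
      open ≡-Reasoning

      InvTrace : ∀ {m} → Carrier → Mat m m → Set
      InvTrace {m} β A = ∃ λ A′ → A ⊗ A′ ≡ 𝟙 m × Tr A + Tr A′ ≡ β

      card-nz : Card {Carrier} (_≢ 0#) (q ℕ.∸ 1)
      card-nz = card-subst (cong (ℕ._∸ 1) (proj₂ (proj₂ card-≢0))) (proj₁ (proj₂ card-≢0))

      inverse-unique-F : ∀ {x y} → x * y ≡ 1# → x ⁻¹ ≡ y
      inverse-unique-F {x} {y} e = *-cancelˡ n (trans (⁻¹-inverse x n) (sym e))
        where
        n : x ≢ 0#
        n z = 0≢1 (trans (sym (zeroˡ y)) (trans (cong (_* y) (sym z)) e))

      reciprocal-quadratic⇒ : ∀ {a β} → a ≢ 0# → a + a ⁻¹ ≡ β → sq a + β * a + 1# ≡ 0#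
      reciprocal-quadratic⇒ {a} {β} n refl = begin
        sq a + (a + a ⁻¹) * a + 1# ≡⟨ solve 2 (λ a i → a :* a :+ (a :+ i) :* a :+ con true := a :* i :+ con true) refl a (a ⁻¹) ⟩
        a * a ⁻¹ + 1#              ≡⟨ ≈⇒+≈0 (⁻¹-inverse a n) ⟩
        0#                         ∎

      reciprocal-quadratic⇐ : ∀ {a β} → sq a + β * a + 1# ≡ 0# → a ≢ 0# × a + a ⁻¹ ≡ β
      reciprocal-quadratic⇐ {a} {β} e = n , trans (cong (a +_) i≡) (solve 2 (λ a β → a :+ (a :+ β) := β) refl a β)
        where
        n : a ≢ 0#
        n refl = 1≢0 (trans (solve 1 (λ β → con true := con false :* con false :+ β :* con false :+ con true) refl β) e)
        i≡ : a ⁻¹ ≡ a + β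
        i≡ = inverse-unique-F (+≈0⇒≈ (trans (solve 2 (λ a β → a :* (a :+ β) :+ con true := a :* a :+ β :* a :+ con true) refl a β) e))

      Tr-scalar : ∀ a → Tr (scalar a) ≡ a
      Tr-scalar a = trans (Tr-sum (scalar a)) (+-identityʳ a)

      card-κ₁ : ∀ {β k} → Card (λ a → sq a + β * a + 1# ≡ 0#) k → Card {Mat 1 1} (InvTrace β) k
      card-κ₁ {β} c = card-bij c scalar (λ A → ent A zero zero)
        (λ a e → let (n , t) = reciprocal-quadratic⇐ e in
          scalar (a ⁻¹) , scalar-inverse n , trans (cong₂ _+_ (Tr-scalar a) (Tr-scalar (a ⁻¹))) t)
        back (λ _ _ → refl) (λ { ((a ∷ []) ∷ []) _ → refl })
        where
        back : ∀ A → InvTrace β A → sq (ent A zero zero) + β * ent A zero zero + 1# ≡ 0#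
        back ((a ∷ []) ∷ []) (((b ∷ []) ∷ []) , e , t) = reciprocal-quadratic⇒ n (trans (cong (a +_) i≡) (trans (sym (cong₂ _+_ (Tr-scalar a) (Tr-scalar b))) t))
          where
          ab : a * b ≡ 1#
          ab = trans (sym (+-identityʳ _)) (trans (sym (ent-⊗ (scalar a) (scalar b) zero zero)) (trans (cong (λ X → ent X zero zero) e) (ent-𝟙 {1} zero zero)))
          i≡ : a ⁻¹ ≡ b
          i≡ = inverse-unique-F ab
          n : a ≢ 0#
          n refl = 0≢1 (trans (sym (zeroˡ b)) ab)

      -- The solvability of a² + β a + 1 = 0 is governed by the trace of 1/β², which squaring
      -- invariance turns into the trace of 1/β.
      tr-quadratic : ∀ β → tr (1# * sq (β ⁻¹)) ≡ tr (β ⁻¹)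
      tr-quadratic β = trans (cong tr (*-identityˡ (sq (β ⁻¹)))) (tr-sq (β ⁻¹))

      card-κ₁-0 : Card {Mat 1 1} (InvTrace 0#) 1
      card-κ₁-0 = card-κ₁ (card-one 1# (trans (solve 0 (con true :* con true :+ con false :* con true :+ con true := con false) refl) refl)
        (λ a e → sq-injective (+≈0⇒≈ (trans (solve 1 (λ a → a :* a :+ con true :* con true := a :* a :+ con false :* a :+ con true) refl a) e))))

      card-κ₁-split : ∀ {β} → β ≢ 0# → tr (β ⁻¹) ≡ 0# → Card {Mat 1 1} (InvTrace β) 2
      card-κ₁-split {β} n t = card-κ₁ (card-quadratic n (trans (tr-quadratic β) t))

      card-κ₁-nonsplit : ∀ {β} → β ≢ 0# → tr (β ⁻¹) ≡ 1# → Card {Mat 1 1} (InvTrace β) 0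
      card-κ₁-nonsplit {β} n t = card-κ₁ (card-zero λ a e → 0≢1 (trans (sym (quadratic-tr n e)) (trans (tr-quadratic β) t)))

      Quad : Set
      Quad = Carrier × Carrier × Carrier × Carrier

      det : Quad → Carrier
      det (a , b , c , d) = a * d + b * c

      tr₂ : Quad → Carrier
      tr₂ (a , b , c , d) = a + d

      private
        mat : Quad → Mat 2 2
        mat (a , b , c , d) = (a ∷ b ∷ []) ∷ (c ∷ d ∷ []) ∷ []

        unmat : Mat 2 2 → Quad
        unmat ((a ∷ b ∷ []) ∷ (c ∷ d ∷ []) ∷ []) = a , b , c , d

        adj : Quad → Quad
        adj X@(a , b , c , d) = i * d , i * b , i * c , i * a where i = det X ⁻¹

        mat-⊗ : ∀ a b c d a′ b′ c′ d′ → mat (a , b , c , d) ⊗ mat (a′ , b′ , c′ , d′)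
              ≡ mat (a * a′ + (b * c′ + 0#) , a * b′ + (b * d′ + 0#) , c * a′ + (d * c′ + 0#) , c * b′ + (d * d′ + 0#))
        mat-⊗ a b c d a′ b′ c′ d′ = ext λ
          { zero zero → e zero zero ; zero (suc zero) → e zero (suc zero)
          ; (suc zero) zero → e (suc zero) zero ; (suc zero) (suc zero) → e (suc zero) (suc zero) }
          where e = ent-⊗ (mat (a , b , c , d)) (mat (a′ , b′ , c′ , d′))

        mat-𝟙 : mat (1# , 0# , 0# , 1#) ≡ 𝟙 2
        mat-𝟙 = ext λ { zero zero → e zero zero ; zero (suc zero) → e zero (suc zero)
                      ; (suc zero) zero → e (suc zero) zero ; (suc zero) (suc zero) → e (suc zero) (suc zero) }
          where e = λ i j → sym (ent-𝟙 {2} i j)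

        quad-cong : ∀ {a b c d a′ b′ c′ d′} → a ≡ a′ → b ≡ b′ → c ≡ c′ → d ≡ d′ → mat (a , b , c , d) ≡ mat (a′ , b′ , c′ , d′)
        quad-cong refl refl refl refl = refl

        adj-inverse : ∀ X → det X ≢ 0# → mat X ⊗ mat (adj X) ≡ 𝟙 2
        adj-inverse X@(a , b , c , d) n = trans (mat-⊗ a b c d (i * d) (i * b) (i * c) (i * a)) (trans (quad-cong
            (trans (solve 5 (λ a b c d i → a :* (i :* d) :+ (b :* (i :* c) :+ con false) := (a :* d :+ b :* c) :* i) refl a b c d i) D)
            (solve 3 (λ a b i → a :* (i :* b) :+ (b :* (i :* a) :+ con false) := con false) refl a b i)
            (solve 3 (λ c d i → c :* (i :* d) :+ (d :* (i :* c) :+ con false) := con false) refl c d i)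
            (trans (solve 5 (λ a b c d i → c :* (i :* b) :+ (d :* (i :* a) :+ con false) := (a :* d :+ b :* c) :* i) refl a b c d i) D)) mat-𝟙)
          where
          i = det X ⁻¹
          D = ⁻¹-inverse (det X) n

        inverse⇒det : ∀ X Y → mat X ⊗ mat Y ≡ 𝟙 2 → det X ≢ 0#
        inverse⇒det X@(a , b , c , d) Y@(a′ , b′ , c′ , d′) e z = 0≢1 (begin
            0#                ≡⟨ trans (cong (_* det Y) z) (zeroˡ (det Y)) ⟨
            det X * det Y     ≡⟨ solve 8 (λ a b c d a′ b′ c′ d′ → (a :* d :+ b :* c) :* (a′ :* d′ :+ b′ :* c′)
                 := (a :* a′ :+ (b :* c′ :+ con false)) :* (c :* b′ :+ (d :* d′ :+ con false)) :+ (a :* b′ :+ (b :* d′ :+ con false)) :* (c :* a′ :+ (d :* c′ :+ con false)))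
                 refl a b c d a′ b′ c′ d′ ⟩
            det (unmat (mat (a * a′ + (b * c′ + 0#) , a * b′ + (b * d′ + 0#) , c * a′ + (d * c′ + 0#) , c * b′ + (d * d′ + 0#))))
              ≡⟨ cong (det ∘ unmat) (trans (sym (mat-⊗ a b c d a′ b′ c′ d′)) (trans e (sym mat-𝟙))) ⟩
            1# * 1# + 0# * 0# ≡⟨ solve 0 (con true :* con true :+ con false :* con false := con true) refl ⟩
            1#                ∎)

        Tr-mat : ∀ X → Tr (mat X) ≡ tr₂ X
        Tr-mat X@(a , b , c , d) = trans (Tr-sum (mat X)) (cong (a +_) (+-identityʳ d))

        Tr-adj : ∀ X → Tr (mat (adj X)) ≡ det X ⁻¹ * tr₂ X
        Tr-adj X@(a , b , c , d) = trans (Tr-mat (adj X)) (solve 3 (λ i a d → i :* d :+ i :* a := i :* (a :+ d)) refl (det X ⁻¹) a d)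

      -- A 2 × 2 matrix of trace T and determinant δ has an inverse of trace T/δ, so the condition
      -- on a matrix becomes one on the pair (T , δ): (1 + δ⁻¹) T = β.
      Good : Carrier → Quad → Set
      Good β X = det X ≢ 0# × tr₂ X + det X ⁻¹ * tr₂ X ≡ β

      card-κ₂ : ∀ {β k} → Card (Good β) k → Card {Mat 2 2} (InvTrace β) k
      card-κ₂ {β} c = card-bij c mat unmat
        (λ X (n , t) → mat (adj X) , adj-inverse X n , trans (cong₂ _+_ (Tr-mat X) (Tr-adj X)) t)
        back (λ _ _ → refl) (λ A _ → mat-unmat A)
        where
        mat-unmat : ∀ A → mat (unmat A) ≡ A
        mat-unmat ((a ∷ b ∷ []) ∷ (c ∷ d ∷ []) ∷ []) = refl
        back : ∀ A → InvTrace β A → Good β (unmat A)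
        back A (A′ , e , t) = n , trans (sym (cong₂ _+_ (Tr-mat X) (Tr-adj X))) (trans (cong₂ (λ P Q → Tr P + Tr Q) (mat-unmat A) adj≡) t)
          where
          X = unmat A
          n = inverse⇒det X (unmat A′) (trans (cong₂ _⊗_ (mat-unmat A) (mat-unmat A′)) e)
          adj≡ : mat (adj X) ≡ A′
          adj≡ = inverse-unique (trans (cong (_⊗ mat (adj X)) (sym (mat-unmat A))) (adj-inverse X n)) e

      -- The order of SL(2), counted by whether the corner a vanishes: if not, d is determined by
      -- the rest; if so, c = b⁻¹ and d is free.
      card-det-1 : Card (λ X → det X ≡ 1#) ((q ℕ.∸ 1) ℕ.* (q ℕ.* q) ℕ.+ (q ℕ.∸ 1) ℕ.* q)
      card-det-1 = card-⊎
        (card-bij {Q = λ (a , b , c , d) → a ≢ 0# × det (a , b , c , d) ≡ 1#} (card-× card-nz (card-× card-F card-F))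
          (λ (a , b , c) → a , b , c , a ⁻¹ * (1# + b * c)) (λ (a , b , c , d) → a , b , c)
          (λ (a , b , c) (n , _) → n , (begin
            a * (a ⁻¹ * (1# + b * c)) + b * c ≡⟨ solve 3 (λ a i x → a :* (i :* (con true :+ x)) :+ x := a :* i :* (con true :+ x) :+ x) refl a (a ⁻¹) (b * c) ⟩
            a * a ⁻¹ * (1# + b * c) + b * c ≡⟨ cong (λ w → w * (1# + b * c) + b * c) (⁻¹-inverse a n) ⟩
            1# * (1# + b * c) + b * c ≡⟨ solve 1 (λ x → con true :* (con true :+ x) :+ x := con true) refl (b * c) ⟩
            1# ∎))
          (λ (a , b , c , d) (n , _) → n , tt , tt) (λ _ _ → refl)
          (λ (a , b , c , d) (n , e) → cong (λ w → a , b , c , w) (*-cancelˡ n (begin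
            a * (a ⁻¹ * (1# + b * c)) ≡⟨ trans (sym (*-assoc a (a ⁻¹) _)) (trans (cong (_* (1# + b * c)) (⁻¹-inverse a n)) (*-identityˡ _)) ⟩
            1# + b * c ≡⟨ cong (_+ b * c) e ⟨
            a * d + b * c + b * c ≡⟨ solve 2 (λ x y → x :+ y :+ y := x) refl (a * d) (b * c) ⟩
            a * d ∎))))
        (card-bij {Q = λ (a , b , c , d) → a ≡ 0# × det (a , b , c , d) ≡ 1#} (card-× card-nz card-F)
          (λ (b , d) → 0# , b , b ⁻¹ , d) (λ (a , b , c , d) → b , d)
          (λ (b , d) (n , _) → refl , trans (cong₂ _+_ (zeroˡ d) (⁻¹-inverse b n)) (+-identityˡ 1#))
          (λ { (_ , b , c , d) (refl , e) → (λ { refl → 0≢1 (trans (solve 2 (λ c d → con false := con false :* d :+ con false :* c) refl c d) e) }) , tt })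
          (λ _ _ → refl)
          (λ { (_ , b , c , d) (refl , e) → cong (λ w → 0# , b , w , d) (inverse-unique-F (trans (solve 3 (λ b c d → b :* c := con false :* d :+ b :* c) refl b c d) e)) }))
        (λ _ (n , _) (z , _) → n z) (λ _ → proj₂) (λ _ → proj₂) cov
        where
        cov : ∀ X → det X ≡ 1# → (proj₁ X ≢ 0# × det X ≡ 1#) ⊎ (proj₁ X ≡ 0# × det X ≡ 1#)
        cov X e with proj₁ X ≟ 0#
        ... | yes z = inj₂ (z , e)
        ... | no n = inj₁ (n , e)

      card-avoid₂ : ∀ {x y} → x ≢ y → Card {Carrier} (λ a → a ≢ x × a ≢ y) (q ℕ.∸ 2)
      card-avoid₂ {x} {y} ne = card-subst (cong (ℕ._∸ 2) (proj₂ (proj₂ rest)))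
          (card-iff (proj₁ (proj₂ rest)) (λ a (_ , h) → h ∘ inj₁ , h ∘ inj₂) (λ a (n , m) → tt , λ { (inj₁ e) → n e ; (inj₂ e) → m e }))
        where
        dec : ∀ a → Dec (a ≡ x ⊎ a ≡ y)
        dec a with a ≟ x | a ≟ y
        ... | yes e | _ = yes (inj₁ e)
        ... | no _ | yes e = yes (inj₂ e)
        ... | no n | no m = no λ { (inj₁ e) → n e ; (inj₂ e) → m e }
        rest : ∃ λ m → Card (λ a → ⊤ × ¬ (a ≡ x ⊎ a ≡ y)) m × 2 ℕ.+ m ≡ q
        rest = card-minus card-F dec (card-two x y ne (tt , inj₁ refl) (tt , inj₂ refl) (λ c → proj₂))

      -- In characteristic 2 trace 0 means a = d and the determinant is a² + b c. Each of the
      -- excluded determinants 0 and 1 rules out one value of a, a unique square root.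
      card-trace-0 : Card (λ X → tr₂ X ≡ 0# × det X ≢ 0# × det X ≢ 1#) (q ℕ.* (q ℕ.* (q ℕ.∸ 2)))
      card-trace-0 = card-bij (card-Σ card-F (λ b _ → card-Σ card-F (λ c _ →
          card-avoid₂ {√ (b * c)} {√ (1# + b * c)} (λ e → 1≢0 (begin
            1# ≡⟨ solve 1 (λ x → con true := x :+ (con true :+ x)) refl (b * c) ⟩
            b * c + (1# + b * c) ≡⟨ ≈⇒+≈0 (trans (sym (sq-√ (b * c))) (trans (cong sq e) (sq-√ (1# + b * c)))) ⟩
            0# ∎)))))
        (λ (b , c , a) → a , b , c , a) (λ (a , b , c , d) → b , c , a)
        (λ (b , c , a) (_ , _ , n , m) → x+x≈0 a , (λ e → n (sq-injective (trans (+≈0⇒≈ e) (sym (sq-√ (b * c))))))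
            , λ e → m (sq-injective (trans (+≈0⇒≈ (begin
                a * a + (1# + b * c) ≡⟨ solve 2 (λ a x → a :* a :+ (con true :+ x) := (a :* a :+ x) :+ con true) refl a (b * c) ⟩
                a * a + b * c + 1# ≡⟨ ≈⇒+≈0 e ⟩
                0# ∎)) (sym (sq-√ (1# + b * c))))))
        back
        (λ _ _ → refl) (λ (a , b , c , d) (t , _) → cong (λ w → a , b , c , w) (+≈0⇒≈ t))
        where
        back : ∀ X → tr₂ X ≡ 0# × det X ≢ 0# × det X ≢ 1# → let (a , b , c , d) = X in ⊤ × ⊤ × a ≢ √ (b * c) × a ≢ √ (1# + b * c)
        back (a , b , c , d) (t , n , m) = equal (+≈0⇒≈ t) n m
          where
          equal : ∀ {d} → a ≡ d → a * d + b * c ≢ 0# → a * d + b * c ≢ 1# → ⊤ × ⊤ × a ≢ √ (b * c) × a ≢ √ (1# + b * c)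
          equal refl n m = tt , tt , (λ e → n (trans (cong (_+ b * c) (trans (cong sq e) (sq-√ (b * c)))) (x+x≈0 (b * c))))
              , λ e → m (trans (cong (_+ b * c) (trans (cong sq e) (sq-√ (1# + b * c)))) (solve 1 (λ x → con true :+ x :+ x := con true) refl (b * c)))

      -- For β = 0 the equation (1 + δ⁻¹) T = 0 splits into δ = 1 with any trace and T = 0 with δ
      -- different from 0 and 1.
      card-κ₂-0 : Card {Mat 2 2} (InvTrace 0#) (((q ℕ.∸ 1) ℕ.* (q ℕ.* q) ℕ.+ (q ℕ.∸ 1) ℕ.* q) ℕ.+ q ℕ.* (q ℕ.* (q ℕ.∸ 2)))
      card-κ₂-0 = card-κ₂ (card-⊎ card-det-1 card-trace-0 (λ X e (_ , _ , n) → n e)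
        (λ X e → (λ z → 0≢1 (trans (sym z) e)) , (begin
          tr₂ X + det X ⁻¹ * tr₂ X ≡⟨ cong (λ w → tr₂ X + w * tr₂ X) (inverse-unique-F (trans (*-identityʳ (det X)) e)) ⟩
          tr₂ X + 1# * tr₂ X ≡⟨ solve 1 (λ t → t :+ con true :* t := con false) refl (tr₂ X) ⟩
          0# ∎))
        (λ X (t , n , _) → n , trans (cong (λ w → w + det X ⁻¹ * w) t) (trans (+-identityˡ _) (zeroʳ _)))
        cov)
        where
        cov : ∀ X → Good 0# X → det X ≡ 1# ⊎ (tr₂ X ≡ 0# × det X ≢ 0# × det X ≢ 1#)
        cov X (n , t) with det X ≟ 1#
        ... | yes e = inj₁ e
        ... | no m = inj₂ (x*y≡0 (trans (solve 2 (λ i t → (con true :+ i) :* t := t :+ i :* t) refl (det X ⁻¹) (tr₂ X)) t) nz , n , m)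
          where
          nz : 1# + det X ⁻¹ ≢ 0#
          nz z = m (begin
            det X                 ≡⟨ *-identityʳ (det X) ⟨
            det X * 1#            ≡⟨ cong (det X *_) (+≈0⇒≈ z) ⟩
            det X * det X ⁻¹      ≡⟨ ⁻¹-inverse (det X) n ⟩
            1#                    ∎)

      card-product-0 : Card {Carrier × Carrier} (λ (b , c) → b * c ≡ 0#) (q ℕ.+ (q ℕ.∸ 1))
      card-product-0 = card-⊎
        (card-bij {Q = λ (b , c) → b ≡ 0#} card-F (0# ,_) proj₂ (λ _ _ → refl) (λ _ _ → tt) (λ _ _ → refl) (λ { _ refl → refl }))
        (card-bij {Q = λ (b , c) → b ≢ 0# × c ≡ 0#} card-nz (_, 0#) proj₁ (λ _ n → n , refl) (λ _ → proj₁) (λ _ _ → refl) (λ { _ (_ , refl) → refl }))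
        (λ _ z (n , _) → n z) (λ { (_ , c) refl → zeroˡ c }) (λ { (b , _) (_ , refl) → zeroʳ b }) cov
        where
        cov : ∀ p → proj₁ p * proj₂ p ≡ 0# → proj₁ p ≡ 0# ⊎ (proj₁ p ≢ 0# × proj₂ p ≡ 0#)
        cov (b , c) e with b ≟ 0#
        ... | yes z = inj₁ z
        ... | no n = inj₂ (n , x*y≡0 e n)

      card-product-≢0 : ∀ {f} → f ≢ 0# → Card {Carrier × Carrier} (λ (b , c) → b * c ≡ f) (q ℕ.∸ 1)
      card-product-≢0 {f} nf = card-bij card-nz (λ b → b , b ⁻¹ * f) proj₁
        (λ b n → trans (sym (*-assoc b (b ⁻¹) f)) (trans (cong (_* f) (⁻¹-inverse b n)) (*-identityˡ f)))
        (λ { (b , c) e refl → nf (trans (sym e) (zeroˡ c)) }) (λ _ _ → refl)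
        (λ { (b , c) refl → cong (b ,_) (trans (sym (*-assoc (b ⁻¹) b c)) (trans (cong (_* c) (trans (*-comm (b ⁻¹) b)
           (⁻¹-inverse b (λ { refl → nf (zeroˡ c) })))) (*-identityˡ c))) })

      private
        charpoly : Carrier → Carrier → Carrier → Carrier
        charpoly T δ a = sq a + T * a + δ

        -- With d = a + T, determinant δ means that b c is the value of the characteristic
        -- polynomial at a. A root leaves 2 q - 1 pairs (b , c), any other a leaves q - 1.
        card-charpoly : ∀ {T δ k l} → Card (λ a → charpoly T δ a ≡ 0#) k → Card (λ a → charpoly T δ a ≢ 0#) l →
          Card (λ X → tr₂ X ≡ T × det X ≡ δ) (k ℕ.* (q ℕ.+ (q ℕ.∸ 1)) ℕ.+ l ℕ.* (q ℕ.∸ 1))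
        card-charpoly {T} {δ} ck cl = card-bij (card-⊎ {R = λ (a , b , c) → b * c ≡ charpoly T δ a}
            (card-Σ ck (λ a e → card-iff card-product-0 (λ _ h → trans h (sym e)) (λ _ h → trans h e)))
            (card-Σ cl (λ a n → card-product-≢0 n))
            (λ _ (z , _) (n , _) → n z) (λ _ → proj₂) (λ _ → proj₂) cov)
          (λ (a , b , c) → a , b , c , a + T) (λ (a , b , c , d) → a , b , c)
          (λ (a , b , c) e → solve 2 (λ a T → a :+ (a :+ T) := T) refl a T , (begin
            a * (a + T) + b * c ≡⟨ cong (a * (a + T) +_) e ⟩
            a * (a + T) + (sq a + T * a + δ) ≡⟨ solve 3 (λ a T δ → a :* (a :+ T) :+ (a :* a :+ T :* a :+ δ) := δ) refl a T δ ⟩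
            δ ∎))
          (λ { (a , b , c , d) (refl , refl) → solve 4 (λ a b c d → b :* c := a :* a :+ (a :+ d) :* a :+ (a :* d :+ b :* c)) refl a b c d })
          (λ _ _ → refl)
          (λ { (a , b , c , d) (refl , _) → cong (λ w → a , b , c , w) (solve 2 (λ a d → a :+ (a :+ d) := d) refl a d) })
          where
          cov : ∀ p → let (a , b , c) = p in b * c ≡ charpoly T δ a →
                (charpoly T δ a ≡ 0# × b * c ≡ charpoly T δ a) ⊎ (charpoly T δ a ≢ 0# × b * c ≡ charpoly T δ a)
          cov (a , b , c) e with charpoly T δ a ≟ 0#
          ... | yes z = inj₁ (z , e)
          ... | no n = inj₂ (n , e)

      -- These equal q² + q and q² - q, the numbers of 2 × 2 matrices whose given characteristic
      -- polynomial has two distinct roots or none.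
      splitCount nonsplitCount : ℕ
      splitCount = 2 ℕ.* (q ℕ.+ (q ℕ.∸ 1)) ℕ.+ (q ℕ.∸ 2) ℕ.* (q ℕ.∸ 1)
      nonsplitCount = q ℕ.* (q ℕ.∸ 1)

      card-split-charpoly : ∀ {T δ} → T ≢ 0# → tr (δ * sq (T ⁻¹)) ≡ 0# → Card (λ X → tr₂ X ≡ T × det X ≡ δ) splitCount
      card-split-charpoly {T} {δ} n t = card-charpoly roots (card-subst (cong (ℕ._∸ 2) (proj₂ (proj₂ rest))) (card-iff (proj₁ (proj₂ rest)) (λ _ → proj₂) (λ _ h → tt , h)))
        where
        roots = card-quadratic n t
        rest = card-minus card-F (λ a → charpoly T δ a ≟ 0#) (card-iff roots (λ _ h → tt , h) (λ _ → proj₂))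

      card-nonsplit-charpoly : ∀ {T δ} → T ≢ 0# → tr (δ * sq (T ⁻¹)) ≡ 1# → Card (λ X → tr₂ X ≡ T × det X ≡ δ) nonsplitCount
      card-nonsplit-charpoly {T} {δ} n t = card-charpoly (card-zero no-root) (card-iff card-F (λ a _ → no-root a) (λ _ _ → tt))
        where
        no-root : ∀ a → charpoly T δ a ≢ 0#
        no-root a e = 0≢1 (trans (sym (quadratic-tr n e)) t)

      module _ {β : Carrier} (β≢0 : β ≢ 0#) where
        private
          i = β ⁻¹
          i≢0 : i ≢ 0#
          i≢0 = ⁻¹-≢0 β≢0
          βi : β * i ≡ 1#
          βi = ⁻¹-inverse β β≢0

        Det : Carrier → Carrier → Set
        Det e δ = δ ≢ 0# × tr ((δ + δ ⁻¹) * sq i) ≡ e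

        -- δ = α⁴β² turns (δ + δ⁻¹)/β² into (α + β⁻¹/α)⁴.
        card-Det : ∀ {e k} → Card (Fibre i e) k → Card (Det e) k
        card-Det {e} c = card-bij c (λ α → sq (sq α) * sq β) (λ δ → √ (√ (δ * sq i)))
            (λ α (n , t) → *-≢0 (*-≢0 (*-≢0 n n) (*-≢0 n n)) (*-≢0 β≢0 β≢0) , trans (tr-eq n) t)
            (λ δ (n , t) → α≢0 n , trans (sym (tr-eq (α≢0 n))) (trans (cong (λ δ → tr ((δ + δ ⁻¹) * sq i)) (δ-α δ)) t))
            (λ α _ → trans (cong (√ ∘ √) (trans (*-assoc _ _ _) (trans (cong (sq (sq α) *_) β²i²) (*-identityʳ _)))) (trans (cong √ (√-sq (sq α))) (√-sq α)))
            (λ δ _ → δ-α δ)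
          where
          β²i² : sq β * sq i ≡ 1#
          β²i² = trans (sym (sq-* β i)) (trans (cong sq βi) (*-identityˡ 1#))
          δ-α : ∀ δ → sq (sq (√ (√ (δ * sq i)))) * sq β ≡ δ
          δ-α δ = trans (cong (_* sq β) (trans (cong sq (sq-√ (√ (δ * sq i)))) (sq-√ (δ * sq i)))) (trans (*-assoc _ _ _)
            (trans (cong (δ *_) (trans (*-comm _ _) β²i²)) (*-identityʳ δ)))
          α≢0 : ∀ {δ} → δ ≢ 0# → √ (√ (δ * sq i)) ≢ 0#
          α≢0 n = √≢0 (√≢0 (*-≢0 n (*-≢0 i≢0 i≢0)))
          tr-eq : ∀ {α} → α ≢ 0# → let δ = sq (sq α) * sq β in tr ((δ + δ ⁻¹) * sq i) ≡ tr (α + i * α ⁻¹)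
          tr-eq {α} n = begin
            tr ((δ + δ ⁻¹) * sq i)             ≡⟨ cong tr (cong (λ w → (δ + w) * sq i) δ⁻¹) ⟩
            tr ((δ + sq (sq j) * sq i) * sq i) ≡⟨ cong tr (solve 4 (λ a b i j → (a :* a :* (a :* a) :* (b :* b) :+ j :* j :* (j :* j) :* (i :* i)) :* (i :* i)
                 := (a :* a :* (a :* a)) :* ((b :* i) :* (b :* i)) :+ (i :* j) :* (i :* j) :* ((i :* j) :* (i :* j))) refl α β i j) ⟩
            tr (sq (sq α) * sq (β * i) + sq (sq (i * j))) ≡⟨ cong (λ w → tr (sq (sq α) * sq w + sq (sq (i * j)))) βi ⟩
            tr (sq (sq α) * sq 1# + sq (sq (i * j))) ≡⟨ cong tr (solve 2 (λ a b → (a :* a) :* (a :* a) :* (con true :* con true) :+ (b :* b) :* (b :* b) := (a :+ b) :* (a :+ b) :* ((a :+ b) :* (a :+ b))) refl α (i * j)) ⟩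
            tr (sq (sq (α + i * j))) ≡⟨ trans (tr-sq (sq (α + i * j))) (tr-sq (α + i * j)) ⟩
            tr (α + i * j) ∎
            where
            j = α ⁻¹
            δ = sq (sq α) * sq β
            δ⁻¹ : δ ⁻¹ ≡ sq (sq j) * sq i
            δ⁻¹ = inverse-unique-F (begin
              sq (sq α) * sq β * (sq (sq j) * sq i) ≡⟨ solve 4 (λ a b j i → a :* a :* (a :* a) :* (b :* b) :* (j :* j :* (j :* j) :* (i :* i))
                  := (a :* j) :* (a :* j) :* ((a :* j) :* (a :* j)) :* ((b :* i) :* (b :* i))) refl α β j i ⟩
              sq (sq (α * j)) * sq (β * i) ≡⟨ cong₂ (λ x y → sq (sq x) * sq y) (⁻¹-inverse α n) βi ⟩
              sq (sq 1#) * sq 1# ≡⟨ solve 0 (con true :* con true :* (con true :* con true) :* (con true :* con true) := con true) refl ⟩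
              1# ∎)

        private
          1⁻¹ : 1# ⁻¹ ≡ 1#
          1⁻¹ = inverse-unique-F (*-identityˡ 1#)

          Det-1 : Det 0# 1#
          Det-1 = 1≢0 , trans (cong tr (trans (cong (λ w → (1# + w) * sq i) 1⁻¹) (trans (cong (_* sq i) (x+x≈0 1#)) (zeroˡ (sq i))))) tr-0

          T-of : Carrier → Carrier
          T-of δ = β * (1# + δ ⁻¹) ⁻¹

          pivot : ∀ {δ} → δ ≢ 0# → δ ≢ 1# → 1# + δ ⁻¹ ≢ 0#
          pivot {δ} n m z = m (trans (sym (*-identityʳ δ)) (trans (cong (δ *_) (+≈0⇒≈ z)) (⁻¹-inverse δ n)))

          T≢0 : ∀ {δ} → δ ≢ 0# → δ ≢ 1# → T-of δ ≢ 0#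
          T≢0 n m = *-≢0 β≢0 (⁻¹-≢0 (pivot n m))

          -- Whether z² + T z + δ splits depends on δ / T². For the forced trace T = β / (1 + δ⁻¹)
          -- this is δ (1 + δ⁻¹)² / β² = (δ + δ⁻¹) / β².
          T-tr : ∀ {δ} → δ ≢ 0# → δ ≢ 1# → tr (δ * sq (T-of δ ⁻¹)) ≡ tr ((δ + δ ⁻¹) * sq i)
          T-tr {δ} n m = cong tr (begin
            δ * sq (T-of δ ⁻¹)      ≡⟨ cong (λ w → δ * sq w) (inverse-unique-F (begin
                β * p ⁻¹ * (i * p)    ≡⟨ solve 4 (λ b p i j → b :* j :* (i :* p) := (b :* i) :* (p :* j)) refl β p i (p ⁻¹) ⟩
                (β * i) * (p * p ⁻¹)  ≡⟨ cong₂ _*_ βi (⁻¹-inverse p (pivot n m)) ⟩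
                1# * 1#               ≡⟨ *-identityˡ 1# ⟩
                1#                    ∎)) ⟩
            δ * sq (i * (1# + δ ⁻¹))  ≡⟨ solve 3 (λ d i j → d :* ((i :* (con true :+ j)) :* (i :* (con true :+ j))) := (d :+ (d :* j) :* j) :* (i :* i)) refl δ i (δ ⁻¹) ⟩
            (δ + δ * δ ⁻¹ * δ ⁻¹) * sq i ≡⟨ cong (λ w → (δ + w * δ ⁻¹) * sq i) (⁻¹-inverse δ n) ⟩
            (δ + 1# * δ ⁻¹) * sq i    ≡⟨ cong (λ w → (δ + w) * sq i) (*-identityˡ (δ ⁻¹)) ⟩
            (δ + δ ⁻¹) * sq i         ∎)
            where p = 1# + δ ⁻¹

          good⇒ : ∀ {X} → Good β X → det X ≢ 1# × tr₂ X ≡ T-of (det X)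
          good⇒ {X} (n , t) = m , *-cancelˡ (pivot n m) (begin
              p * tr₂ X          ≡⟨ p*t ⟩
              β                  ≡⟨ trans (cong (β *_) (⁻¹-inverse p (pivot n m))) (*-identityʳ β) ⟨
              β * (p * p ⁻¹)     ≡⟨ solve 3 (λ b p j → b :* (p :* j) := p :* (b :* j)) refl β p (p ⁻¹) ⟩
              p * (β * p ⁻¹)     ∎)
            where
            p = 1# + det X ⁻¹
            p*t : p * tr₂ X ≡ β
            p*t = trans (solve 2 (λ t j → (con true :+ j) :* t := t :+ j :* t) refl (tr₂ X) (det X ⁻¹)) t
            m : det X ≢ 1#
            m e = β≢0 (trans (sym p*t) (trans (cong (_* tr₂ X) (trans (cong (λ w → 1# + w ⁻¹) e) (trans (cong (1# +_) 1⁻¹) (x+x≈0 1#)))) (zeroˡ (tr₂ X))))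

          good⇐ : ∀ {X} → det X ≢ 0# → det X ≢ 1# → tr₂ X ≡ T-of (det X) → Good β X
          good⇐ {X} n m t = n , (begin
              tr₂ X + j * tr₂ X     ≡⟨ solve 2 (λ t j → t :+ j :* t := (con true :+ j) :* t) refl (tr₂ X) j ⟩
              p * tr₂ X             ≡⟨ cong (p *_) t ⟩
              p * (β * p ⁻¹)        ≡⟨ solve 3 (λ b p j → p :* (b :* j) := b :* (p :* j)) refl β p (p ⁻¹) ⟩
              β * (p * p ⁻¹)        ≡⟨ trans (cong (β *_) (⁻¹-inverse p (pivot n m))) (*-identityʳ β) ⟩
              β                     ∎)
            where
            j = det X ⁻¹
            p = 1# + j

          fibred : ∀ {e k N} → Card (λ δ → Det e δ × δ ≢ 1#) k →
            (∀ δ → Det e δ × δ ≢ 1# → Card (λ X → tr₂ X ≡ T-of δ × det X ≡ δ) N) →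
            Card (λ X → Good β X × tr ((det X + det X ⁻¹) * sq i) ≡ e) (k ℕ.* N)
          fibred {e} c f = card-bij (card-Σ c f) proj₂ (λ X → det X , X)
            (λ { (δ , X) (((n , t) , m) , t₂ , refl) → good⇐ {X} n m t₂ , t })
            (λ X (g , t) → ((proj₁ g , t) , proj₁ (good⇒ {X} g)) , proj₂ (good⇒ {X} g) , refl)
            (λ { (δ , X) (_ , _ , refl) → refl }) (λ _ _ → refl)

        -- The determinant δ = 1 belongs to the class of trace 0 but would force β = 0. It is
        -- removed from that class, which is why the fibre over 0 is given with `suc k₀` elements.
        card-κ₂-≢0 : ∀ {k₀ k₁} → Card (Fibre i 0#) (suc k₀) → Card (Fibre i 1#) k₁ →
          Card {Mat 2 2} (InvTrace β) (k₀ ℕ.* splitCount ℕ.+ k₁ ℕ.* nonsplitCount)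
        card-κ₂-≢0 {k₀} {k₁} c₀ c₁ = card-κ₂ (card-⊎
            (fibred Δ₀ (λ δ ((n , t) , m) → card-split-charpoly (T≢0 n m) (trans (T-tr n m) t)))
            (fibred Δ₁ (λ δ ((n , t) , m) → card-nonsplit-charpoly (T≢0 n m) (trans (T-tr n m) t)))
            (λ X (_ , z) (_ , o) → 0≢1 (trans (sym z) o)) (λ X → proj₁) (λ X → proj₁) cov)
          where
          without-1 : ∃ λ m → Card (λ δ → Det 0# δ × ¬ δ ≡ 1#) m × 1 ℕ.+ m ≡ suc k₀
          without-1 = card-minus (card-Det c₀) (_≟ 1#) (card-one {P = λ δ → Det 0# δ × δ ≡ 1#} 1# (Det-1 , refl) (λ _ → proj₂))
          Δ₀ : Card (λ δ → Det 0# δ × δ ≢ 1#) k₀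
          Δ₀ = card-subst (ℕP.suc-injective (proj₂ (proj₂ without-1))) (proj₁ (proj₂ without-1))
          Δ₁ : Card (λ δ → Det 1# δ × δ ≢ 1#) k₁
          Δ₁ = card-iff (card-Det c₁) (λ δ h → h , λ { refl → 0≢1 (trans (sym (proj₂ Det-1)) (proj₂ h)) }) (λ _ → proj₁)
          cov : ∀ X → Good β X → (Good β X × tr ((det X + det X ⁻¹) * sq i) ≡ 0#) ⊎ (Good β X × tr ((det X + det X ⁻¹) * sq i) ≡ 1#)
          cov X g with tr-bit ((det X + det X ⁻¹) * sq i)
          ... | inj₁ z = inj₁ (g , z)
          ... | inj₂ o = inj₂ (g , o)

  -- Trace forms on alternating matrices and the group P inside the orthogonal group.

  module DoubleCosets where

    import Defs
    open Defs using (FiniteField)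
    open Counting
    open CharTwo
    open FieldBasics
    open Matrices
    open GroupOrders
    open TraceCounts
    open import Data.Nat as ℕ using (ℕ; zero; suc)
    import Data.Nat.Properties as ℕP
    open import Data.Fin as Fin using (Fin; zero; suc)
    import Data.Fin.Properties as FinP
    open import Data.Bool using (false)
    open import Data.Product using (∃; _×_; _,_; proj₁; proj₂)
    open import Data.Empty using (⊥-elim)
    open import Data.Unit using (⊤; tt)
    open import Relation.Nullary using (¬_; yes; no)
    open import Relation.Nullary.Decidable using (¬?)
    open import Relation.Binary.PropositionalEquality hiding (J)
    open import Function using (_∘_)

    card-∃! : ∀ {A B : Set} {R : A → B → Set} {k} → Card (λ a → ∃ (R a)) k → (∀ {a b c} → R a b → R a c → b ≡ c) →
              Card {A × B} (λ p → R (proj₁ p) (proj₂ p)) k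
    card-∃! {R = R} {k} c u = card-iff (card-subst (ℕP.*-identityʳ k) (card-Σ c (λ a (b , h) → card-one {P = R a} b h (λ b′ h′ → u h′ h))))
      (λ _ → proj₂) (λ (a , b) h → (b , h) , h)

    module Forms where
      open Field-F
      open Mats
      open Orders
      open ≡-Reasoning

      private variable
        n : ℕ

      Tr-ᵀ : ∀ (A : Mat n n) → Tr (A ᵀ) ≡ Tr A
      Tr-ᵀ A = trans (Tr-sum (A ᵀ)) (trans (sum-cong-≗ λ i → ent-ᵀ A i i) (sym (Tr-sum A)))

      Tr-⊗ : ∀ (C B : Mat n n) → Tr (C ⊗ B) ≡ sum (λ i → sum (λ j → ent C i j * ent B j i))
      Tr-⊗ C B = trans (Tr-sum (C ⊗ B)) (sum-cong-≗ λ i → ent-⊗ C B i i)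

      Tr-symm-alt : ∀ {C B : Mat n n} → Symm C → Alt B → Tr (C ⊗ B) ≡ 0#
      Tr-symm-alt {C = C} {B} c (b , d) = trans (Tr-⊗ C B) (sum-alternating _
        (λ i j → cong₂ _*_ (swap c i j) (swap b j i)) (λ i → trans (cong (ent C i i *_) (d i)) (zeroʳ (ent C i i))))
        where
        swap : ∀ {n} {A : Mat n n} → Symm A → ∀ i j → ent A i j ≡ ent A j i
        swap {A = A} s i j = trans (cong (λ X → ent X i j) (sym s)) (ent-ᵀ A i j)

      private
        not-symm : ∀ {C : Mat n n} → ¬ Symm C → ∃ λ i → ∃ λ j → ent C i j ≢ ent C j i
        not-symm {C = C} ns with FinP.any? (λ i → FinP.any? (λ j → ¬? (ent C i j ≟ ent C j i)))
        ... | yes h = h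
        ... | no h = ⊥-elim (ns (ext λ i j → trans (ent-ᵀ C i j) (eq i j)))
          where
          eq : ∀ i j → ent C j i ≡ ent C i j
          eq i j with ent C j i ≟ ent C i j
          ... | yes e = e
          ... | no ne = ⊥-elim (h (j , i , ne))

      -- The witness is x (E_ij + E_ji) with x = 1/(C_ij + C_ji)
      Tr-not-symm : ∀ {C : Mat n n} → ¬ Symm C → ∃ λ B → Alt B × Tr (C ⊗ B) ≡ 1#
      Tr-not-symm {n} {C} ns = mk b , (ext (λ k l → trans (ent-ᵀ (mk b) k l) (trans (ent-mk b l k) (trans (cong (x *_) (b-symm l k)) (sym (ent-mk b k l))))) , (λ k → trans (ent-mk b k k) (b-diag k))) , (begin
          Tr (C ⊗ mk b) ≡⟨ Tr-⊗ C (mk b) ⟩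
          sum (λ k → sum (λ l → ent C k l * ent (mk b) l k)) ≡⟨ sum-cong-≗ (λ k → sum-cong-≗ (λ l → trans (cong (ent C k l *_) (ent-mk b l k)) (split (ent C k l) (δ i l) (δ j k) (δ j l) (δ i k)))) ⟩
          sum (λ k → sum (λ l → δ j k * (δ i l * (ent C k l * x)) + δ i k * (δ j l * (ent C k l * x))))
            ≡⟨ trans (sum-cong-≗ (λ k → ∑-distrib-+ (λ l → δ j k * (δ i l * (ent C k l * x))) (λ l → δ i k * (δ j l * (ent C k l * x)))))
                 (∑-distrib-+ (λ k → sum (λ l → δ j k * (δ i l * (ent C k l * x)))) (λ k → sum (λ l → δ i k * (δ j l * (ent C k l * x))))) ⟩
          sum (λ k → sum (λ l → δ j k * (δ i l * (ent C k l * x)))) + sum (λ k → sum (λ l → δ i k * (δ j l * (ent C k l * x))))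
            ≡⟨ cong₂ _+_ (pick j i) (pick i j) ⟩
          ent C j i * x + ent C i j * x ≡⟨ trans (sym (distribʳ x (ent C j i) (ent C i j))) (cong (_* x) (+-comm (ent C j i) (ent C i j))) ⟩
          (ent C i j + ent C j i) * x ≡⟨ ⁻¹-inverse _ (λ z → ne (+≈0⇒≈ z)) ⟩
          1# ∎)
        where
        found = not-symm ns
        i = proj₁ found
        j = proj₁ (proj₂ found)
        ne = proj₂ (proj₂ found)
        x = (ent C i j + ent C j i) ⁻¹
        b : Fin n → Fin n → Carrier
        b k l = x * (δ i k * δ j l + δ j k * δ i l)
        b-symm : ∀ k l → δ i k * δ j l + δ j k * δ i l ≡ δ i l * δ j k + δ j l * δ i k
        b-symm k l = solve 4 (λ p q s t → p :* q :+ s :* t := t :* s :+ q :* p) refl (δ i k) (δ j l) (δ j k) (δ i l)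
        b-diag : ∀ k → b k k ≡ 0#
        b-diag k = solve 3 (λ x p q → x :* (p :* q :+ q :* p) := con false) refl x (δ i k) (δ j k)
        split : ∀ c p q s t → c * (x * (p * q + s * t)) ≡ q * (p * (c * x)) + t * (s * (c * x))
        split = solve 6 (λ x c p q s t → c :* (x :* (p :* q :+ s :* t)) := q :* (p :* (c :* x)) :+ t :* (s :* (c :* x))) refl x
        pick : ∀ u v → sum (λ k → sum (λ l → δ u k * (δ v l * (ent C k l * x)))) ≡ ent C u v * x
        pick u v = begin
          sum (λ k → sum (λ l → δ u k * (δ v l * (ent C k l * x)))) ≡⟨ sum-single u (λ k ne → sum-zero (λ l → trans (cong (_* (δ v l * (ent C k l * x))) (δ-≢ (ne ∘ sym))) (zeroˡ _))) ⟩
          sum (λ l → δ u u * (δ v l * (ent C u l * x))) ≡⟨ sum-single v (λ l ne → trans (cong (δ u u *_) (trans (cong (_* (ent C u l * x)) (δ-≢ (ne ∘ sym))) (zeroˡ _))) (zeroʳ (δ u u))) ⟩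
          δ u u * (δ v v * (ent C u v * x)) ≡⟨ cong₂ (λ p q → p * (q * (ent C u v * x))) (δ-refl u) (δ-refl v) ⟩
          1# * (1# * (ent C u v * x)) ≡⟨ trans (*-identityˡ _) (*-identityˡ _) ⟩
          ent C u v * x ∎

      scale : Carrier → Mat n n → Mat n n
      scale a B = mk λ i j → a * ent B i j

      alt-scale : ∀ a {B : Mat n n} → Alt B → Alt (scale a B)
      alt-scale a {B} (s , d) = ext (λ i j → trans (ent-ᵀ (scale a B) i j) (trans (ent-mk _ j i) (trans (cong (a *_) (trans (sym (ent-ᵀ B i j)) (cong (λ X → ent X i j) s))) (sym (ent-mk _ i j)))))
        , λ i → trans (ent-mk _ i i) (trans (cong (a *_) (d i)) (zeroʳ a))

      Tr-scale : ∀ a (C B : Mat n n) → Tr (C ⊗ scale a B) ≡ a * Tr (C ⊗ B)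
      Tr-scale a C B = begin
        Tr (C ⊗ scale a B) ≡⟨ Tr-⊗ C (scale a B) ⟩
        sum (λ i → sum (λ j → ent C i j * ent (scale a B) j i)) ≡⟨ sum-cong-≗ (λ i → trans (sum-cong-≗ (λ j → trans (cong (ent C i j *_) (ent-mk _ j i))
           (solve 3 (λ c a b → c :* (a :* b) := a :* (c :* b)) refl (ent C i j) a (ent B j i)))) (sym (*-distribˡ-sum a (λ j → ent C i j * ent B j i)))) ⟩
        sum (λ i → a * sum (λ j → ent C i j * ent B j i)) ≡⟨ *-distribˡ-sum a (λ i → sum (λ j → ent C i j * ent B j i)) ⟨
        a * sum (λ i → sum (λ j → ent C i j * ent B j i)) ≡⟨ cong (a *_) (Tr-⊗ C B) ⟨
        a * Tr (C ⊗ B) ∎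

      Tr-⊞-⊗ : ∀ (C B B′ : Mat n n) → Tr (C ⊗ (B ⊞ B′)) ≡ Tr (C ⊗ B) + Tr (C ⊗ B′)
      Tr-⊞-⊗ C B B′ = trans (cong Tr (⊗-distribˡ C B B′)) (Tr-⊞ (C ⊗ B) (C ⊗ B′))

      -- B ↦ Tr (C B) is linear and takes the value 1 at some B₀, so adding γ B₀ carries the level
      -- set of 0 onto that of γ. All q level sets therefore have the same size.
      card-alt-level : ∀ {C : Mat n n} → ¬ Symm C → ∃ λ u → (∀ γ → Card (λ B → Alt B × Tr (C ⊗ B) ≡ γ) u) × q ℕ.* u ≡ al q n
      card-alt-level {n} {C} ns = u , level , sym (card-fibres (card-Alt n) card-F (λ B → Tr (C ⊗ B)) (λ _ _ → tt) (λ γ _ → level γ))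
        where
        B₀∃ = Tr-not-symm ns
        B₀ = proj₁ B₀∃
        zeroes = card-split (card-Alt n) (λ B → Tr (C ⊗ B) ≟ 0#)
        u = proj₁ zeroes
        shift : Carrier → Mat n n → Mat n n
        shift γ B = B ⊞ scale γ B₀
        shift-alt : ∀ γ {B} → Alt B → Alt (shift γ B)
        shift-alt γ b = alt-⊞ b (alt-scale γ (proj₁ (proj₂ B₀∃)))
        shift-Tr : ∀ γ B → Tr (C ⊗ shift γ B) ≡ Tr (C ⊗ B) + γ
        shift-Tr γ B = trans (Tr-⊞-⊗ C B (scale γ B₀)) (cong (λ w → Tr (C ⊗ B) + w) (trans (Tr-scale γ C B₀) (trans (cong (γ *_) (proj₂ (proj₂ B₀∃))) (*-identityʳ γ))))
        shift² : ∀ γ B → shift γ (shift γ B) ≡ B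
        shift² γ B = trans (⊞-assoc B (scale γ B₀) (scale γ B₀)) (trans (cong (B ⊞_) (⊞-self (scale γ B₀))) (⊞-identityʳ B))
        level : ∀ γ → Card (λ B → Alt B × Tr (C ⊗ B) ≡ γ) u
        level γ = card-bij (proj₁ (proj₂ (proj₂ zeroes))) (shift γ) (shift γ)
          (λ B (b , z) → shift-alt γ b , trans (shift-Tr γ B) (trans (cong (_+ γ) z) (+-identityˡ γ)))
          (λ B (b , z) → shift-alt γ b , trans (shift-Tr γ B) (≈⇒+≈0 z))
          (λ B _ → shift² γ B) (λ B _ → shift² γ B)

      Θ : Mat (n ℕ.+ n) (n ℕ.+ n)
      Θ {n} = blk 𝟘 (𝟙 n) 𝟘 𝟘

      -- g preserves θ⁺(x) = Σ xᵢ xₙ₊ᵢ exactly when gᵀ Θ g − Θ is alternating.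
      IsO : Mat (n ℕ.+ n) (n ℕ.+ n) → Set
      IsO {n} g = Alt (g ᵀ ⊗ Θ {n} ⊗ g ⊞ Θ {n})

      O-⊗ : ∀ {g h : Mat (n ℕ.+ n) (n ℕ.+ n)} → IsO {n} g → IsO {n} h → IsO {n} (g ⊗ h)
      O-⊗ {n} {g} {h} og oh = subst Alt eq (alt-⊞ (alt-congruence og h) oh)
        where
        t = Θ {n}
        eq : (h ᵀ ⊗ (g ᵀ ⊗ t ⊗ g ⊞ t) ⊗ h) ⊞ (h ᵀ ⊗ t ⊗ h ⊞ t) ≡ (g ⊗ h) ᵀ ⊗ t ⊗ (g ⊗ h) ⊞ t
        eq = begin
          (h ᵀ ⊗ (g ᵀ ⊗ t ⊗ g ⊞ t) ⊗ h) ⊞ (h ᵀ ⊗ t ⊗ h ⊞ t)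
            ≡⟨ cong (_⊞ (h ᵀ ⊗ t ⊗ h ⊞ t)) (trans (cong (_⊗ h) (⊗-distribˡ (h ᵀ) (g ᵀ ⊗ t ⊗ g) t)) (⊗-distribʳ h (h ᵀ ⊗ (g ᵀ ⊗ t ⊗ g)) (h ᵀ ⊗ t))) ⟩
          P ⊞ R ⊞ (R ⊞ t) ≡⟨ trans (⊞-assoc P R (R ⊞ t)) (cong (P ⊞_) (trans (sym (⊞-assoc R R t)) (trans (cong (_⊞ t) (⊞-self R)) (⊞-identityˡ t)))) ⟩
          P ⊞ t ≡⟨ cong (_⊞ t) (trans (cong (_⊗ h) (trans (sym (⊗-assoc (h ᵀ) (g ᵀ ⊗ t) g)) (cong (_⊗ g) (trans (sym (⊗-assoc (h ᵀ) (g ᵀ) t)) (cong (_⊗ t) (sym (ᵀ-⊗ g h)))))))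
                     (⊗-assoc ((g ⊗ h) ᵀ ⊗ t) g h)) ⟩
          (g ⊗ h) ᵀ ⊗ t ⊗ (g ⊗ h) ⊞ t ∎
          where
          P = h ᵀ ⊗ (g ᵀ ⊗ t ⊗ g) ⊗ h
          R = h ᵀ ⊗ t ⊗ h

      module _ (A X D : Mat n n) where
        private
          form : blk A X 𝟘 D ᵀ ⊗ Θ {n} ⊗ blk A X 𝟘 D ⊞ Θ {n} ≡ blk 𝟘 (A ᵀ ⊗ D ⊞ 𝟙 n) 𝟘 (X ᵀ ⊗ D)
          form = begin
            blk A X 𝟘 D ᵀ ⊗ Θ {n} ⊗ blk A X 𝟘 D ⊞ Θ {n}
              ≡⟨ cong (_⊞ Θ {n}) (trans (⊗-assoc (blk A X 𝟘 D ᵀ) (Θ {n}) (blk A X 𝟘 D)) (cong₂ _⊗_ (trans (blk-ᵀ A X 𝟘 D) (blk-cong refl 𝟘ᵀ refl refl))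
                   (trans (blk-⊗ 𝟘 (𝟙 n) 𝟘 𝟘 A X 𝟘 D) (blk-cong
                     (trans (cong₂ _⊞_ (𝟘⊗ A) (⊗𝟘 (𝟙 n))) (⊞-identityˡ 𝟘)) (trans (cong₂ _⊞_ (𝟘⊗ X) (⊗-identityˡ D)) (⊞-identityˡ D))
                     (trans (cong₂ _⊞_ (𝟘⊗ A) (⊗𝟘 𝟘)) (⊞-identityˡ 𝟘)) (trans (cong₂ _⊞_ (𝟘⊗ X) (𝟘⊗ D)) (⊞-identityˡ 𝟘)))))) ⟩
            blk (A ᵀ) 𝟘 (X ᵀ) (D ᵀ) ⊗ blk 𝟘 D 𝟘 𝟘 ⊞ Θ {n}
              ≡⟨ cong (_⊞ Θ {n}) (trans (blk-⊗ (A ᵀ) 𝟘 (X ᵀ) (D ᵀ) 𝟘 D 𝟘 𝟘) (blk-cong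
                   (trans (cong₂ _⊞_ (⊗𝟘 (A ᵀ)) (⊗𝟘 𝟘)) (⊞-identityˡ 𝟘)) (trans (cong (A ᵀ ⊗ D ⊞_) (⊗𝟘 𝟘)) (⊞-identityʳ (A ᵀ ⊗ D)))
                   (trans (cong₂ _⊞_ (⊗𝟘 (X ᵀ)) (⊗𝟘 (D ᵀ))) (⊞-identityˡ 𝟘)) (trans (cong (X ᵀ ⊗ D ⊞_) (⊗𝟘 (D ᵀ))) (⊞-identityʳ (X ᵀ ⊗ D))))) ⟩
            blk 𝟘 (A ᵀ ⊗ D) 𝟘 (X ᵀ ⊗ D) ⊞ Θ {n}
              ≡⟨ trans (blk-⊞ 𝟘 (A ᵀ ⊗ D) 𝟘 (X ᵀ ⊗ D) 𝟘 (𝟙 n) 𝟘 𝟘) (blk-cong (⊞-identityˡ 𝟘) refl (⊞-identityˡ 𝟘) (⊞-identityʳ (X ᵀ ⊗ D))) ⟩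
            blk 𝟘 (A ᵀ ⊗ D ⊞ 𝟙 n) 𝟘 (X ᵀ ⊗ D) ∎

        O-upper⇒ : IsO {n} (blk A X 𝟘 D) → A ᵀ ⊗ D ≡ 𝟙 n × Alt (X ᵀ ⊗ D)
        O-upper⇒ o = (begin
            A ᵀ ⊗ D                ≡⟨ trans (⊞-assoc (A ᵀ ⊗ D) (𝟙 n) (𝟙 n)) (trans (cong (A ᵀ ⊗ D ⊞_) (⊞-self (𝟙 n))) (⊞-identityʳ (A ᵀ ⊗ D))) ⟨
            A ᵀ ⊗ D ⊞ 𝟙 n ⊞ 𝟙 n    ≡⟨ cong (_⊞ 𝟙 n) (trans (sym (proj₁ (proj₂ t))) 𝟘ᵀ) ⟩
            𝟘 ⊞ 𝟙 n                ≡⟨ ⊞-identityˡ (𝟙 n) ⟩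
            𝟙 n                    ∎) , proj₂ (proj₂ t)
          where t = alt-blk⇒ (subst Alt form o)

        O-upper⇐ : A ᵀ ⊗ D ≡ 𝟙 n → Alt (X ᵀ ⊗ D) → IsO {n} (blk A X 𝟘 D)
        O-upper⇐ e a = subst Alt (sym form) (alt-blk⇐ alt-𝟘 (trans 𝟘ᵀ (sym (trans (cong (_⊞ 𝟙 n) e) (⊞-self (𝟙 n))))) a)

      -- P described as the orthogonal matrices with zero lower left block. In this form membership
      -- of σ p σ in P is a single block equation, because σ p σ is orthogonal anyway; `param` and
      -- `coords` connect it with the factorised description.
      IsP : Mat (n ℕ.+ n) (n ℕ.+ n) → Set
      IsP {n} p = IsO {n} p × B₂₁ {n} {n} {n} {n} p ≡ 𝟘

      module Blocks (p : Mat (n ℕ.+ n) (n ℕ.+ n)) where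
        A = B₁₁ {n} {n} {n} {n} p
        X = B₁₂ {n} {n} {n} {n} p
        C = B₂₁ {n} {n} {n} {n} p
        D = B₂₂ {n} {n} {n} {n} p

      P-shape : ∀ {p : Mat (n ℕ.+ n) (n ℕ.+ n)} → IsP {n} p → let open Blocks {n} p in p ≡ blk A X 𝟘 D × A ᵀ ⊗ D ≡ 𝟙 n × Alt (X ᵀ ⊗ D)
      P-shape {n} {p} (o , z) = shape , O-upper⇒ A X D (subst (IsO {n}) shape o)
        where
        open Blocks {n} p
        shape = trans (blk-η {n} {n} {n} {n} p) (blk-cong refl refl z refl)

      P-intro : ∀ {A X D : Mat n n} → A ᵀ ⊗ D ≡ 𝟙 n → Alt (X ᵀ ⊗ D) → IsP {n} (blk A X 𝟘 D)
      P-intro {A = A} {X} {D} e a = O-upper⇐ A X D e a , B₂₁-blk A X 𝟘 D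

      upper-⊗ : ∀ (A X D A′ X′ D′ : Mat n n) → blk A X 𝟘 D ⊗ blk A′ X′ 𝟘 D′ ≡ blk (A ⊗ A′) (A ⊗ X′ ⊞ X ⊗ D′) 𝟘 (D ⊗ D′)
      upper-⊗ A X D A′ X′ D′ = trans (blk-⊗ A X 𝟘 D A′ X′ 𝟘 D′) (blk-cong
        (trans (cong (A ⊗ A′ ⊞_) (⊗𝟘 X)) (⊞-identityʳ (A ⊗ A′))) refl
        (trans (cong₂ _⊞_ (𝟘⊗ A′) (⊗𝟘 D)) (⊞-identityˡ 𝟘)) (trans (cong (_⊞ D ⊗ D′) (𝟘⊗ X′)) (⊞-identityˡ (D ⊗ D′))))

      P-⊗ : ∀ {p p′ : Mat (n ℕ.+ n) (n ℕ.+ n)} → IsP {n} p → IsP {n} p′ → IsP {n} (p ⊗ p′)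
      P-⊗ {n} {p} {p′} h h′ = O-⊗ {n} (proj₁ h) (proj₁ h′) , trans (cong (B₂₁ {n} {n} {n} {n})
          (trans (cong₂ _⊗_ (proj₁ (P-shape {n} h)) (proj₁ (P-shape {n} h′))) (upper-⊗ P.A P.X P.D P′.A P′.X P′.D)))
        (B₂₁-blk (P.A ⊗ P′.A) (P.A ⊗ P′.X ⊞ P.X ⊗ P′.D) 𝟘 (P.D ⊗ P′.D))
        where
        module P = Blocks {n} p
        module P′ = Blocks {n} p′

      -- The inverse J ᵗp J of an orthogonal matrix, where J interchanges the two halves of the
      -- coordinates and is the matrix of the polar form of θ⁺.
      inverseP : Mat (n ℕ.+ n) (n ℕ.+ n) → Mat (n ℕ.+ n) (n ℕ.+ n)
      inverseP {n} p = blk (D ᵀ) (X ᵀ) 𝟘 (A ᵀ) where open Blocks {n} p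

      module _ {p : Mat (n ℕ.+ n) (n ℕ.+ n)} (h : IsP {n} p) where
        private
          open Blocks {n} p using (A; X; D)
          AᵀD = proj₁ (proj₂ (P-shape {n} h))
          alt = proj₂ (proj₂ (P-shape {n} h))
          DAᵀ : D ⊗ A ᵀ ≡ 𝟙 n
          DAᵀ = ⊗-left-inverse AᵀD
          DᵀA : D ᵀ ⊗ A ≡ 𝟙 n
          DᵀA = trans (cong (D ᵀ ⊗_) (sym (ᵀᵀ A))) (trans (sym (ᵀ-⊗ (A ᵀ) D)) (trans (cong _ᵀ AᵀD) 𝟙ᵀ))
          ADᵀ : A ⊗ D ᵀ ≡ 𝟙 n
          ADᵀ = ⊗-left-inverse DᵀA
          AXᵀ : A ⊗ X ᵀ ≡ A ᵀ ᵀ ⊗ (X ᵀ ⊗ D) ⊗ A ᵀ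
          AXᵀ = begin
            A ⊗ X ᵀ                     ≡⟨ trans (cong (A ⊗ X ᵀ ⊗_) DAᵀ) (⊗-identityʳ (A ⊗ X ᵀ)) ⟨
            A ⊗ X ᵀ ⊗ (D ⊗ A ᵀ)         ≡⟨ trans (sym (⊗-assoc (A ⊗ X ᵀ) D (A ᵀ))) (cong (_⊗ A ᵀ) (⊗-assoc A (X ᵀ) D)) ⟩
            A ⊗ (X ᵀ ⊗ D) ⊗ A ᵀ         ≡⟨ cong (λ Y → Y ⊗ (X ᵀ ⊗ D) ⊗ A ᵀ) (ᵀᵀ A) ⟨
            A ᵀ ᵀ ⊗ (X ᵀ ⊗ D) ⊗ A ᵀ     ∎
          alt-AXᵀ : Alt (A ⊗ X ᵀ)
          alt-AXᵀ = subst Alt (sym AXᵀ) (alt-congruence alt (A ᵀ))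
          XAᵀ : X ⊗ A ᵀ ≡ A ⊗ X ᵀ
          XAᵀ = trans (cong (_⊗ A ᵀ) (sym (ᵀᵀ X))) (trans (sym (ᵀ-⊗ A (X ᵀ))) (proj₁ alt-AXᵀ))

        P-inverse : p ⊗ inverseP {n} p ≡ 𝟙 (n ℕ.+ n)
        P-inverse = begin
          p ⊗ inverseP {n} p                                  ≡⟨ cong (_⊗ inverseP {n} p) (proj₁ (P-shape {n} h)) ⟩
          blk A X 𝟘 D ⊗ blk (D ᵀ) (X ᵀ) 𝟘 (A ᵀ)               ≡⟨ upper-⊗ A X D (D ᵀ) (X ᵀ) (A ᵀ) ⟩
          blk (A ⊗ D ᵀ) (A ⊗ X ᵀ ⊞ X ⊗ A ᵀ) 𝟘 (D ⊗ A ᵀ)       ≡⟨ blk-cong ADᵀ (trans (cong (A ⊗ X ᵀ ⊞_) XAᵀ) (⊞-self (A ⊗ X ᵀ))) refl DAᵀ ⟩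
          blk (𝟙 n) 𝟘 𝟘 (𝟙 n)                                 ≡⟨ 𝟙-blk n n ⟨
          𝟙 (n ℕ.+ n)                                         ∎

        P-inverseˡ : inverseP {n} p ⊗ p ≡ 𝟙 (n ℕ.+ n)
        P-inverseˡ = ⊗-left-inverse P-inverse

        inverse-P : IsP {n} (inverseP {n} p)
        inverse-P = P-intro {A = D ᵀ} {X ᵀ} {A ᵀ} (trans (cong (_⊗ A ᵀ) (ᵀᵀ D)) DAᵀ)
          (subst Alt (trans (sym XAᵀ) (cong (_⊗ A ᵀ) (sym (ᵀᵀ X)))) alt-AXᵀ)

        P-A⁻¹ : A ⊗ D ᵀ ≡ 𝟙 n
        P-A⁻¹ = ADᵀ

        P-B-alt : Alt (D ᵀ ⊗ X)
        P-B-alt = subst Alt (trans (sym (proj₁ alt)) (trans (ᵀ-⊗ (X ᵀ) D) (cong (D ᵀ ⊗_) (ᵀᵀ X)))) alt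

        P-AB : A ⊗ (D ᵀ ⊗ X) ≡ X
        P-AB = trans (sym (⊗-assoc A (D ᵀ) X)) (trans (cong (_⊗ X) ADᵀ) (⊗-identityˡ X))

      Triple : ℕ → Set
      Triple n = (Mat n n × Mat n n) × Mat n n

      param : Triple n → Mat (n ℕ.+ n) (n ℕ.+ n)
      param ((A , A′) , B) = blk A (A ⊗ B) 𝟘 (A′ ᵀ)

      IsTriple : Triple n → Set
      IsTriple {n} ((A , A′) , B) = A ⊗ A′ ≡ 𝟙 n × Alt B

      P-param : ∀ {t : Triple n} → IsTriple t → IsP {n} (param t)
      P-param {n} {(A , A′) , B} (e , b) = P-intro {A = A} {A ⊗ B} {A′ ᵀ} AᵀA′ᵀ (subst Alt (sym (begin
          (A ⊗ B) ᵀ ⊗ A′ ᵀ      ≡⟨ cong (_⊗ A′ ᵀ) (ᵀ-⊗ A B) ⟩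
          B ᵀ ⊗ A ᵀ ⊗ A′ ᵀ      ≡⟨ ⊗-assoc (B ᵀ) (A ᵀ) (A′ ᵀ) ⟩
          B ᵀ ⊗ (A ᵀ ⊗ A′ ᵀ)    ≡⟨ trans (cong (B ᵀ ⊗_) AᵀA′ᵀ) (⊗-identityʳ (B ᵀ)) ⟩
          B ᵀ                   ≡⟨ proj₁ b ⟩
          B                     ∎)) b)
        where
        AᵀA′ᵀ : A ᵀ ⊗ A′ ᵀ ≡ 𝟙 n
        AᵀA′ᵀ = trans (sym (ᵀ-⊗ A′ A)) (trans (cong _ᵀ (⊗-left-inverse e)) 𝟙ᵀ)

      coords : Mat (n ℕ.+ n) (n ℕ.+ n) → Triple n
      coords {n} p = (A , D ᵀ) , D ᵀ ⊗ X where open Blocks {n} p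

      coords-triple : ∀ {p : Mat (n ℕ.+ n) (n ℕ.+ n)} → IsP {n} p → IsTriple (coords {n} p)
      coords-triple {n} h = P-A⁻¹ {n} h , P-B-alt {n} h

      param-coords : ∀ {p : Mat (n ℕ.+ n) (n ℕ.+ n)} → IsP {n} p → param (coords {n} p) ≡ p
      param-coords {n} {p} h = trans (blk-cong refl (P-AB {n} h) refl (ᵀᵀ D)) (sym (proj₁ (P-shape {n} h)))
        where open Blocks {n} p

      coords-param : ∀ {t : Triple n} → IsTriple t → coords {n} (param t) ≡ t
      coords-param {n} {(A , A′) , B} (e , b) = cong₂ _,_ (cong₂ _,_ (B₁₁-blk A (A ⊗ B) 𝟘 (A′ ᵀ)) D≡)
          (trans (cong₂ _⊗_ D≡ (B₁₂-blk A (A ⊗ B) 𝟘 (A′ ᵀ))) (trans (sym (⊗-assoc A′ A B)) (trans (cong (_⊗ B) (⊗-left-inverse e)) (⊗-identityˡ B))))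
        where
        D≡ = trans (cong _ᵀ (B₂₂-blk A (A ⊗ B) 𝟘 (A′ ᵀ))) (ᵀᵀ A′)

      card-P : ∀ {Q : Triple n → Set} {R : Mat (n ℕ.+ n) (n ℕ.+ n) → Set} {k} → Card (λ t → IsTriple t × Q t) k →
               (∀ t → IsTriple t → Q t → R (param t)) → (∀ t → IsTriple t → R (param t) → Q t) → Card (λ p → IsP {n} p × R p) k
      card-P {n} {R = R} c to′ from′ = card-bij c param (coords {n}) (λ t (h , x) → P-param h , to′ t h x)
        (λ p (h , x) → coords-triple {n} h , from′ _ (coords-triple {n} h) (subst R (sym (param-coords {n} h)) x))
        (λ t (h , _) → coords-param h) (λ p (h , _) → param-coords {n} h)

      card-inverse-pairs : ∀ {k} {R : Mat n n → Mat n n → Set} → Card (λ A → ∃ λ A′ → A ⊗ A′ ≡ 𝟙 n × R A A′) k →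
        Card {Mat n n × Mat n n} (λ p → proj₁ p ⊗ proj₂ p ≡ 𝟙 n × R (proj₁ p) (proj₂ p)) k
      card-inverse-pairs {n} {R = R} c = card-∃! {R = λ A A′ → A ⊗ A′ ≡ 𝟙 n × R A A′} c (λ (e , _) (e′ , _) → inverse-unique e e′)

      card-P-all : Card (IsP {n}) (gl q n ℕ.* al q n)
      card-P-all {n} = card-iff (card-P {n} {Q = λ _ → ⊤} {R = λ _ → ⊤} (card-iff (card-× (card-inverse-pairs {R = λ _ _ → ⊤}
          (card-iff (card-GL n) (λ A (A′ , e) → A′ , e , tt) (λ A (A′ , e , _) → A′ , e))) (card-Alt n))
          (λ { _ ((e , _) , b) → (e , b) , tt }) (λ { _ ((e , b) , _) → (e , tt) , b })) (λ _ _ _ → tt) (λ _ _ _ → tt))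
        (λ _ → proj₁) (λ _ h → h , tt)

  -- Counting the elements of a double coset by trace.

  module CosetCounts where

    import Defs
    open Defs using (FiniteField)
    open Counting
    open CharTwo
    open FieldBasics
    open Matrices
    open GroupOrders
    open TraceCounts
    open DoubleCosets
    open import Data.Nat as ℕ using (ℕ; zero; suc; z≤n; s≤s)
    import Data.Nat.Properties as ℕP
    open import Data.Nat.Tactic.RingSolver using (solve-∀)
    open import Data.Fin using (zero; suc)
    open import Data.Product using (∃; _×_; _,_; proj₁; proj₂)
    open import Data.Sum using (_⊎_; inj₁; inj₂)
    open import Data.Unit using (⊤; tt)
    open import Relation.Nullary using (¬_; yes; no)
    open import Relation.Binary.PropositionalEquality hiding (J)

    module Coset (s m : ℕ) where
      open Field-F
      open Mats
      open Orders
      open Forms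
      open Kappa using (InvTrace)
      open ≡-Reasoning

      N : ℕ
      N = s ℕ.+ m

      a₁₁ : Mat N N → Mat s s
      a₁₁ = B₁₁ {s} {m} {s} {m}
      a₁₂ : Mat N N → Mat s m
      a₁₂ = B₁₂ {s} {m} {s} {m}
      a₂₁ : Mat N N → Mat m s
      a₂₁ = B₂₁ {s} {m} {s} {m}
      a₂₂ : Mat N N → Mat m m
      a₂₂ = B₂₂ {s} {m} {s} {m}

      η : ∀ (A : Mat N N) → A ≡ blk (a₁₁ A) (a₁₂ A) (a₂₁ A) (a₂₂ A)
      η = blk-η {s} {m} {s} {m}

      -- Complementary idempotents projecting to the last m and the first s coordinates. They turn σ
      -- into `Sg`, a 2 × 2 block matrix whose products follow from the idempotent relations.
      D₀ Dₛ : Mat N N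
      D₀ = blk 𝟘 𝟘 𝟘 (𝟙 m)
      Dₛ = blk (𝟙 s) 𝟘 𝟘 𝟘

      module _ (a : Mat s s) (b : Mat s m) (c : Mat m s) (d : Mat m m) where
        D₀-⊗ : D₀ ⊗ blk a b c d ≡ blk 𝟘 𝟘 c d
        D₀-⊗ = trans (blk-⊗ 𝟘 𝟘 𝟘 (𝟙 m) a b c d) (blk-cong
          (trans (cong₂ _⊞_ (𝟘⊗ a) (𝟘⊗ c)) (⊞-identityˡ 𝟘)) (trans (cong₂ _⊞_ (𝟘⊗ b) (𝟘⊗ d)) (⊞-identityˡ 𝟘))
          (trans (cong₂ _⊞_ (𝟘⊗ a) (⊗-identityˡ c)) (⊞-identityˡ c)) (trans (cong₂ _⊞_ (𝟘⊗ b) (⊗-identityˡ d)) (⊞-identityˡ d)))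

        Dₛ-⊗ : Dₛ ⊗ blk a b c d ≡ blk a b 𝟘 𝟘
        Dₛ-⊗ = trans (blk-⊗ (𝟙 s) 𝟘 𝟘 𝟘 a b c d) (blk-cong
          (trans (cong₂ _⊞_ (⊗-identityˡ a) (𝟘⊗ c)) (⊞-identityʳ a)) (trans (cong₂ _⊞_ (⊗-identityˡ b) (𝟘⊗ d)) (⊞-identityʳ b))
          (trans (cong₂ _⊞_ (𝟘⊗ a) (𝟘⊗ c)) (⊞-identityˡ 𝟘)) (trans (cong₂ _⊞_ (𝟘⊗ b) (𝟘⊗ d)) (⊞-identityˡ 𝟘)))

        ⊗-D₀ : blk a b c d ⊗ D₀ ≡ blk 𝟘 b 𝟘 d
        ⊗-D₀ = trans (blk-⊗ a b c d 𝟘 𝟘 𝟘 (𝟙 m)) (blk-cong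
          (trans (cong₂ _⊞_ (⊗𝟘 a) (⊗𝟘 b)) (⊞-identityˡ 𝟘)) (trans (cong₂ _⊞_ (⊗𝟘 a) (⊗-identityʳ b)) (⊞-identityˡ b))
          (trans (cong₂ _⊞_ (⊗𝟘 c) (⊗𝟘 d)) (⊞-identityˡ 𝟘)) (trans (cong₂ _⊞_ (⊗𝟘 c) (⊗-identityʳ d)) (⊞-identityˡ d)))

        ⊗-Dₛ : blk a b c d ⊗ Dₛ ≡ blk a 𝟘 c 𝟘
        ⊗-Dₛ = trans (blk-⊗ a b c d (𝟙 s) 𝟘 𝟘 𝟘) (blk-cong
          (trans (cong₂ _⊞_ (⊗-identityʳ a) (⊗𝟘 b)) (⊞-identityʳ a)) (trans (cong₂ _⊞_ (⊗𝟘 a) (⊗𝟘 b)) (⊞-identityˡ 𝟘))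
          (trans (cong₂ _⊞_ (⊗-identityʳ c) (⊗𝟘 d)) (⊞-identityʳ c)) (trans (cong₂ _⊞_ (⊗𝟘 c) (⊗𝟘 d)) (⊞-identityˡ 𝟘)))

      blk-𝟘 : blk (𝟘 {s} {s}) (𝟘 {s} {m}) (𝟘 {m} {s}) (𝟘 {m} {m}) ≡ 𝟘 {N} {N}
      blk-𝟘 = trans (blk-cong (sym (⊞-self X)) (sym (⊞-self Y)) (sym (⊞-self Z)) (sym (⊞-self W))) (trans (sym (blk-⊞ X Y Z W X Y Z W)) (⊞-self (blk X Y Z W)))
        where
        X = 𝟘 {s} {s}
        Y = 𝟘 {s} {m}
        Z = 𝟘 {m} {s}
        W = 𝟘 {m} {m}

      D₀D₀ : D₀ ⊗ D₀ ≡ D₀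
      D₀D₀ = D₀-⊗ 𝟘 𝟘 𝟘 (𝟙 m)
      DₛDₛ : Dₛ ⊗ Dₛ ≡ Dₛ
      DₛDₛ = Dₛ-⊗ (𝟙 s) 𝟘 𝟘 𝟘
      D₀Dₛ : D₀ ⊗ Dₛ ≡ 𝟘
      D₀Dₛ = trans (D₀-⊗ (𝟙 s) 𝟘 𝟘 𝟘) blk-𝟘
      DₛD₀ : Dₛ ⊗ D₀ ≡ 𝟘
      DₛD₀ = trans (Dₛ-⊗ 𝟘 𝟘 𝟘 (𝟙 m)) blk-𝟘
      D₀⊞Dₛ : D₀ ⊞ Dₛ ≡ 𝟙 N
      D₀⊞Dₛ = trans (blk-⊞ 𝟘 𝟘 𝟘 (𝟙 m) (𝟙 s) 𝟘 𝟘 𝟘) (trans (blk-cong (⊞-identityˡ (𝟙 s)) (⊞-identityˡ 𝟘) (⊞-identityˡ 𝟘) (⊞-identityʳ (𝟙 m))) (sym (𝟙-blk s m)))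
      D₀ᵀ : D₀ ᵀ ≡ D₀
      D₀ᵀ = trans (blk-ᵀ 𝟘 𝟘 𝟘 (𝟙 m)) (blk-cong 𝟘ᵀ 𝟘ᵀ 𝟘ᵀ 𝟙ᵀ)
      Dₛᵀ : Dₛ ᵀ ≡ Dₛ
      Dₛᵀ = trans (blk-ᵀ (𝟙 s) 𝟘 𝟘 𝟘) (blk-cong 𝟙ᵀ 𝟘ᵀ 𝟘ᵀ 𝟘ᵀ)

      Sg : Mat (N ℕ.+ N) (N ℕ.+ N)
      Sg = blk D₀ Dₛ Dₛ D₀

      Sg-⊗ : ∀ (A X C D : Mat N N) → Sg ⊗ blk A X C D ≡ blk (D₀ ⊗ A ⊞ Dₛ ⊗ C) (D₀ ⊗ X ⊞ Dₛ ⊗ D) (Dₛ ⊗ A ⊞ D₀ ⊗ C) (Dₛ ⊗ X ⊞ D₀ ⊗ D)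
      Sg-⊗ = blk-⊗ D₀ Dₛ Dₛ D₀

      Sg² : Sg ⊗ Sg ≡ 𝟙 (N ℕ.+ N)
      Sg² = trans (Sg-⊗ D₀ Dₛ Dₛ D₀) (trans (blk-cong (trans (cong₂ _⊞_ D₀D₀ DₛDₛ) D₀⊞Dₛ) (trans (cong₂ _⊞_ D₀Dₛ DₛD₀) (⊞-identityˡ 𝟘))
        (trans (cong₂ _⊞_ DₛD₀ D₀Dₛ) (⊞-identityˡ 𝟘)) (trans (cong₂ _⊞_ DₛDₛ D₀D₀) (trans (⊞-comm Dₛ D₀) D₀⊞Dₛ))) (sym (𝟙-blk N N)))

      cancel-Sg : ∀ (p : Mat (N ℕ.+ N) (N ℕ.+ N)) → Sg ⊗ (Sg ⊗ p) ≡ p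
      cancel-Sg p = trans (sym (⊗-assoc Sg Sg p)) (trans (cong (_⊗ p) Sg²) (⊗-identityˡ p))

      Sg-O : IsO {N} Sg
      Sg-O = subst Alt (sym form) (alt-blk⇐ alt-𝟘 (trans Dₛᵀ (sym Dₛ≡)) alt-𝟘)
        where
        Dₛ≡ : D₀ ⊞ 𝟙 N ≡ Dₛ
        Dₛ≡ = trans (cong (D₀ ⊞_) (sym D₀⊞Dₛ)) (trans (sym (⊞-assoc D₀ D₀ Dₛ)) (trans (cong (_⊞ Dₛ) (⊞-self D₀)) (⊞-identityˡ Dₛ)))
        form : Sg ᵀ ⊗ Θ {N} ⊗ Sg ⊞ Θ {N} ≡ blk 𝟘 (D₀ ⊞ 𝟙 N) Dₛ 𝟘
        form = begin
          Sg ᵀ ⊗ Θ {N} ⊗ Sg ⊞ Θ {N}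
            ≡⟨ cong (_⊞ Θ {N}) (trans (⊗-assoc (Sg ᵀ) (Θ {N}) Sg) (cong₂ _⊗_ (trans (blk-ᵀ D₀ Dₛ Dₛ D₀) (blk-cong D₀ᵀ Dₛᵀ Dₛᵀ D₀ᵀ))
                 (trans (blk-⊗ 𝟘 (𝟙 N) 𝟘 𝟘 D₀ Dₛ Dₛ D₀) (blk-cong
                   (trans (cong₂ _⊞_ (𝟘⊗ D₀) (⊗-identityˡ Dₛ)) (⊞-identityˡ Dₛ)) (trans (cong₂ _⊞_ (𝟘⊗ Dₛ) (⊗-identityˡ D₀)) (⊞-identityˡ D₀))
                   (trans (cong₂ _⊞_ (𝟘⊗ D₀) (𝟘⊗ Dₛ)) (⊞-identityˡ 𝟘)) (trans (cong₂ _⊞_ (𝟘⊗ Dₛ) (𝟘⊗ D₀)) (⊞-identityˡ 𝟘)))))) ⟩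
          Sg ⊗ blk Dₛ D₀ 𝟘 𝟘 ⊞ Θ {N}
            ≡⟨ cong (_⊞ Θ {N}) (trans (Sg-⊗ Dₛ D₀ 𝟘 𝟘) (blk-cong
                 (trans (cong₂ _⊞_ D₀Dₛ (⊗𝟘 Dₛ)) (⊞-identityˡ 𝟘)) (trans (cong₂ _⊞_ D₀D₀ (⊗𝟘 Dₛ)) (⊞-identityʳ D₀))
                 (trans (cong₂ _⊞_ DₛDₛ (⊗𝟘 D₀)) (⊞-identityʳ Dₛ)) (trans (cong₂ _⊞_ DₛD₀ (⊗𝟘 D₀)) (⊞-identityˡ 𝟘)))) ⟩
          blk 𝟘 D₀ Dₛ 𝟘 ⊞ Θ {N}
            ≡⟨ trans (blk-⊞ 𝟘 D₀ Dₛ 𝟘 𝟘 (𝟙 N) 𝟘 𝟘) (blk-cong (⊞-identityˡ 𝟘) refl (⊞-identityʳ Dₛ) (⊞-identityˡ 𝟘)) ⟩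
          blk 𝟘 (D₀ ⊞ 𝟙 N) Dₛ 𝟘 ∎

      -- This block decides membership in P ∩ σPσ: σ p σ lies in P exactly when it vanishes.
      conj-lower-left : ∀ (A X D : Mat N N) → B₂₁ {N} {N} {N} {N} (Sg ⊗ blk A X 𝟘 D ⊗ Sg) ≡ blk (a₁₁ X) (a₁₂ A) (a₂₁ D) 𝟘
      conj-lower-left A X D = begin
        B₂₁ {N} {N} {N} {N} (Sg ⊗ blk A X 𝟘 D ⊗ Sg)
          ≡⟨ cong (B₂₁ {N} {N} {N} {N}) (trans (cong (_⊗ Sg) (Sg-⊗ A X 𝟘 D)) (blk-⊗ _ _ (Dₛ ⊗ A ⊞ D₀ ⊗ 𝟘) (Dₛ ⊗ X ⊞ D₀ ⊗ D) D₀ Dₛ Dₛ D₀)) ⟩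
        _ ≡⟨ B₂₁-blk _ _ _ _ ⟩
        (Dₛ ⊗ A ⊞ D₀ ⊗ 𝟘) ⊗ D₀ ⊞ (Dₛ ⊗ X ⊞ D₀ ⊗ D) ⊗ Dₛ
          ≡⟨ cong₂ _⊞_ (cong (_⊗ D₀) (trans (cong₂ _⊞_ (left A) (⊗𝟘 D₀)) (⊞-identityʳ _)))
                       (cong (_⊗ Dₛ) (trans (cong₂ _⊞_ (left X) (lower D)) (blk-⊞ (a₁₁ X) (a₁₂ X) 𝟘 𝟘 𝟘 𝟘 (a₂₁ D) (a₂₂ D)))) ⟩
        blk (a₁₁ A) (a₁₂ A) 𝟘 𝟘 ⊗ D₀ ⊞ blk (a₁₁ X ⊞ 𝟘) (a₁₂ X ⊞ 𝟘) (𝟘 ⊞ a₂₁ D) (𝟘 ⊞ a₂₂ D) ⊗ Dₛ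
          ≡⟨ cong₂ _⊞_ (⊗-D₀ (a₁₁ A) (a₁₂ A) 𝟘 𝟘) (⊗-Dₛ (a₁₁ X ⊞ 𝟘) (a₁₂ X ⊞ 𝟘) (𝟘 ⊞ a₂₁ D) (𝟘 ⊞ a₂₂ D)) ⟩
        blk 𝟘 (a₁₂ A) 𝟘 𝟘 ⊞ blk (a₁₁ X ⊞ 𝟘) 𝟘 (𝟘 ⊞ a₂₁ D) 𝟘
          ≡⟨ trans (blk-⊞ 𝟘 (a₁₂ A) 𝟘 𝟘 (a₁₁ X ⊞ 𝟘) 𝟘 (𝟘 ⊞ a₂₁ D) 𝟘) (blk-cong
               (trans (⊞-identityˡ _) (⊞-identityʳ (a₁₁ X))) (⊞-identityʳ (a₁₂ A)) (trans (⊞-identityˡ _) (⊞-identityˡ (a₂₁ D))) (⊞-identityˡ 𝟘)) ⟩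
        blk (a₁₁ X) (a₁₂ A) (a₂₁ D) 𝟘 ∎
        where
        left : ∀ Y → Dₛ ⊗ Y ≡ blk (a₁₁ Y) (a₁₂ Y) 𝟘 𝟘
        left Y = trans (cong (Dₛ ⊗_) (η Y)) (Dₛ-⊗ (a₁₁ Y) (a₁₂ Y) (a₂₁ Y) (a₂₂ Y))
        lower : ∀ Y → D₀ ⊗ Y ≡ blk 𝟘 𝟘 (a₂₁ Y) (a₂₂ Y)
        lower Y = trans (cong (D₀ ⊗_) (η Y)) (D₀-⊗ (a₁₁ Y) (a₁₂ Y) (a₂₁ Y) (a₂₂ Y))

      conj-O : ∀ {p} → IsP {N} p → IsO {N} (Sg ⊗ p ⊗ Sg)
      conj-O h = O-⊗ {N} (O-⊗ {N} Sg-O (proj₁ h)) Sg-O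

      -- Two of the three blocks that have to vanish suffice. If A is block lower triangular, so is
      -- its inverse, which kills the lower left block of ᵗA⁻¹; and A₁₁ is then invertible, so (A
      -- B)₁₁ = A₁₁ B₁₁ vanishes exactly when B₁₁ does.
      Stable : Triple N → Set
      Stable ((A , A′) , B) = a₁₂ A ≡ 𝟘 × a₁₁ B ≡ 𝟘

      private
        lower-form : ∀ {A : Mat N N} → a₁₂ A ≡ 𝟘 → A ≡ blk (a₁₁ A) 𝟘 (a₂₁ A) (a₂₂ A)
        lower-form {A} e = trans (η A) (blk-cong refl e refl refl)

        a₁₁-⊗ : ∀ {A B : Mat N N} → a₁₂ A ≡ 𝟘 → a₁₁ (A ⊗ B) ≡ a₁₁ A ⊗ a₁₁ B
        a₁₁-⊗ {A} {B} e = trans (cong a₁₁ (trans (cong₂ _⊗_ (lower-form e) (η B)) (blk-⊗ (a₁₁ A) 𝟘 (a₂₁ A) (a₂₂ A) (a₁₁ B) (a₁₂ B) (a₂₁ B) (a₂₂ B))))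
          (trans (B₁₁-blk _ _ _ _) (trans (cong (a₁₁ A ⊗ a₁₁ B ⊞_) (𝟘⊗ (a₂₁ B))) (⊞-identityʳ _)))

      stable⇒ : ∀ t → IsTriple t → Stable t → IsP {N} (Sg ⊗ param t ⊗ Sg)
      stable⇒ t@((A , A′) , B) h@(e , b) (z , w) = conj-O (P-param h) , trans (conj-lower-left A (A ⊗ B) (A′ ᵀ)) (trans (blk-cong x₁₁ z d₂₁ refl) blk-𝟘)
        where
        x₁₁ : a₁₁ (A ⊗ B) ≡ 𝟘
        x₁₁ = trans (a₁₁-⊗ {A} {B} z) (trans (cong (a₁₁ A ⊗_) w) (⊗𝟘 (a₁₁ A)))
        parts = inv-lower⇒ {A = a₁₁ A} {a₂₁ A} {a₂₂ A} (subst Inv (lower-form z) (A′ , e))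
        explicit = lower-inverse (a₁₁ A) (proj₁ (proj₁ parts)) (a₂₁ A) (a₂₂ A) (proj₁ (proj₂ parts)) (proj₂ (proj₁ parts)) (proj₂ (proj₂ parts))
        i₁ = proj₁ (proj₁ parts)
        i₂ = proj₁ (proj₂ parts)
        E = blk i₁ 𝟘 (i₂ ⊗ (a₂₁ A ⊗ i₁)) i₂
        A′≡ : A′ ≡ E
        A′≡ = inverse-unique e (trans (cong (_⊗ E) (lower-form z)) explicit)
        d₂₁ : a₂₁ (A′ ᵀ) ≡ 𝟘
        d₂₁ = trans (cong a₂₁ (trans (cong _ᵀ A′≡) (blk-ᵀ i₁ 𝟘 (i₂ ⊗ (a₂₁ A ⊗ i₁)) i₂))) (trans (B₂₁-blk (i₁ ᵀ) ((i₂ ⊗ (a₂₁ A ⊗ i₁)) ᵀ) (𝟘 ᵀ) (i₂ ᵀ)) 𝟘ᵀ)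

      stable⇐ : ∀ t → IsTriple t → IsP {N} (Sg ⊗ param t ⊗ Sg) → Stable t
      stable⇐ ((A , A′) , B) (e , b) (_ , z) = a₁₂≡ , (begin
          a₁₁ B                          ≡⟨ trans (cong (_⊗ a₁₁ B) (⊗-left-inverse inv)) (⊗-identityˡ (a₁₁ B)) ⟨
          proj₁ inv₁₁ ⊗ a₁₁ A ⊗ a₁₁ B    ≡⟨ ⊗-assoc (proj₁ inv₁₁) (a₁₁ A) (a₁₁ B) ⟩
          proj₁ inv₁₁ ⊗ (a₁₁ A ⊗ a₁₁ B)  ≡⟨ cong (proj₁ inv₁₁ ⊗_) (trans (sym (a₁₁-⊗ {A} {B} a₁₂≡)) (blk-inj₁₁ zero-blk)) ⟩
          proj₁ inv₁₁ ⊗ 𝟘                ≡⟨ ⊗𝟘 (proj₁ inv₁₁) ⟩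
          𝟘                              ∎)
        where
        zero-blk : blk (a₁₁ (A ⊗ B)) (a₁₂ A) (a₂₁ (A′ ᵀ)) 𝟘 ≡ blk (𝟘 {s} {s}) 𝟘 𝟘 𝟘
        zero-blk = trans (sym (conj-lower-left A (A ⊗ B) (A′ ᵀ))) (trans z (sym blk-𝟘))
        a₁₂≡ : a₁₂ A ≡ 𝟘
        a₁₂≡ = blk-inj₁₂ zero-blk
        inv₁₁ : Inv (a₁₁ A)
        inv₁₁ = proj₁ (inv-lower⇒ {A = a₁₁ A} {a₂₁ A} {a₂₂ A} (subst Inv (lower-form a₁₂≡) (A′ , e)))
        inv = proj₂ inv₁₁

      -- The conditions `L` and `R` on the two diagonal corners let one bijection serve both counts:
      -- the order of the stabiliser, and the matrices with symmetric corner and prescribed Tr D +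
      -- Tr D⁻¹.
      card-lower : ∀ {L : Mat s s → Set} {R : Mat m m → Mat m m → Set} {k₁ k₂} →
        Card (λ a → Inv a × L a) k₁ → Card (λ d → ∃ λ d′ → d ⊗ d′ ≡ 𝟙 m × R d d′) k₂ →
        Card (λ A → ∃ λ A′ → A ⊗ A′ ≡ 𝟙 N × (a₁₂ A ≡ 𝟘 × L (a₁₁ A)) × R (a₂₂ A) (a₂₂ A′)) (k₁ ℕ.* ((q ℕ.^ s) ℕ.^ m ℕ.* k₂))
      card-lower {L} {R} ca cd = card-bij (card-× ca (card-× (card-Mat m s) cd))
        (λ (a , c , d) → blk a 𝟘 c d) (λ A → a₁₁ A , a₂₁ A , a₂₂ A)
        (λ { (a , c , d) (((a′ , ea) , la) , _ , (d′ , ed , rd)) →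
          blk a′ 𝟘 (d′ ⊗ (c ⊗ a′)) d′ , lower-inverse a a′ c d d′ ea ed , (B₁₂-blk a 𝟘 c d , subst L (sym (B₁₁-blk a 𝟘 c d)) la) ,
          subst₂ R (sym (B₂₂-blk a 𝟘 c d)) (sym (B₂₂-blk a′ 𝟘 (d′ ⊗ (c ⊗ a′)) d′)) rd })
        back
        (λ (a , c , d) _ → cong₂ _,_ (B₁₁-blk a 𝟘 c d) (cong₂ _,_ (B₂₁-blk a 𝟘 c d) (B₂₂-blk a 𝟘 c d)))
        (λ A (_ , _ , (z , _) , _) → sym (lower-form z))
        where
        back : ∀ A → (∃ λ A′ → A ⊗ A′ ≡ 𝟙 N × (a₁₂ A ≡ 𝟘 × L (a₁₁ A)) × R (a₂₂ A) (a₂₂ A′)) →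
               (Inv (a₁₁ A) × L (a₁₁ A)) × ⊤ × ∃ λ d′ → a₂₂ A ⊗ d′ ≡ 𝟙 m × R (a₂₂ A) d′
        back A (A′ , e , (z , l) , x) = (proj₁ parts , l) , tt , a₂₂ A′ , proj₂ (proj₂ parts) , x
          where parts = inv-lower⇒ {A = a₁₁ A} {a₂₁ A} {a₂₂ A} (A′ , trans (cong (_⊗ A′) (sym (lower-form z))) e)

      card-Alt-corner : Card (λ B → Alt B × a₁₁ B ≡ 𝟘) ((q ℕ.^ s) ℕ.^ m ℕ.* al q m)
      card-Alt-corner = card-bij (card-× (card-Mat m s) (card-Alt m))
        (λ (C , D) → blk 𝟘 (C ᵀ) C D) (λ X → a₂₁ X , a₂₂ X)
        (λ (C , D) (_ , d) → alt-blk⇐ alt-𝟘 refl d , B₁₁-blk 𝟘 (C ᵀ) C D)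
        (λ X (x , _) → tt , proj₂ (proj₂ (alt-blk⇒ (subst Alt (η X) x))))
        (λ (C , D) _ → cong₂ _,_ (B₂₁-blk 𝟘 (C ᵀ) C D) (B₂₂-blk 𝟘 (C ᵀ) C D))
        (λ X (x , z) → sym (trans (η X) (blk-cong z (sym (proj₁ (proj₂ (alt-blk⇒ (subst Alt (η X) x))))) refl refl)))

      stabiliserOrder : ℕ
      stabiliserOrder = gl q s ℕ.* ((q ℕ.^ s) ℕ.^ m ℕ.* gl q m) ℕ.* ((q ℕ.^ s) ℕ.^ m ℕ.* al q m)

      card-stable : Card (λ p → IsP {N} p × IsP {N} (Sg ⊗ p ⊗ Sg)) stabiliserOrder
      card-stable = card-P {N} {Q = Stable} (card-iff (card-× (card-inverse-pairs {R = λ A A′ → (a₁₂ A ≡ 𝟘 × ⊤) × ⊤} (card-lower {L = λ _ → ⊤} {R = λ _ _ → ⊤}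
            (card-iff (card-GL s) (λ _ i → i , tt) (λ _ → proj₁)) (card-iff (card-GL m) (λ _ (d′ , e) → d′ , e , tt) (λ _ (d′ , e , _) → d′ , e)))) card-Alt-corner)
          (λ { _ ((e , (z , _) , _) , b , w) → (e , b) , z , w }) (λ { _ ((e , b) , z , w) → (e , (z , tt) , tt) , b , w }))
        stable⇒ stable⇐

      private
        cTrace : Mat N N → Mat N N → Carrier
        cTrace A A′ = Tr (D₀ ⊗ A) + Tr (D₀ ⊗ A′ ᵀ)

        Tr-D₀ : ∀ (A : Mat N N) → Tr (D₀ ⊗ A) ≡ Tr (a₂₂ A)
        Tr-D₀ A = trans (cong Tr (trans (cong (D₀ ⊗_) (η A)) (D₀-⊗ (a₁₁ A) (a₁₂ A) (a₂₁ A) (a₂₂ A))))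
          (trans (Tr-blk 𝟘 𝟘 (a₂₁ A) (a₂₂ A)) (trans (cong (_+ Tr (a₂₂ A)) Tr-𝟘) (+-identityˡ _)))

        cTrace≡ : ∀ A A′ → cTrace A A′ ≡ Tr (a₂₂ A) + Tr (a₂₂ A′)
        cTrace≡ A A′ = cong₂ _+_ (Tr-D₀ A) (trans (Tr-D₀ (A′ ᵀ)) (trans (cong Tr (trans (cong a₂₂ (trans (cong _ᵀ (η A′)) (blk-ᵀ (a₁₁ A′) (a₁₂ A′) (a₂₁ A′) (a₂₂ A′))))
          (B₂₂-blk _ _ _ _))) (Tr-ᵀ (a₂₂ A′))))

        Tr-param : ∀ A A′ B → Tr (Sg ⊗ param ((A , A′) , B)) ≡ cTrace A A′ + Tr (Dₛ ⊗ A ⊗ B)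
        Tr-param A A′ B = begin
          Tr (Sg ⊗ blk A (A ⊗ B) 𝟘 (A′ ᵀ)) ≡⟨ trans (cong Tr (Sg-⊗ A (A ⊗ B) 𝟘 (A′ ᵀ))) (Tr-blk _ _ _ _) ⟩
          Tr (D₀ ⊗ A ⊞ Dₛ ⊗ 𝟘) + Tr (Dₛ ⊗ (A ⊗ B) ⊞ D₀ ⊗ A′ ᵀ)
            ≡⟨ cong₂ _+_ (cong Tr (trans (cong (D₀ ⊗ A ⊞_) (⊗𝟘 Dₛ)) (⊞-identityʳ _))) (trans (Tr-⊞ (Dₛ ⊗ (A ⊗ B)) (D₀ ⊗ A′ ᵀ)) (cong (λ X → Tr X + Tr (D₀ ⊗ A′ ᵀ)) (sym (⊗-assoc Dₛ A B)))) ⟩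
          Tr (D₀ ⊗ A) + (Tr (Dₛ ⊗ A ⊗ B) + Tr (D₀ ⊗ A′ ᵀ))
            ≡⟨ solve 3 (λ x y z → x :+ (y :+ z) := x :+ z :+ y) refl (Tr (D₀ ⊗ A)) (Tr (Dₛ ⊗ A ⊗ B)) (Tr (D₀ ⊗ A′ ᵀ)) ⟩
          cTrace A A′ + Tr (Dₛ ⊗ A ⊗ B) ∎

        -- The last m rows of Dₛ A are zero. Symmetry forces its last m columns to be zero as well,
        -- that is A₁₂ = 0, and makes A₁₁ symmetric.
        corner⇒ : ∀ {A} → Symm (Dₛ ⊗ A) → a₁₂ A ≡ 𝟘 × Symm (a₁₁ A)
        corner⇒ {A} h = trans (sym (proj₁ (proj₂ t))) 𝟘ᵀ , proj₁ t
          where t = symm-blk⇒ (subst Symm (trans (cong (Dₛ ⊗_) (η A)) (Dₛ-⊗ (a₁₁ A) (a₁₂ A) (a₂₁ A) (a₂₂ A))) h)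

        corner⇐ : ∀ {A} → a₁₂ A ≡ 𝟘 → Symm (a₁₁ A) → Symm (Dₛ ⊗ A)
        corner⇐ {A} z h = subst Symm (sym (trans (cong (Dₛ ⊗_) (lower-form z)) (Dₛ-⊗ (a₁₁ A) 𝟘 (a₂₁ A) (a₂₂ A)))) (symm-blk⇐ h 𝟘ᵀ 𝟘ᵀ 𝟘ᵀ)

        card-symm-pairs : ∀ {R : Mat m m → Mat m m → Set} {k} → Card (λ d → ∃ λ d′ → d ⊗ d′ ≡ 𝟙 m × R d d′) k →
          Card {Mat N N × Mat N N} (λ p → proj₁ p ⊗ proj₂ p ≡ 𝟙 N × Symm (Dₛ ⊗ proj₁ p) × R (a₂₂ (proj₁ p)) (a₂₂ (proj₂ p))) (sy q s ℕ.* ((q ℕ.^ s) ℕ.^ m ℕ.* k))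
        card-symm-pairs {R} cd = card-iff (card-inverse-pairs {R = λ A A′ → (a₁₂ A ≡ 𝟘 × Symm (a₁₁ A)) × R (a₂₂ A) (a₂₂ A′)}
            (card-lower {L = Symm} {R = R} (card-iff (card-Sy s) (λ _ (x , y) → y , x) (λ _ (y , x) → x , y)) cd))
          (λ { _ (e , (z , h) , x) → e , corner⇐ z h , x }) (λ { _ (e , h , x) → e , corner⇒ h , x })

      IsDC : Mat (N ℕ.+ N) (N ℕ.+ N) → Set
      IsDC g = ∃ λ p₁ → ∃ λ p₂ → IsP {N} p₁ × IsP {N} p₂ × g ≡ p₁ ⊗ Sg ⊗ p₂

      -- The pairs (p₁ , p₂) of P with p₁ σ p₂ of trace β are counted along p₁ σ p₂ and along p₂ p₁.
      module Count {β : Carrier} {κ : ℕ} (card-κ : Card (InvTrace {m} β) κ) where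
        symmPairs allSymmPairs : ℕ
        symmPairs = sy q s ℕ.* ((q ℕ.^ s) ℕ.^ m ℕ.* κ)
        allSymmPairs = sy q s ℕ.* ((q ℕ.^ s) ℕ.^ m ℕ.* gl q m)

        private
          pairs : Card {Mat N N × Mat N N} (λ p → proj₁ p ⊗ proj₂ p ≡ 𝟙 N × ⊤) (gl q N)
          pairs = card-inverse-pairs {R = λ _ _ → ⊤} (card-iff (card-GL N) (λ _ (d′ , e) → d′ , e , tt) (λ _ (d′ , e , _) → d′ , e))

          symm : Card {Mat N N × Mat N N} (λ p → (proj₁ p ⊗ proj₂ p ≡ 𝟙 N × ⊤) × Symm (Dₛ ⊗ proj₁ p)) allSymmPairs
          symm = card-iff (card-symm-pairs {R = λ _ _ → ⊤} (card-iff (card-GL m) (λ _ (d′ , e) → d′ , e , tt) (λ _ (d′ , e , _) → d′ , e)))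
            (λ { _ (e , h , _) → (e , tt) , h }) (λ { _ ((e , _) , h) → e , h , tt })

          others : ∃ λ k → Card {Mat N N × Mat N N} (λ p → (proj₁ p ⊗ proj₂ p ≡ 𝟙 N × ⊤) × ¬ Symm (Dₛ ⊗ proj₁ p)) k × allSymmPairs ℕ.+ k ≡ gl q N
          others = card-minus pairs (λ p → ((Dₛ ⊗ proj₁ p) ᵀ) ≟ᴹ (Dₛ ⊗ proj₁ p)) symm

          nz = proj₁ others
          instance q≢0 = ℕ.>-nonZero (ℕP.≤-trans (s≤s z≤n) 2≤q)
          -- The common size of the level sets. The division is exact as soon as one pair with
          -- nonzero form exists, by `card-alt-level`; if there is none, `nz` is 0 and `qu` holds
          -- trivially.
          u = al q N ℕ./ q

          level : ∀ p → ¬ Symm (Dₛ ⊗ proj₁ p) → Card (λ B → Alt B × cTrace (proj₁ p) (proj₂ p) + Tr (Dₛ ⊗ proj₁ p ⊗ B) ≡ β) u × q ℕ.* u ≡ al q N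
          level (A , A′) ns = card-iff (card-subst u≡ (proj₁ (proj₂ lev) (c + β)))
              (λ B (b , t) → b , trans (cong (λ w → c + w) t) (solve 2 (λ c b → c :+ (c :+ b) := b) refl c β))
              (λ B (b , t) → b , trans (solve 2 (λ c x → x := c :+ (c :+ x)) refl c _) (cong (λ w → c + w) t))
            , trans (cong (q ℕ.*_) (sym u≡)) (proj₂ (proj₂ lev))
            where
            c = cTrace A A′
            lev = card-alt-level {C = Dₛ ⊗ A} ns
            u≡ : proj₁ lev ≡ u
            u≡ = trans (sym (Data.Nat.DivMod.m*n/n≡m (proj₁ lev) q)) (cong (ℕ._/ q) (trans (ℕP.*-comm (proj₁ lev) q) (proj₂ (proj₂ lev))))
              where import Data.Nat.DivMod

          qu : q ℕ.* (nz ℕ.* u) ≡ nz ℕ.* al q N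
          qu = go nz (proj₁ (proj₂ others))
            where
            go : ∀ k → Card {Mat N N × Mat N N} (λ p → (proj₁ p ⊗ proj₂ p ≡ 𝟙 N × ⊤) × ¬ Symm (Dₛ ⊗ proj₁ p)) k → q ℕ.* (k ℕ.* u) ≡ k ℕ.* al q N
            go zero _ = ℕP.*-zeroʳ q
            go k@(suc _) c = let (p , _ , ns) = card-inhabited (s≤s z≤n) c in
              trans (swap q k u) (cong (k ℕ.*_) (proj₂ (level p ns)))
              where
              swap : ∀ q k u → q ℕ.* (k ℕ.* u) ≡ k ℕ.* (q ℕ.* u)
              swap = solve-∀

          W = symmPairs ℕ.* al q N ℕ.+ nz ℕ.* u

          card-W : Card (λ p → IsP {N} p × Tr (Sg ⊗ p) ≡ β) W
          card-W = card-P {N} {Q = λ { ((A , A′) , B) → cTrace A A′ + Tr (Dₛ ⊗ A ⊗ B) ≡ β }} (card-⊎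
              (card-× (card-symm-pairs {R = λ d d′ → Tr d + Tr d′ ≡ β} card-κ) (card-Alt N))
              (card-Σ (proj₁ (proj₂ others)) (λ p (_ , ns) → proj₁ (level p ns)))
              (λ { _ ((_ , h , _) , _) ((_ , ns) , _) → ns h })
              (λ { ((A , A′) , B) ((e , h , t) , b) → (e , b) , trans (cong₂ _+_ (cTrace≡ A A′) (Tr-symm-alt h b)) (trans (+-identityʳ _) t) })
              (λ { _ (((e , _) , _) , b , t) → (e , b) , t })
              cov)
            (λ { ((A , A′) , B) _ t → trans (Tr-param A A′ B) t }) (λ { ((A , A′) , B) _ t → trans (sym (Tr-param A A′ B)) t })
            where
            cov : ∀ t → IsTriple t × (cTrace (proj₁ (proj₁ t)) (proj₂ (proj₁ t)) + Tr (Dₛ ⊗ proj₁ (proj₁ t) ⊗ proj₂ t) ≡ β) → let ((A , A′) , B) = t in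
              ((A ⊗ A′ ≡ 𝟙 N × Symm (Dₛ ⊗ A) × Tr (a₂₂ A) + Tr (a₂₂ A′) ≡ β) × Alt B) ⊎
              (((A ⊗ A′ ≡ 𝟙 N × ⊤) × ¬ Symm (Dₛ ⊗ A)) × Alt B × cTrace A A′ + Tr (Dₛ ⊗ A ⊗ B) ≡ β)
            cov ((A , A′) , B) ((e , b) , t) with ((Dₛ ⊗ A) ᵀ) ≟ᴹ (Dₛ ⊗ A)
            ... | yes h = inj₁ ((e , h , trans (sym (trans (cong₂ _+_ (cTrace≡ A A′) (Tr-symm-alt h b)) (+-identityʳ _))) t) , b)
            ... | no ns = inj₂ (((e , tt) , ns) , b , t)

          Pairs : Set
          Pairs = Mat (N ℕ.+ N) (N ℕ.+ N) × Mat (N ℕ.+ N) (N ℕ.+ N)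

          PairTrace : Pairs → Set
          PairTrace (p₁ , p₂) = IsP {N} p₁ × IsP {N} p₂ × Tr (p₁ ⊗ Sg ⊗ p₂) ≡ β

          card-pairs : Card PairTrace (gl q N ℕ.* al q N ℕ.* W)
          card-pairs = card-bij (card-× card-P-all card-W)
            (λ (p₁ , w) → p₁ , w ⊗ inverseP {N} p₁) (λ (p₁ , p₂) → p₁ , p₂ ⊗ p₁)
            (λ (p₁ , w) (h₁ , h , t) → h₁ , P-⊗ {N} h (inverse-P {N} h₁) , trans (Tr-comm (p₁ ⊗ Sg) (w ⊗ inverseP {N} p₁))
              (trans (cong Tr (trans (sym (⊗-assoc (w ⊗ inverseP {N} p₁) p₁ Sg)) (cong (_⊗ Sg) (undo⁻ h₁ w)))) (trans (Tr-comm w Sg) t)))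
            (λ (p₁ , p₂) (h₁ , h₂ , t) → h₁ , P-⊗ {N} h₂ h₁ , trans (Tr-comm Sg (p₂ ⊗ p₁)) (trans (cong Tr (⊗-assoc p₂ p₁ Sg)) (trans (Tr-comm p₂ (p₁ ⊗ Sg)) t)))
            (λ (p₁ , w) (h₁ , _) → cong (p₁ ,_) (undo⁻ h₁ w)) (λ (p₁ , p₂) (h₁ , _) → cong (p₁ ,_) (undo h₁ p₂))
            where
            undo : ∀ {p} → IsP {N} p → ∀ w → w ⊗ p ⊗ inverseP {N} p ≡ w
            undo {p} h w = trans (⊗-assoc w p (inverseP {N} p)) (trans (cong (w ⊗_) (P-inverse {N} h)) (⊗-identityʳ w))
            undo⁻ : ∀ {p} → IsP {N} p → ∀ w → w ⊗ inverseP {N} p ⊗ p ≡ w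
            undo⁻ {p} h w = trans (⊗-assoc w (inverseP {N} p) p) (trans (cong (w ⊗_) (P-inverseˡ {N} h)) (⊗-identityʳ w))

          -- x σ y = σ says that σ y σ is the inverse of x. So z = σ y σ determines the pair, and it
          -- ranges over P ∩ σPσ.
          card-fibre-σ : Card {Pairs} (λ (x , y) → IsP {N} x × IsP {N} y × x ⊗ Sg ⊗ y ≡ Sg) stabiliserOrder
          card-fibre-σ = card-bij card-stable (λ z → inverseP {N} z , Sg ⊗ z ⊗ Sg) (λ (x , y) → Sg ⊗ y ⊗ Sg)
            (λ z (h , h′) → inverse-P {N} h , h′ , (begin
              inverseP {N} z ⊗ Sg ⊗ (Sg ⊗ z ⊗ Sg)   ≡⟨ trans (⊗-assoc (inverseP {N} z) Sg (Sg ⊗ z ⊗ Sg)) (cong (inverseP {N} z ⊗_) (trans (cong (Sg ⊗_) (⊗-assoc Sg z Sg)) (cancel-Sg (z ⊗ Sg)))) ⟩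
              inverseP {N} z ⊗ (z ⊗ Sg)             ≡⟨ trans (sym (⊗-assoc (inverseP {N} z) z Sg)) (trans (cong (_⊗ Sg) (P-inverseˡ {N} h)) (⊗-identityˡ Sg)) ⟩
              Sg                                    ∎))
            (λ (x , y) (hx , hy , e) → subst (IsP {N}) (sym (inverse-x hx e)) (inverse-P {N} hx) , subst (IsP {N}) (sym (double y)) hy)
            (λ z _ → double z)
            (λ (x , y) (hx , hy , e) → cong₂ _,_ (trans (cong (inverseP {N}) (inverse-x hx e)) (inverse² hx)) (double y))
            where
            double : ∀ y → Sg ⊗ (Sg ⊗ y ⊗ Sg) ⊗ Sg ≡ y
            double y = trans (cong (_⊗ Sg) (trans (cong (Sg ⊗_) (⊗-assoc Sg y Sg)) (cancel-Sg (y ⊗ Sg)))) (trans (⊗-assoc y Sg Sg) (trans (cong (y ⊗_) Sg²) (⊗-identityʳ y)))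
            x-inverse : ∀ {x y} → x ⊗ Sg ⊗ y ≡ Sg → x ⊗ (Sg ⊗ y ⊗ Sg) ≡ 𝟙 (N ℕ.+ N)
            x-inverse {x} {y} e = trans (sym (⊗-assoc x (Sg ⊗ y) Sg)) (trans (cong (_⊗ Sg) (trans (sym (⊗-assoc x Sg y)) e)) Sg²)
            inverse-x : ∀ {x y} → IsP {N} x → x ⊗ Sg ⊗ y ≡ Sg → Sg ⊗ y ⊗ Sg ≡ inverseP {N} x
            inverse-x hx e = inverse-unique (x-inverse e) (P-inverse {N} hx)
            inverse² : ∀ {x} → IsP {N} x → inverseP {N} (inverseP {N} x) ≡ x
            inverse² hx = inverse-unique (P-inverse {N} (inverse-P {N} hx)) (P-inverseˡ {N} hx)

          card-fibre : ∀ {p₁ p₂} → IsP {N} p₁ → IsP {N} p₂ →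
            Card {Pairs} (λ (x , y) → IsP {N} x × IsP {N} y × x ⊗ Sg ⊗ y ≡ p₁ ⊗ Sg ⊗ p₂) stabiliserOrder
          card-fibre {p₁} {p₂} h₁ h₂ = card-bij card-fibre-σ (λ (x , y) → p₁ ⊗ x , y ⊗ p₂) (λ (x , y) → inverseP {N} p₁ ⊗ x , y ⊗ inverseP {N} p₂)
            (λ (x , y) (hx , hy , e) → P-⊗ {N} h₁ hx , P-⊗ {N} hy h₂ , trans (regroup p₁ x y p₂) (cong (λ g → p₁ ⊗ g ⊗ p₂) e))
            (λ (x , y) (hx , hy , e) → P-⊗ {N} (inverse-P {N} h₁) hx , P-⊗ {N} hy (inverse-P {N} h₂) , (begin
              inverseP {N} p₁ ⊗ x ⊗ Sg ⊗ (y ⊗ inverseP {N} p₂)     ≡⟨ regroup (inverseP {N} p₁) x y (inverseP {N} p₂) ⟩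
              inverseP {N} p₁ ⊗ (x ⊗ Sg ⊗ y) ⊗ inverseP {N} p₂     ≡⟨ cong (λ g → inverseP {N} p₁ ⊗ g ⊗ inverseP {N} p₂) e ⟩
              inverseP {N} p₁ ⊗ (p₁ ⊗ Sg ⊗ p₂) ⊗ inverseP {N} p₂   ≡⟨ cong (_⊗ inverseP {N} p₂) (trans (cong (inverseP {N} p₁ ⊗_) (⊗-assoc p₁ Sg p₂)) (trans (sym (⊗-assoc (inverseP {N} p₁) p₁ (Sg ⊗ p₂))) (trans (cong (_⊗ (Sg ⊗ p₂)) (P-inverseˡ {N} h₁)) (⊗-identityˡ (Sg ⊗ p₂))))) ⟩
              Sg ⊗ p₂ ⊗ inverseP {N} p₂                            ≡⟨ trans (⊗-assoc Sg p₂ (inverseP {N} p₂)) (trans (cong (Sg ⊗_) (P-inverse {N} h₂)) (⊗-identityʳ Sg)) ⟩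
              Sg                                                   ∎))
            (λ (x , y) _ → cong₂ _,_ (left (P-inverseˡ {N} h₁) x) (right (P-inverse {N} h₂) y))
            (λ (x , y) _ → cong₂ _,_ (left (P-inverse {N} h₁) x) (right (P-inverseˡ {N} h₂) y))
            where
            regroup : ∀ a x y b → a ⊗ x ⊗ Sg ⊗ (y ⊗ b) ≡ a ⊗ (x ⊗ Sg ⊗ y) ⊗ b
            regroup a x y b = trans (sym (⊗-assoc (a ⊗ x ⊗ Sg) y b)) (cong (_⊗ b) (trans (cong (_⊗ y) (⊗-assoc a x Sg)) (⊗-assoc a (x ⊗ Sg) y)))
            left : ∀ {a b} → a ⊗ b ≡ 𝟙 (N ℕ.+ N) → ∀ x → a ⊗ (b ⊗ x) ≡ x
            left {a} {b} e x = trans (sym (⊗-assoc a b x)) (trans (cong (_⊗ x) e) (⊗-identityˡ x))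
            right : ∀ {a b} → a ⊗ b ≡ 𝟙 (N ℕ.+ N) → ∀ x → x ⊗ a ⊗ b ≡ x
            right {a} {b} e x = trans (⊗-assoc x a b) (trans (cong (x ⊗_) e) (⊗-identityʳ x))

        -- Counting pairs in two ways gives Nβ |P ∩ σPσ| = |P| W, where q W = |P| + |Alt| (q
        -- `symmPairs` - `allSymmPairs`). The statement is this equation times q, with the negative
        -- term moved to the left.
        trace-count : ∀ {Nβ} → Card (λ g → IsDC g × Tr g ≡ β) Nβ →
          q ℕ.* (Nβ ℕ.* stabiliserOrder) ℕ.+ gl q N ℕ.* al q N ℕ.* (allSymmPairs ℕ.* al q N)
            ≡ gl q N ℕ.* al q N ℕ.* (q ℕ.* (symmPairs ℕ.* al q N) ℕ.+ gl q N ℕ.* al q N)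
        trace-count {Nβ} cN = begin
          q ℕ.* (Nβ ℕ.* stabiliserOrder) ℕ.+ P ℕ.* (allSymmPairs ℕ.* al q N) ≡⟨ cong (λ z → q ℕ.* z ℕ.+ P ℕ.* (allSymmPairs ℕ.* al q N)) two-ways ⟨
          q ℕ.* (P ℕ.* W) ℕ.+ P ℕ.* (allSymmPairs ℕ.* al q N) ≡⟨ arith₁ q P symmPairs (al q N) (nz ℕ.* u) allSymmPairs ⟩
          P ℕ.* (q ℕ.* (symmPairs ℕ.* al q N) ℕ.+ (q ℕ.* (nz ℕ.* u) ℕ.+ allSymmPairs ℕ.* al q N))
            ≡⟨ cong (λ z → P ℕ.* (q ℕ.* (symmPairs ℕ.* al q N) ℕ.+ z)) (trans (cong (ℕ._+ allSymmPairs ℕ.* al q N) qu)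
                 (trans (arith₂ nz allSymmPairs (al q N)) (cong (ℕ._* al q N) (proj₂ (proj₂ others))))) ⟩
          P ℕ.* (q ℕ.* (symmPairs ℕ.* al q N) ℕ.+ gl q N ℕ.* al q N) ∎
          where
          P = gl q N ℕ.* al q N
          two-ways : P ℕ.* W ≡ Nβ ℕ.* stabiliserOrder
          two-ways = card-fibres card-pairs cN (λ (p₁ , p₂) → p₁ ⊗ Sg ⊗ p₂) (λ (p₁ , p₂) (h₁ , h₂ , t) → (p₁ , p₂ , h₁ , h₂ , refl) , t)
            (λ { _ ((p₁ , p₂ , h₁ , h₂ , refl) , t) → card-iff (card-fibre h₁ h₂)
              (λ { _ (hx , hy , e) → (hx , hy , trans (cong Tr e) t) , e }) (λ { _ ((hx , hy , _) , e) → hx , hy , e }) })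
          arith₁ : ∀ q P z a w y → q ℕ.* (P ℕ.* (z ℕ.* a ℕ.+ w)) ℕ.+ P ℕ.* (y ℕ.* a) ≡ P ℕ.* (q ℕ.* (z ℕ.* a) ℕ.+ (q ℕ.* w ℕ.+ y ℕ.* a))
          arith₁ = solve-∀
          arith₂ : ∀ n y a → n ℕ.* a ℕ.+ y ℕ.* a ≡ (y ℕ.+ n) ℕ.* a
          arith₂ = solve-∀

  -- Agreement of the block description with the given matrices and groups.

  module DefsLink where

    import Defs
    open Defs using (FiniteField)
    open FieldBasics
    open Matrices
    open DoubleCosets
    open CosetCounts
    open import Data.Nat as ℕ using (ℕ; zero; suc; _≤_; _<_)
    import Data.Nat.Properties as ℕP
    open import Data.Fin as Fin using (Fin; zero; suc; _↑ˡ_; _↑ʳ_; toℕ)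
    import Data.Fin.Properties as FinP
    open import Data.Bool using (if_then_else_)
    open import Data.Product using (∃; _×_; _,_; proj₁; proj₂)
    open import Relation.Nullary using (¬_; Dec; yes; no; does)
    open import Relation.Nullary.Decidable using (dec-true; dec-false)
    open import Relation.Binary.PropositionalEquality hiding (J)
    open import Function using (_∘_)

    module Link (s m : ℕ) where
      open Field-F
      open Mats
      open Forms
      open Coset s m

      private
        σperm = Defs.σperm F N s

        σperm₁ : ∀ x → x < s → σperm x ≡ x ℕ.+ N
        σperm₁ x h rewrite dec-true (x ℕ.<? s) h = refl

        σperm₂ : ∀ x → ¬ x < s → x < N → σperm x ≡ x
        σperm₂ x h l rewrite dec-false (x ℕ.<? s) h | dec-false (N ℕ.≤? x) (ℕP.<⇒≱ l) = refl

        σperm₃ : ∀ x → ¬ x < s → N ≤ x → x < N ℕ.+ s → σperm x ≡ x ℕ.∸ N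
        σperm₃ x h l u rewrite dec-false (x ℕ.<? s) h | dec-true (N ℕ.≤? x) l | dec-true (x ℕ.<? N ℕ.+ s) u = refl

        σperm₄ : ∀ x → ¬ x < s → N ≤ x → ¬ x < N ℕ.+ s → σperm x ≡ x
        σperm₄ x h l u rewrite dec-false (x ℕ.<? s) h | dec-true (N ℕ.≤? x) l | dec-false (x ℕ.<? N ℕ.+ s) u = refl

        ent-σ : ∀ i (k j : Fin (N ℕ.+ N)) → σperm (toℕ i) ≡ toℕ k → ent (Defs.σ F N s) i j ≡ δ k j
        ent-σ i k j e = trans (ent-mk (λ i j → if does (toℕ j ℕ.≟ σperm (toℕ i)) then 1# else 0#) i j)
          (trans (cong (λ z → if does (toℕ j ℕ.≟ z) then 1# else 0#) e) (compare (k Fin.≟ j)))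
          where
          compare : Dec (k ≡ j) → (if does (toℕ j ℕ.≟ toℕ k) then 1# else 0#) ≡ δ k j
          compare (yes refl) = trans (cong (λ b → if b then 1# else 0#) (dec-true (toℕ k ℕ.≟ toℕ k) refl)) (sym (δ-refl k))
          compare (no n) = trans (cong (λ b → if b then 1# else 0#) (dec-false (toℕ j ℕ.≟ toℕ k) (n ∘ sym ∘ FinP.toℕ-injective))) (sym (δ-≢ n))

        D₀-row₁ : ∀ (x : Fin s) j → ent D₀ (x ↑ˡ m) j ≡ 0#
        D₀-row₁ x = fin-split s _ (λ j → trans (ent-blk₁₁ 𝟘 𝟘 𝟘 (𝟙 m) x j) (ent-𝟘 x j)) (λ j → trans (ent-blk₁₂ 𝟘 𝟘 𝟘 (𝟙 m) x j) (ent-𝟘 x j))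

        D₀-row₂ : ∀ (x : Fin m) j → ent D₀ (s ↑ʳ x) j ≡ δ (s ↑ʳ x) j
        D₀-row₂ x = fin-split s _ (λ j → trans (ent-blk₂₁ 𝟘 𝟘 𝟘 (𝟙 m) x j) (trans (ent-𝟘 x j) (sym (δ-≢ (↑ˡ≢↑ʳ m j x ∘ sym)))))
          (λ j → trans (ent-blk₂₂ 𝟘 𝟘 𝟘 (𝟙 m) x j) (trans (ent-𝟙 x j) (sym (δ-cong (s ↑ʳ_) (FinP.↑ʳ-injective s _ _) x j))))

        Dₛ-row₁ : ∀ (x : Fin s) j → ent Dₛ (x ↑ˡ m) j ≡ δ (x ↑ˡ m) j
        Dₛ-row₁ x = fin-split s _ (λ j → trans (ent-blk₁₁ (𝟙 s) 𝟘 𝟘 𝟘 x j) (trans (ent-𝟙 x j) (sym (δ-cong (_↑ˡ m) (FinP.↑ˡ-injective m _ _) x j))))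
          (λ j → trans (ent-blk₁₂ (𝟙 s) 𝟘 𝟘 𝟘 x j) (trans (ent-𝟘 x j) (sym (δ-≢ (↑ˡ≢↑ʳ m x j)))))

        Dₛ-row₂ : ∀ (x : Fin m) j → ent Dₛ (s ↑ʳ x) j ≡ 0#
        Dₛ-row₂ x = fin-split s _ (λ j → trans (ent-blk₂₁ (𝟙 s) 𝟘 𝟘 𝟘 x j) (ent-𝟘 x j)) (λ j → trans (ent-blk₂₂ (𝟙 s) 𝟘 𝟘 𝟘 x j) (ent-𝟘 x j))

        δ-ˡˡ : ∀ (i j : Fin N) → δ i j ≡ δ (i ↑ˡ N) (j ↑ˡ N)
        δ-ˡˡ i j = sym (δ-cong (_↑ˡ N) (FinP.↑ˡ-injective N _ _) i j)

        δ-ʳʳ : ∀ (i j : Fin N) → δ i j ≡ δ (N ↑ʳ i) (N ↑ʳ j)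
        δ-ʳʳ i j = sym (δ-cong (N ↑ʳ_) (FinP.↑ʳ-injective N _ _) i j)

        δ-ˡʳ : ∀ (i j : Fin N) → 0# ≡ δ (i ↑ˡ N) (N ↑ʳ j)
        δ-ˡʳ i j = sym (δ-≢ (↑ˡ≢↑ʳ N i j))

        δ-ʳˡ : ∀ (i j : Fin N) → 0# ≡ δ (N ↑ʳ i) (j ↑ˡ N)
        δ-ʳˡ i j = sym (δ-≢ (↑ˡ≢↑ʳ N j i ∘ sym))

        Row : Fin (N ℕ.+ N) → Set
        Row i = ∀ j → ent (Defs.σ F N s) i j ≡ ent Sg i j

        row : ∀ i k → σperm (toℕ i) ≡ toℕ k → (∀ j → ent Sg i j ≡ δ k j) → Row i
        row i k e h j = trans (ent-σ i k j e) (sym (h j))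

        row₁ : ∀ x → Row ((x ↑ˡ m) ↑ˡ N)
        row₁ x = row _ (N ↑ʳ (x ↑ˡ m)) (trans (cong σperm ix) (trans (σperm₁ (toℕ x) (FinP.toℕ<n x))
            (trans (ℕP.+-comm (toℕ x) N) (sym (trans (FinP.toℕ-↑ʳ N (x ↑ˡ m)) (cong (N ℕ.+_) (FinP.toℕ-↑ˡ x m)))))))
          (fin-split N _ (λ j → trans (ent-blk₁₁ D₀ Dₛ Dₛ D₀ (x ↑ˡ m) j) (trans (D₀-row₁ x j) (δ-ʳˡ (x ↑ˡ m) j)))
                         (λ j → trans (ent-blk₁₂ D₀ Dₛ Dₛ D₀ (x ↑ˡ m) j) (trans (Dₛ-row₁ x j) (δ-ʳʳ (x ↑ˡ m) j))))
          where
          ix : toℕ ((x ↑ˡ m) ↑ˡ N) ≡ toℕ x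
          ix = trans (FinP.toℕ-↑ˡ (x ↑ˡ m) N) (FinP.toℕ-↑ˡ x m)

        row₂ : ∀ x → Row ((s ↑ʳ x) ↑ˡ N)
        row₂ x = row _ ((s ↑ʳ x) ↑ˡ N) (trans (cong σperm ix) (trans (σperm₂ (s ℕ.+ toℕ x) (λ h → ℕP.<⇒≱ h (ℕP.m≤m+n s (toℕ x))) (ℕP.+-monoʳ-< s (FinP.toℕ<n x))) (sym ix)))
          (fin-split N _ (λ j → trans (ent-blk₁₁ D₀ Dₛ Dₛ D₀ (s ↑ʳ x) j) (trans (D₀-row₂ x j) (δ-ˡˡ (s ↑ʳ x) j)))
                         (λ j → trans (ent-blk₁₂ D₀ Dₛ Dₛ D₀ (s ↑ʳ x) j) (trans (Dₛ-row₂ x j) (δ-ˡʳ (s ↑ʳ x) j))))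
          where
          ix : toℕ ((s ↑ʳ x) ↑ˡ N) ≡ s ℕ.+ toℕ x
          ix = trans (FinP.toℕ-↑ˡ (s ↑ʳ x) N) (FinP.toℕ-↑ʳ s x)

        row₃ : ∀ x → Row (N ↑ʳ (x ↑ˡ m))
        row₃ x = row _ ((x ↑ˡ m) ↑ˡ N) (trans (cong σperm ix) (trans (σperm₃ (N ℕ.+ toℕ x)
            (λ h → ℕP.<⇒≱ h (ℕP.≤-trans (ℕP.m≤m+n s m) (ℕP.m≤m+n N (toℕ x)))) (ℕP.m≤m+n N (toℕ x)) (ℕP.+-monoʳ-< N (FinP.toℕ<n x)))
            (trans (ℕP.m+n∸m≡n N (toℕ x)) (sym (trans (FinP.toℕ-↑ˡ (x ↑ˡ m) N) (FinP.toℕ-↑ˡ x m))))))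
          (fin-split N _ (λ j → trans (ent-blk₂₁ D₀ Dₛ Dₛ D₀ (x ↑ˡ m) j) (trans (Dₛ-row₁ x j) (δ-ˡˡ (x ↑ˡ m) j)))
                         (λ j → trans (ent-blk₂₂ D₀ Dₛ Dₛ D₀ (x ↑ˡ m) j) (trans (D₀-row₁ x j) (δ-ˡʳ (x ↑ˡ m) j))))
          where
          ix : toℕ (N ↑ʳ (x ↑ˡ m)) ≡ N ℕ.+ toℕ x
          ix = trans (FinP.toℕ-↑ʳ N (x ↑ˡ m)) (cong (N ℕ.+_) (FinP.toℕ-↑ˡ x m))

        row₄ : ∀ x → Row (N ↑ʳ (s ↑ʳ x))
        row₄ x = row _ (N ↑ʳ (s ↑ʳ x)) (trans (cong σperm ix) (trans (σperm₄ (N ℕ.+ (s ℕ.+ toℕ x))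
            (λ h → ℕP.<⇒≱ h (ℕP.≤-trans (ℕP.m≤m+n s m) (ℕP.m≤m+n N _))) (ℕP.m≤m+n N _) (λ h → ℕP.<⇒≱ h (ℕP.+-monoʳ-≤ N (ℕP.m≤m+n s (toℕ x))))) (sym ix)))
          (fin-split N _ (λ j → trans (ent-blk₂₁ D₀ Dₛ Dₛ D₀ (s ↑ʳ x) j) (trans (Dₛ-row₂ x j) (δ-ʳˡ (s ↑ʳ x) j)))
                         (λ j → trans (ent-blk₂₂ D₀ Dₛ Dₛ D₀ (s ↑ʳ x) j) (trans (D₀-row₂ x j) (δ-ʳʳ (s ↑ʳ x) j))))
          where
          ix : toℕ (N ↑ʳ (s ↑ʳ x)) ≡ N ℕ.+ (s ℕ.+ toℕ x)
          ix = trans (FinP.toℕ-↑ʳ N (s ↑ʳ x)) (cong (N ℕ.+_) (FinP.toℕ-↑ʳ s x))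

      -- Compared row by row; the four ranges of row indices correspond to the cases in `σperm`.
      σ≡ : Defs.σ F N s ≡ Sg
      σ≡ = ext (fin-split N _ (fin-split s _ row₁ row₂) (fin-split s _ row₃ row₄))

      private
        IsPᴰ : Mat (N ℕ.+ N) (N ℕ.+ N) → Set
        IsPᴰ p = ∃ λ A → ∃ λ A′ → ∃ λ B → (A ⊗ A′ ≡ 𝟙 N × A′ ⊗ A ≡ 𝟙 N) × (B ᵀ ≡ B) × (∀ i → ent B i i ≡ 0#)
          × (p ≡ blk A 𝟘 𝟘 (A′ ᵀ) ⊗ blk (𝟙 N) B 𝟘 (𝟙 N))

        opaque
          unfolding _⊗_

          InP⇒ : ∀ p → Defs.InP F N p → IsPᴰ p
          InP⇒ p h = h

          InP⇐ : ∀ p → IsPᴰ p → Defs.InP F N p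
          InP⇐ p h = h

        factored : ∀ (A B D : Mat N N) → blk A 𝟘 𝟘 D ⊗ blk (𝟙 N) B 𝟘 (𝟙 N) ≡ blk A (A ⊗ B) 𝟘 D
        factored A B D = trans (blk-⊗ A 𝟘 𝟘 D (𝟙 N) B 𝟘 (𝟙 N)) (blk-cong
          (trans (cong₂ _⊞_ (⊗-identityʳ A) (𝟘⊗ 𝟘)) (⊞-identityʳ A)) (trans (cong (A ⊗ B ⊞_) (𝟘⊗ (𝟙 N))) (⊞-identityʳ (A ⊗ B)))
          (trans (cong₂ _⊞_ (𝟘⊗ (𝟙 N)) (⊗𝟘 D)) (⊞-identityˡ 𝟘)) (trans (cong₂ _⊞_ (𝟘⊗ B) (⊗-identityʳ D)) (⊞-identityˡ D)))

        P⇒ : ∀ {p} → Defs.InP F N p → IsP {N} p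
        P⇒ {p} h = subst (IsP {N}) (sym (trans e (factored A B (A′ ᵀ)))) (P-param {t = (A , A′) , B} (inv , symmetric , diagonal))
          where
          h′ = InP⇒ p h
          A = proj₁ h′
          A′ = proj₁ (proj₂ h′)
          B = proj₁ (proj₂ (proj₂ h′))
          rest = proj₂ (proj₂ (proj₂ h′))
          inv = proj₁ (proj₁ rest)
          symmetric = proj₁ (proj₂ rest)
          diagonal = proj₁ (proj₂ (proj₂ rest))
          e = proj₂ (proj₂ (proj₂ rest))

        P⇐ : ∀ {p} → IsP {N} p → Defs.InP F N p
        P⇐ {p} h = InP⇐ p (A , A′ , B , (inv , ⊗-left-inverse inv) , proj₁ alt , proj₂ alt ,
            sym (trans (factored A B (A′ ᵀ)) (param-coords {N} h)))
          where
          A = proj₁ (proj₁ (coords {N} p))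
          A′ = proj₂ (proj₁ (coords {N} p))
          B = proj₂ (coords {N} p)
          inv = proj₁ (coords-triple {N} h)
          alt = proj₂ (coords-triple {N} h)

      opaque
        unfolding _⊗_

        Tr≡ : ∀ {n} (A : Mat n n) → Defs.Tr F A ≡ Tr A
        Tr≡ A = refl

        private
          ⊗≡ : ∀ (p σ p′ : Mat (N ℕ.+ N) (N ℕ.+ N)) → Defs._⊗_ F (Defs._⊗_ F p σ) p′ ≡ p ⊗ σ ⊗ p′
          ⊗≡ p σ p′ = refl

      DC⇒ : ∀ {g} → Defs.InDC F N s g → IsDC g
      DC⇒ (p₁ , p₂ , h₁ , h₂ , e) = p₁ , p₂ , P⇒ h₁ , P⇒ h₂ , trans e (trans (⊗≡ p₁ _ p₂) (cong (λ σ → p₁ ⊗ σ ⊗ p₂) σ≡))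

      DC⇐ : ∀ {g} → IsDC g → Defs.InDC F N s g
      DC⇐ (p₁ , p₂ , h₁ , h₂ , e) = p₁ , p₂ , P⇐ h₁ , P⇐ h₂ , trans e (sym (trans (⊗≡ p₁ _ p₂) (cong (λ σ → p₁ ⊗ σ ⊗ p₂) σ≡)))

  -- Codewords of given weight and sums of products of binomial coefficients.

  module Words where

    import Defs
    open Defs using (FiniteField; families; allWords; hammingWeight)
    open CharTwo
    open FieldBasics
    open import Data.Nat as ℕ using (ℕ; zero; suc; _≤_; _<_; z≤n; s≤s)
    import Data.Nat.Properties as ℕP
    open import Data.Nat.Combinatorics using (_C_; nCn≡1; nCk≡nC[n∸k]; nCk+nC[k+1]≡[n+1]C[k+1])
    import Data.Nat.ListAction as ListAction
    open import Data.Nat.Tactic.RingSolver using (solve-∀)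
    open import Data.Fin as Fin using (Fin; zero; suc)
    open import Data.Bool using (Bool; true; false; if_then_else_)
    open import Data.List as List using (List; []; _∷_; length; filter; map; concatMap; upTo; allFin; _++_)
    import Data.List.Properties as ListP
    open import Data.Vec using (Vec; []; _∷_; lookup)
    open import Data.Product using (_,_)
    open import Data.Empty using (⊥-elim)
    open import Relation.Nullary using (¬_; Dec; yes; no; does)
    open import Relation.Nullary.Decidable using (_×-dec_; dec-true; dec-false)
    open import Relation.Unary using (Decidable)
    open import Relation.Binary.PropositionalEquality
    open import Function using (_∘_; id)

    private variable
      A B : Set

    nC0 : ∀ n → n C 0 ≡ 1
    nC0 n = trans (nCk≡nC[n∸k] {0} {n} z≤n) (nCn≡1 n)

    ind : {P : Set} → Dec P → ℕ → ℕ
    ind d x = if does d then x else 0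

    ind-yes : {P : Set} (d : Dec P) → P → ∀ x → ind d x ≡ x
    ind-yes d p x = cong (λ b → if b then x else 0) (dec-true d p)

    ind-no : {P : Set} (d : Dec P) → ¬ P → ∀ x → ind d x ≡ 0
    ind-no d n x = cong (λ b → if b then x else 0) (dec-false d n)

    ind-iff : {P Q : Set} (d : Dec P) (e : Dec Q) → (P → Q) → (Q → P) → ∀ x → ind d x ≡ ind e x
    ind-iff d (yes q) f g x = ind-yes d (g q) x
    ind-iff d (no n) f g x = ind-no d (n ∘ f) x

    Σᴸ : List A → (A → ℕ) → ℕ
    Σᴸ [] f = 0
    Σᴸ (x ∷ xs) f = f x ℕ.+ Σᴸ xs f

    Σᴸ-cong : ∀ (xs : List A) {f g} → f ≗ g → Σᴸ xs f ≡ Σᴸ xs g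
    Σᴸ-cong [] e = refl
    Σᴸ-cong (x ∷ xs) e = cong₂ ℕ._+_ (e x) (Σᴸ-cong xs e)

    Σᴸ-++ : ∀ (xs ys : List A) f → Σᴸ (xs ++ ys) f ≡ Σᴸ xs f ℕ.+ Σᴸ ys f
    Σᴸ-++ [] ys f = refl
    Σᴸ-++ (x ∷ xs) ys f = trans (cong (f x ℕ.+_) (Σᴸ-++ xs ys f)) (sym (ℕP.+-assoc (f x) _ _))

    Σᴸ-map : ∀ (g : A → B) xs f → Σᴸ (map g xs) f ≡ Σᴸ xs (f ∘ g)
    Σᴸ-map g [] f = refl
    Σᴸ-map g (x ∷ xs) f = cong (f (g x) ℕ.+_) (Σᴸ-map g xs f)

    Σᴸ-concatMap : ∀ (g : A → List B) xs f → Σᴸ (concatMap g xs) f ≡ Σᴸ xs (λ x → Σᴸ (g x) f)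
    Σᴸ-concatMap g [] f = refl
    Σᴸ-concatMap g (x ∷ xs) f = trans (Σᴸ-++ (g x) (concatMap g xs) f) (cong (Σᴸ (g x) f ℕ.+_) (Σᴸ-concatMap g xs f))

    Σᴸ-+ : ∀ (xs : List A) f g → Σᴸ xs (λ x → f x ℕ.+ g x) ≡ Σᴸ xs f ℕ.+ Σᴸ xs g
    Σᴸ-+ [] f g = refl
    Σᴸ-+ (x ∷ xs) f g = trans (cong (f x ℕ.+ g x ℕ.+_) (Σᴸ-+ xs f g)) (swap (f x) (g x) _ _)
      where
      swap : ∀ a b c d → a ℕ.+ b ℕ.+ (c ℕ.+ d) ≡ a ℕ.+ c ℕ.+ (b ℕ.+ d)
      swap = solve-∀

    Σᴸ-* : ∀ (xs : List A) c f → Σᴸ xs (λ x → c ℕ.* f x) ≡ c ℕ.* Σᴸ xs f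
    Σᴸ-* [] c f = sym (ℕP.*-zeroʳ c)
    Σᴸ-* (x ∷ xs) c f = trans (cong (c ℕ.* f x ℕ.+_) (Σᴸ-* xs c f)) (sym (ℕP.*-distribˡ-+ c (f x) _))

    Σᴸ-zero : ∀ (xs : List A) {f} → (∀ x → f x ≡ 0) → Σᴸ xs f ≡ 0
    Σᴸ-zero [] e = refl
    Σᴸ-zero (x ∷ xs) e = cong₂ ℕ._+_ (e x) (Σᴸ-zero xs e)

    Σᴸ-swap : ∀ (xs : List A) (ys : List B) (f : A → B → ℕ) → Σᴸ xs (λ x → Σᴸ ys (f x)) ≡ Σᴸ ys (λ y → Σᴸ xs (λ x → f x y))
    Σᴸ-swap [] ys f = sym (Σᴸ-zero ys λ _ → refl)
    Σᴸ-swap (x ∷ xs) ys f = trans (cong (Σᴸ ys (f x) ℕ.+_) (Σᴸ-swap xs ys f)) (sym (Σᴸ-+ ys (f x) (λ y → Σᴸ xs (λ x → f x y))))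

    length-filter : ∀ {P : A → Set} (P? : Decidable P) xs → length (filter P? xs) ≡ Σᴸ xs (λ x → ind (P? x) 1)
    length-filter P? [] = refl
    length-filter P? (x ∷ xs) with P? x
    ... | yes _ = cong suc (length-filter P? xs)
    ... | no _ = length-filter P? xs

    sum-map-filter : ∀ {P : A → Set} (P? : Decidable P) f xs → ListAction.sum (map f (filter P? xs)) ≡ Σᴸ xs (λ x → ind (P? x) (f x))
    sum-map-filter P? f [] = refl
    sum-map-filter P? f (x ∷ xs) with P? x
    ... | yes _ = cong (f x ℕ.+_) (sum-map-filter P? f xs)
    ... | no _ = sum-map-filter P? f xs

    Σ≤ : ℕ → (ℕ → ℕ) → ℕ
    Σ≤ zero f = f 0
    Σ≤ (suc j) f = f 0 ℕ.+ Σ≤ j (f ∘ suc)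

    Σ≤-cong : ∀ j {f g} → (∀ a → a ≤ j → f a ≡ g a) → Σ≤ j f ≡ Σ≤ j g
    Σ≤-cong zero e = e 0 z≤n
    Σ≤-cong (suc j) e = cong₂ ℕ._+_ (e 0 z≤n) (Σ≤-cong j (λ a h → e (suc a) (s≤s h)))

    Σ≤-+ : ∀ j f g → Σ≤ j (λ a → f a ℕ.+ g a) ≡ Σ≤ j f ℕ.+ Σ≤ j g
    Σ≤-+ zero f g = refl
    Σ≤-+ (suc j) f g = trans (cong (f 0 ℕ.+ g 0 ℕ.+_) (Σ≤-+ j (f ∘ suc) (g ∘ suc))) (swap (f 0) (g 0) _ _)
      where
      swap : ∀ a b c d → a ℕ.+ b ℕ.+ (c ℕ.+ d) ≡ a ℕ.+ c ℕ.+ (b ℕ.+ d)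
      swap = solve-∀

    Σ≤-snoc : ∀ i f → Σ≤ (suc i) f ≡ Σ≤ i f ℕ.+ f (suc i)
    Σ≤-snoc zero f = refl
    Σ≤-snoc (suc i) f = trans (cong (f 0 ℕ.+_) (Σ≤-snoc i (f ∘ suc))) (sym (ℕP.+-assoc (f 0) _ _))

    Σ≤-upTo : ∀ {j J} f → j ≤ J → (∀ a → j < a → f a ≡ 0) → Σᴸ (upTo (suc J)) f ≡ Σ≤ j f
    Σ≤-upTo {j} {J} f h z = go j J id h (λ a l → z a l)
      where
      go : ∀ j J (g : ℕ → ℕ) → j ≤ J → (∀ a → j < a → f (g a) ≡ 0) → Σᴸ (List.applyUpTo g (suc J)) f ≡ Σ≤ j (f ∘ g)
      go zero zero g h z = ℕP.+-identityʳ _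
      go zero (suc J) g h z = trans (cong (f (g 0) ℕ.+_) (zeroes (suc J) (g ∘ suc) (λ a → z (suc a) (s≤s z≤n)))) (ℕP.+-identityʳ _)
        where
        zeroes : ∀ n (g : ℕ → ℕ) → (∀ a → f (g a) ≡ 0) → Σᴸ (List.applyUpTo g n) f ≡ 0
        zeroes zero g e = refl
        zeroes (suc n) g e = cong₂ ℕ._+_ (e 0) (zeroes n (g ∘ suc) (e ∘ suc))
      go (suc j) (suc J) g (s≤s h) z = cong (f (g 0) ℕ.+_) (go j J (g ∘ suc) h (λ a l → z (suc a) (s≤s l)))

    foldF : {B : Set} → (B → B → B) → B → ∀ {n} → (Fin n → B) → B
    foldF _⊕_ e {zero} f = e
    foldF _⊕_ e {suc n} f = f zero ⊕ foldF _⊕_ e (f ∘ suc)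

    foldr-allFin : ∀ {B : Set} (_⊕_ : B → B → B) e {n} (f : Fin n → B) → List.foldr (λ k acc → f k ⊕ acc) e (allFin n) ≡ foldF _⊕_ e f
    foldr-allFin _⊕_ e {n} f = go id
      where
      go : ∀ {m} (g : Fin m → Fin n) → List.foldr (λ k acc → f k ⊕ acc) e (List.tabulate g) ≡ foldF _⊕_ e (f ∘ g)
      go {zero} g = refl
      go {suc m} g = cong (f (g zero) ⊕_) (go (g ∘ suc))

    foldF-cong : ∀ {B : Set} (_⊕_ : B → B → B) e {n} {f g : Fin n → B} → f ≗ g → foldF _⊕_ e f ≡ foldF _⊕_ e g
    foldF-cong _⊕_ e {zero} h = refl
    foldF-cong _⊕_ e {suc n} h = cong₂ _⊕_ (h zero) (foldF-cong _⊕_ e (h ∘ suc))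

    Πᶠ : ∀ {n} → (Fin n → ℕ) → ℕ
    Πᶠ = foldF ℕ._*_ 1

    Σᶠ : ∀ {n} → (Fin n → ℕ) → ℕ
    Σᶠ = foldF ℕ._+_ 0

    module WordCount where
      open Field-F

      private
        infixr 8 _·_
        _·_ : ℕ → Carrier → Carrier
        _·_ = Defs._·_ F

      weighted : ∀ {l} → (Fin l → Carrier) → Vec ℕ l → Carrier
      weighted βs v = foldF _+_ 0# (λ k → lookup v k · βs k)

      -- Σ Π C(nₖ, νₖ) over the families ν with Σ νₖ = j and Σ νₖ βₖ = t.
      choose : ∀ {l} → (Fin l → ℕ) → (Fin l → Carrier) → ℕ → Carrier → ℕ
      choose {zero} ns βs j t = ind ((0 ℕ.≟ j) ×-dec (0# ≟ t)) 1
      choose {suc l} ns βs j t = Σ≤ j (λ a → (ns zero C a) ℕ.* choose (ns ∘ suc) (βs ∘ suc) (j ℕ.∸ a) (t + a · βs zero))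

      -- The bound J on the entries stays fixed while the required sum j decreases in the recursion;
      -- entries exceeding j contribute 0, so J only has to be at least j.
      choose-families : ∀ {l} J (ns : Fin l → ℕ) (βs : Fin l → Carrier) j t → j ≤ J →
        Σᴸ (families l J) (λ v → ind ((Σᶠ (lookup v) ℕ.≟ j) ×-dec (weighted βs v ≟ t)) (Πᶠ (λ k → ns k C lookup v k))) ≡ choose ns βs j t
      choose-families {zero} J ns βs j t h = ℕP.+-identityʳ _
      choose-families {suc l} J ns βs j t h = begin
        Σᴸ (families (suc l) J) f ≡⟨ Σᴸ-concatMap (λ v → map (λ a → a ∷ v) (upTo (suc J))) (families l J) f ⟩
        Σᴸ (families l J) (λ v → Σᴸ (map (λ a → a ∷ v) (upTo (suc J))) f) ≡⟨ Σᴸ-cong (families l J) (λ v → Σᴸ-map (λ a → a ∷ v) (upTo (suc J)) f) ⟩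
        Σᴸ (families l J) (λ v → Σᴸ (upTo (suc J)) (λ a → f (a ∷ v))) ≡⟨ Σᴸ-swap (families l J) (upTo (suc J)) (λ v a → f (a ∷ v)) ⟩
        Σᴸ (upTo (suc J)) (λ a → Σᴸ (families l J) (λ v → f (a ∷ v))) ≡⟨ Σ≤-upTo (λ a → Σᴸ (families l J) (λ v → f (a ∷ v))) h too-big ⟩
        Σ≤ j (λ a → Σᴸ (families l J) (λ v → f (a ∷ v))) ≡⟨ Σ≤-cong j inner ⟩
        choose ns βs j t ∎
        where
        open ≡-Reasoning
        f : Vec ℕ (suc l) → ℕ
        f v = ind ((Σᶠ (lookup v) ℕ.≟ j) ×-dec (weighted βs v ≟ t)) (Πᶠ (λ k → ns k C lookup v k))
        too-big : ∀ a → j < a → Σᴸ (families l J) (λ v → f (a ∷ v)) ≡ 0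
        too-big a l = Σᴸ-zero (families _ J) λ v → ind-no ((Σᶠ (lookup (a ∷ v)) ℕ.≟ j) ×-dec (weighted βs (a ∷ v) ≟ t))
          (λ (e , _) → ℕP.<⇒≱ l (ℕP.≤-trans (ℕP.m≤m+n a (Σᶠ (lookup v))) (ℕP.≤-reflexive e))) (Πᶠ (λ k → ns k C lookup (a ∷ v) k))
        inner : ∀ a → a ≤ j → Σᴸ (families l J) (λ v → f (a ∷ v)) ≡ (ns zero C a) ℕ.* choose (ns ∘ suc) (βs ∘ suc) (j ℕ.∸ a) (t + a · βs zero)
        inner a h′ = begin
          Σᴸ (families l J) (λ v → f (a ∷ v)) ≡⟨ Σᴸ-cong (families l J) step ⟩
          Σᴸ (families l J) (λ v → (ns zero C a) ℕ.* g v) ≡⟨ Σᴸ-* (families l J) (ns zero C a) g ⟩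
          (ns zero C a) ℕ.* Σᴸ (families l J) g ≡⟨ cong ((ns zero C a) ℕ.*_) (choose-families J (ns ∘ suc) (βs ∘ suc) (j ℕ.∸ a) (t + a · βs zero) (ℕP.≤-trans (ℕP.m∸n≤m j a) h)) ⟩
          (ns zero C a) ℕ.* choose (ns ∘ suc) (βs ∘ suc) (j ℕ.∸ a) (t + a · βs zero) ∎
          where
          g : Vec ℕ l → ℕ
          g v = ind ((Σᶠ (lookup v) ℕ.≟ j ℕ.∸ a) ×-dec (weighted (βs ∘ suc) v ≟ (t + a · βs zero))) (Πᶠ (λ k → ns (suc k) C lookup v k))
          ind-* : ∀ {P : Set} (d : Dec P) c x → ind d (c ℕ.* x) ≡ c ℕ.* ind d x
          ind-* (yes _) c x = refl
          ind-* (no _) c x = sym (ℕP.*-zeroʳ c)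
          step : ∀ v → f (a ∷ v) ≡ (ns zero C a) ℕ.* g v
          step v = trans (ind-iff ((Σᶠ (lookup (a ∷ v)) ℕ.≟ j) ×-dec (weighted βs (a ∷ v) ≟ t))
              ((Σᶠ (lookup v) ℕ.≟ j ℕ.∸ a) ×-dec (weighted (βs ∘ suc) v ≟ (t + a · βs zero)))
              (λ { (refl , refl) → sym (ℕP.m+n∸m≡n a _) , solve 2 (λ x y → y := x :+ y :+ x) refl (a · βs zero) (weighted (βs ∘ suc) v) })
              (λ (e , e′) → trans (cong (a ℕ.+_) e) (ℕP.m+[n∸m]≡n h′) , trans (cong (a · βs zero +_) e′) (solve 2 (λ x t → x :+ (t :+ x) := t) refl (a · βs zero) t))
              ((ns zero C a) ℕ.* Πᶠ (λ k → ns (suc k) C lookup v k)))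
            (ind-* ((Σᶠ (lookup v) ℕ.≟ j ℕ.∸ a) ×-dec (weighted (βs ∘ suc) v ≟ (t + a · βs zero))) (ns zero C a) (Πᶠ (λ k → ns (suc k) C lookup v k)))

      choose-cong : ∀ {l} {ns ns′ : Fin l → ℕ} (βs : Fin l → Carrier) j t → ns ≗ ns′ → choose ns βs j t ≡ choose ns′ βs j t
      choose-cong {zero} βs j t e = refl
      choose-cong {suc l} βs j t e = Σ≤-cong j λ a _ → cong₂ (λ n x → (n C a) ℕ.* x) (e zero) (choose-cong (βs ∘ suc) (j ℕ.∸ a) (t + a · βs zero) (e ∘ suc))

      choose-0 : ∀ {l} (ns ns′ : Fin l → ℕ) (βs : Fin l → Carrier) t → choose ns βs 0 t ≡ choose ns′ βs 0 t
      choose-0 {zero} ns ns′ βs t = refl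
      choose-0 {suc l} ns ns′ βs t = cong₂ ℕ._*_ (trans (nC0 (ns zero)) (sym (nC0 (ns′ zero)))) (choose-0 (ns ∘ suc) (ns′ ∘ suc) (βs ∘ suc) (t + 0#))

      choose-empty : ∀ {l} (βs : Fin l → Carrier) j t → choose (λ _ → 0) βs j t ≡ ind ((0 ℕ.≟ j) ×-dec (0# ≟ t)) 1
      choose-empty {zero} βs j t = refl
      choose-empty {suc l} βs zero t = trans (ℕP.+-identityʳ _) (trans (choose-empty (βs ∘ suc) 0 (t + 0#)) (cong (λ z → ind ((0 ℕ.≟ 0) ×-dec (0# ≟ z)) 1) (+-identityʳ t)))
      choose-empty {suc l} βs (suc j) t = trans (cong₂ ℕ._+_ (ℕP.+-identityʳ _) (Σ≤-zero j {λ a → choose (λ _ → 0) (βs ∘ suc) (j ℕ.∸ a) (t + suc a · βs zero)}))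
          (trans (ℕP.+-identityʳ _) (trans (choose-empty (βs ∘ suc) (suc j) (t + 0#)) (cong (λ z → ind ((0 ℕ.≟ suc j) ×-dec (0# ≟ z)) 1) (+-identityʳ t))))
        where
        Σ≤-zero : ∀ i {f : ℕ → ℕ} → Σ≤ i (λ a → 0 ℕ.* f a) ≡ 0
        Σ≤-zero zero = refl
        Σ≤-zero (suc i) {f} = Σ≤-zero i {f ∘ suc}

      incr : ∀ {l} → Fin l → (Fin l → ℕ) → Fin l → ℕ
      incr zero ns zero = suc (ns zero)
      incr zero ns (suc i) = ns (suc i)
      incr (suc k) ns zero = ns zero
      incr (suc k) ns (suc i) = incr k (ns ∘ suc) i

      incr-self : ∀ {l} (k : Fin l) ns → incr k ns k ≡ suc (ns k)
      incr-self zero ns = refl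
      incr-self (suc k) ns = incr-self k (ns ∘ suc)

      incr-other : ∀ {l} (k : Fin l) ns i → i ≢ k → incr k ns i ≡ ns i
      incr-other zero ns zero n = ⊥-elim (n refl)
      incr-other zero ns (suc i) n = refl
      incr-other (suc k) ns zero n = refl
      incr-other (suc k) ns (suc i) n = incr-other k (ns ∘ suc) i (n ∘ cong suc)

      -- Pascal's rule in the k-th binomial. The choices that use the new element of value βₖ have
      -- one element less to place and target t - βₖ, which is t + βₖ in characteristic 2.
      choose-pascal : ∀ {l} (k : Fin l) ns (βs : Fin l → Carrier) j t →
        choose (incr k ns) βs (suc j) t ≡ choose ns βs j (t + βs k) ℕ.+ choose ns βs (suc j) t
      choose-pascal zero ns βs j t = begin
        (suc n C 0) ℕ.* R (suc j) (t + 0#) ℕ.+ Σ≤ j (λ a → (suc n C suc a) ℕ.* R (j ℕ.∸ a) (t + suc a · β))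
          ≡⟨ cong₂ ℕ._+_ (cong (ℕ._* R (suc j) (t + 0#)) (trans (nC0 (suc n)) (sym (nC0 n)))) (Σ≤-cong j (λ a _ → trans (cong (ℕ._* R (j ℕ.∸ a) (t + suc a · β)) (sym (nCk+nC[k+1]≡[n+1]C[k+1] n a)))
               (ℕP.*-distribʳ-+ (R (j ℕ.∸ a) (t + suc a · β)) (n C a) (n C suc a)))) ⟩
        (n C 0) ℕ.* R (suc j) (t + 0#) ℕ.+ Σ≤ j (λ a → (n C a) ℕ.* R (j ℕ.∸ a) (t + suc a · β) ℕ.+ (n C suc a) ℕ.* R (j ℕ.∸ a) (t + suc a · β))
          ≡⟨ cong ((n C 0) ℕ.* R (suc j) (t + 0#) ℕ.+_) (Σ≤-+ j (λ a → (n C a) ℕ.* R (j ℕ.∸ a) (t + suc a · β)) (λ a → (n C suc a) ℕ.* R (j ℕ.∸ a) (t + suc a · β))) ⟩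
        (n C 0) ℕ.* R (suc j) (t + 0#) ℕ.+ (Σ≤ j (λ a → (n C a) ℕ.* R (j ℕ.∸ a) (t + suc a · β)) ℕ.+ Σ≤ j (λ a → (n C suc a) ℕ.* R (j ℕ.∸ a) (t + suc a · β)))
          ≡⟨ rotate ((n C 0) ℕ.* R (suc j) (t + 0#)) (Σ≤ j (λ a → (n C a) ℕ.* R (j ℕ.∸ a) (t + suc a · β))) (Σ≤ j (λ a → (n C suc a) ℕ.* R (j ℕ.∸ a) (t + suc a · β))) ⟩
        Σ≤ j (λ a → (n C a) ℕ.* R (j ℕ.∸ a) (t + suc a · β)) ℕ.+ choose ns βs (suc j) t
          ≡⟨ cong (ℕ._+ choose ns βs (suc j) t) (Σ≤-cong j (λ a _ → cong (λ z → (n C a) ℕ.* R (j ℕ.∸ a) z) (sym (+-assoc t β (a · β))))) ⟩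
        choose ns βs j (t + β) ℕ.+ choose ns βs (suc j) t ∎
        where
        open ≡-Reasoning
        n = ns zero
        β = βs zero
        R = choose (ns ∘ suc) (βs ∘ suc)
        rotate : ∀ a b c → a ℕ.+ (b ℕ.+ c) ≡ b ℕ.+ (a ℕ.+ c)
        rotate = solve-∀
      choose-pascal {suc l} (suc k) ns βs j t = begin
        Σ≤ (suc j) (λ a → c a ℕ.* R′ (suc j ℕ.∸ a) (s a)) ≡⟨ Σ≤-snoc j (λ a → c a ℕ.* R′ (suc j ℕ.∸ a) (s a)) ⟩
        Σ≤ j (λ a → c a ℕ.* R′ (suc j ℕ.∸ a) (s a)) ℕ.+ c (suc j) ℕ.* R′ (suc j ℕ.∸ suc j) (s (suc j))
          ≡⟨ cong₂ ℕ._+_ (Σ≤-cong j (λ a h → trans (cong (c a ℕ.*_) (pascal a h)) (ℕP.*-distribˡ-+ (c a) _ _))) (cong (c (suc j) ℕ.*_) last) ⟩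
        Σ≤ j (λ a → c a ℕ.* R (j ℕ.∸ a) (s a + βₖ) ℕ.+ c a ℕ.* R (suc j ℕ.∸ a) (s a)) ℕ.+ c (suc j) ℕ.* R (suc j ℕ.∸ suc j) (s (suc j))
          ≡⟨ cong (ℕ._+ c (suc j) ℕ.* R (suc j ℕ.∸ suc j) (s (suc j))) (Σ≤-+ j (λ a → c a ℕ.* R (j ℕ.∸ a) (s a + βₖ)) (λ a → c a ℕ.* R (suc j ℕ.∸ a) (s a))) ⟩
        Σ≤ j (λ a → c a ℕ.* R (j ℕ.∸ a) (s a + βₖ)) ℕ.+ Σ≤ j (λ a → c a ℕ.* R (suc j ℕ.∸ a) (s a)) ℕ.+ c (suc j) ℕ.* R (suc j ℕ.∸ suc j) (s (suc j))
          ≡⟨ ℕP.+-assoc (Σ≤ j (λ a → c a ℕ.* R (j ℕ.∸ a) (s a + βₖ))) _ _ ⟩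
        Σ≤ j (λ a → c a ℕ.* R (j ℕ.∸ a) (s a + βₖ)) ℕ.+ (Σ≤ j (λ a → c a ℕ.* R (suc j ℕ.∸ a) (s a)) ℕ.+ c (suc j) ℕ.* R (suc j ℕ.∸ suc j) (s (suc j)))
          ≡⟨ cong₂ ℕ._+_ (Σ≤-cong j (λ a _ → cong (λ z → c a ℕ.* R (j ℕ.∸ a) z) (solve 3 (λ t x b → t :+ x :+ b := t :+ b :+ x) refl t (a · βs zero) βₖ)))
               (sym (Σ≤-snoc j (λ a → c a ℕ.* R (suc j ℕ.∸ a) (s a)))) ⟩
        choose ns βs j (t + βₖ) ℕ.+ choose ns βs (suc j) t ∎
        where
        open ≡-Reasoning
        c = λ a → ns zero C a
        s = λ a → t + a · βs zero
        βₖ = βs (suc k)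
        R = choose (ns ∘ suc) (βs ∘ suc)
        R′ = choose (incr k (ns ∘ suc)) (βs ∘ suc)
        pascal : ∀ a → a ≤ j → R′ (suc j ℕ.∸ a) (s a) ≡ R (j ℕ.∸ a) (s a + βₖ) ℕ.+ R (suc j ℕ.∸ a) (s a)
        pascal a h rewrite ℕP.+-∸-assoc 1 h = choose-pascal k (ns ∘ suc) (βs ∘ suc) (j ℕ.∸ a) (s a)
        -- In the last term no weight is left, and at weight 0 `choose` does not depend on the
        -- counts.
        last : R′ (suc j ℕ.∸ suc j) (s (suc j)) ≡ R (suc j ℕ.∸ suc j) (s (suc j))
        last rewrite ℕP.n∸n≡0 j = choose-0 (incr k (ns ∘ suc)) (ns ∘ suc) (βs ∘ suc) (s (suc j))

      module _ {n : ℕ} where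
        private
          M = Defs.Mat F (n ℕ.+ n) (n ℕ.+ n)
          Tr = Defs.Tr F {n ℕ.+ n}

        codewords : List M → ℕ → Carrier → ℕ
        codewords gs j t = Σᴸ (allWords (length gs)) (λ u → ind ((hammingWeight u ℕ.≟ j) ×-dec (Defs.syndrome F {n} gs u ≟ t)) 1)

        multiplicity : List M → Carrier → ℕ
        multiplicity gs β = length (filter (λ g → Tr g ≟ β) gs)

        private
          codewords-∷ : ∀ g gs j t → codewords (g ∷ gs) j t ≡
            Σᴸ (allWords (length gs)) (λ u → ind ((suc (hammingWeight u) ℕ.≟ j) ×-dec ((Tr g + Defs.syndrome F {n} gs u) ≟ t)) 1)
            ℕ.+ Σᴸ (allWords (length gs)) (λ u → ind ((hammingWeight u ℕ.≟ j) ×-dec ((0# + Defs.syndrome F {n} gs u) ≟ t)) 1)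
          codewords-∷ g gs j t = trans (Σᴸ-concatMap (λ w → (true ∷ w) ∷ (false ∷ w) ∷ []) ws f)
            (trans (Σᴸ-cong ws (λ u → cong (f (true ∷ u) ℕ.+_) (ℕP.+-identityʳ (f (false ∷ u))))) (Σᴸ-+ ws (λ u → f (true ∷ u)) (λ u → f (false ∷ u))))
            where
            ws = allWords (length gs)
            f : Vec Bool (suc (length gs)) → ℕ
            f u = ind ((hammingWeight u ℕ.≟ j) ×-dec (Defs.syndrome F {n} (g ∷ gs) u ≟ t)) 1

          without : ∀ gs j t → Σᴸ (allWords (length gs)) (λ u → ind ((hammingWeight u ℕ.≟ j) ×-dec ((0# + Defs.syndrome F {n} gs u) ≟ t)) 1) ≡ codewords gs j t
          without gs j t = Σᴸ-cong (allWords (length gs)) λ u → cong (λ z → ind ((hammingWeight u ℕ.≟ j) ×-dec (z ≟ t)) 1) (+-identityˡ _)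

        codewords-0 : ∀ g gs t → codewords (g ∷ gs) 0 t ≡ codewords gs 0 t
        codewords-0 g gs t = trans (codewords-∷ g gs 0 t) (cong₂ ℕ._+_ (Σᴸ-zero (allWords (length gs)) (λ u → refl)) (without gs 0 t))

        codewords-suc : ∀ g gs j t → codewords (g ∷ gs) (suc j) t ≡ codewords gs j (t + Tr g) ℕ.+ codewords gs (suc j) t
        codewords-suc g gs j t = trans (codewords-∷ g gs (suc j) t) (cong₂ ℕ._+_ (Σᴸ-cong (allWords (length gs)) with-g) (without gs (suc j) t))
          where
          with-g : ∀ u → ind ((suc (hammingWeight u) ℕ.≟ suc j) ×-dec ((Tr g + Defs.syndrome F {n} gs u) ≟ t)) 1
                 ≡ ind ((hammingWeight u ℕ.≟ j) ×-dec (Defs.syndrome F {n} gs u ≟ (t + Tr g))) 1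
          with-g u = ind-iff ((suc (hammingWeight u) ℕ.≟ suc j) ×-dec ((Tr g + Defs.syndrome F {n} gs u) ≟ t)) ((hammingWeight u ℕ.≟ j) ×-dec (Defs.syndrome F {n} gs u ≟ (t + Tr g)))
            (λ (e , e′) → ℕP.suc-injective e , trans (solve 2 (λ x y → y := x :+ y :+ x) refl (Tr g) (Defs.syndrome F {n} gs u)) (cong (_+ Tr g) e′))
            (λ (e , e′) → cong suc e , trans (cong (Tr g +_) e′) (solve 2 (λ x t → x :+ (t :+ x) := t) refl (Tr g) t)) 1

        -- Whether the first matrix belongs to the word gives the same recursion as `choose-pascal`,
        -- since adding that matrix raises the multiplicity of its trace by one.
        codewords-choose : ∀ gs j t → codewords gs j t ≡ choose (λ k → multiplicity gs (to k)) to j t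
        codewords-choose [] j t = trans (ℕP.+-identityʳ _) (sym (choose-empty to j t))
        codewords-choose (g ∷ gs) j t = trans (step j) (choose-cong to j t incremented)
          where
          ns = λ k → multiplicity gs (to k)
          k₀ = from (Tr g)
          incremented : incr k₀ ns ≗ (λ k → multiplicity (g ∷ gs) (to k))
          incremented k with k Fin.≟ k₀
          ... | yes refl = trans (incr-self k₀ ns) (sym (cong length (ListP.filter-accept (λ g → Tr g ≟ to k₀) {g} {gs} (sym (to∘from (Tr g))))))
          ... | no ne = trans (incr-other k₀ ns k ne) (sym (cong length (ListP.filter-reject (λ g → Tr g ≟ to k) {g} {gs} (λ e → ne (trans (sym (from∘to k)) (cong from (sym e)))))))
          step : ∀ j → codewords (g ∷ gs) j t ≡ choose (incr k₀ ns) to j t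
          step zero = trans (codewords-0 g gs t) (trans (codewords-choose gs 0 t) (choose-0 ns (incr k₀ ns) to t))
          step (suc j) = trans (codewords-suc g gs j t) (trans (cong₂ ℕ._+_ (trans (codewords-choose gs j (t + Tr g)) (cong (λ z → choose ns to j (t + z)) (sym (to∘from (Tr g)))))
            (codewords-choose gs (suc j) t)) (sym (choose-pascal k₀ ns to j t)))

        weightDist-families : ∀ gs j (summand : (Carrier → ℕ) → ℕ) →
          (∀ ν → summand ν ≡ Πᶠ (λ k → multiplicity gs (to k) C ν (to k))) →
          Defs.weightDist F {n} gs j ≡ Defs.familySum F j summand
        weightDist-families gs j summand h = begin
          Defs.weightDist F {n} gs j ≡⟨ length-filter _ (allWords (length gs)) ⟩
          codewords gs j 0# ≡⟨ codewords-choose gs j 0# ⟩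
          choose ns to j 0# ≡⟨ choose-families j ns to j 0# ℕP.≤-refl ⟨
          Σᴸ (families q j) (λ v → ind ((Σᶠ (lookup v) ℕ.≟ j) ×-dec (weighted to v ≟ 0#)) (Πᶠ (λ k → ns k C lookup v k)))
            ≡⟨ Σᴸ-cong (families q j) eq ⟩
          Σᴸ (families q j) (λ v → ind ((ListAction.sum (map (lookup v) (allFin q)) ℕ.≟ j)
              ×-dec (List.foldr (λ k acc → lookup v k · to k + acc) 0# (allFin q) ≟ 0#)) (summand (λ β → lookup v (from β))))
            ≡⟨ sum-map-filter _ _ (families q j) ⟨
          Defs.familySum F j summand ∎
          where
          open ≡-Reasoning
          ns = λ k → multiplicity gs (to k)
          sum-lookup : ∀ (v : Vec ℕ q) → ListAction.sum (map (lookup v) (allFin q)) ≡ Σᶠ (lookup v)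
          sum-lookup v = trans (ListP.foldr-map ℕ._+_ (lookup v) 0 (allFin q)) (foldr-allFin ℕ._+_ 0 (lookup v))
          eq : ∀ v → ind ((Σᶠ (lookup v) ℕ.≟ j) ×-dec (weighted to v ≟ 0#)) (Πᶠ (λ k → ns k C lookup v k))
             ≡ ind ((ListAction.sum (map (lookup v) (allFin q)) ℕ.≟ j) ×-dec (List.foldr (λ k acc → lookup v k · to k + acc) 0# (allFin q) ≟ 0#)) (summand (λ β → lookup v (from β)))
          eq v = trans (ind-iff ((Σᶠ (lookup v) ℕ.≟ j) ×-dec (weighted to v ≟ 0#)) ((ListAction.sum (map (lookup v) (allFin q)) ℕ.≟ j) ×-dec (List.foldr (λ k acc → lookup v k · to k + acc) 0# (allFin q) ≟ 0#))
              (λ (e , e′) → trans (sum-lookup v) e , trans (foldr-allFin _+_ 0# (λ k → lookup v k · to k)) e′)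
              (λ (e , e′) → trans (sym (sum-lookup v)) e , trans (sym (foldr-allFin _+_ 0# (λ k → lookup v k · to k))) e′) _)
            (cong (ind ((ListAction.sum (map (lookup v) (allFin q)) ℕ.≟ j) ×-dec (List.foldr (λ k acc → lookup v k · to k + acc) 0# (allFin q) ≟ 0#)))
              (trans (foldF-cong ℕ._*_ 1 (λ k → cong (λ i → ns k C lookup v i) (sym (from∘to k)))) (sym (h (λ β → lookup v (from β))))))

  -- Rational constants, closed forms of the orders, and the top entries of the binomials.

  module Arithmetic where

    import Defs
    open Defs using (Sign; plus; minus; Valid₁; Valid₂; ℕ→ℚ; ℤ→ℚ; invℕ; divℕ; qpow; prodℚ; gauss; qm1; ex; top)
    open GroupOrders using (gl; sy; al)
    open KloostermanSum using (parity)
    open import Data.Nat as ℕ using (ℕ; zero; suc; _≤_; _<_; z≤n; s≤s; _∸_; _^_)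
    import Data.Nat.Properties as ℕP
    import Data.Nat.DivMod as DM
    open import Data.Nat.Tactic.RingSolver using (solve-∀)
    open import Data.Integer as ℤ using (ℤ; +_; -[1+_])
    import Data.Integer.Properties as ℤP
    import Data.Integer.DivMod as ℤDM
    import Data.Integer.Tactic.RingSolver as ℤSolver
    open import Data.Rational as ℚ using (ℚ; 1ℚ)
    import Data.Rational.Properties as ℚP
    open import Data.Rational.Unnormalised as ℚᵘ using (mkℚᵘ; *≡*)
    import Data.Rational.Unnormalised.Properties as ℚᵘP
    open import Data.List as List using (List; []; _∷_; upTo)
    import Data.List.Properties as ListP
    open import Data.Product using (∃; _,_; proj₁; proj₂)
    open import Data.Sum using (inj₁; inj₂)
    open import Data.Empty using (⊥-elim)
    open import Algebra.Bundles using (CommutativeRing)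
    open import Level using (0ℓ)
    open import Relation.Binary.PropositionalEquality hiding (setoid)
    open import Function using (_∘_)

    private
      ι : ℕ → ℚ
      ι = ℕ→ℚ

      unnormalised : ∀ z → ℚ.toℚᵘ (ℤ→ℚ z) ℚᵘ.≃ mkℚᵘ z 0
      unnormalised z = ℚP.toℚᵘ-fromℚᵘ (mkℚᵘ z 0)

    ℤ→ℚ-* : ∀ a b → ℤ→ℚ (a ℤ.* b) ≡ ℤ→ℚ a ℚ.* ℤ→ℚ b
    ℤ→ℚ-* a b = ℚP.toℚᵘ-injective (ℚᵘP.≃-trans (unnormalised (a ℤ.* b)) (ℚᵘP.≃-sym
      (ℚᵘP.≃-trans (ℚP.toℚᵘ-homo-* (ℤ→ℚ a) (ℤ→ℚ b)) (ℚᵘP.≃-trans (ℚᵘP.*-cong (unnormalised a) (unnormalised b)) (*≡* refl)))))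

    ℤ→ℚ-+ : ∀ a b → ℤ→ℚ (a ℤ.+ b) ≡ ℤ→ℚ a ℚ.+ ℤ→ℚ b
    ℤ→ℚ-+ a b = ℚP.toℚᵘ-injective (ℚᵘP.≃-trans (unnormalised (a ℤ.+ b)) (ℚᵘP.≃-sym
      (ℚᵘP.≃-trans (ℚP.toℚᵘ-homo-+ (ℤ→ℚ a) (ℤ→ℚ b)) (ℚᵘP.≃-trans (ℚᵘP.+-cong (unnormalised a) (unnormalised b)) (*≡* (eq a b))))))
      where
      eq : ∀ a b → (a ℤ.* + 1 ℤ.+ b ℤ.* + 1) ℤ.* + 1 ≡ (a ℤ.+ b) ℤ.* + 1
      eq = ℤSolver.solve-∀

    ι-* : ∀ a b → ι (a ℕ.* b) ≡ ι a ℚ.* ι b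
    ι-* a b = trans (cong ℤ→ℚ (ℤP.pos-* a b)) (ℤ→ℚ-* (+ a) (+ b))

    ι-+ : ∀ a b → ι (a ℕ.+ b) ≡ ι a ℚ.+ ι b
    ι-+ a b = ℤ→ℚ-+ (+ a) (+ b)

    invℕ-inverse : ∀ m → 1 ≤ m → invℕ m ℚ.* ι m ≡ 1ℚ
    invℕ-inverse (suc m) _ = ℚP.toℚᵘ-injective (ℚᵘP.≃-trans (ℚP.toℚᵘ-homo-* (invℕ (suc m)) (ι (suc m)))
      (ℚᵘP.≃-trans (ℚᵘP.*-cong (ℚP.toℚᵘ-fromℚᵘ (mkℚᵘ (+ 1) m)) (unnormalised (+ suc m))) (*≡* (eq (+ suc m)))))
      where
      eq : ∀ z → (+ 1 ℤ.* z) ℤ.* + 1 ≡ + 1 ℤ.* (z ℤ.* + 1)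
      eq = ℤSolver.solve-∀

    ι-cancel : ∀ m → 1 ≤ m → ∀ {x y} → x ℚ.* ι m ≡ y ℚ.* ι m → x ≡ y
    ι-cancel m h {x} {y} e = trans (undo x) (trans (cong (ℚ._* invℕ m) e) (sym (undo y)))
      where
      undo : ∀ x → x ≡ x ℚ.* ι m ℚ.* invℕ m
      undo x = sym (trans (ℚP.*-assoc x (ι m) (invℕ m)) (trans (cong (x ℚ.*_) (trans (ℚP.*-comm (ι m) (invℕ m)) (invℕ-inverse m h))) (ℚP.*-identityʳ x)))

    floor-ι : ∀ n → ℚ.floor (ι n) ≡ + n
    floor-ι n = trans (cong ℚ.floor (ℚP.normalize-coprime {n} {0} (coprime-1 n))) (trans (ℤP.*-identityˡ _) (cong +_ (DM.n/1≡n n)))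
      where
      open import Data.Nat.Coprimality using (Coprime; 1-coprimeTo) renaming (sym to coprime-sym)
      coprime-1 : ∀ n → Coprime n 1
      coprime-1 n = coprime-sym (1-coprimeTo n)

    exact-quarter : ∀ z → (+ 4 ℤ.* z) ℤDM./ + 4 ≡ z
    exact-quarter z = help ((+ 4 ℤ.* z) ℤDM.% + 4) (ℤDM.n%d<d (+ 4 ℤ.* z) (+ 4)) (ℤDM.a≡a%n+[a/n]*n (+ 4 ℤ.* z) (+ 4))
      where
      d = (+ 4 ℤ.* z) ℤDM./ + 4
      lem : ∀ z d → + 4 ℤ.* (z ℤ.- d) ≡ + 4 ℤ.* z ℤ.- d ℤ.* + 4
      lem = ℤSolver.solve-∀
      lem′ : ∀ r x → (r ℤ.+ x) ℤ.- x ≡ r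
      lem′ = ℤSolver.solve-∀
      remainder : ∀ r → + 4 ℤ.* z ≡ + r ℤ.+ d ℤ.* + 4 → + 4 ℤ.* (z ℤ.- d) ≡ + r
      remainder r e = trans (lem z d) (trans (cong (ℤ._- d ℤ.* + 4) e) (lem′ (+ r) (d ℤ.* + 4)))
      size : ∀ r → + 4 ℤ.* z ≡ + r ℤ.+ d ℤ.* + 4 → 4 ℕ.* ℤ.∣ z ℤ.- d ∣ ≡ r
      size r e = trans (sym (ℤP.abs-* (+ 4) (z ℤ.- d))) (cong ℤ.∣_∣ (remainder r e))
      zero-of : ∀ k r → 4 ℕ.* k ≡ r → r < 4 → k ≡ 0
      zero-of zero r e l = refl
      zero-of (suc k) r refl l = ⊥-elim (ℕP.<⇒≱ l (ℕP.m≤m*n 4 (suc k)))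
      help : ∀ r → r < 4 → + 4 ℤ.* z ≡ + r ℤ.+ d ℤ.* + 4 → d ≡ z
      help r l e = sym (ℤP.i-j≡0⇒i≡j z d (ℤP.∣i∣≡0⇒i≡0 (zero-of ℤ.∣ z ℤ.- d ∣ r (size r e) l)))

    -- The identity q⁻¹ A (B + c) = N, freed of denominators.
    module Combine (R : CommutativeRing 0ℓ 0ℓ) where
      open CommutativeRing R renaming (refl to ≈-refl; sym to ≈-sym; trans to ≈-trans)
      open import Algebra.Solver.Ring.NaturalCoefficients.Default commutativeSemiring using (solve; _:=_; _:+_; _:*_)
      open import Algebra.Properties.Group +-group using () renaming (∙-cancelʳ to +-cancelʳ)
      open import Relation.Binary.Reasoning.Setoid setoid

      combine : ∀ {A B c q q⁻¹ N gs gm ε s t a as G κ} →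
        A * (gs * gm) ≈ ε * (a * as * (G * s)) → B * (ε * (s * t)) ≈ G → ε * c + gm ≈ q * κ → q⁻¹ * q ≈ 1# →
        q * (N * (gs * (t * gm))) + G * a * (s * (t * gm) * as) ≈ G * a * (q * (s * (t * κ) * as) + G * as) →
        q⁻¹ * (A * (B + c)) * (gs * gm * (ε * (s * t))) ≈ N * (gs * gm * (ε * (s * t)))
      combine {A} {B} {c} {q} {q⁻¹} {N} {gs} {gm} {ε} {s} {t} {a} {as} {G} {κ} hA hB hc hq hE = begin
        q⁻¹ * (A * (B + c)) * (gs * gm * (ε * (s * t)))
          ≈⟨ solve 9 (λ A B c i gs gm ε s t → i :* (A :* (B :+ c)) :* (gs :* gm :* (ε :* (s :* t)))
               := i :* (A :* (gs :* gm)) :* (B :* (ε :* (s :* t)) :+ ε :* c :* (s :* t))) ≈-refl A B c q⁻¹ gs gm ε s t ⟩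
        q⁻¹ * (A * (gs * gm)) * (B * (ε * (s * t)) + ε * c * (s * t)) ≈⟨ *-cong (*-congˡ hA) (+-congʳ hB) ⟩
        q⁻¹ * (ε * (a * as * (G * s))) * (G + ε * c * (s * t))
          ≈⟨ solve 8 (λ i ε a as G s t y → i :* (ε :* (a :* as :* (G :* s))) :* (G :+ y :* (s :* t)) := i :* ε :* s :* (G :* a :* as :* (G :+ y :* (s :* t))))
               ≈-refl q⁻¹ ε a as G s t (ε * c) ⟩
        q⁻¹ * ε * s * (G * a * as * (G + ε * c * (s * t))) ≈⟨ *-congˡ main ⟩
        q⁻¹ * ε * s * (q * (N * (gs * (t * gm))))
          ≈⟨ solve 8 (λ i q N gs gm ε s t → i :* ε :* s :* (q :* (N :* (gs :* (t :* gm)))) := i :* q :* (N :* (gs :* gm :* (ε :* (s :* t))))) ≈-refl q⁻¹ q N gs gm ε s t ⟩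
        q⁻¹ * q * (N * (gs * gm * (ε * (s * t)))) ≈⟨ ≈-trans (*-congʳ hq) (*-identityˡ _) ⟩
        N * (gs * gm * (ε * (s * t))) ∎
        where
        main : G * a * as * (G + ε * c * (s * t)) ≈ q * (N * (gs * (t * gm)))
        main = +-cancelʳ (G * a * (s * (t * gm) * as)) _ _ (begin
          G * a * as * (G + ε * c * (s * t)) + G * a * (s * (t * gm) * as)
            ≈⟨ solve 7 (λ G a as y s t gm → G :* a :* as :* (G :+ y :* (s :* t)) :+ G :* a :* (s :* (t :* gm) :* as)
                 := G :* a :* ((y :+ gm) :* (s :* t :* as) :+ G :* as)) ≈-refl G a as (ε * c) s t gm ⟩
          G * a * ((ε * c + gm) * (s * t * as) + G * as) ≈⟨ *-congˡ (+-congʳ (*-congʳ hc)) ⟩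
          G * a * (q * κ * (s * t * as) + G * as)
            ≈⟨ solve 7 (λ G a as q κ s t → G :* a :* (q :* κ :* (s :* t :* as) :+ G :* as) := G :* a :* (q :* (s :* (t :* κ) :* as) :+ G :* as)) ≈-refl G a as q κ s t ⟩
          G * a * (q * (s * (t * κ) * as) + G * as) ≈⟨ hE ⟨
          q * (N * (gs * (t * gm))) + G * a * (s * (t * gm) * as) ∎)

    module Orders (q : ℕ) (2≤q : 2 ≤ q) where
      instance q≢0 = ℕ.>-nonZero (ℕP.≤-trans (s≤s z≤n) 2≤q)

      P : ℕ → ℕ
      P j = q ^ j ∸ 1

      q^≡ : ∀ j → q ^ j ≡ suc (P j)
      q^≡ j = sym (ℕP.m+[n∸m]≡n (ℕP.m^n>0 q j))

      P>0 : ∀ j → 1 ≤ P (suc j)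
      P>0 j = ℕP.m<n⇒0<n∸m (ℕP.≤-trans 2≤q (ℕP.≤-trans (ℕP.≤-reflexive (sym (ℕP.*-identityʳ q))) (ℕP.*-monoʳ-≤ q (ℕP.m^n>0 q j))))

      -- `O k` and `E k` are the products of q^j - 1 over the first k odd and the first k even
      -- positive j, `Pn n` is the product over all j up to n, and `T n` = n (n - 1) / 2.
      O E Pn T : ℕ → ℕ
      O zero = 1
      O (suc k) = O k ℕ.* P (suc (k ℕ.+ k))
      E zero = 1
      E (suc k) = E k ℕ.* P (suc (suc (k ℕ.+ k)))
      Pn zero = 1
      Pn (suc n) = P (suc n) ℕ.* Pn n
      T zero = 0
      T (suc n) = n ℕ.+ T n

      al≡ : ∀ n → al q n ≡ q ^ T n
      al≡ zero = refl
      al≡ (suc n) = trans (cong (q ^ n ℕ.*_) (al≡ n)) (sym (ℕP.^-distribˡ-+-* q n (T n)))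

      gl≡ : ∀ n → gl q n ≡ q ^ T n ℕ.* Pn n
      gl≡ zero = refl
      gl≡ (suc n) = trans (cong (λ z → P (suc n) ℕ.* (q ^ n ℕ.* z)) (gl≡ n)) (trans (arith (P (suc n)) (q ^ n) (q ^ T n) (Pn n))
        (cong (ℕ._* Pn (suc n)) (sym (ℕP.^-distribˡ-+-* q n (T n)))))
        where
        arith : ∀ p a b c → p ℕ.* (a ℕ.* (b ℕ.* c)) ≡ a ℕ.* b ℕ.* (p ℕ.* c)
        arith = solve-∀

      Pn-even : ∀ k → Pn (k ℕ.+ k) ≡ O k ℕ.* E k
      Pn-odd : ∀ k → Pn (suc (k ℕ.+ k)) ≡ O (suc k) ℕ.* E k
      Pn-odd k = trans (cong (P (suc (k ℕ.+ k)) ℕ.*_) (Pn-even k)) (arith (P (suc (k ℕ.+ k))) (O k) (E k))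
        where
        arith : ∀ p o e → p ℕ.* (o ℕ.* e) ≡ o ℕ.* p ℕ.* e
        arith = solve-∀
      Pn-even zero = refl
      Pn-even (suc k) = trans (cong Pn (cong suc (ℕP.+-suc k k))) (trans (cong (P (suc (suc (k ℕ.+ k))) ℕ.*_) (Pn-odd k)) (arith (P (suc (suc (k ℕ.+ k)))) (O (suc k)) (E k)))
        where
        arith : ∀ p o e → p ℕ.* (o ℕ.* e) ≡ o ℕ.* (e ℕ.* p)
        arith = solve-∀

      -- Raising the size to 2 k + 2, both summands of the recursion share the factor q^(2k+1) - 1
      -- and their sum only raises the power of q. Raising it to 2 k + 3, (q - 1) x + (x - 1) = q x
      -- - 1 with x = q^(2k+2) produces the next odd factor.
      sy-even : ∀ k → sy q (k ℕ.+ k) ≡ q ^ (k ℕ.* suc k) ℕ.* O k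
      sy-odd : ∀ k → sy q (suc (k ℕ.+ k)) ≡ q ^ (k ℕ.* suc k) ℕ.* O (suc k)

      sy-even zero = refl
      sy-even (suc k) = trans (cong (sy q ∘ suc) (ℕP.+-suc k k)) (begin
        (q ∸ 1) ℕ.* (q ^ suc n ℕ.* sy q (suc n)) ℕ.+ P (suc n) ℕ.* (q ^ suc n ℕ.* sy q n)
          ≡⟨ cong₂ (λ x y → (q ∸ 1) ℕ.* (q ^ suc n ℕ.* x) ℕ.+ P (suc n) ℕ.* (q ^ suc n ℕ.* y)) (sy-odd k) (sy-even k) ⟩
        (q ∸ 1) ℕ.* (q ^ suc n ℕ.* (e ℕ.* (O k ℕ.* p))) ℕ.+ p ℕ.* (q ^ suc n ℕ.* (e ℕ.* O k)) ≡⟨ arith (q ∸ 1) (q ^ suc n) e (O k) p ⟩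
        suc (q ∸ 1) ℕ.* (q ^ suc n ℕ.* e) ℕ.* (O k ℕ.* p)
          ≡⟨ cong (ℕ._* O (suc k)) (trans (cong₂ ℕ._*_ (ℕP.m+[n∸m]≡n (ℕP.≤-trans (s≤s z≤n) 2≤q)) (sym (ℕP.^-distribˡ-+-* q (suc n) (k ℕ.* suc k)))) (cong (q ^_) (exponent k))) ⟩
        q ^ (suc k ℕ.* suc (suc k)) ℕ.* O (suc k) ∎)
        where
        open ≡-Reasoning
        n = k ℕ.+ k
        p = P (suc n)
        e = q ^ (k ℕ.* suc k)
        arith : ∀ u x e o p → u ℕ.* (x ℕ.* (e ℕ.* (o ℕ.* p))) ℕ.+ p ℕ.* (x ℕ.* (e ℕ.* o)) ≡ suc u ℕ.* (x ℕ.* e) ℕ.* (o ℕ.* p)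
        arith = solve-∀
        exponent : ∀ k → suc (suc (k ℕ.+ k) ℕ.+ k ℕ.* suc k) ≡ suc k ℕ.* suc (suc k)
        exponent = solve-∀
      sy-odd zero = trans (cong (ℕ._* (1 ℕ.* 1)) (cong (_∸ 1) (sym (ℕP.*-identityʳ q)))) (arith (P 1))
        where
        arith : ∀ p → p ℕ.* (1 ℕ.* 1) ≡ 1 ℕ.* (1 ℕ.* p)
        arith = solve-∀
      sy-odd (suc k) = trans (cong (sy q ∘ suc ∘ suc) (ℕP.+-suc k k)) (begin
        (q ∸ 1) ℕ.* (q ^ suc (suc n) ℕ.* sy q (suc (suc n))) ℕ.+ P (suc (suc n)) ℕ.* (q ^ suc (suc n) ℕ.* sy q (suc n))
          ≡⟨ cong₂ (λ x y → (q ∸ 1) ℕ.* (q ^ suc (suc n) ℕ.* x) ℕ.+ P (suc (suc n)) ℕ.* (q ^ suc (suc n) ℕ.* y))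
               (trans (cong (sy q ∘ suc) (sym (ℕP.+-suc k k))) (trans (sy-even (suc k)) (cong (ℕ._* O (suc k)) (trans (cong (q ^_) (exponent k)) (ℕP.^-distribˡ-+-* q (suc (suc n)) (k ℕ.* suc k)))))) (sy-odd k) ⟩
        (q ∸ 1) ℕ.* (x ℕ.* (x ℕ.* e ℕ.* O (suc k))) ℕ.+ P (suc (suc n)) ℕ.* (x ℕ.* (e ℕ.* O (suc k)))
          ≡⟨ cong (λ z → (q ∸ 1) ℕ.* (x ℕ.* (z ℕ.* e ℕ.* O (suc k))) ℕ.+ p ℕ.* (x ℕ.* (e ℕ.* O (suc k)))) (q^≡ (suc (suc n))) ⟩
        (q ∸ 1) ℕ.* (x ℕ.* (suc p ℕ.* e ℕ.* O (suc k))) ℕ.+ p ℕ.* (x ℕ.* (e ℕ.* O (suc k)))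
          ≡⟨ arith (q ∸ 1) x p e (O (suc k)) ⟩
        x ℕ.* e ℕ.* (O (suc k) ℕ.* ((q ∸ 1) ℕ.+ suc (q ∸ 1) ℕ.* p))
          ≡⟨ cong₂ (λ y z → y ℕ.* (O (suc k) ℕ.* z)) (trans (sym (ℕP.^-distribˡ-+-* q (suc (suc n)) (k ℕ.* suc k))) (cong (q ^_) (sym (exponent k)))) last ⟩
        q ^ (suc k ℕ.* suc (suc k)) ℕ.* O (suc (suc k)) ∎)
        where
        open ≡-Reasoning
        n = k ℕ.+ k
        x = q ^ suc (suc n)
        p = P (suc (suc n))
        e = q ^ (k ℕ.* suc k)
        exponent : ∀ k → suc k ℕ.* suc (suc k) ≡ suc (suc (k ℕ.+ k)) ℕ.+ k ℕ.* suc k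
        exponent = solve-∀
        arith : ∀ u x p e o → u ℕ.* (x ℕ.* (suc p ℕ.* e ℕ.* o)) ℕ.+ p ℕ.* (x ℕ.* (e ℕ.* o)) ≡ x ℕ.* e ℕ.* (o ℕ.* (u ℕ.+ suc u ℕ.* p))
        arith = solve-∀
        arith′ : ∀ u p → suc (u ℕ.+ suc u ℕ.* p) ≡ suc u ℕ.* suc p
        arith′ = solve-∀
        last : (q ∸ 1) ℕ.+ suc (q ∸ 1) ℕ.* p ≡ P (suc (suc k ℕ.+ suc k))
        last = ℕP.suc-injective (trans (arith′ (q ∸ 1) p) (trans (cong₂ ℕ._*_ (ℕP.m+[n∸m]≡n (ℕP.≤-trans (s≤s z≤n) 2≤q)) (sym (q^≡ (suc (suc n)))))
          (trans (cong (λ z → q ^ suc (suc z)) (sym (ℕP.+-suc k k))) (q^≡ (suc (suc k ℕ.+ suc k))))))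

      T-double : ∀ k → T (k ℕ.+ k) ℕ.+ k ≡ 2 ℕ.* (k ℕ.* k)
      T-double zero = refl
      T-double (suc k) = trans (cong (λ z → T (suc z) ℕ.+ suc k) (ℕP.+-suc k k)) (trans (arith k (T (k ℕ.+ k))) (trans (cong (λ z → z ℕ.+ 4 ℕ.* k ℕ.+ 2) (T-double k)) (arith′ k)))
        where
        arith : ∀ k x → suc (k ℕ.+ k) ℕ.+ (k ℕ.+ k ℕ.+ x) ℕ.+ suc k ≡ x ℕ.+ k ℕ.+ 4 ℕ.* k ℕ.+ 2
        arith = solve-∀
        arith′ : ∀ k → 2 ℕ.* (k ℕ.* k) ℕ.+ 4 ℕ.* k ℕ.+ 2 ≡ 2 ℕ.* (suc k ℕ.* suc k)
        arith′ = solve-∀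

      ι-P : ∀ j → qm1 q j ≡ ι (P j)
      ι-P j = trans (cong (ℚ._- 1ℚ) (trans (cong ι (q^≡ j)) (ι-+ 1 (P j)))) (trans (cong (ℚ._- 1ℚ) (ℚP.+-comm 1ℚ (ι (P j))))
        (trans (ℚP.+-assoc (ι (P j)) 1ℚ (ℚ.- 1ℚ)) (ℚP.+-identityʳ (ι (P j)))))

      prodℚ-suc : ∀ k f → prodℚ (suc k) f ≡ prodℚ k f ℚ.* f (suc k)
      prodℚ-suc k f = trans (cong (List.foldr (λ j acc → f (suc j) ℚ.* acc) 1ℚ) (sym (ListP.upTo-∷ʳ k))) (snoc (upTo k))
        where
        snoc : ∀ xs → List.foldr (λ j acc → f (suc j) ℚ.* acc) 1ℚ (xs List.++ k ∷ []) ≡ List.foldr (λ j acc → f (suc j) ℚ.* acc) 1ℚ xs ℚ.* f (suc k)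
        snoc [] = ℚP.*-comm (f (suc k)) 1ℚ
        snoc (x ∷ xs) = trans (cong (f (suc x) ℚ.*_) (snoc xs)) (sym (ℚP.*-assoc (f (suc x)) _ (f (suc k))))

      prod-O : ∀ k → prodℚ k (λ j → qm1 q (2 ℕ.* j ∸ 1)) ≡ ι (O k)
      prod-O zero = refl
      prod-O (suc k) = trans (prodℚ-suc k (λ j → qm1 q (2 ℕ.* j ∸ 1))) (trans (cong₂ ℚ._*_ (prod-O k) (trans (cong (qm1 q) (index k)) (ι-P (suc (k ℕ.+ k))))) (sym (ι-* (O k) (P (suc (k ℕ.+ k))))))
        where
        index : ∀ k → 2 ℕ.* suc k ∸ 1 ≡ suc (k ℕ.+ k)
        index k = trans (ℕP.+-suc k (k ℕ.+ 0)) (cong (λ z → suc (k ℕ.+ z)) (ℕP.+-identityʳ k))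

      prod-E : ∀ k → prodℚ k (λ j → qm1 q (2 ℕ.* j)) ≡ ι (E k)
      prod-E zero = refl
      prod-E (suc k) = trans (prodℚ-suc k (λ j → qm1 q (2 ℕ.* j))) (trans (cong₂ ℚ._*_ (prod-E k) (trans (cong (qm1 q) (index k)) (ι-P (suc (suc (k ℕ.+ k)))))) (sym (ι-* (E k) (P (suc (suc (k ℕ.+ k)))))))
        where
        index : ∀ k → 2 ℕ.* suc k ≡ suc (suc (k ℕ.+ k))
        index = solve-∀

      geometric : ∀ a b → ∃ λ c → P (b ℕ.* a) ≡ c ℕ.* P a
      geometric a zero = 0 , refl
      geometric a (suc b) = let (c , e) = geometric a b in c ℕ.* suc (P a) ℕ.+ 1 , ℕP.suc-injective (begin
        suc (P (a ℕ.+ b ℕ.* a))          ≡⟨ q^≡ (a ℕ.+ b ℕ.* a) ⟨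
        q ^ (a ℕ.+ b ℕ.* a)              ≡⟨ ℕP.^-distribˡ-+-* q a (b ℕ.* a) ⟩
        q ^ a ℕ.* q ^ (b ℕ.* a)          ≡⟨ cong₂ ℕ._*_ (q^≡ a) (trans (q^≡ (b ℕ.* a)) (cong suc e)) ⟩
        suc (P a) ℕ.* suc (c ℕ.* P a)    ≡⟨ arith (P a) c ⟩
        suc ((c ℕ.* suc (P a) ℕ.+ 1) ℕ.* P a) ∎)
        where
        open ≡-Reasoning
        arith : ∀ p c → suc p ℕ.* suc (c ℕ.* p) ≡ suc ((c ℕ.* suc p ℕ.+ 1) ℕ.* p)
        arith = solve-∀

      divℕ-exact : ∀ {a} c b → 1 ≤ b → a ≡ c ℕ.* b → divℕ a b ℕ.* b ≡ a
      divℕ-exact c (suc b) _ refl = cong (ℕ._* suc b) (DM.m*n/n≡m c (suc b))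

      gauss-1 : ∀ n → gauss q n 1 ℕ.* P 1 ≡ P n
      gauss-1 n = trans (cong (gauss q n 1 ℕ.*_) (sym (ℕP.*-identityʳ (P 1)))) (trans (divℕ-exact c (P 1 ℕ.* 1) (ℕP.≤-trans (P>0 0) (ℕP.≤-reflexive (sym (ℕP.*-identityʳ (P 1)))))
          (trans (ℕP.*-identityʳ (P n)) (trans (cong P (sym (ℕP.*-identityʳ n))) (trans e (cong (c ℕ.*_) (sym (ℕP.*-identityʳ (P 1)))))))) (ℕP.*-identityʳ (P n)))
        where
        c = proj₁ (geometric 1 n)
        e = proj₂ (geometric 1 n)

      -- The truncating division in `gauss` is exact because one of n and n + 1 is even: its factor
      -- is divisible by q² - 1 and the other one by q - 1.
      gauss-2 : ∀ n → gauss q (suc n) 2 ℕ.* (P 2 ℕ.* P 1) ≡ P (suc n) ℕ.* P n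
      gauss-2 n = trans (cong (λ z → gauss q (suc n) 2 ℕ.* (P 2 ℕ.* z)) (sym (ℕP.*-identityʳ (P 1))))
        (trans (divℕ-exact (proj₁ divides) (P 2 ℕ.* (P 1 ℕ.* 1)) (ℕP.*-mono-≤ {1} {_} {1} (P>0 1) (ℕP.*-mono-≤ {1} {_} {1} (P>0 0) (s≤s z≤n)))
          (trans (cong (P (suc n) ℕ.*_) (ℕP.*-identityʳ (P n))) (trans (proj₂ divides) (cong (λ z → proj₁ divides ℕ.* (P 2 ℕ.* z)) (sym (ℕP.*-identityʳ (P 1)))))))
         (cong (P (suc n) ℕ.*_) (ℕP.*-identityʳ (P n))))
        where
        arith : ∀ a b x y → a ℕ.* x ℕ.* (b ℕ.* y) ≡ b ℕ.* a ℕ.* (y ℕ.* x)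
        arith = solve-∀
        arith′ : ∀ a b x y → a ℕ.* y ℕ.* (b ℕ.* x) ≡ a ℕ.* b ℕ.* (y ℕ.* x)
        arith′ = solve-∀
        by-1 : ∀ n → ∃ λ c → P n ≡ c ℕ.* P 1
        by-1 n = proj₁ (geometric 1 n) , trans (cong P (sym (ℕP.*-identityʳ n))) (proj₂ (geometric 1 n))
        by-2 : ∀ k → ∃ λ c → P (k ℕ.+ k) ≡ c ℕ.* P 2
        by-2 k = proj₁ (geometric 2 k) , trans (cong P (double k)) (proj₂ (geometric 2 k))
          where
          double : ∀ k → k ℕ.+ k ≡ k ℕ.* 2
          double = solve-∀
        divides : ∃ λ c → P (suc n) ℕ.* P n ≡ c ℕ.* (P 2 ℕ.* P 1)
        divides with parity n
        ... | inj₁ (k , refl) = let (c , e) = by-1 (suc (k ℕ.+ k)) ; (d , f) = by-2 k in d ℕ.* c , trans (cong₂ ℕ._*_ e f) (arith c d (P 1) (P 2))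
        ... | inj₂ (k , refl) = let (c , e) = by-2 (suc k) ; (d , f) = by-1 (suc (k ℕ.+ k)) in
              c ℕ.* d , trans (cong₂ ℕ._*_ (trans (cong (P ∘ suc) (sym (ℕP.+-suc k k))) e) f) (arith′ c d (P 1) (P 2))

      -- The exponents in B can be negative for small n. Multiplying by q^k moves the comparison to
      -- natural exponents.
      qpow-shift : ∀ z k l → z ℤ.+ + k ≡ + l → qpow q z ℚ.* ι (q ^ k) ≡ ι (q ^ l)
      qpow-shift (+ z) k l e = trans (sym (ι-* (q ^ z) (q ^ k))) (cong ι (trans (sym (ℕP.^-distribˡ-+-* q z k)) (cong (q ^_) (ℤP.+-injective e))))
      qpow-shift -[1+ j ] k l e = begin
        invℕ (q ^ suc j) ℚ.* ι (q ^ k) ≡⟨ cong (λ z → invℕ (q ^ suc j) ℚ.* ι (q ^ z)) k≡ ⟩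
        invℕ (q ^ suc j) ℚ.* ι (q ^ (suc j ℕ.+ l)) ≡⟨ cong (invℕ (q ^ suc j) ℚ.*_) (trans (cong ι (ℕP.^-distribˡ-+-* q (suc j) l)) (ι-* (q ^ suc j) (q ^ l))) ⟩
        invℕ (q ^ suc j) ℚ.* (ι (q ^ suc j) ℚ.* ι (q ^ l)) ≡⟨ ℚP.*-assoc (invℕ (q ^ suc j)) (ι (q ^ suc j)) (ι (q ^ l)) ⟨
        invℕ (q ^ suc j) ℚ.* ι (q ^ suc j) ℚ.* ι (q ^ l) ≡⟨ cong (ℚ._* ι (q ^ l)) (invℕ-inverse (q ^ suc j) (ℕP.m^n>0 q (suc j))) ⟩
        1ℚ ℚ.* ι (q ^ l) ≡⟨ ℚP.*-identityˡ (ι (q ^ l)) ⟩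
        ι (q ^ l) ∎
        where
        open ≡-Reasoning
        lem : ∀ x y → x ≡ y ℤ.+ (ℤ.- y ℤ.+ x)
        lem = ℤSolver.solve-∀
        k≡ : k ≡ suc j ℕ.+ l
        k≡ = ℤP.+-injective (trans (lem (+ k) (+ suc j)) (cong (λ z → + suc j ℤ.+ z) e))

      ex-value : ∀ a b c n z → a ℤ.* + n ℤ.* + n ℤ.+ b ℤ.* + n ℤ.+ c ≡ + 4 ℤ.* z → ex a b c n ≡ z
      ex-value a b c n z e = trans (cong (ℤDM._/ + 4) e) (exact-quarter z)

      sy>0 : ∀ n → 1 ≤ sy q n
      sy>0 zero = s≤s z≤n
      sy>0 (suc zero) = ℕP.*-mono-≤ {1} {_} {1} (ℕP.m<n⇒0<n∸m 2≤q) (s≤s z≤n)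
      sy>0 (suc (suc n)) = ℕP.≤-trans (ℕP.*-mono-≤ {1} {_} {1} (ℕP.m<n⇒0<n∸m 2≤q) (ℕP.*-mono-≤ {1} {_} {1} (ℕP.m^n>0 q (suc n)) (sy>0 (suc n)))) (ℕP.m≤m+n _ _)

      gl>0 : ∀ n → 1 ≤ gl q n
      gl>0 zero = s≤s z≤n
      gl>0 (suc n) = ℕP.*-mono-≤ {1} {_} {1} (P>0 n) (ℕP.*-mono-≤ {1} {_} {1} (ℕP.m^n>0 q n) (gl>0 n))

      -- ε = 1 for A₁, B₁ and ε = q for A₂, B₂.
      record Factors (A B : ℚ) (s m ε : ℕ) : Set where
        field
          ε>0 : 1 ≤ ε
          A-eq : A ℚ.* ι (gl q s ℕ.* gl q m) ≡ ι (ε ℕ.* (al q (s ℕ.+ m) ℕ.* al q s ℕ.* (gl q (s ℕ.+ m) ℕ.* sy q s)))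
          B-eq : B ℚ.* ι (ε ℕ.* (sy q s ℕ.* (q ^ s) ^ m)) ≡ ι (gl q (s ℕ.+ m))

      -- The counting identity, after cancelling |Alt(N)| / |Alt(s)|, is divided by q and by
      -- positive group orders in the rationals. The quotient q⁻¹ A (B + c) comes out as the natural
      -- number N, which `floor` returns unchanged.
      top-value : ∀ {A B s m ε} → Factors A B s m ε → ∀ {c κ N} → ι ε ℚ.* c ℚ.+ ι (gl q m) ≡ ι q ℚ.* ι κ →
        al q (s ℕ.+ m) ≡ al q s ℕ.* ((q ^ s) ^ m ℕ.* al q m) →
        q ℕ.* (N ℕ.* (gl q s ℕ.* ((q ^ s) ^ m ℕ.* gl q m) ℕ.* ((q ^ s) ^ m ℕ.* al q m)))
          ℕ.+ gl q (s ℕ.+ m) ℕ.* al q (s ℕ.+ m) ℕ.* (sy q s ℕ.* ((q ^ s) ^ m ℕ.* gl q m) ℕ.* al q (s ℕ.+ m))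
          ≡ gl q (s ℕ.+ m) ℕ.* al q (s ℕ.+ m) ℕ.* (q ℕ.* (sy q s ℕ.* ((q ^ s) ^ m ℕ.* κ) ℕ.* al q (s ℕ.+ m)) ℕ.+ gl q (s ℕ.+ m) ℕ.* al q (s ℕ.+ m)) →
        top q A B c ≡ + N
      top-value {A} {B} {s} {m} {ε} fs {c} {κ} {N} hc al-split count = trans (cong ℚ.floor {x} {ι N} (ι-cancel w w>0 {x} {ι N} (trans (cong (x ℚ.*_) ιw) (trans combined (cong (ι N ℚ.*_) (sym ιw)))))) (floor-ι N)
        where
        open Factors fs
        open ≡-Reasoning
        gs = gl q s
        gm = gl q m
        t = (q ^ s) ^ m
        σ = sy q s
        a = al q (s ℕ.+ m)
        as = al q s
        G = gl q (s ℕ.+ m)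
        x = invℕ q ℚ.* (A ℚ.* (B ℚ.+ c))
        w = gs ℕ.* gm ℕ.* (ε ℕ.* (σ ℕ.* t))
        t>0 : 1 ≤ t
        t>0 = ℕP.m^n>0 (q ^ s) {{ℕ.>-nonZero (ℕP.m^n>0 q s)}} m
        w>0 : 1 ≤ w
        w>0 = ℕP.*-mono-≤ {1} {_} {1} (ℕP.*-mono-≤ {1} {_} {1} (gl>0 s) (gl>0 m)) (ℕP.*-mono-≤ {1} {_} {1} ε>0 (ℕP.*-mono-≤ {1} {_} {1} (sy>0 s) t>0))
        -- By the block decomposition of alternating matrices `a` = `as` · d, and d is a common
        -- factor of both sides of the counting identity.
        d = t ℕ.* al q m
        instance d≢0 = ℕ.>-nonZero (ℕP.*-mono-≤ {1} {_} {1} t>0 (ℕP.≤-trans (ℕP.m^n>0 q (T m)) (ℕP.≤-reflexive (sym (al≡ m)))))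
        arith : ∀ d q N x g a y as → d ℕ.* (q ℕ.* (N ℕ.* x) ℕ.+ g ℕ.* a ℕ.* (y ℕ.* as)) ≡ q ℕ.* (N ℕ.* (x ℕ.* d)) ℕ.+ g ℕ.* a ℕ.* (y ℕ.* (as ℕ.* d))
        arith = solve-∀
        arith′ : ∀ d q g a z as → g ℕ.* a ℕ.* (q ℕ.* (z ℕ.* (as ℕ.* d)) ℕ.+ g ℕ.* (as ℕ.* d)) ≡ d ℕ.* (g ℕ.* a ℕ.* (q ℕ.* (z ℕ.* as) ℕ.+ g ℕ.* as))
        arith′ = solve-∀
        reduced : q ℕ.* (N ℕ.* (gs ℕ.* (t ℕ.* gm))) ℕ.+ G ℕ.* a ℕ.* (σ ℕ.* (t ℕ.* gm) ℕ.* as) ≡ G ℕ.* a ℕ.* (q ℕ.* (σ ℕ.* (t ℕ.* κ) ℕ.* as) ℕ.+ G ℕ.* as)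
        reduced = ℕP.*-cancelˡ-≡ _ _ d (begin
          d ℕ.* (q ℕ.* (N ℕ.* (gs ℕ.* (t ℕ.* gm))) ℕ.+ G ℕ.* a ℕ.* (σ ℕ.* (t ℕ.* gm) ℕ.* as)) ≡⟨ arith d q N (gs ℕ.* (t ℕ.* gm)) G a (σ ℕ.* (t ℕ.* gm)) as ⟩
          q ℕ.* (N ℕ.* (gs ℕ.* (t ℕ.* gm) ℕ.* d)) ℕ.+ G ℕ.* a ℕ.* (σ ℕ.* (t ℕ.* gm) ℕ.* (as ℕ.* d))
            ≡⟨ cong (λ z → q ℕ.* (N ℕ.* (gs ℕ.* (t ℕ.* gm) ℕ.* d)) ℕ.+ G ℕ.* a ℕ.* (σ ℕ.* (t ℕ.* gm) ℕ.* z)) al-split ⟨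
          q ℕ.* (N ℕ.* (gs ℕ.* (t ℕ.* gm) ℕ.* d)) ℕ.+ G ℕ.* a ℕ.* (σ ℕ.* (t ℕ.* gm) ℕ.* a) ≡⟨ count ⟩
          G ℕ.* a ℕ.* (q ℕ.* (σ ℕ.* (t ℕ.* κ) ℕ.* a) ℕ.+ G ℕ.* a) ≡⟨ cong (λ z → G ℕ.* a ℕ.* (q ℕ.* (σ ℕ.* (t ℕ.* κ) ℕ.* z) ℕ.+ G ℕ.* z)) al-split ⟩
          G ℕ.* a ℕ.* (q ℕ.* (σ ℕ.* (t ℕ.* κ) ℕ.* (as ℕ.* d)) ℕ.+ G ℕ.* (as ℕ.* d)) ≡⟨ arith′ d q G a (σ ℕ.* (t ℕ.* κ)) as ⟩
          d ℕ.* (G ℕ.* a ℕ.* (q ℕ.* (σ ℕ.* (t ℕ.* κ) ℕ.* as) ℕ.+ G ℕ.* as)) ∎)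
        ι-*³ : ∀ x y z → ι (x ℕ.* (y ℕ.* z)) ≡ ι x ℚ.* (ι y ℚ.* ι z)
        ι-*³ x y z = trans (ι-* x (y ℕ.* z)) (cong (ι x ℚ.*_) (ι-* y z))
        ιw : ι w ≡ ι gs ℚ.* ι gm ℚ.* (ι ε ℚ.* (ι σ ℚ.* ι t))
        ιw = trans (ι-* (gs ℕ.* gm) (ε ℕ.* (σ ℕ.* t))) (cong₂ ℚ._*_ (ι-* gs gm) (ι-*³ ε σ t))
        ι-Y : ∀ z → ι (σ ℕ.* (t ℕ.* z) ℕ.* as) ≡ ι σ ℚ.* (ι t ℚ.* ι z) ℚ.* ι as
        ι-Y z = trans (ι-* (σ ℕ.* (t ℕ.* z)) as) (cong (ℚ._* ι as) (ι-*³ σ t z))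
        combined = Combine.combine ℚP.+-*-commutativeRing {A} {B} {c} {ι q} {invℕ q} {ι N} {ι gs} {ι gm} {ι ε} {ι σ} {ι t} {ι a} {ι as} {ι G} {ι κ}
          (trans (cong (A ℚ.*_) (sym (ι-* gs gm))) (trans A-eq (trans (ι-* ε (a ℕ.* as ℕ.* (G ℕ.* σ))) (cong (ι ε ℚ.*_) (trans (ι-* (a ℕ.* as) (G ℕ.* σ)) (cong₂ ℚ._*_ (ι-* a as) (ι-* G σ)))))))
          (trans (cong (B ℚ.*_) (sym (ι-*³ ε σ t))) B-eq) hc (invℕ-inverse q (ℕP.≤-trans (s≤s z≤n) 2≤q))
          (trans (cong₂ ℚ._+_ (sym (trans (ι-* q (N ℕ.* (gs ℕ.* (t ℕ.* gm)))) (cong (ι q ℚ.*_) (trans (ι-* N (gs ℕ.* (t ℕ.* gm))) (cong (ι N ℚ.*_) (ι-*³ gs t gm))))))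
                            (sym (trans (ι-* (G ℕ.* a) (σ ℕ.* (t ℕ.* gm) ℕ.* as)) (cong₂ ℚ._*_ (ι-* G a) (ι-Y gm)))))
            (trans (sym (ι-+ (q ℕ.* (N ℕ.* (gs ℕ.* (t ℕ.* gm)))) (G ℕ.* a ℕ.* (σ ℕ.* (t ℕ.* gm) ℕ.* as)))) (trans (cong ι reduced)
              (trans (ι-* (G ℕ.* a) (q ℕ.* (σ ℕ.* (t ℕ.* κ) ℕ.* as) ℕ.+ G ℕ.* as)) (cong₂ ℚ._*_ (ι-* G a)
                (trans (ι-+ (q ℕ.* (σ ℕ.* (t ℕ.* κ) ℕ.* as)) (G ℕ.* as)) (cong₂ ℚ._+_ (trans (ι-* q (σ ℕ.* (t ℕ.* κ) ℕ.* as)) (cong (ι q ℚ.*_) (ι-Y κ))) (ι-* G as))))))))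

  -- The constants A and B expressed by group orders.

  module PaperFactors where

    import Defs
    open Defs using (Sign; plus; minus; A₁; B₁; A₂; B₂; ℕ→ℚ; qpow; prodℚ; gauss; qm1; ex)
    open GroupOrders using (gl; sy; al)
    open Arithmetic
    open import Data.Nat as ℕ using (ℕ; suc; _≤_; z≤n; s≤s; _∸_; _^_)
    import Data.Nat.Properties as ℕP
    import Data.Nat.DivMod as DM
    open import Data.Nat.Tactic.RingSolver using (solve-∀)
    open import Data.Integer as ℤ using (ℤ; +_)
    import Data.Integer.Properties as ℤP
    import Data.Integer.Tactic.RingSolver as ℤSolver
    open import Data.Rational as ℚ using (ℚ)
    import Data.Rational.Properties as ℚP
    open import Relation.Binary.PropositionalEquality
    open import Function using (_∘_)

    module _ (q : ℕ) (2≤q : 2 ≤ q) where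
      open Orders q 2≤q
      open ≡-Reasoning

      private
        ι = ℕ→ℚ

        half : ∀ {n} k → n ≡ k ℕ.* 2 → n ℕ./ 2 ≡ k
        half k refl = DM.m*n/n≡m k 2

        A-from : ∀ {z} l g o {X Y} → z ≡ + l → q ^ l ℕ.* g ℕ.* o ℕ.* X ≡ Y → qpow q z ℚ.* ι g ℚ.* ι o ℚ.* ι X ≡ ι Y
        A-from l g o {X} refl e = trans (sym (trans (ι-* (q ^ l ℕ.* g ℕ.* o) X) (cong (ℚ._* ι X) (trans (ι-* (q ^ l ℕ.* g) o) (cong (ℚ._* ι o) (ι-* (q ^ l) g)))))) (cong ι e)

        B-from : ∀ {z} k l R o {X G} → z ℤ.+ + k ≡ + l → X ≡ q ^ k ℕ.* o → G ≡ q ^ l ℕ.* (R ℕ.* o) → qpow q z ℚ.* ι R ℚ.* ι X ≡ ι G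
        B-from {z} k l R o e refl refl = begin
          qpow q z ℚ.* ι R ℚ.* ι (q ^ k ℕ.* o)        ≡⟨ cong (qpow q z ℚ.* ι R ℚ.*_) (ι-* (q ^ k) o) ⟩
          qpow q z ℚ.* ι R ℚ.* (ι (q ^ k) ℚ.* ι o)    ≡⟨ interchange (qpow q z) (ι R) (ι (q ^ k)) (ι o) ⟩
          qpow q z ℚ.* ι (q ^ k) ℚ.* (ι R ℚ.* ι o)    ≡⟨ cong₂ ℚ._*_ (qpow-shift z k l e) (sym (ι-* R o)) ⟩
          ι (q ^ l) ℚ.* ι (R ℕ.* o)                   ≡⟨ ι-* (q ^ l) (R ℕ.* o) ⟨
          ι (q ^ l ℕ.* (R ℕ.* o))                     ∎
          where
          interchange : ∀ a b c d → a ℚ.* b ℚ.* (c ℚ.* d) ≡ a ℚ.* c ℚ.* (b ℚ.* d)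
          interchange a b c d = trans (ℚP.*-assoc a b (c ℚ.* d)) (trans (cong (a ℚ.*_) (trans (sym (ℚP.*-assoc b c d)) (trans (cong (ℚ._* d) (ℚP.*-comm b c)) (ℚP.*-assoc c b d)))) (sym (ℚP.*-assoc a c (b ℚ.* d))))

        ^-+ : ∀ m n → q ^ (m ℕ.+ n) ≡ q ^ m ℕ.* q ^ n
        ^-+ = ℕP.^-distribˡ-+-* q

        -- The exponent of q collects T (s + 1) and T s from the two alternating counts, s from the
        -- recursion for GL(s + 1), and x from the symmetric count; the Gaussian coefficient
        -- supplies q^(s+1) - 1 over q - 1.
        A₁-identity : ∀ {N} s x o → N ≡ suc s → sy q s ≡ q ^ x ℕ.* o →
          q ^ (T (suc s) ℕ.+ T s ℕ.+ s ℕ.+ x) ℕ.* gauss q N 1 ℕ.* o ℕ.* (gl q s ℕ.* gl q 1) ≡ 1 ℕ.* (al q N ℕ.* al q s ℕ.* (gl q N ℕ.* sy q s))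
        A₁-identity s x o refl e = begin
          q ^ (T (suc s) ℕ.+ T s ℕ.+ s ℕ.+ x) ℕ.* g ℕ.* o ℕ.* (gl q s ℕ.* (P 1 ℕ.* (1 ℕ.* 1)))
            ≡⟨ cong (λ z → z ℕ.* g ℕ.* o ℕ.* (gl q s ℕ.* (P 1 ℕ.* (1 ℕ.* 1))))
                 (trans (^-+ (T (suc s) ℕ.+ T s ℕ.+ s) x) (cong (ℕ._* q ^ x) (trans (^-+ (T (suc s) ℕ.+ T s) s) (cong (ℕ._* q ^ s) (^-+ (T (suc s)) (T s)))))) ⟩
          a ℕ.* b ℕ.* c ℕ.* d ℕ.* g ℕ.* o ℕ.* (gl q s ℕ.* (P 1 ℕ.* (1 ℕ.* 1))) ≡⟨ arith a b c d g o (gl q s) (P 1) ⟩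
          1 ℕ.* (a ℕ.* b ℕ.* (g ℕ.* P 1 ℕ.* (c ℕ.* gl q s) ℕ.* (d ℕ.* o)))
            ≡⟨ cong₂ (λ u v → 1 ℕ.* (u ℕ.* (v ℕ.* (c ℕ.* gl q s) ℕ.* (d ℕ.* o)))) (sym (cong₂ ℕ._*_ (al≡ (suc s)) (al≡ s))) (gauss-1 (suc s)) ⟩
          1 ℕ.* (al q (suc s) ℕ.* al q s ℕ.* (gl q (suc s) ℕ.* (d ℕ.* o))) ≡⟨ cong (λ z → 1 ℕ.* (al q (suc s) ℕ.* al q s ℕ.* (gl q (suc s) ℕ.* z))) e ⟨
          1 ℕ.* (al q (suc s) ℕ.* al q s ℕ.* (gl q (suc s) ℕ.* sy q s)) ∎
          where
          a = q ^ T (suc s)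
          b = q ^ T s
          c = q ^ s
          d = q ^ x
          g = gauss q (suc s) 1
          arith : ∀ a b c d g o l p → a ℕ.* b ℕ.* c ℕ.* d ℕ.* g ℕ.* o ℕ.* (l ℕ.* (p ℕ.* (1 ℕ.* 1))) ≡ 1 ℕ.* (a ℕ.* b ℕ.* (g ℕ.* p ℕ.* (c ℕ.* l) ℕ.* (d ℕ.* o)))
          arith = solve-∀

        A₂-identity : ∀ {N} s x o → N ≡ suc (suc s) → sy q s ≡ q ^ x ℕ.* o →
          q ^ (T (suc (suc s)) ℕ.+ T s ℕ.+ suc s ℕ.+ s ℕ.+ x) ℕ.* gauss q N 2 ℕ.* o ℕ.* (gl q s ℕ.* gl q 2) ≡ q ℕ.* (al q N ℕ.* al q s ℕ.* (gl q N ℕ.* sy q s))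
        A₂-identity s x o refl e = begin
          q ^ (T (suc (suc s)) ℕ.+ T s ℕ.+ suc s ℕ.+ s ℕ.+ x) ℕ.* g ℕ.* o ℕ.* (gl q s ℕ.* gl q 2)
            ≡⟨ cong (λ z → z ℕ.* g ℕ.* o ℕ.* (gl q s ℕ.* gl q 2))
                 (trans (^-+ (T (suc (suc s)) ℕ.+ T s ℕ.+ suc s ℕ.+ s) x) (cong (ℕ._* q ^ x) (trans (^-+ (T (suc (suc s)) ℕ.+ T s ℕ.+ suc s) s)
                   (cong (ℕ._* q ^ s) (trans (^-+ (T (suc (suc s)) ℕ.+ T s) (suc s)) (cong (ℕ._* q ^ suc s) (^-+ (T (suc (suc s))) (T s)))))))) ⟩
          a ℕ.* b ℕ.* f ℕ.* c ℕ.* d ℕ.* g ℕ.* o ℕ.* (gl q s ℕ.* (P 2 ℕ.* (q ℕ.* 1 ℕ.* (P 1 ℕ.* (1 ℕ.* 1))))) ≡⟨ arith a b c d f g o (gl q s) (P 1) (P 2) q ⟩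
          q ℕ.* (a ℕ.* b ℕ.* (f ℕ.* (g ℕ.* (P 2 ℕ.* P 1)) ℕ.* (c ℕ.* gl q s) ℕ.* (d ℕ.* o)))
            ≡⟨ cong₂ (λ u v → q ℕ.* (u ℕ.* (f ℕ.* v ℕ.* (c ℕ.* gl q s) ℕ.* (d ℕ.* o)))) (sym (cong₂ ℕ._*_ (al≡ (suc (suc s))) (al≡ s))) (gauss-2 (suc s)) ⟩
          q ℕ.* (al q (suc (suc s)) ℕ.* al q s ℕ.* (f ℕ.* (P (suc (suc s)) ℕ.* P (suc s)) ℕ.* (c ℕ.* gl q s) ℕ.* (d ℕ.* o)))
            ≡⟨ cong₂ (λ u v → q ℕ.* (al q (suc (suc s)) ℕ.* al q s ℕ.* (u ℕ.* v))) (arith′ f (P (suc (suc s))) (P (suc s)) (c ℕ.* gl q s)) (sym e) ⟩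
          q ℕ.* (al q (suc (suc s)) ℕ.* al q s ℕ.* (gl q (suc (suc s)) ℕ.* sy q s)) ∎
          where
          a = q ^ T (suc (suc s))
          b = q ^ T s
          c = q ^ s
          d = q ^ x
          f = q ^ suc s
          g = gauss q (suc (suc s)) 2
          arith : ∀ a b c d f g o l p r q → a ℕ.* b ℕ.* f ℕ.* c ℕ.* d ℕ.* g ℕ.* o ℕ.* (l ℕ.* (r ℕ.* (q ℕ.* 1 ℕ.* (p ℕ.* (1 ℕ.* 1)))))
            ≡ q ℕ.* (a ℕ.* b ℕ.* (f ℕ.* (g ℕ.* (r ℕ.* p)) ℕ.* (c ℕ.* l) ℕ.* (d ℕ.* o)))
          arith = solve-∀
          arith′ : ∀ f p r l → f ℕ.* (p ℕ.* r) ℕ.* l ≡ p ℕ.* (f ℕ.* (r ℕ.* l))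
          arith′ = solve-∀

        X₁ : ∀ s x o → sy q s ≡ q ^ x ℕ.* o → 1 ℕ.* (sy q s ℕ.* (q ^ s) ^ 1) ≡ q ^ (x ℕ.+ s) ℕ.* o
        X₁ s x o e = trans (cong (λ z → 1 ℕ.* (z ℕ.* (q ^ s) ^ 1)) e) (trans (arith (q ^ x) o (q ^ s)) (cong (ℕ._* o) (sym (^-+ x s))))
          where
          arith : ∀ a o b → 1 ℕ.* (a ℕ.* o ℕ.* (b ℕ.* 1)) ≡ a ℕ.* b ℕ.* o
          arith = solve-∀

        X₂ : ∀ s x o → sy q s ≡ q ^ x ℕ.* o → q ℕ.* (sy q s ℕ.* (q ^ s) ^ 2) ≡ q ^ (suc (x ℕ.+ (s ℕ.+ s))) ℕ.* o
        X₂ s x o e = trans (cong (λ z → q ℕ.* (z ℕ.* (q ^ s) ^ 2)) e) (trans (arith q (q ^ x) o (q ^ s))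
            (cong (λ z → q ℕ.* z ℕ.* o) (sym (trans (^-+ x (s ℕ.+ s)) (cong (q ^ x ℕ.*_) (^-+ s s))))))
          where
          arith : ∀ q a o b → q ℕ.* (a ℕ.* o ℕ.* (b ℕ.* (b ℕ.* 1))) ≡ q ℕ.* (a ℕ.* (b ℕ.* b)) ℕ.* o
          arith = solve-∀

        T-ℤ : ∀ k → + T (k ℕ.+ k) ≡ + 2 ℤ.* (+ k ℤ.* + k) ℤ.- + k
        T-ℤ k = trans (lem (+ T (k ℕ.+ k)) (+ k)) (cong (ℤ._- + k) (trans (cong +_ (T-double k)) (trans (ℤP.pos-* 2 (k ℕ.* k)) (cong (+ 2 ℤ.*_) (ℤP.pos-* k k)))))
          where
          lem : ∀ t k → t ≡ (t ℤ.+ k) ℤ.- k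
          lem = ℤSolver.solve-∀

        pronic-ℤ : ∀ k → + (k ℕ.* suc k) ≡ + k ℤ.* (+ 1 ℤ.+ + k)
        pronic-ℤ k = ℤP.pos-* k (suc k)

      -- Writing s as 2 k or 2 k + 1 selects the closed form of `sy` and makes the quarter exponents
      -- integral. With T (2 k) = 2 k² - k and x = k (k + 1), all exponents become integer
      -- polynomials in k. The other three cases follow the same pattern.
      factors₁⁺ : ∀ k → Factors (A₁ plus q (suc (k ℕ.+ k) ℕ.+ 1)) (B₁ plus q (suc (k ℕ.+ k) ℕ.+ 1)) (suc (k ℕ.+ k)) 1 1
      factors₁⁺ k = record
        { ε>0 = s≤s z≤n
        ; A-eq = trans (cong (λ z → qpow q (ex (+ 5) (ℤ.- (+ 6)) (+ 0) n) ℚ.* ι (gauss q n 1) ℚ.* z ℚ.* ι (gl q s ℕ.* gl q 1)) product)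
            (A-from l (gauss q n 1) o (ex-value (+ 5) (ℤ.- (+ 6)) (+ 0) n (+ l) (A-exponent (+ k) (+ T (k ℕ.+ k)) (+ x) (T-ℤ k) (pronic-ℤ k))) (A₁-identity s x o n≡ (sy-odd k)))
        ; B-eq = trans (cong (λ z → z ℚ.* ι (1 ℕ.* (sy q s ℕ.* (q ^ s) ^ 1))) B≡)
            (B-from {ex (+ 1) (ℤ.- (+ 4)) (+ 4) n} (x ℕ.+ s) (T (suc s)) R o
              (trans (cong (ℤ._+ + (x ℕ.+ s)) (ex-value (+ 1) (ℤ.- (+ 4)) (+ 4) n ((+ k) ℤ.* (+ k)) (B-exponent (+ k)))) (B-shift (+ k) (+ T (k ℕ.+ k)) (+ x) (T-ℤ k) (pronic-ℤ k)))
              (X₁ s x o (sy-odd k))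
              (trans (cong (gl q) n≡) (trans (gl≡ (suc s)) (cong (q ^ T (suc s) ℕ.*_) G≡))))
        }
        where
        s = suc (k ℕ.+ k)
        n = s ℕ.+ 1
        x = k ℕ.* suc k
        o = O (suc k)
        R = E (suc k)
        l = T (suc s) ℕ.+ T s ℕ.+ s ℕ.+ x
        n≡ : n ≡ suc s
        n≡ = ℕP.+-comm s 1
        half-n : n ℕ./ 2 ≡ suc k
        half-n = half (suc k) (arith k)
          where
          arith : ∀ k → suc (k ℕ.+ k) ℕ.+ 1 ≡ suc k ℕ.* 2
          arith = solve-∀
        product = trans (cong (λ j → prodℚ j (λ j → qm1 q (2 ℕ.* j ∸ 1))) half-n) (prod-O (suc k))
        product′ = trans (cong (λ j → prodℚ j (λ j → qm1 q (2 ℕ.* j))) half-n) (prod-E (suc k))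
        B≡ : B₁ plus q n ≡ qpow q (ex (+ 1) (ℤ.- (+ 4)) (+ 4) n) ℚ.* ι R
        B≡ = cong (qpow q (ex (+ 1) (ℤ.- (+ 4)) (+ 4) n) ℚ.*_) product′
        G≡ : Pn (suc s) ≡ R ℕ.* o
        G≡ = trans (cong (Pn ∘ suc) (sym (ℕP.+-suc k k))) (trans (Pn-even (suc k)) (ℕP.*-comm o R))
        A-exponent : ∀ K t x → t ≡ + 2 ℤ.* (K ℤ.* K) ℤ.- K → x ≡ K ℤ.* (+ 1 ℤ.+ K) → let s = + 1 ℤ.+ (K ℤ.+ K) in let n = s ℤ.+ + 1 in
          + 5 ℤ.* n ℤ.* n ℤ.+ (ℤ.- (+ 6)) ℤ.* n ℤ.+ + 0 ≡ + 4 ℤ.* ((s ℤ.+ ((K ℤ.+ K) ℤ.+ t)) ℤ.+ ((K ℤ.+ K) ℤ.+ t) ℤ.+ s ℤ.+ x)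
        A-exponent K _ _ refl refl = poly K
          where
          poly : ∀ K → let t = + 2 ℤ.* (K ℤ.* K) ℤ.- K in let x = K ℤ.* (+ 1 ℤ.+ K) in let s = + 1 ℤ.+ (K ℤ.+ K) in let n = s ℤ.+ + 1 in
            + 5 ℤ.* n ℤ.* n ℤ.+ (ℤ.- (+ 6)) ℤ.* n ℤ.+ + 0 ≡ + 4 ℤ.* ((s ℤ.+ ((K ℤ.+ K) ℤ.+ t)) ℤ.+ ((K ℤ.+ K) ℤ.+ t) ℤ.+ s ℤ.+ x)
          poly = ℤSolver.solve-∀
        B-exponent : ∀ K → let n = + 1 ℤ.+ (K ℤ.+ K) ℤ.+ + 1 in + 1 ℤ.* n ℤ.* n ℤ.+ (ℤ.- (+ 4)) ℤ.* n ℤ.+ + 4 ≡ + 4 ℤ.* (K ℤ.* K)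
        B-exponent = ℤSolver.solve-∀
        B-shift : ∀ K t x → t ≡ + 2 ℤ.* (K ℤ.* K) ℤ.- K → x ≡ K ℤ.* (+ 1 ℤ.+ K) → let s = + 1 ℤ.+ (K ℤ.+ K) in
          K ℤ.* K ℤ.+ (x ℤ.+ s) ≡ (s ℤ.+ ((K ℤ.+ K) ℤ.+ t))
        B-shift K _ _ refl refl = poly K
          where
          poly : ∀ K → let t = + 2 ℤ.* (K ℤ.* K) ℤ.- K in let x = K ℤ.* (+ 1 ℤ.+ K) in let s = + 1 ℤ.+ (K ℤ.+ K) in K ℤ.* K ℤ.+ (x ℤ.+ s) ≡ (s ℤ.+ ((K ℤ.+ K) ℤ.+ t))
          poly = ℤSolver.solve-∀

      factors₁⁻ : ∀ k → Factors (A₁ minus q (k ℕ.+ k ℕ.+ 1)) (B₁ minus q (k ℕ.+ k ℕ.+ 1)) (k ℕ.+ k) 1 1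
      factors₁⁻ k = record
        { ε>0 = s≤s z≤n
        ; A-eq = trans (cong (λ z → qpow q (ex (+ 5) (ℤ.- (+ 4)) (ℤ.- (+ 1)) n) ℚ.* ι (gauss q n 1) ℚ.* z ℚ.* ι (gl q s ℕ.* gl q 1)) product)
            (A-from l (gauss q n 1) o (ex-value (+ 5) (ℤ.- (+ 4)) (ℤ.- (+ 1)) n (+ l) (A-exponent (+ k) (+ T (k ℕ.+ k)) (+ x) (T-ℤ k) (pronic-ℤ k))) (A₁-identity s x o n≡ (sy-even k)))
        ; B-eq = trans (cong (λ z → z ℚ.* ι (1 ℕ.* (sy q s ℕ.* (q ^ s) ^ 1))) B≡)
            (B-from {ex (+ 1) (ℤ.- (+ 6)) (+ 5) n} (x ℕ.+ s) (T (suc s)) R o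
              (trans (cong (ℤ._+ + (x ℕ.+ s)) (ex-value (+ 1) (ℤ.- (+ 6)) (+ 5) n ((+ k) ℤ.* (+ k) ℤ.- + 2 ℤ.* (+ k)) (B-exponent (+ k)))) (B-shift (+ k) (+ T (k ℕ.+ k)) (+ x) (T-ℤ k) (pronic-ℤ k)))
              (X₁ s x o (sy-even k))
              (trans (cong (gl q) n≡) (trans (gl≡ (suc s)) (cong (q ^ T (suc s) ℕ.*_) G≡))))
        }
        where
        s = k ℕ.+ k
        n = s ℕ.+ 1
        x = k ℕ.* suc k
        o = O (k)
        R = P (suc s) ℕ.* E k
        l = T (suc s) ℕ.+ T s ℕ.+ s ℕ.+ x
        n≡ : n ≡ suc s
        n≡ = ℕP.+-comm s 1
        half-n : (n ∸ 1) ℕ./ 2 ≡ k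
        half-n = half k (trans (ℕP.m+n∸n≡m s 1) (arith k))
          where
          arith : ∀ k → k ℕ.+ k ≡ k ℕ.* 2
          arith = solve-∀
        product = trans (cong (λ j → prodℚ j (λ j → qm1 q (2 ℕ.* j ∸ 1))) half-n) (prod-O (k))
        product′ = trans (cong (λ j → prodℚ j (λ j → qm1 q (2 ℕ.* j))) half-n) (prod-E (k))
        B≡ : B₁ minus q n ≡ qpow q (ex (+ 1) (ℤ.- (+ 6)) (+ 5) n) ℚ.* ι R
        B≡ = trans (ℚP.*-assoc (qpow q (ex (+ 1) (ℤ.- (+ 6)) (+ 5) n)) _ _) (cong (qpow q (ex (+ 1) (ℤ.- (+ 6)) (+ 5) n) ℚ.*_)
          (trans (cong₂ ℚ._*_ (trans (cong (qm1 q) n≡) (ι-P (suc s))) product′) (sym (ι-* (P (suc s)) (E k)))))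
        G≡ : Pn (suc s) ≡ R ℕ.* o
        G≡ = trans (Pn-odd k) (arith (O k) (P (suc s)) (E k))
          where
          arith : ∀ o p e → o ℕ.* p ℕ.* e ≡ p ℕ.* e ℕ.* o
          arith = solve-∀
        A-exponent : ∀ K t x → t ≡ + 2 ℤ.* (K ℤ.* K) ℤ.- K → x ≡ K ℤ.* (+ 1 ℤ.+ K) → let s = K ℤ.+ K in let n = s ℤ.+ + 1 in
          + 5 ℤ.* n ℤ.* n ℤ.+ (ℤ.- (+ 4)) ℤ.* n ℤ.+ (ℤ.- (+ 1)) ≡ + 4 ℤ.* ((s ℤ.+ t) ℤ.+ t ℤ.+ s ℤ.+ x)
        A-exponent K _ _ refl refl = poly K
          where
          poly : ∀ K → let t = + 2 ℤ.* (K ℤ.* K) ℤ.- K in let x = K ℤ.* (+ 1 ℤ.+ K) in let s = K ℤ.+ K in let n = s ℤ.+ + 1 in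
            + 5 ℤ.* n ℤ.* n ℤ.+ (ℤ.- (+ 4)) ℤ.* n ℤ.+ (ℤ.- (+ 1)) ≡ + 4 ℤ.* ((s ℤ.+ t) ℤ.+ t ℤ.+ s ℤ.+ x)
          poly = ℤSolver.solve-∀
        B-exponent : ∀ K → let n = K ℤ.+ K ℤ.+ + 1 in + 1 ℤ.* n ℤ.* n ℤ.+ (ℤ.- (+ 6)) ℤ.* n ℤ.+ + 5 ≡ + 4 ℤ.* (K ℤ.* K ℤ.- + 2 ℤ.* K)
        B-exponent = ℤSolver.solve-∀
        B-shift : ∀ K t x → t ≡ + 2 ℤ.* (K ℤ.* K) ℤ.- K → x ≡ K ℤ.* (+ 1 ℤ.+ K) → let s = K ℤ.+ K in
          K ℤ.* K ℤ.- + 2 ℤ.* K ℤ.+ (x ℤ.+ s) ≡ (s ℤ.+ t)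
        B-shift K _ _ refl refl = poly K
          where
          poly : ∀ K → let t = + 2 ℤ.* (K ℤ.* K) ℤ.- K in let x = K ℤ.* (+ 1 ℤ.+ K) in let s = K ℤ.+ K in K ℤ.* K ℤ.- + 2 ℤ.* K ℤ.+ (x ℤ.+ s) ≡ (s ℤ.+ t)
          poly = ℤSolver.solve-∀

      factors₂⁺ : ∀ k → Factors (A₂ plus q (k ℕ.+ k ℕ.+ 2)) (B₂ plus q (k ℕ.+ k ℕ.+ 2)) (k ℕ.+ k) 2 q
      factors₂⁺ k = record
        { ε>0 = ℕP.≤-trans (s≤s z≤n) 2≤q
        ; A-eq = trans (cong (λ z → qpow q (ex (+ 5) (ℤ.- (+ 6)) (+ 0) n) ℚ.* ι (gauss q n 2) ℚ.* z ℚ.* ι (gl q s ℕ.* gl q 2)) product)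
            (A-from l (gauss q n 2) o (ex-value (+ 5) (ℤ.- (+ 6)) (+ 0) n (+ l) (A-exponent (+ k) (+ T (k ℕ.+ k)) (+ x) (T-ℤ k) (pronic-ℤ k))) (A₂-identity s x o n≡ (sy-even k)))
        ; B-eq = trans (cong (λ z → z ℚ.* ι (q ℕ.* (sy q s ℕ.* (q ^ s) ^ 2))) B≡)
            (B-from {ex (+ 1) (ℤ.- (+ 8)) (+ 12) n} (suc (x ℕ.+ (s ℕ.+ s))) (T (suc (suc s))) R o
              (trans (cong (ℤ._+ + (suc (x ℕ.+ (s ℕ.+ s)))) (ex-value (+ 1) (ℤ.- (+ 8)) (+ 12) n ((+ k) ℤ.* (+ k) ℤ.- + 2 ℤ.* (+ k)) (B-exponent (+ k)))) (B-shift (+ k) (+ T (k ℕ.+ k)) (+ x) (T-ℤ k) (pronic-ℤ k)))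
              (X₂ s x o (sy-even k))
              (trans (cong (gl q) n≡) (trans (gl≡ (suc (suc s))) (cong (q ^ T (suc (suc s)) ℕ.*_) G≡))))
        }
        where
        s = k ℕ.+ k
        n = s ℕ.+ 2
        x = k ℕ.* suc k
        o = O (k)
        R = P (suc s) ℕ.* P (suc (suc s)) ℕ.* E k
        l = T (suc (suc s)) ℕ.+ T s ℕ.+ suc s ℕ.+ s ℕ.+ x
        n≡ : n ≡ suc (suc s)
        n≡ = ℕP.+-comm s 2
        half-n : (n ∸ 2) ℕ./ 2 ≡ k
        half-n = half k (trans (ℕP.m+n∸n≡m s 2) (arith k))
          where
          arith : ∀ k → k ℕ.+ k ≡ k ℕ.* 2
          arith = solve-∀
        product = trans (cong (λ j → prodℚ j (λ j → qm1 q (2 ℕ.* j ∸ 1))) half-n) (prod-O (k))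
        product′ = trans (cong (λ j → prodℚ j (λ j → qm1 q (2 ℕ.* j))) half-n) (prod-E (k))
        B≡ : B₂ plus q n ≡ qpow q (ex (+ 1) (ℤ.- (+ 8)) (+ 12) n) ℚ.* ι R
        B≡ = trans (cong₂ (λ u v → qpow q e ℚ.* u ℚ.* v ℚ.* prodℚ ((n ∸ 2) ℕ./ 2) (λ j → qm1 q (2 ℕ.* j)))
            (trans (cong (λ z → qm1 q (z ∸ 1)) n≡) (ι-P (suc s))) (trans (cong (qm1 q) n≡) (ι-P (suc (suc s)))))
          (trans (cong (qpow q e ℚ.* ι (P (suc s)) ℚ.* ι (P (suc (suc s))) ℚ.*_) product′)
            (trans (cong (ℚ._* ι (E k)) (ℚP.*-assoc (qpow q e) (ι (P (suc s))) (ι (P (suc (suc s)))))) (trans (ℚP.*-assoc (qpow q e) _ (ι (E k)))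
              (cong (qpow q e ℚ.*_) (trans (cong (ℚ._* ι (E k)) (sym (ι-* (P (suc s)) (P (suc (suc s)))))) (sym (ι-* (P (suc s) ℕ.* P (suc (suc s))) (E k))))))))
          where e = ex (+ 1) (ℤ.- (+ 8)) (+ 12) n
        G≡ : Pn (suc (suc s)) ≡ R ℕ.* o
        G≡ = trans (cong (P (suc (suc s)) ℕ.*_) (Pn-odd k)) (arith (O k) (P (suc s)) (P (suc (suc s))) (E k))
          where
          arith : ∀ o p r e → r ℕ.* (o ℕ.* p ℕ.* e) ≡ p ℕ.* r ℕ.* e ℕ.* o
          arith = solve-∀
        A-exponent : ∀ K t x → t ≡ + 2 ℤ.* (K ℤ.* K) ℤ.- K → x ≡ K ℤ.* (+ 1 ℤ.+ K) → let s = K ℤ.+ K in let n = s ℤ.+ + 2 in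
          + 5 ℤ.* n ℤ.* n ℤ.+ (ℤ.- (+ 6)) ℤ.* n ℤ.+ + 0 ≡ + 4 ℤ.* (((+ 1 ℤ.+ s) ℤ.+ (s ℤ.+ t)) ℤ.+ t ℤ.+ (+ 1 ℤ.+ s) ℤ.+ s ℤ.+ x)
        A-exponent K _ _ refl refl = poly K
          where
          poly : ∀ K → let t = + 2 ℤ.* (K ℤ.* K) ℤ.- K in let x = K ℤ.* (+ 1 ℤ.+ K) in let s = K ℤ.+ K in let n = s ℤ.+ + 2 in
            + 5 ℤ.* n ℤ.* n ℤ.+ (ℤ.- (+ 6)) ℤ.* n ℤ.+ + 0 ≡ + 4 ℤ.* (((+ 1 ℤ.+ s) ℤ.+ (s ℤ.+ t)) ℤ.+ t ℤ.+ (+ 1 ℤ.+ s) ℤ.+ s ℤ.+ x)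
          poly = ℤSolver.solve-∀
        B-exponent : ∀ K → let n = K ℤ.+ K ℤ.+ + 2 in + 1 ℤ.* n ℤ.* n ℤ.+ (ℤ.- (+ 8)) ℤ.* n ℤ.+ + 12 ≡ + 4 ℤ.* (K ℤ.* K ℤ.- + 2 ℤ.* K)
        B-exponent = ℤSolver.solve-∀
        B-shift : ∀ K t x → t ≡ + 2 ℤ.* (K ℤ.* K) ℤ.- K → x ≡ K ℤ.* (+ 1 ℤ.+ K) → let s = K ℤ.+ K in
          K ℤ.* K ℤ.- + 2 ℤ.* K ℤ.+ (+ 1 ℤ.+ (x ℤ.+ (s ℤ.+ s))) ≡ ((+ 1 ℤ.+ s) ℤ.+ (s ℤ.+ t))
        B-shift K _ _ refl refl = poly K
          where
          poly : ∀ K → let t = + 2 ℤ.* (K ℤ.* K) ℤ.- K in let x = K ℤ.* (+ 1 ℤ.+ K) in let s = K ℤ.+ K in K ℤ.* K ℤ.- + 2 ℤ.* K ℤ.+ (+ 1 ℤ.+ (x ℤ.+ (s ℤ.+ s))) ≡ ((+ 1 ℤ.+ s) ℤ.+ (s ℤ.+ t))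
          poly = ℤSolver.solve-∀

      factors₂⁻ : ∀ k → Factors (A₂ minus q (suc (k ℕ.+ k) ℕ.+ 2)) (B₂ minus q (suc (k ℕ.+ k) ℕ.+ 2)) (suc (k ℕ.+ k)) 2 q
      factors₂⁻ k = record
        { ε>0 = ℕP.≤-trans (s≤s z≤n) 2≤q
        ; A-eq = trans (cong (λ z → qpow q (ex (+ 5) (ℤ.- (+ 8)) (+ 3) n) ℚ.* ι (gauss q n 2) ℚ.* z ℚ.* ι (gl q s ℕ.* gl q 2)) product)
            (A-from l (gauss q n 2) o (ex-value (+ 5) (ℤ.- (+ 8)) (+ 3) n (+ l) (A-exponent (+ k) (+ T (k ℕ.+ k)) (+ x) (T-ℤ k) (pronic-ℤ k))) (A₂-identity s x o n≡ (sy-odd k)))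
        ; B-eq = trans (cong (λ z → z ℚ.* ι (q ℕ.* (sy q s ℕ.* (q ^ s) ^ 2))) B≡)
            (B-from {ex (+ 1) (ℤ.- (+ 6)) (+ 9) n} (suc (x ℕ.+ (s ℕ.+ s))) (T (suc (suc s))) R o
              (trans (cong (ℤ._+ + (suc (x ℕ.+ (s ℕ.+ s)))) (ex-value (+ 1) (ℤ.- (+ 6)) (+ 9) n ((+ k) ℤ.* (+ k)) (B-exponent (+ k)))) (B-shift (+ k) (+ T (k ℕ.+ k)) (+ x) (T-ℤ k) (pronic-ℤ k)))
              (X₂ s x o (sy-odd k))
              (trans (cong (gl q) n≡) (trans (gl≡ (suc (suc s))) (cong (q ^ T (suc (suc s)) ℕ.*_) G≡))))
        }
        where
        s = suc (k ℕ.+ k)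
        n = s ℕ.+ 2
        x = k ℕ.* suc k
        o = O (suc k)
        R = P (suc (suc s)) ℕ.* E (suc k)
        l = T (suc (suc s)) ℕ.+ T s ℕ.+ suc s ℕ.+ s ℕ.+ x
        n≡ : n ≡ suc (suc s)
        n≡ = ℕP.+-comm s 2
        half-n : (n ∸ 1) ℕ./ 2 ≡ suc k
        half-n = half (suc k) (trans (cong (_∸ 1) n≡) (arith k))
          where
          arith : ∀ k → suc (suc (k ℕ.+ k)) ≡ suc k ℕ.* 2
          arith = solve-∀
        product = trans (cong (λ j → prodℚ j (λ j → qm1 q (2 ℕ.* j ∸ 1))) half-n) (prod-O (suc k))
        product′ = trans (cong (λ j → prodℚ j (λ j → qm1 q (2 ℕ.* j))) half-n) (prod-E (suc k))
        B≡ : B₂ minus q n ≡ qpow q (ex (+ 1) (ℤ.- (+ 6)) (+ 9) n) ℚ.* ι R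
        B≡ = trans (ℚP.*-assoc (qpow q (ex (+ 1) (ℤ.- (+ 6)) (+ 9) n)) _ _) (cong (qpow q (ex (+ 1) (ℤ.- (+ 6)) (+ 9) n) ℚ.*_)
          (trans (cong₂ ℚ._*_ (trans (cong (qm1 q) n≡) (ι-P (suc (suc s)))) product′) (sym (ι-* (P (suc (suc s))) (E (suc k))))))
        G≡ : Pn (suc (suc s)) ≡ R ℕ.* o
        G≡ = trans (cong (P (suc (suc s)) ℕ.*_) (trans (cong (Pn ∘ suc) (sym (ℕP.+-suc k k))) (Pn-even (suc k)))) (arith (O (suc k)) (P (suc (suc s))) (E (suc k)))
          where
          arith : ∀ o p e → p ℕ.* (o ℕ.* e) ≡ p ℕ.* e ℕ.* o
          arith = solve-∀
        A-exponent : ∀ K t x → t ≡ + 2 ℤ.* (K ℤ.* K) ℤ.- K → x ≡ K ℤ.* (+ 1 ℤ.+ K) → let s = + 1 ℤ.+ (K ℤ.+ K) in let n = s ℤ.+ + 2 in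
          + 5 ℤ.* n ℤ.* n ℤ.+ (ℤ.- (+ 8)) ℤ.* n ℤ.+ + 3 ≡ + 4 ℤ.* (((+ 1 ℤ.+ s) ℤ.+ (s ℤ.+ ((K ℤ.+ K) ℤ.+ t))) ℤ.+ ((K ℤ.+ K) ℤ.+ t) ℤ.+ (+ 1 ℤ.+ s) ℤ.+ s ℤ.+ x)
        A-exponent K _ _ refl refl = poly K
          where
          poly : ∀ K → let t = + 2 ℤ.* (K ℤ.* K) ℤ.- K in let x = K ℤ.* (+ 1 ℤ.+ K) in let s = + 1 ℤ.+ (K ℤ.+ K) in let n = s ℤ.+ + 2 in
            + 5 ℤ.* n ℤ.* n ℤ.+ (ℤ.- (+ 8)) ℤ.* n ℤ.+ + 3 ≡ + 4 ℤ.* (((+ 1 ℤ.+ s) ℤ.+ (s ℤ.+ ((K ℤ.+ K) ℤ.+ t))) ℤ.+ ((K ℤ.+ K) ℤ.+ t) ℤ.+ (+ 1 ℤ.+ s) ℤ.+ s ℤ.+ x)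
          poly = ℤSolver.solve-∀
        B-exponent : ∀ K → let n = + 1 ℤ.+ (K ℤ.+ K) ℤ.+ + 2 in + 1 ℤ.* n ℤ.* n ℤ.+ (ℤ.- (+ 6)) ℤ.* n ℤ.+ + 9 ≡ + 4 ℤ.* (K ℤ.* K)
        B-exponent = ℤSolver.solve-∀
        B-shift : ∀ K t x → t ≡ + 2 ℤ.* (K ℤ.* K) ℤ.- K → x ≡ K ℤ.* (+ 1 ℤ.+ K) → let s = + 1 ℤ.+ (K ℤ.+ K) in
          K ℤ.* K ℤ.+ (+ 1 ℤ.+ (x ℤ.+ (s ℤ.+ s))) ≡ ((+ 1 ℤ.+ s) ℤ.+ (s ℤ.+ ((K ℤ.+ K) ℤ.+ t)))
        B-shift K _ _ refl refl = poly K
          where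
          poly : ∀ K → let t = + 2 ℤ.* (K ℤ.* K) ℤ.- K in let x = K ℤ.* (+ 1 ℤ.+ K) in let s = + 1 ℤ.+ (K ℤ.+ K) in K ℤ.* K ℤ.+ (+ 1 ℤ.+ (x ℤ.+ (s ℤ.+ s))) ≡ ((+ 1 ℤ.+ s) ℤ.+ (s ℤ.+ ((K ℤ.+ K) ℤ.+ t)))
          poly = ℤSolver.solve-∀

  -- The weight distributions.

  module Main where

    import Defs
    open Defs using (FiniteField; Sign; plus; minus; Valid₁; Valid₂; A₁; B₁; A₂; B₂; ℕ→ℚ; ℤ→ℚ; top; binomℤ; families)
    open Counting
    open CharTwo
    open FieldBasics
    open TraceMap
    open KloostermanSum
    open GroupOrders
    open TraceCounts
    open CosetCounts
    open DefsLink
    open Words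
    open Arithmetic
    open PaperFactors
    open Matrices
    open import Data.Nat as ℕ using (ℕ; zero; suc; _≤_; z≤n; s≤s; _∸_)
    import Data.Nat.Properties as ℕP
    import Data.Nat.DivMod as DM
    open import Data.Nat.Combinatorics using (_C_)
    open import Data.Nat.Tactic.RingSolver using (solve-∀)
    open import Data.Integer as ℤ using (ℤ; +_)
    import Data.Integer.Properties as ℤP
    open import Data.Rational as ℚ using (ℚ; 1ℚ)
    import Data.Rational.Properties as ℚP
    import Data.Rational.Solver as ℚSolver
    import Algebra.Properties.Group ℚP.+-0-group as ℚGroup
    open import Data.Fin as Fin using (Fin; zero; suc)
    import Data.Fin.Properties as FinP
    import Data.List.Properties as ListP
    import Data.Nat.ListAction as ListAction
    open import Data.Vec using (Vec; lookup)
    open import Data.Bool using (Bool; if_then_else_)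
    open import Data.List as List using (List; filter)
    open import Data.List.Membership.Propositional.Properties using (∈-filter⁺; ∈-filter⁻)
    import Data.List.Relation.Unary.Unique.Propositional.Properties as UniqueP
    open import Data.Product using (∃; _×_; _,_; proj₁; proj₂)
    open import Data.Sum using (_⊎_; inj₁; inj₂)
    open import Data.Empty using (⊥-elim)
    open import Relation.Nullary using (yes; no; does)
    open import Relation.Nullary.Decidable using (dec-true; dec-false; _×-dec_)
    open import Relation.Binary.PropositionalEquality
    open import Function using (_∘_)

    Πᶠ-extract : ∀ {n} (g g′ : Fin n → ℕ) k → g′ k ≡ 1 → (∀ i → i ≢ k → g′ i ≡ g i) → g k ℕ.* Πᶠ g′ ≡ Πᶠ g
    Πᶠ-extract g g′ zero e h = cong (g zero ℕ.*_) (trans (cong (ℕ._* Πᶠ (g′ ∘ suc)) e) (trans (ℕP.+-identityʳ _) (foldF-cong ℕ._*_ 1 (λ i → h (suc i) λ ()))))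
    Πᶠ-extract g g′ (suc k) e h = trans (swap (g (suc k)) (g′ zero) (Πᶠ (g′ ∘ suc)))
      (cong₂ ℕ._*_ (h zero λ ()) (Πᶠ-extract (g ∘ suc) (g′ ∘ suc) k e (λ i n → h (suc i) (n ∘ FinP.suc-injective))))
      where
      swap : ∀ a b c → a ℕ.* (b ℕ.* c) ≡ b ℕ.* (a ℕ.* c)
      swap = solve-∀

    -- The constant c is a difference x - y of natural numbers, possibly negative, so the identity ε
    -- c + g = q κ is verified in ℕ with y moved to the other side.
    constant-from : ∀ {ε q x y g κ} {c : ℚ} → c ℚ.+ ℕ→ℚ y ≡ ℕ→ℚ x → ε ℕ.* x ℕ.+ g ≡ q ℕ.* κ ℕ.+ ε ℕ.* y →
                    ℕ→ℚ ε ℚ.* c ℚ.+ ℕ→ℚ g ≡ ℕ→ℚ q ℚ.* ℕ→ℚ κ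
    constant-from {ε} {q} {x} {y} {g} {κ} {c} hc e = ℚGroup.∙-cancelʳ (ℕ→ℚ ε ℚ.* ℕ→ℚ y) _ _ (begin
      ℕ→ℚ ε ℚ.* c ℚ.+ ℕ→ℚ g ℚ.+ ℕ→ℚ ε ℚ.* ℕ→ℚ y ≡⟨ solve 4 (λ e c g y → e :* c :+ g :+ e :* y := e :* (c :+ y) :+ g) refl (ℕ→ℚ ε) c (ℕ→ℚ g) (ℕ→ℚ y) ⟩
      ℕ→ℚ ε ℚ.* (c ℚ.+ ℕ→ℚ y) ℚ.+ ℕ→ℚ g          ≡⟨ cong (λ z → ℕ→ℚ ε ℚ.* z ℚ.+ ℕ→ℚ g) hc ⟩
      ℕ→ℚ ε ℚ.* ℕ→ℚ x ℚ.+ ℕ→ℚ g                  ≡⟨ trans (cong (ℚ._+ ℕ→ℚ g) (sym (ι-* ε x))) (sym (ι-+ (ε ℕ.* x) g)) ⟩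
      ℕ→ℚ (ε ℕ.* x ℕ.+ g)                        ≡⟨ cong ℕ→ℚ e ⟩
      ℕ→ℚ (q ℕ.* κ ℕ.+ ε ℕ.* y)                  ≡⟨ trans (ι-+ (q ℕ.* κ) (ε ℕ.* y)) (cong₂ ℚ._+_ (ι-* q κ) (ι-* ε y)) ⟩
      ℕ→ℚ q ℚ.* ℕ→ℚ κ ℚ.+ ℕ→ℚ ε ℚ.* ℕ→ℚ y        ∎)
      where
      open ≡-Reasoning
      open ℚSolver.+-*-Solver using (solve; _:=_; _:+_; _:*_)

    ℤ→ℚ-difference : ∀ a b → ℤ→ℚ (+ a ℤ.- + b) ℚ.+ ℕ→ℚ b ≡ ℕ→ℚ a
    ℤ→ℚ-difference a b = trans (sym (ℤ→ℚ-+ (+ a ℤ.- + b) (+ b))) (cong ℤ→ℚ (trans (ℤP.+-assoc (+ a) (ℤ.- + b) (+ b)) (trans (cong (λ z → + a ℤ.+ z) (ℤP.+-inverseˡ (+ b))) (ℤP.+-identityʳ (+ a)))))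

    private
      open ℚSolver.+-*-Solver using (solve; _:=_; _:+_; _:*_; _:-_; con)

      cancel-cubic : ∀ Q → Q ℚ.* Q ℚ.* Q ℚ.- Q ℚ.* Q ℚ.- 1ℚ ℚ.+ (Q ℚ.* Q ℚ.+ 1ℚ) ≡ Q ℚ.* Q ℚ.* Q
      cancel-cubic = solve 1 (λ Q → Q :* Q :* Q :- Q :* Q :- con 1ℚ :+ (Q :* Q :+ con 1ℚ) := Q :* Q :* Q) refl

      cancel-quadratic : ∀ Q T k → Q ℚ.* T ℚ.- Q ℚ.* Q ℚ.- 1ℚ ℚ.+ (Q ℚ.* k ℚ.+ (Q ℚ.* Q ℚ.+ 1ℚ)) ≡ Q ℚ.* (T ℚ.+ k)
      cancel-quadratic = solve 3 (λ Q T k → Q :* T :- Q :* Q :- con 1ℚ :+ (Q :* k :+ (Q :* Q :+ con 1ℚ)) := Q :* (T :+ k)) refl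

    module Codes (s m : ℕ) (gs : List (Defs.Mat F ((s ℕ.+ m) ℕ.+ (s ℕ.+ m)) ((s ℕ.+ m) ℕ.+ (s ℕ.+ m))))
                 (enumerates : Defs.Enumerates F (s ℕ.+ m) s gs) where
      open Field-F
      open WordCount
      open Coset s m
      open Link s m
      open GroupOrders.Orders using (2≤q; al-+)
      open Kappa using (InvTrace)

      N[_] : Carrier → ℕ
      N[ β ] = multiplicity {s ℕ.+ m} gs β

      card-trace : ∀ β → Card (λ g → IsDC g × Mats.Tr g ≡ β) N[ β ]
      card-trace β = card-iff (card-list _ (UniqueP.filter⁺ (λ g → Defs.Tr F g ≟ β) (proj₁ enumerates)))
        (λ g h → let (h′ , t) = ∈-filter⁻ (λ g → Defs.Tr F g ≟ β) {xs = gs} h in DC⇒ (proj₁ (proj₂ enumerates) g h′) , trans (sym (Tr≡ g)) t)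
        (λ g (d , t) → ∈-filter⁺ (λ g → Defs.Tr F g ≟ β) (proj₂ (proj₂ enumerates) g (DC⇐ d)) (trans (Tr≡ g) t))

      binom-N : ∀ A B ε c κ β → Arithmetic.Orders.Factors q 2≤q A B s m ε → Card (InvTrace {m} β) κ → ℕ→ℚ ε ℚ.* c ℚ.+ ℕ→ℚ (gl q m) ≡ ℕ→ℚ q ℚ.* ℕ→ℚ κ →
                ∀ a → binomℤ (top q A B c) a ≡ N[ β ] C a
      binom-N A B ε c κ β fs card-κ hc a = cong (λ z → binomℤ z a) (Arithmetic.Orders.top-value q 2≤q fs {κ = κ} {N[ β ]} hc (al-+ s m) (Count.trace-count card-κ (card-trace β)))

      product-over-field : ∀ {b₀ f} (ν : Carrier → ℕ) → b₀ ≡ N[ 0# ] C ν 0# → (∀ β → β ≢ 0# → f β ≡ N[ β ] C ν β) →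
        b₀ ℕ.* Defs.ΠF* F f ≡ Πᶠ (λ k → N[ to k ] C ν (to k))
      product-over-field {b₀} {f} ν e h = trans (cong₂ ℕ._*_ (trans e (cong (λ β → N[ β ] C ν β) (sym (to∘from 0#)))) (foldr-allFin ℕ._*_ 1 g′))
          (Πᶠ-extract (λ k → N[ to k ] C ν (to k)) g′ (from 0#) at-0 elsewhere)
        where
        g′ : Fin q → ℕ
        g′ k = if does (to k ≟ 0#) then 1 else f (to k)
        at-0 : g′ (from 0#) ≡ 1
        at-0 = cong (λ b → if b then 1 else f (to (from 0#))) (dec-true (to (from 0#) ≟ 0#) (to∘from 0#))
        elsewhere : ∀ k → k ≢ from 0# → g′ k ≡ N[ to k ] C ν (to k)
        elsewhere k n = trans (cong (λ b → if b then 1 else f (to k)) (dec-false (to k ≟ 0#) nz)) (h (to k) nz)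
          where
          nz : to k ≢ 0#
          nz e = n (trans (sym (from∘to k)) (cong from e))

    gl-1 : ∀ u → gl (suc u) 1 ≡ u
    gl-1 u = trans (arith u) refl
      where
      arith : ∀ u → (u ℕ.* 1) ℕ.* (1 ℕ.* 1) ≡ u
      arith = solve-∀

    gl-2 : ∀ u → gl (suc u) 2 ≡ (u ℕ.+ u ℕ.* suc u) ℕ.* (suc u ℕ.* u)
    gl-2 u = arith u
      where
      arith : ∀ u → (u ℕ.* 1 ℕ.+ u ℕ.* (suc u ℕ.* 1)) ℕ.* ((suc u ℕ.* 1) ℕ.* ((u ℕ.* 1) ℕ.* (1 ℕ.* 1))) ≡ (u ℕ.+ u ℕ.* suc u) ℕ.* (suc u ℕ.* u)
      arith = solve-∀

    module Distribution₁ (sg : Sign) (s : ℕ) (gs : List (Defs.Mat F ((s ℕ.+ 1) ℕ.+ (s ℕ.+ 1)) ((s ℕ.+ 1) ℕ.+ (s ℕ.+ 1))))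
                 (enumerates : Defs.Enumerates F (s ℕ.+ 1) s gs) where
      open Field-F
      open WordCount
      open GroupOrders.Orders using (2≤q)
      open Kappa using (card-κ₁-0; card-κ₁-split; card-κ₁-nonsplit)
      open Codes s 1 gs enumerates

      private
        u = q ∸ 1
        q≡ : q ≡ suc u
        q≡ = sym (ℕP.m+[n∸m]≡n (ℕP.≤-trans (s≤s z≤n) 2≤q))

        gl≡ : gl q 1 ≡ u
        gl≡ = trans (cong (λ z → gl z 1) q≡) (gl-1 u)

        -- For m = 1 the constant is c = q κ - (q - 1): the solution numbers κ = 1, 2, 0 give 1, q +
        -- 1 and 1 - q.
        c-zero : ℕ→ℚ 1 ℚ.* 1ℚ ℚ.+ ℕ→ℚ (gl q 1) ≡ ℕ→ℚ q ℚ.* ℕ→ℚ 1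
        c-zero = constant-from {1} {q} {1} {0} {gl q 1} {1} {1ℚ} refl (trans (cong (λ z → 1 ℕ.* 1 ℕ.+ z) gl≡) (trans (arith u) (cong (λ z → z ℕ.* 1 ℕ.+ 1 ℕ.* 0) (sym q≡))))
          where
          arith : ∀ u → 1 ℕ.* 1 ℕ.+ u ≡ suc u ℕ.* 1 ℕ.+ 1 ℕ.* 0
          arith = solve-∀

        c-split : ℕ→ℚ 1 ℚ.* (ℕ→ℚ q ℚ.+ 1ℚ) ℚ.+ ℕ→ℚ (gl q 1) ≡ ℕ→ℚ q ℚ.* ℕ→ℚ 2
        c-split = constant-from {1} {q} {q ℕ.+ 1} {0} {gl q 1} {2} {ℕ→ℚ q ℚ.+ 1ℚ} (trans (ℚP.+-identityʳ (ℕ→ℚ q ℚ.+ 1ℚ)) (sym (ι-+ q 1)))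
          (trans (cong₂ (λ p z → 1 ℕ.* (p ℕ.+ 1) ℕ.+ z) q≡ gl≡) (trans (arith u) (cong (λ z → z ℕ.* 2 ℕ.+ 1 ℕ.* 0) (sym q≡))))
          where
          arith : ∀ u → 1 ℕ.* (suc u ℕ.+ 1) ℕ.+ u ≡ suc u ℕ.* 2 ℕ.+ 1 ℕ.* 0
          arith = solve-∀

        c-nonsplit : ℕ→ℚ 1 ℚ.* (1ℚ ℚ.- ℕ→ℚ q) ℚ.+ ℕ→ℚ (gl q 1) ≡ ℕ→ℚ q ℚ.* ℕ→ℚ 0
        c-nonsplit = constant-from {1} {q} {1} {q} {gl q 1} {0} {1ℚ ℚ.- ℕ→ℚ q}
          (trans (ℚP.+-assoc 1ℚ (ℚ.- ℕ→ℚ q) (ℕ→ℚ q)) (trans (cong (1ℚ ℚ.+_) (ℚP.+-inverseˡ (ℕ→ℚ q))) (ℚP.+-identityʳ 1ℚ)))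
          (trans (cong (λ z → 1 ℕ.* 1 ℕ.+ z) gl≡) (trans (arith u) (cong (λ z → z ℕ.* 0 ℕ.+ 1 ℕ.* z) (sym q≡))))
          where
          arith : ∀ u → 1 ℕ.* 1 ℕ.+ u ≡ suc u ℕ.* 0 ℕ.+ 1 ℕ.* suc u
          arith = solve-∀

      weight-distribution : Arithmetic.Orders.Factors q 2≤q (A₁ sg q (s ℕ.+ 1)) (B₁ sg q (s ℕ.+ 1)) s 1 1 →
        ∀ j → Defs.weightDist F {s ℕ.+ 1} gs j ≡ Defs.formulaA F sg (s ℕ.+ 1) j
      weight-distribution fs j = weightDist-families {s ℕ.+ 1} gs j
        (λ ν → binomℤ (top q A B 1ℚ) (ν 0#) ℕ.* Defs.ΠF* F (factor ν))
        (λ ν → product-over-field {f = factor ν} ν (binom-N A B 1 1ℚ 1 0# fs card-κ₁-0 c-zero (ν 0#)) (at ν))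
        where
        A = A₁ sg q (s ℕ.+ 1)
        B = B₁ sg q (s ℕ.+ 1)
        factor : (Carrier → ℕ) → Carrier → ℕ
        factor ν β = if does (tr (β ⁻¹) ≟ 0#) then binomℤ (top q A B (ℕ→ℚ q ℚ.+ 1ℚ)) (ν β)
                     else if does (tr (β ⁻¹) ≟ 1#) then binomℤ (top q A B (1ℚ ℚ.- ℕ→ℚ q)) (ν β) else 1
        at : ∀ ν β → β ≢ 0# → factor ν β ≡ N[ β ] C ν β
        at ν β nz = cases (tr-bit (β ⁻¹))
          where
          branch : Bool → Bool → ℕ
          branch b b′ = if b then binomℤ (top q A B (ℕ→ℚ q ℚ.+ 1ℚ)) (ν β) else if b′ then binomℤ (top q A B (1ℚ ℚ.- ℕ→ℚ q)) (ν β) else 1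
          cases : tr (β ⁻¹) ≡ 0# ⊎ tr (β ⁻¹) ≡ 1# → branch (does (tr (β ⁻¹) ≟ 0#)) (does (tr (β ⁻¹) ≟ 1#)) ≡ N[ β ] C ν β
          cases (inj₁ t) = trans (cong (λ b → branch b (does (tr (β ⁻¹) ≟ 1#))) (dec-true (tr (β ⁻¹) ≟ 0#) t)) (binom-N A B 1 (ℕ→ℚ q ℚ.+ 1ℚ) 2 β fs (card-κ₁-split nz t) c-split (ν β))
          cases (inj₂ t) = trans (cong₂ branch (dec-false (tr (β ⁻¹) ≟ 0#) (λ z → 0≢1 (trans (sym z) t))) (dec-true (tr (β ⁻¹) ≟ 1#) t))
            (binom-N A B 1 (1ℚ ℚ.- ℕ→ℚ q) 0 β fs (card-κ₁-nonsplit nz t) c-nonsplit (ν β))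

    module Distribution₂ (2≤r : 2 ≤ r) (sg : Sign) (s : ℕ) (gs : List (Defs.Mat F ((s ℕ.+ 2) ℕ.+ (s ℕ.+ 2)) ((s ℕ.+ 2) ℕ.+ (s ℕ.+ 2))))
                 (enumerates : Defs.Enumerates F (s ℕ.+ 2) s gs) where
      open Field-F
      open WordCount
      open GroupOrders.Orders using (2≤q)
      open Kappa using (card-κ₂-0; card-κ₂-≢0)
      open KSum-F
      open Codes s 2 gs enumerates

      private
        w = q ∸ 2
        q≡ : q ≡ suc (suc w)
        q≡ = sym (ℕP.m+[n∸m]≡n 2≤q)

        -- This is 2 q³ - 2 q² - q. Subtracting |GL(2)| / q = (q² - 1)(q - 1) leaves the constant q³
        -- - q² - 1 that belongs to β = 0.
        κ₀ : ℕ → ℕ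
        κ₀ q = ((q ∸ 1) ℕ.* (q ℕ.* q) ℕ.+ (q ∸ 1) ℕ.* q) ℕ.+ q ℕ.* (q ℕ.* (q ∸ 2))

        c-zero : ℕ→ℚ q ℚ.* (ℕ→ℚ q ℚ.* ℕ→ℚ q ℚ.* ℕ→ℚ q ℚ.- ℕ→ℚ q ℚ.* ℕ→ℚ q ℚ.- 1ℚ) ℚ.+ ℕ→ℚ (gl q 2) ≡ ℕ→ℚ q ℚ.* ℕ→ℚ (κ₀ q)
        c-zero = constant-from {q} {q} {q ℕ.* q ℕ.* q} {q ℕ.* q ℕ.+ 1} {gl q 2} {κ₀ q}
          (trans (cong (λ z → ℕ→ℚ q ℚ.* ℕ→ℚ q ℚ.* ℕ→ℚ q ℚ.- ℕ→ℚ q ℚ.* ℕ→ℚ q ℚ.- 1ℚ ℚ.+ z) (trans (ι-+ (q ℕ.* q) 1) (cong (ℚ._+ 1ℚ) (ι-* q q)))) (trans (cancel-cubic (ℕ→ℚ q)) (sym (trans (ι-* (q ℕ.* q) q) (cong (ℚ._* ℕ→ℚ q) (ι-* q q))))))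
          (subst (λ q → q ℕ.* (q ℕ.* q ℕ.* q) ℕ.+ gl q 2 ≡ q ℕ.* κ₀ q ℕ.+ q ℕ.* (q ℕ.* q ℕ.+ 1)) (sym q≡)
            (trans (cong (λ z → suc (suc w) ℕ.* (suc (suc w) ℕ.* suc (suc w) ℕ.* suc (suc w)) ℕ.+ z) (gl-2 (suc w))) (arith w)))
          where
          arith : ∀ w → let q = suc (suc w) in let u = suc w in
            q ℕ.* (q ℕ.* q ℕ.* q) ℕ.+ (u ℕ.+ u ℕ.* suc u) ℕ.* (suc u ℕ.* u) ≡ q ℕ.* ((u ℕ.* (q ℕ.* q) ℕ.+ u ℕ.* q) ℕ.+ q ℕ.* (q ℕ.* w)) ℕ.+ q ℕ.* (q ℕ.* q ℕ.+ 1)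
          arith = solve-∀

        module _ (k₀ k₁ : ℕ) (total : 1 ℕ.+ (suc k₀ ℕ.+ k₁) ≡ q) where
          κ₁ : ℕ → ℕ
          κ₁ q = k₀ ℕ.* (2 ℕ.* (q ℕ.+ (q ∸ 1)) ℕ.+ (q ∸ 2) ℕ.* (q ∸ 1)) ℕ.+ k₁ ℕ.* (q ℕ.* (q ∸ 1))

          -- As k₀ + k₁ = q - 2 and τ = k₀ + 1 - k₁, the number κ₁ is k₀ (q² + q) + k₁ (q² - q) = q³
          -- - 2 q² + q (τ - 1). Subtracting |GL(2)| / q leaves q τ - q² - 1.
          c-nonzero : ∀ {τ} → τ ≡ + suc k₀ ℤ.- + k₁ →
            ℕ→ℚ q ℚ.* (ℕ→ℚ q ℚ.* ℤ→ℚ τ ℚ.- ℕ→ℚ q ℚ.* ℕ→ℚ q ℚ.- 1ℚ) ℚ.+ ℕ→ℚ (gl q 2) ≡ ℕ→ℚ q ℚ.* ℕ→ℚ (κ₁ q)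
          c-nonzero {τ} refl = constant-from {q} {q} {q ℕ.* suc k₀} {q ℕ.* k₁ ℕ.+ (q ℕ.* q ℕ.+ 1)} {gl q 2} {κ₁ q}
            (trans (cong (λ z → ℕ→ℚ q ℚ.* ℤ→ℚ τ ℚ.- ℕ→ℚ q ℚ.* ℕ→ℚ q ℚ.- 1ℚ ℚ.+ z) (trans (ι-+ (q ℕ.* k₁) (q ℕ.* q ℕ.+ 1)) (cong₂ ℚ._+_ (ι-* q k₁) (trans (ι-+ (q ℕ.* q) 1) (cong (ℚ._+ 1ℚ) (ι-* q q))))))
              (trans (cancel-quadratic (ℕ→ℚ q) (ℤ→ℚ τ) (ℕ→ℚ k₁)) (trans (cong (ℕ→ℚ q ℚ.*_) (ℤ→ℚ-difference (suc k₀) k₁)) (sym (ι-* q (suc k₀))))))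
            (subst (λ q → q ℕ.* (q ℕ.* suc k₀) ℕ.+ gl q 2 ≡ q ℕ.* κ₁ q ℕ.+ q ℕ.* (q ℕ.* k₁ ℕ.+ (q ℕ.* q ℕ.+ 1))) total
              (trans (cong (λ z → Q ℕ.* (Q ℕ.* suc k₀) ℕ.+ z) (gl-2 (suc (k₀ ℕ.+ k₁)))) (arith k₀ k₁)))
            where
            Q = suc (suc (k₀ ℕ.+ k₁))
            arith : ∀ k l → let q = suc (suc (k ℕ.+ l)) in let u = suc (k ℕ.+ l) in
              q ℕ.* (q ℕ.* suc k) ℕ.+ (u ℕ.+ u ℕ.* suc u) ℕ.* (suc u ℕ.* u)
              ≡ q ℕ.* (k ℕ.* (2 ℕ.* (q ℕ.+ u) ℕ.+ (k ℕ.+ l) ℕ.* u) ℕ.+ l ℕ.* (q ℕ.* u)) ℕ.+ q ℕ.* (q ℕ.* l ℕ.+ (q ℕ.* q ℕ.+ 1))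
            arith = solve-∀

      private
        A = A₂ sg q (s ℕ.+ 2)
        B = B₂ sg q (s ℕ.+ 2)
        c₀ = ℕ→ℚ q ℚ.* ℕ→ℚ q ℚ.* ℕ→ℚ q ℚ.- ℕ→ℚ q ℚ.* ℕ→ℚ q ℚ.- 1ℚ
        c : ℤ → ℚ
        c τ = ℕ→ℚ q ℚ.* ℤ→ℚ τ ℚ.- ℕ→ℚ q ℚ.* ℕ→ℚ q ℚ.- 1ℚ

      module _ (j : ℕ) where
        private
          balanced : List (Vec ℕ q)
          balanced = filter (λ v → (ListAction.sum (List.map (λ k → lookup v k) (List.allFin q)) ℕ.≟ j)
                             ×-dec (List.foldr (λ k acc → (Defs._·_ F (lookup v k) (to k)) + acc) 0# (List.allFin q) ≟ 0#)) (families q j)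

          -- The conjunction in `formulaB` is local to its definition, so the summand and the step
          -- of its product are obtained from it by unification with `refl`.
          summand : Vec ℕ q → ℕ
          summand = mapped balanced {_} {Defs.formulaB F sg (s ℕ.+ 2) j} refl
            where
            mapped : ∀ {A : Set} (xs : List A) {f : A → ℕ} {y} → ListAction.sum (List.map f xs) ≡ y → A → ℕ
            mapped _ {f} _ = f

          step : Vec ℕ q → Fin q → ℕ → ℕ
          step v = folded {binomℤ (top q A B c₀) (lookup v (from 0#))} {_} {summand v} refl
            where
            folded : ∀ {a} {h : Fin q → ℕ → ℕ} {y} → a ℕ.* List.foldr h 1 (List.allFin q) ≡ y → Fin q → ℕ → ℕ
            folded {h = h} _ = h

          factor : (Carrier → ℕ) → Carrier → ℕ
          factor ν β = binomℤ (top q A B (c (Defs.K F (β ⁻¹)))) (ν β)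

          -- For nonzero β both guards on τ hold, by `K-bound` and `K-mod-4`. The product restricted
          -- by τ therefore omits no β.
          step-factor : ∀ v k acc → step v k acc ≡ (if does (to k ≟ 0#) then 1 else factor (λ β → lookup v (from β)) (to k)) ℕ.* acc
          step-factor v k acc with to k ≟ 0#
          ... | yes _ = refl
          ... | no nz with Defs.K F (to k ⁻¹) | K-bound F 2≤r (⁻¹-≢0 nz) | K-mod-4 F 2≤r (⁻¹-≢0 nz)
          ... | τ | small | mod4 rewrite dec-true (τ ℤ.* τ ℤ.<? + (4 ℕ.* q)) small | dec-true ((τ ℤ.% + 4) ℕ.≟ 3) mod4 = refl

          families-factor : Defs.familySum F j (λ ν → binomℤ (top q A B c₀) (ν 0#) ℕ.* Defs.ΠF* F (factor ν)) ≡ Defs.formulaB F sg (s ℕ.+ 2) j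
          families-factor = cong ListAction.sum (ListP.map-cong (λ v → cong (binomℤ (top q A B c₀) (lookup v (from 0#)) ℕ.*_)
            (sym (ListP.foldr-cong {f = step v} (step-factor v) refl (List.allFin q)))) balanced)

        weight-distribution : Arithmetic.Orders.Factors q 2≤q A B s 2 q → Defs.weightDist F {s ℕ.+ 2} gs j ≡ Defs.formulaB F sg (s ℕ.+ 2) j
        weight-distribution fs = trans (weightDist-families {s ℕ.+ 2} gs j
          (λ ν → binomℤ (top q A B c₀) (ν 0#) ℕ.* Defs.ΠF* F (factor ν))
          (λ ν → product-over-field {f = factor ν} ν (binom-N A B q c₀ (κ₀ q) 0# fs card-κ₂-0 c-zero (ν 0#)) (λ β nz → count β nz (ν β)))) families-factor
          where
          -- The fibre over 0 has odd size, so its size has the form `suc` that `card-κ₂-≢0`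
          -- expects.
          count : ∀ β → β ≢ 0# → ∀ a → binomℤ (top q A B (c (Defs.K F (β ⁻¹)))) a ≡ N[ β ] C a
          count β nz a = from-odd (counts (β ⁻¹)) (k₀-odd (⁻¹-≢0 nz) (Counts.card₀ (counts (β ⁻¹))))
            where
            from-odd : (cs : Counts (β ⁻¹)) → (∃ λ l → Counts.k₀ cs ≡ suc (l ℕ.+ l)) → binomℤ (top q A B (c (Defs.K F (β ⁻¹)))) a ≡ N[ β ] C a
            from-odd record { k₁ = k₁ ; card₀ = c₀ ; card₁ = c₁ ; total = t ; sum≡ = e } (l , refl) =
              binom-N A B q (c (Defs.K F (β ⁻¹))) (κ₁ (l ℕ.+ l) k₁ t q) β fs (card-κ₂-≢0 nz c₀ c₁) (c-nonzero (l ℕ.+ l) k₁ t e) a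

    private
      odd-% : ∀ k → suc (k ℕ.+ k) ℕ.% 2 ≡ 1
      odd-% k = trans (cong (ℕ._% 2) (arith k)) (DM.[m+kn]%n≡m%n 1 k 2)
        where
        arith : ∀ k → suc (k ℕ.+ k) ≡ 1 ℕ.+ k ℕ.* 2
        arith = solve-∀

      even-% : ∀ k → (k ℕ.+ k) ℕ.% 2 ≡ 0
      even-% k = trans (cong (ℕ._% 2) (arith k)) (DM.[m+kn]%n≡m%n 0 k 2)
        where
        arith : ∀ k → k ℕ.+ k ≡ 0 ℕ.+ k ℕ.* 2
        arith = solve-∀

    open Field-F using (q)
    open GroupOrders.Orders using (2≤q)

    valid₁ : ∀ sg n → Valid₁ sg n → ∃ λ s → n ≡ s ℕ.+ 1 × Arithmetic.Orders.Factors q 2≤q (A₁ sg q (s ℕ.+ 1)) (B₁ sg q (s ℕ.+ 1)) s 1 1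
    valid₁ sg n v with parity n
    valid₁ plus _ (() , _) | inj₁ (zero , refl)
    valid₁ plus _ v | inj₁ (suc k , refl) = suc (k ℕ.+ k) , arith k , factors₁⁺ q 2≤q k
      where
      arith : ∀ k → suc k ℕ.+ suc k ≡ suc (k ℕ.+ k) ℕ.+ 1
      arith = solve-∀
    valid₁ plus _ (_ , e) | inj₂ (k , refl) = ⊥-elim (ℕP.1+n≢0 (trans (sym (odd-% k)) e))
    valid₁ minus _ (_ , e) | inj₁ (k , refl) = ⊥-elim (ℕP.0≢1+n (trans (sym (even-% k)) e))
    valid₁ minus _ v | inj₂ (k , refl) = k ℕ.+ k , ℕP.+-comm 1 (k ℕ.+ k) , factors₁⁻ q 2≤q k

    valid₂ : ∀ sg n → Valid₂ sg n → ∃ λ s → n ≡ s ℕ.+ 2 × Arithmetic.Orders.Factors q 2≤q (A₂ sg q (s ℕ.+ 2)) (B₂ sg q (s ℕ.+ 2)) s 2 q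
    valid₂ sg n v with parity n
    valid₂ plus _ (() , _) | inj₁ (zero , refl)
    valid₂ plus _ v | inj₁ (suc k , refl) = k ℕ.+ k , arith k , factors₂⁺ q 2≤q k
      where
      arith : ∀ k → suc k ℕ.+ suc k ≡ k ℕ.+ k ℕ.+ 2
      arith = solve-∀
    valid₂ plus _ (_ , e) | inj₂ (k , refl) = ⊥-elim (ℕP.1+n≢0 (trans (sym (odd-% k)) e))
    valid₂ minus _ (_ , e) | inj₁ (k , refl) = ⊥-elim (ℕP.0≢1+n (trans (sym (even-% k)) e))
    valid₂ minus _ (s≤s () , _) | inj₂ (zero , refl)
    valid₂ minus _ v | inj₂ (suc k , refl) = suc (k ℕ.+ k) , arith k , factors₂⁻ q 2≤q k
      where
      arith : ∀ k → suc (suc k ℕ.+ suc k) ≡ suc (k ℕ.+ k) ℕ.+ 2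
      arith = solve-∀

    part-a : ∀ sg n → Valid₁ sg n → (gs : List (Defs.Mat F (n ℕ.+ n) (n ℕ.+ n))) → Defs.Enumerates F n (n ∸ 1) gs →
             ∀ j → Defs.weightDist F {n} gs j ≡ Defs.formulaA F sg n j
    part-a sg n v gs enum with valid₁ sg n v
    ... | s , refl , fs = Distribution₁.weight-distribution sg s gs (subst (λ z → Defs.Enumerates F (s ℕ.+ 1) z gs) (ℕP.m+n∸n≡m s 1) enum) fs

    part-b : 2 ≤ r → ∀ sg n → Valid₂ sg n → (gs : List (Defs.Mat F (n ℕ.+ n) (n ℕ.+ n))) → Defs.Enumerates F n (n ∸ 2) gs →
             ∀ j → Defs.weightDist F {n} gs j ≡ Defs.formulaB F sg n j
    part-b 2≤r sg n v gs enum j with valid₂ sg n v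
    ... | s , refl , fs = Distribution₂.weight-distribution 2≤r sg s gs (subst (λ z → Defs.Enumerates F (s ℕ.+ 2) z gs) (ℕP.m+n∸n≡m s 2) enum) j fs

open import Defs
open import Data.Nat using (_≤_; _∸_; _+_)
open import Data.List using (List; length)
open import Data.Product using (_×_; _,_)
open import Relation.Binary.PropositionalEquality using (_≡_)

theorem19 : (r : ℕ) (F : FiniteField r) (sg : Sign) (n : ℕ)
    → (Valid₁ sg n → (gs : List (Mat F (n + n) (n + n)))
         → Enumerates F n (n ∸ 1) gs
         → (j : ℕ) → j ≤ length gs → weightDist F {n} gs j ≡ formulaA F sg n j)
    × (2 ≤ r → Valid₂ sg n → (gs : List (Mat F (n + n) (n + n)))
         → Enumerates F n (n ∸ 2) gs
         → (j : ℕ) → j ≤ length gs → weightDist F {n} gs j ≡ formulaB F sg n j)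
theorem19 r F sg n = (λ v gs enum j _ → OverField.Main.part-a F sg n v gs enum j) , (λ 2≤r v gs enum j _ → OverField.Main.part-b F 2≤r sg n v gs enum j)
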